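{- Let $\overline{N}_2(s,5,n)$ denote the number of overpartitions of $n$ whose $M_2$-rank is congruent to $s$ modulo $5$, and for $s,t\in\{0,1,2,3,4\}$, $d\in\{0,1,2,3,4\}$ set $$R_{st}(d)=\sum_{n\ge 0}\bigl(\overline{N}_2(s,5,5n+d)-\overline{N}_2(t,5,5n+d)\bigr)q^n .$$ Then, as formal power series (equivalently for $0<|q|<1$): $$R_{12}(0) = \frac{10q^2(q^{10};q^{10})_\infty^4 (q,q^2,q^8,q^9;q^{10})_\infty}{(q)_\infty^3(q;q^2)_\infty} + \frac{2q(q^5;q^5)_\infty}{(q;q^2)_\infty^5(q^3,q^4,q^6,q^7;q^{10})_\infty},$$ $$R_{12}(1) = \frac{ -6q^3(-q^5;q^5)_\infty}{(q^5;q^5)_\infty}\sum_{n\in\mathbb{Z}}\frac{(-1)^nq^{5n^2+10n}}{1-q^{10n+4}} + \frac{4q(q^{10};q^{10})_\infty^2}{(q;q^2)_\infty^5(q^4,q^6;q^{10})_\infty(q^5;q^5)_\infty} + \frac{20q^3(q^{10};q^{10})_\infty^7(q,q^9;q^{10})_\infty^2(q^2,q^8;q^{10})_\infty^3}{(q)_\infty^4(q^5;q^5)_\infty^2},$$ $$R_{12}(2) = \frac{10q(q^{10};q^{10})_\infty^3}{(q)_\infty^2(q^3,q^7;q^{10})_\infty^3(q,q^2,q^8,q^9;q^{10})_\infty},$$ $$R_{12}(3) = \frac{10(q^{10};q^{10})_\infty^3}{(q)_\infty^2(q^3,q^4,q^6,q^7;q^{10})_\infty(q,q^9;q^{10})_\infty^3}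 - \frac{8(q^5;q^5)_\infty}{(q;q^2)_\infty^5(q^2,q^3,q^7,q^8;q^{10})_\infty},$$ $$R_{12}(4) = \frac{ -2q(-q^5;q^5)_\infty}{(q^5;q^5)_\infty}\sum_{n\in\mathbb{Z}}\frac{(-1)^nq^{5n^2+10n}}{1-q^{10n+2}} + \frac{4(q^2;q^2)_\infty}{(q;q^2)_\infty^4(q^2,q^3,q^7,q^8;q^{10})_\infty^3},$$ $$R_{02}(0) = -1 + \frac{(q^5;q^5)_\infty^6}{(q;q^2)_\infty^6(q^3,q^4,q^6,q^7;q^{10})_\infty(q^{10};q^{10})_\infty^5} + \frac{q^2(q)_\infty(q^{10};q^{10})_\infty}{(q^3,q^4,q^6,q^7;q^{10})_\infty^3(q^5;q^5)_\infty} + \frac{4q(q^5;q^5)_\infty^2(q,q^9;q^{10})_\infty}{(q;q^2)_\infty^6(q^4,q^6,q^{10};q^{10})_\infty} - \frac{10q^2(q^{10};q^{10})_\infty^3}{(q)_\infty^2(q^2,q^8;q^{10})_\infty(q^3,q^7;q^{10})_\infty^4},$$ $$R_{02}(1) = \frac{2q^3(-q^5;q^5)_\infty}{(q^5;q^5)_\infty}\sum_{n\in\mathbb{Z}}\frac{(-1)^nq^{5n^2+10n}}{1-q^{10n+4}} + \frac{2(q^5;q^5)_\infty^4}{(q;q^2)_\infty^6(q^4,q^6;q^{10})_\infty(q^{10};q^{10})_\infty^3} + \frac{2q^2(q)_\infty(q^{10};q^{10})_\infty^3}{(q^3,q^7;q^{10})_\infty^2(q^4,q^6;q^{10})_\infty^3(q^5;q^5)_\infty^3},$$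 $$R_{02}(2) = \frac{4(q^3,q^7;q^{10})_\infty(q^5;q^5)_\infty^2}{(q;q^2)_\infty^6(q^4,q^6,q^{10};q^{10})_\infty} - \frac{10q(q^{10};q^{10})_\infty^3}{(q)_\infty^2(q^3,q^7;q^{10})_\infty^3(q,q^2,q^8,q^9;q^{10})_\infty},$$ $$R_{02}(3) = \frac{4(q^5;q^5)_\infty}{(q;q^2)_\infty^5(q^2,q^3,q^7,q^8;q^{10})_\infty},$$ $$R_{02}(4) = \frac{4q(-q^5;q^5)_\infty}{(q^5;q^5)_\infty}\sum_{n\in\mathbb{Z}}\frac{(-1)^nq^{5n^2+10n}}{1-q^{10n+2}} - \frac{10(q^{10};q^{10})_\infty^3(q^5;q^5)_\infty(q^4,q^6;q^{10})_\infty}{(q,q^9;q^{10})_\infty(q)_\infty^3(q^3,q^7;q^{10})_\infty} - \frac{2(q^{10};q^{10})_\infty(-q^2,-q^3;q^5)_\infty}{q(-q,-q^4;q^5)_\infty(q,q^2,q^8,q^9;q^{10})_\infty} + \frac{2(q^5;q^5)_\infty^2(q^2,q^8;q^{10})_\infty^5(q^{10};q^{10})_\infty^2}{q(q;q^2)_\infty^4(q,q^9;q^{10})_\infty^4(q^2;q^2)_\infty^3}.$$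
   Context: Notation: $(a_1,\dots,a_j;q)_\infty=\prod_{k\ge 0}(1-a_1q^k)\cdots(1-a_jq^k)$, and $(q)_\infty=(q;q)_\infty$, $(-q)_\infty=(-q;q)_\infty$. An overpartition of $n$ is a partition of $n$ in which the first occurrence of each distinct part may (or may not) be overlined. For an overpartition $\lambda$, let $\ell(\lambda)$ be its largest part, $n(\lambda)$ its number of parts, $\lambda_o$ the subpartition consisting of the odd non-overlined parts, and $\chi(\lambda)=1$ if the largest part of $\lambda$ is odd and non-overlined, $\chi(\lambda)=0$ otherwise. The $M_2$-rank of $\lambda$ is $\lceil \ell(\lambda)/2\rceil - n(\lambda)+n(\lambda_o)-\chi(\lambda)$. Convention: $\overline{N}_2(s,\ell,0)=0$ for all $s$ (the empty overpartition is not counted), as dictated by the paper's generating function for $M_2$-ranks. -}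

module Defs where

open import Data.Bool using (Bool; true; false; not; _∧_; _∨_; if_then_else_)
open import Data.Nat as ℕ using (ℕ; zero; suc; _≡ᵇ_; _<ᵇ_; NonZero)
open import Data.Nat.Base using (_/_; _%_)
open import Data.Integer as ℤ using (ℤ; +_; -[1+_]; _%ℕ_)
open import Data.List using (List; []; _∷_; length; map; concatMap; filterᵇ; upTo; foldr)
open import Data.Product using (_×_; _,_)
open import Relation.Binary.PropositionalEquality using (_≡_)

-- A part is a pair (size , overlined?).
Part : Set
Part = ℕ × Bool

-- An overpartition is represented canonically as a list of parts written in
-- nonincreasing order of size, where among equal sizes the (at most one)
-- overlined copy comes first.  Consecutive parts (k₁,b₁),(k₂,b₂) must satisfy
-- k₂ < k₁, or k₁ = k₂ and the second one is not overlined.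
canonical : List Part → Bool
canonical [] = true
canonical (_ ∷ []) = true
canonical ((k₁ , b₁) ∷ (k₂ , b₂) ∷ r) =
  ((k₂ <ᵇ k₁) ∨ ((k₁ ≡ᵇ k₂) ∧ not b₂)) ∧ canonical ((k₂ , b₂) ∷ r)

positiveParts : List Part → Bool
positiveParts [] = true
positiveParts ((k , _) ∷ r) = (0 <ᵇ k) ∧ positiveParts r

weight : List Part → ℕ
weight [] = 0
weight ((k , _) ∷ r) = k ℕ.+ weight r

isOverpartitionOf : ℕ → List Part → Bool
isOverpartitionOf n λs = positiveParts λs ∧ canonical λs ∧ (weight λs ≡ᵇ n)

-- largest part ℓ(λ) (the first part in canonical order; 0 for the empty one)
largest : List Part → ℕ
largest [] = 0
largest ((k , _) ∷ _) = k

isOdd : ℕ → Bool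
isOdd k = (k % 2) ≡ᵇ 1

numOddNonOverlined : List Part → ℕ
numOddNonOverlined [] = 0
numOddNonOverlined ((k , b) ∷ r) =
  (if isOdd k ∧ not b then 1 else 0) ℕ.+ numOddNonOverlined r

chi : List Part → ℕ
chi [] = 0
chi ((k , b) ∷ _) = if isOdd k ∧ not b then 1 else 0

-- M₂-rank:  ⌈ℓ(λ)/2⌉ - n(λ) + n(λ_o) - χ(λ)     (⌈ℓ/2⌉ = ⌊(ℓ+1)/2⌋)
m2rank : List Part → ℤ
m2rank λs = ((+ ((largest λs ℕ.+ 1) / 2) ℤ.- + length λs) ℤ.+ + numOddNonOverlined λs)
            ℤ.- + chi λs

-- Brute-force finite superset of all overpartitions of n: every list of length
-- ≤ n whose entries are parts (k , b) with 1 ≤ k ≤ n.  Each list occurs once.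
alphabet : ℕ → List Part
alphabet n = concatMap (λ k → (suc k , true) ∷ (suc k , false) ∷ []) (upTo n)

listsOfLength : {A : Set} → List A → ℕ → List (List A)
listsOfLength A zero = [] ∷ []
listsOfLength A (suc k) = concatMap (λ a → map (a ∷_) (listsOfLength A k)) A

candidates : ℕ → List (List Part)
candidates n = concatMap (listsOfLength (alphabet n)) (upTo (suc n))

congruent : (m : ℕ) .{{_ : NonZero m}} → ℤ → ℕ → Bool
congruent m r s = ((r ℤ.- + s) %ℕ m) ≡ᵇ 0

-- N̄₂(s,m,n): number of overpartitions of n with M₂-rank ≡ s (mod m);
-- by the paper's convention N̄₂(s,m,0) = 0.
N̄₂ : ℕ → (m : ℕ) .{{_ : NonZero m}} → ℕ → ℕ
N̄₂ s m zero = 0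
N̄₂ s m n@(suc _) =
  length (filterᵇ (λ λs → isOverpartitionOf n λs ∧ congruent m (m2rank λs) s)
                  (candidates n))

Series : Set
Series = ℕ → ℤ

infix 4 _≈ˢ_
_≈ˢ_ : Series → Series → Set
f ≈ˢ g = ∀ n → f n ≡ g n

Σ≤ : ℕ → (ℕ → ℤ) → ℤ
Σ≤ zero f = f 0
Σ≤ (suc n) f = Σ≤ n f ℤ.+ f (suc n)

q^ : ℕ → Series
q^ k n = if k ≡ᵇ n then + 1 else + 0

one : Series
one = q^ 0

infixl 6 _⊕_ _⊖_
infixl 7 _⊗_ _÷_
infixr 8 _⋆_
infixr 9 _^ˢ_

_⊕_ : Series → Series → Series
(f ⊕ g) n = f n ℤ.+ g n

_⊖_ : Series → Series → Series
(f ⊖ g) n = f n ℤ.- g n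

_⋆_ : ℤ → Series → Series
(c ⋆ f) n = c ℤ.* f n

_⊗_ : Series → Series → Series
(f ⊗ g) n = Σ≤ n (λ i → f i ℤ.* g (n ℕ.∸ i))

_^ˢ_ : Series → ℕ → Series
f ^ˢ zero = one
f ^ˢ suc k = f ⊗ f ^ˢ k

-- Multiplicative inverse of a series with constant term 1 (the only case used):
-- g 0 = 1,  g (n+1) = - Σ_{j=1}^{n+1} f j · g (n+1-j).
-- invList f n = [g n , g (n-1) , … , g 0].
private
  wsum : (ℕ → ℤ) → List ℤ → ℤ
  wsum w [] = + 0
  wsum w (x ∷ xs) = w 0 ℤ.* x ℤ.+ wsum (λ i → w (suc i)) xs

  invList : Series → ℕ → List ℤ
  invList f zero = + 1 ∷ []
  invList f (suc n) = ℤ.- wsum (λ i → f (suc i)) (invList f n) ∷ invList f n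

  headℤ : List ℤ → ℤ
  headℤ [] = + 0
  headℤ (x ∷ _) = x

inv : Series → Series
inv f n = headℤ (invList f n)

_÷_ : Series → Series → Series
f ÷ g = f ⊗ inv g

prod< : ℕ → (ℕ → Series) → Series
prod< zero F = one
prod< (suc m) F = prod< m F ⊗ F m

-- (ε q^a ; q^c)_∞ = ∏_{k≥0} (1 - ε q^{a+ck}), for a ≥ 1.  Its n-th coefficient
-- is that of the finite product over k ≤ n (all other factors are ≡ 1 mod q^{n+1}).
poch : ℤ → ℕ → ℕ → Series
poch ε a c n = prod< (suc n) (λ k → one ⊖ ε ⋆ q^ (a ℕ.+ c ℕ.* k)) n

P : ℕ → ℕ → Series
P a c = poch (+ 1) a c

Pn : ℕ → ℕ → Series
Pn a c = poch (ℤ.- + 1) a c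

-- The n-th summand  (-1)^n q^{5n²+10n} / (1 - q^{10n+a})  (a ∈ {2,4}) as a
-- formal power series (expansion valid for |q|<1).  For n = -m (m ≥ 1):
--   (-1)^m q^{5m²-10m} / (1 - q^{-(10m-a)}) = -(-1)^m q^{5m²-a} / (1 - q^{10m-a}).
bilTerm : ℕ → ℤ → Series
bilTerm a (+ n) =
  ((ℤ.- + 1) ℤ.^ n) ⋆ (q^ (5 ℕ.* n ℕ.* n ℕ.+ 10 ℕ.* n) ⊗ inv (one ⊖ q^ (10 ℕ.* n ℕ.+ a)))
bilTerm a -[1+ k ] =
  (ℤ.- ((ℤ.- + 1) ℤ.^ suc k)) ⋆
    (q^ (5 ℕ.* suc k ℕ.* suc k ℕ.∸ a) ⊗ inv (one ⊖ q^ (10 ℕ.* suc k ℕ.∸ a)))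

-- S a = Σ_{n∈ℤ} (-1)^n q^{5n²+10n} / (1 - q^{10n+a}).  The n-th summand has
-- order ≥ |n| (for a ∈ {2,4}), so the N-th coefficient is the finite sum over |n| ≤ N.
S : ℕ → Series
S a N = bilTerm a (+ 0) N ℤ.+ go N
  where
  go : ℕ → ℤ
  go zero = + 0
  go (suc k) = go k ℤ.+ (bilTerm a (+ suc k) N ℤ.+ bilTerm a -[1+ k ] N)

R : ℕ → ℕ → ℕ → Series
R s t d n = + N̄₂ s 5 (5 ℕ.* n ℕ.+ d) ℤ.- + N̄₂ t 5 (5 ℕ.* n ℕ.+ d)

{-# OPTIONS --safe #-}
module Submission where

-- Let F_k(a) be the generating function of the overpartitions whose largest part contributes at most k to the
-- M₂-rank, those with at most a and those with at most a - 1 negatively counted parts being added up.  It satisfies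
-- a contiguous relation in k and a, which telescopes along the lines of constant rank.  Hence
-- φ(-q) = Σ (-1)^n q^{n²} times the number of overpartitions of rank r or r - 1 is a partial theta series, and since 5
-- is odd, φ(-q) times each rank difference modulo 5 is a combination of
-- Σ_{n ≠ 0} (-1)^n q^{n² + 2an} / (1 - q^{10n}) for a = 1, 2.  Comparing exponents modulo 5 turns this into five linear
-- equations which determine the R_st(d).  The claimed values solve them: the partial fraction identity
-- θ_b T_{c,b'} - θ_{b'} T_{c,b} = θ_{b+b'-c} Λ_{c-b,b'-c} eliminates the Appell sums, and all remaining products are, up
-- to a common factor, monomials in κ = q (q,q²,q⁸,q⁹;q¹⁰)_∞ / (q³,q⁴,q⁶,q⁷;q¹⁰)_∞, 1 ± κ, 1 + κ - κ² and
-- 1 - 4κ - κ², so that polynomial identities in κ remain.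

-- The claimed values are verified, not derived: the five equations are unitriangular at each
-- coefficient, so whatever satisfies them is the solution. Two obstacles shape the rest. Summands
-- with a denominator `1 - q^m`, `m` of either sign, must be power series in `q`; each is expanded
-- in nonnegative powers according to the sign of `m`, a polar summand is set to zero, and every
-- rearrangement takes place in a finite window of indices at each coefficient. On the combinatorial
-- side, let `w` mark the negatively counted parts: it is the multiple by `(1 + w) / (1 - w)` that
-- obeys a relation telescoping along lines of constant rank, and since `1 + w` survives in the
-- differences, two neighbouring ranks are counted together. Products for Lambert series come from
-- the zero of `θ b` at `b = - 5`, logarithmic derivatives from the one at `b = 5`. The polynomial
-- `1 - 4κ - κ²` stems from the norm form of the Gaussian integers, `1 ± κ` and `1 + κ - κ²` from
-- three-term theta relations. The `- 1` in `R_02(0)` is the uncounted empty overpartition.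

open import Defs
open import Algebra.Bundles using (CommutativeRing)
import Algebra.Properties.Ring as RingProperties
import Algebra.Solver.Ring as RingSolver
open import Algebra.Solver.Ring.AlmostCommutativeRing using (AlmostCommutativeRing; fromCommutativeRing; _-Raw-AlmostCommutative⟶_; Induced-equivalence)
open import Data.Bool using (Bool; true; false; not; _∧_; _∨_; if_then_else_) renaming (T to IsTrue)
open import Data.Empty using (⊥-elim)
open import Data.Fin using (Fin; zero; suc; toℕ; #_)
open import Data.Integer as ℤ using (ℤ; +_; -[1+_]; ∣_∣; _%ℕ_)
import Data.Integer.Properties as ℤP
import Data.Integer.Solver
open import Data.List as List using (List; []; _∷_; _++_)
open import Data.Maybe.Base using (just; nothing)
open import Data.Nat as ℕ using (ℕ; zero; suc; z≤n; s≤s; _/_)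
open import Data.Nat.DivMod using (m*n/n≡m; m*n%n≡0; [m+kn]%n≡m%n; +-distrib-/-∣ʳ)
open import Data.Nat.Divisibility using (divides)
import Data.Nat.Properties as ℕP
import Data.Nat.Solver
open import Data.Product using (_×_; _,_; proj₁; proj₂)
open import Data.Sum using (_⊎_; inj₁; inj₂)
open import Data.Vec as Vec using (Vec; []; _∷_)
open import Function using (_∘_)
open import Level using (0ℓ)
open import Relation.Binary.Definitions using (WeaklyDecidable)
open import Relation.Binary.PropositionalEquality as ≡ using (_≡_; _≢_; refl; cong; cong₂; sym; trans)
import Relation.Binary.Reasoning.Setoid as SetoidReasoning
open import Relation.Nullary using (yes; no)
open import Relation.Nullary.Decidable using (True; toWitness)

-- Integer coefficients and power series over a ring

module IntegerCoefficients {c ℓ} (R : CommutativeRing c ℓ) where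
  open CommutativeRing R renaming (refl to reflR; sym to symR; trans to transR)
  open RingProperties ring
  open SetoidReasoning setoid

  -- The separate clause for `suc zero` makes `int (+ 1)` definitionally `1#`, so the solver
  -- constant `con (+ 1)` denotes the unit itself.
  nat : ℕ → Carrier
  nat zero = 0#
  nat (suc zero) = 1#
  nat (suc (suc n)) = 1# + nat (suc n)

  int : ℤ → Carrier
  int (+ n) = nat n
  int -[1+ n ] = - nat (suc n)

  nat-suc : ∀ n → nat (suc n) ≈ 1# + nat n
  nat-suc zero = symR (+-identityʳ 1#)
  nat-suc (suc n) = reflR

  nat-+ : ∀ m n → nat (m ℕ.+ n) ≈ nat m + nat n
  nat-+ zero n = symR (+-identityˡ _)
  nat-+ (suc m) n = begin
    nat (suc (m ℕ.+ n))      ≈⟨ nat-suc (m ℕ.+ n) ⟩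
    1# + nat (m ℕ.+ n)       ≈⟨ +-congˡ (nat-+ m n) ⟩
    1# + (nat m + nat n)     ≈⟨ +-assoc _ _ _ ⟨
    (1# + nat m) + nat n     ≈⟨ +-congʳ (nat-suc m) ⟨
    nat (suc m) + nat n      ∎

  nat-* : ∀ m n → nat (m ℕ.* n) ≈ nat m * nat n
  nat-* zero n = symR (zeroˡ _)
  nat-* (suc m) n = begin
    nat (n ℕ.+ m ℕ.* n)          ≈⟨ nat-+ n (m ℕ.* n) ⟩
    nat n + nat (m ℕ.* n)        ≈⟨ +-cong (symR (*-identityˡ _)) (nat-* m n) ⟩
    1# * nat n + nat m * nat n   ≈⟨ distribʳ _ _ _ ⟨
    (1# + nat m) * nat n         ≈⟨ *-congʳ (nat-suc m) ⟨
    nat (suc m) * nat n          ∎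

  int-⊖ : ∀ m n → int (m ℤ.⊖ n) ≈ nat m - nat n
  int-⊖ zero zero = symR (-‿inverseʳ 0#)
  int-⊖ zero (suc n) = symR (+-identityˡ _)
  int-⊖ (suc m) zero = symR (transR (+-congˡ -0#≈0#) (+-identityʳ _))
  int-⊖ (suc m) (suc n) = begin
    int (suc m ℤ.⊖ suc n)              ≡⟨ cong int (ℤP.[1+m]⊖[1+n]≡m⊖n m n) ⟩
    int (m ℤ.⊖ n)                      ≈⟨ int-⊖ m n ⟩
    nat m - nat n                      ≈⟨ +-congˡ (+-identityˡ _) ⟨
    nat m + (0# - nat n)               ≈⟨ +-congˡ (+-congʳ (-‿inverseʳ 1#)) ⟨
    nat m + ((1# - 1#) - nat n)        ≈⟨ +-congˡ (+-assoc _ _ _) ⟩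
    nat m + (1# + (- 1# - nat n))      ≈⟨ +-assoc _ _ _ ⟨
    (nat m + 1#) + (- 1# - nat n)      ≈⟨ +-cong (+-comm _ _) (⁻¹-∙-comm 1# (nat n)) ⟩
    (1# + nat m) - (1# + nat n)        ≈⟨ +-cong (nat-suc m) (-‿cong (nat-suc n)) ⟨
    nat (suc m) - nat (suc n)          ∎
    where open import Algebra.Properties.AbelianGroup +-abelianGroup using (⁻¹-∙-comm)

  int-neg : ∀ i → int (ℤ.- i) ≈ - int i
  int-neg (+ zero) = symR -0#≈0#
  int-neg (+ suc n) = reflR
  int-neg -[1+ n ] = symR (-‿involutive _)

  int-+ : ∀ i j → int (i ℤ.+ j) ≈ int i + int j
  int-+ (+ m) (+ n) = nat-+ m n
  int-+ (+ m) -[1+ n ] = int-⊖ m (suc n)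
  int-+ -[1+ m ] (+ n) = transR (int-⊖ n (suc m)) (+-comm _ _)
  int-+ -[1+ m ] -[1+ n ] = begin
    - nat (suc (suc (m ℕ.+ n)))      ≡⟨ cong (λ k → - nat (suc k)) (ℕP.+-suc m n) ⟨
    - nat (suc m ℕ.+ suc n)          ≈⟨ -‿cong (nat-+ (suc m) (suc n)) ⟩
    - (nat (suc m) + nat (suc n))    ≈⟨ ⁻¹-∙-comm _ _ ⟨
    - nat (suc m) - nat (suc n)      ∎
    where open import Algebra.Properties.AbelianGroup +-abelianGroup using (⁻¹-∙-comm)

  nat-int-* : ∀ m j → int (+ m ℤ.* j) ≈ nat m * int j
  nat-int-* m (+ n) = transR (reflexive (cong int (sym (ℤP.pos-* m n)))) (nat-* m n)
  nat-int-* m -[1+ n ] = begin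
    int (+ m ℤ.* -[1+ n ])        ≡⟨ cong int (ℤP.neg-distribʳ-* (+ m) (+ suc n)) ⟨
    int (ℤ.- (+ m ℤ.* + suc n))   ≈⟨ int-neg (+ m ℤ.* + suc n) ⟩
    - int (+ m ℤ.* + suc n)       ≈⟨ -‿cong (nat-int-* m (+ suc n)) ⟩
    - (nat m * nat (suc n))       ≈⟨ -‿distribʳ-* _ _ ⟩
    nat m * - nat (suc n)         ∎

  int-* : ∀ i j → int (i ℤ.* j) ≈ int i * int j
  int-* (+ m) j = nat-int-* m j
  int-* -[1+ m ] j = begin
    int (-[1+ m ] ℤ.* j)          ≡⟨ cong int (ℤP.neg-distribˡ-* (+ suc m) j) ⟨
    int (ℤ.- (+ suc m ℤ.* j))     ≈⟨ int-neg (+ suc m ℤ.* j) ⟩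
    - int (+ suc m ℤ.* j)         ≈⟨ -‿cong (nat-int-* (suc m) j) ⟩
    - (nat (suc m) * int j)       ≈⟨ -‿distribˡ-* _ _ ⟩
    - nat (suc m) * int j         ∎

  private
    almost : AlmostCommutativeRing c ℓ
    almost = fromCommutativeRing R

    intMorphism : ℤ.+-*-rawRing -Raw-AlmostCommutative⟶ almost
    intMorphism = record
      { ⟦_⟧ = int
      ; +-homo = int-+
      ; *-homo = int-*
      ; -‿homo = int-neg
      ; 0-homo = reflR
      ; 1-homo = reflR
      }

    int≟ : WeaklyDecidable (Induced-equivalence intMorphism)
    int≟ i j with i ℤ.≟ j
    ... | yes i≡j = just (reflexive (cong int i≡j))
    ... | no _ = nothing

  open RingSolver ℤ.+-*-rawRing almost intMorphism int≟ public
    using (Polynomial; solve; _:=_; _:+_; _:*_; _:-_; :-_; con; _:^_)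

module PowerSeries {c ℓ} (R : CommutativeRing c ℓ) where
  open CommutativeRing R renaming (refl to reflR; sym to symR; trans to transR)
  open SetoidReasoning setoid
  open IntegerCoefficients R using (solve; _:=_; _:+_; _:*_)

  Coefficients : Set c
  Coefficients = ℕ → Carrier

  tail : Coefficients → Coefficients
  tail f n = f (suc n)

  infixl 7 _·_
  -- Recursion on the first factor turns the ring laws into inductions on the index, over any
  -- commutative ring. The construction serves twice: over ℤ for series in `q`, and over those for
  -- series in a second variable `w`.
  _·_ : Coefficients → Coefficients → Coefficients
  (f · g) zero = f 0 * g 0
  (f · g) (suc n) = f 0 * g (suc n) + (tail f · g) n

  ·-cong : ∀ {f f′ g g′} → (∀ n → f n ≈ f′ n) → (∀ n → g n ≈ g′ n) → ∀ n → (f · g) n ≈ (f′ · g′) n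
  ·-cong p q zero = *-cong (p 0) (q 0)
  ·-cong p q (suc n) = +-cong (*-cong (p 0) (q (suc n))) (·-cong (p ∘ suc) q n)

  ·-last : ∀ f g n → (f · g) (suc n) ≈ (f · tail g) n + f (suc n) * g 0
  ·-last f g zero = reflR
  ·-last f g (suc n) = transR (+-congˡ (·-last (tail f) g n)) (symR (+-assoc _ _ _))

  ·-comm : ∀ f g n → (f · g) n ≈ (g · f) n
  ·-comm f g zero = *-comm _ _
  ·-comm f g (suc n) = begin
    f 0 * g (suc n) + (tail f · g) n   ≈⟨ +-cong (*-comm _ _) (·-comm (tail f) g n) ⟩
    g (suc n) * f 0 + (g · tail f) n   ≈⟨ +-comm _ _ ⟩
    (g · tail f) n + g (suc n) * f 0   ≈⟨ ·-last g f n ⟨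
    (g · f) (suc n)                    ∎

  ·-distribʳ : ∀ h f g n → ((λ m → f m + g m) · h) n ≈ (f · h) n + (g · h) n
  ·-distribʳ h f g zero = distribʳ _ _ _
  ·-distribʳ h f g (suc n) = begin
    (f 0 + g 0) * h (suc n) + ((λ m → f (suc m) + g (suc m)) · h) n
      ≈⟨ +-congˡ (·-distribʳ h (tail f) (tail g) n) ⟩
    (f 0 + g 0) * h (suc n) + ((tail f · h) n + (tail g · h) n)
      ≈⟨ solve 5 (λ a b k x y → (a :+ b) :* k :+ (x :+ y) := (a :* k :+ x) :+ (b :* k :+ y)) reflR (f 0) (g 0) (h (suc n)) _ _ ⟩
    (f · h) (suc n) + (g · h) (suc n) ∎

  ·-scaleˡ : ∀ a f g n → ((λ m → a * f m) · g) n ≈ a * (f · g) n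
  ·-scaleˡ a f g zero = *-assoc _ _ _
  ·-scaleˡ a f g (suc n) = begin
    a * f 0 * g (suc n) + ((λ m → a * f (suc m)) · g) n  ≈⟨ +-cong (*-assoc _ _ _) (·-scaleˡ a (tail f) g n) ⟩
    a * (f 0 * g (suc n)) + a * (tail f · g) n           ≈⟨ distribˡ _ _ _ ⟨
    a * (f · g) (suc n)                                  ∎

  ·-assoc : ∀ f g h n → ((f · g) · h) n ≈ (f · (g · h)) n
  ·-assoc f g h zero = *-assoc _ _ _
  ·-assoc f g h (suc n) = begin
    f 0 * g 0 * h (suc n) + (tail (f · g) · h) n
      ≈⟨ +-congˡ (·-distribʳ h (λ m → f 0 * g (suc m)) (tail f · g) n) ⟩
    f 0 * g 0 * h (suc n) + (((λ m → f 0 * g (suc m)) · h) n + ((tail f · g) · h) n)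
      ≈⟨ +-congˡ (+-cong (·-scaleˡ (f 0) (tail g) h n) (·-assoc (tail f) g h n)) ⟩
    f 0 * g 0 * h (suc n) + (f 0 * (tail g · h) n + (tail f · (g · h)) n)
      ≈⟨ solve 5 (λ a b k x y → a :* b :* k :+ (a :* x :+ y) := a :* (b :* k :+ x) :+ y) reflR (f 0) (g 0) (h (suc n)) _ _ ⟩
    (f · (g · h)) (suc n) ∎

  constant : Carrier → Coefficients
  constant a zero = a
  constant a (suc n) = 0#

  ·-zeroˡ : ∀ f n → ((λ _ → 0#) · f) n ≈ 0#
  ·-zeroˡ f zero = zeroˡ _
  ·-zeroˡ f (suc n) = transR (+-cong (zeroˡ _) (·-zeroˡ f n)) (+-identityˡ _)

  constant-· : ∀ a f n → (constant a · f) n ≈ a * f n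
  constant-· a f zero = reflR
  constant-· a f (suc n) = transR (+-congˡ (·-zeroˡ f n)) (+-identityʳ _)

  ·-identityˡ : ∀ f n → (constant 1# · f) n ≈ f n
  ·-identityˡ f n = transR (constant-· 1# f n) (*-identityˡ _)

  powerSeriesRing : CommutativeRing c ℓ
  powerSeriesRing = record
    { Carrier = Coefficients
    ; _≈_ = λ f g → ∀ n → f n ≈ g n
    ; _+_ = λ f g n → f n + g n
    ; _*_ = _·_
    ; -_ = λ f n → - f n
    ; 0# = λ _ → 0#
    ; 1# = constant 1#
    ; isCommutativeRing = record
      { isRing = record
        { +-isAbelianGroup = record
          { isGroup = record
            { isMonoid = record
              { isSemigroup = record
                { isMagma = record
                  { isEquivalence = record
                    { refl = λ _ → reflR
                    ; sym = λ p n → symR (p n)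
                    ; trans = λ p q n → transR (p n) (q n) }
                  ; ∙-cong = λ p q n → +-cong (p n) (q n) }
                ; assoc = λ f g h n → +-assoc _ _ _ }
              ; identity = (λ f n → +-identityˡ _) , (λ f n → +-identityʳ _) }
            ; inverse = (λ f n → -‿inverseˡ _) , (λ f n → -‿inverseʳ _)
            ; ⁻¹-cong = λ p n → -‿cong (p n) }
          ; comm = λ f g n → +-comm _ _ }
        ; *-cong = ·-cong
        ; *-assoc = ·-assoc
        ; *-identity = ·-identityˡ , (λ f n → transR (·-comm f _ n) (·-identityˡ f n))
        ; distrib = (λ f g h n → transR (·-comm f _ n) (transR (·-distribʳ f g h n) (+-cong (·-comm g f n) (·-comm h f n))))
                  , ·-distribʳ }
      ; *-comm = ·-comm } }

-- The ring of integer power series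

open PowerSeries ℤP.+-*-commutativeRing using (_·_) renaming (powerSeriesRing to ℤ⟦q⟧; ·-cong to ·ℤ-cong)

Σ≤-cong : ∀ n {f g : ℕ → ℤ} → (∀ i → i ℕ.≤ n → f i ≡ g i) → Σ≤ n f ≡ Σ≤ n g
Σ≤-cong zero p = p 0 z≤n
Σ≤-cong (suc n) p = cong₂ ℤ._+_ (Σ≤-cong n (λ i i≤n → p i (ℕP.m≤n⇒m≤1+n i≤n))) (p (suc n) ℕP.≤-refl)

Σ≤-head : ∀ n (f : ℕ → ℤ) → Σ≤ (suc n) f ≡ f 0 ℤ.+ Σ≤ n (f ∘ suc)
Σ≤-head zero f = refl
Σ≤-head (suc n) f = trans (cong (ℤ._+ f (suc (suc n))) (Σ≤-head n f)) (ℤP.+-assoc (f 0) _ _)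

⊗≡· : ∀ f g n → (f ⊗ g) n ≡ (f · g) n
⊗≡· f g zero = refl
⊗≡· f g (suc n) = trans (Σ≤-head n _) (cong (λ z → f 0 ℤ.* g (suc n) ℤ.+ z) (⊗≡· (f ∘ suc) g n))

one≡constant : ∀ n → one n ≡ CommutativeRing.1# ℤ⟦q⟧ n
one≡constant zero = refl
one≡constant (suc n) = refl

-- Built on `_⊗_` and `one` themselves, with the laws transported along `⊗≡·`, so that the ring
-- solver acts on the very expressions of the theorem.
seriesRing : CommutativeRing 0ℓ 0ℓ
seriesRing = record
  { Carrier = Series
  ; _≈_ = _≈ˢ_
  ; _+_ = _⊕_
  ; _*_ = _⊗_
  ; -_ = λ f n → ℤ.- f n
  ; 0# = λ _ → + 0
  ; 1# = one
  ; isCommutativeRing = record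
    { isRing = record
      { +-isAbelianGroup = Z.+-isAbelianGroup
      ; *-cong = λ {f} {f′} {g} {g′} p q n → trans (⊗≡· f g n) (trans (·ℤ-cong p q n) (sym (⊗≡· f′ g′ n)))
      ; *-assoc = λ f g h n → trans (⊗≡· (f ⊗ g) h n) (trans (·ℤ-cong (⊗≡· f g) (λ _ → refl) n)
                     (trans (Z.*-assoc f g h n) (trans (·ℤ-cong {f} (λ _ → refl) (λ m → sym (⊗≡· g h m)) n) (sym (⊗≡· f (g ⊗ h) n)))))
      ; *-identity = idˡ , (λ f n → trans (comm f one n) (idˡ f n))
      ; distrib = (λ f g h n → trans (⊗≡· f (g ⊕ h) n) (trans (Z.distribˡ f g h n) (cong₂ ℤ._+_ (sym (⊗≡· f g n)) (sym (⊗≡· f h n)))))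
                , (λ f g h n → trans (⊗≡· (g ⊕ h) f n) (trans (Z.distribʳ f g h n) (cong₂ ℤ._+_ (sym (⊗≡· g f n)) (sym (⊗≡· h f n)))))
      }
    ; *-comm = comm } }
  where
  module Z = CommutativeRing ℤ⟦q⟧
  comm : ∀ f g → f ⊗ g ≈ˢ g ⊗ f
  comm f g n = trans (⊗≡· f g n) (trans (Z.*-comm f g n) (sym (⊗≡· g f n)))
  idˡ : ∀ f → one ⊗ f ≈ˢ f
  idˡ f n = trans (⊗≡· one f n) (trans (·ℤ-cong {one} {Z.1#} {f} one≡constant (λ _ → refl) n) (Z.*-identityˡ f n))

module Modulo {c ℓ} (R : CommutativeRing c ℓ) where
  open CommutativeRing R renaming (trans to transR; sym to symR; refl to reflR)

  vanish-+ : ∀ {x y} → x ≈ 0# → y ≈ 0# → x + y ≈ 0#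
  vanish-+ p r = transR (+-cong p r) (+-identityˡ 0#)

  vanish-* : ∀ z {x y} → x ≈ y → z * (x + - y) ≈ 0#
  vanish-* z {x} {y} p = transR (*-congˡ (transR (+-congʳ p) (-‿inverseʳ y))) (zeroʳ z)

  -- Pattern for deducing an equation from several others: the solver checks that one side is the
  -- other plus a combination of differences `x - y`, and each hypothesis kills its difference. Such
  -- a proof consists of its list of multipliers.
  remove : ∀ {x y z} → x ≈ y + z → z ≈ 0# → x ≈ y
  remove {y = y} p r = transR p (transR (+-congˡ r) (+-identityʳ y))

-- The weighted sum inside `inv` is private to its definition, so the type is left to be inferred
-- from the use in `inv-step`. There `with` replaces the weights by a variable `w`, which is the
-- generality that the induction needs.
inv-step-shift : ∀ (f : Series) (M : ℕ) (w : ℕ → ℤ) → _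

inv-step : ∀ f M → inv f (suc M) ≡ ℤ.- ((λ i → f (suc i)) · inv f) M
inv-step f M with (λ i → f (suc i))
... | w = inv-step-shift f M w

inv-step-shift f zero w = cong ℤ.-_ (ℤP.+-identityʳ _)
inv-step-shift f (suc M) w =
  cong (λ z → ℤ.- (w 0 ℤ.* inv f (suc M) ℤ.+ z)) (ℤP.neg-injective (inv-step-shift f M (w ∘ suc)))

S-partial : ℕ → ℕ → ℕ → ℤ
S-partial a N zero = + 0
S-partial a N (suc k) = S-partial a N k ℤ.+ (bilTerm a (+ suc k) N ℤ.+ bilTerm a -[1+ k ] N)

-- The left side is the local partial sum of `S`, inferred for the same reason. Naming `suc M` as
-- `x` separates the coefficient index, which stays fixed, from the number of summands, on which the
-- induction runs.
S-partial-unique : ∀ (a x M : ℕ) (t : ℤ) → _ ≡ S-partial a x M ℤ.+ t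
S-expand-suc : ∀ (a M : ℕ) (s t : ℤ) → _

S-expand : ∀ a N → S a N ≡ bilTerm a (+ 0) N ℤ.+ S-partial a N N
S-expand a zero = refl
S-expand a (suc M) with bilTerm a (+ 0) (suc M) | bilTerm a (+ suc M) (suc M) ℤ.+ bilTerm a -[1+ M ] (suc M)
... | s | t = S-expand-suc a M s t

S-expand-suc a M s t with suc M
... | x = cong (λ z → s ℤ.+ z) (S-partial-unique a x M t)

S-partial-unique a x zero t = refl
S-partial-unique a x (suc M) t =
  cong (ℤ._+ t) (S-partial-unique a x M (bilTerm a (+ suc M) x ℤ.+ bilTerm a -[1+ M ] x))

-- Sums over ℤ

open import Data.Integer using (_+_; _*_; _-_; -_; _≤_; _<_)
module ℤS = Data.Integer.Solver.+-*-Solver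
module N = Data.Nat.Solver.+-*-Solver
module 𝕊 = IntegerCoefficients seriesRing
open ℤS using (_:+_; _:*_; :-_; _:-_; _:=_; con)
open CommutativeRing seriesRing using () renaming (-_ to ⊝_; -‿cong to ⊝-cong)
open 𝕊 using () renaming (_:+_ to _+:_; _:*_ to _*:_; :-_ to -:_; _:-_ to _-:_; _:=_ to _=:_; con to con:)

1: : ∀ {n} → 𝕊.Polynomial n
1: = con: (+ 1)
open CommutativeRing seriesRing using () renaming
  ( refl to ≈-refl; sym to ≈-sym; trans to ≈-trans; *-cong to ⊗-cong; *-congˡ to ⊗-congˡ; *-congʳ to ⊗-congʳ
  ; *-comm to ⊗-comm; *-assoc to ⊗-assoc; *-identityˡ to ⊗-identityˡ; *-identityʳ to ⊗-identityʳ
  ; +-cong to ⊕-cong; setoid to seriesSetoid; zeroˡ to ⊗-zeroˡ; zeroʳ to ⊗-zeroʳ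
  ; distribˡ to ⊗-distribˡ-⊕; distribʳ to ⊗-distribʳ-⊕)

interchange : ∀ a b c d → (a + b) + (c + d) ≡ (a + c) + (b + d)
interchange = ℤS.solve 4 (λ a b c d → (a :+ b) :+ (c :+ d) := (a :+ c) :+ (b :+ d)) refl

sumZ : ℕ → (ℤ → ℤ) → ℤ
sumZ zero f = f (+ 0)
sumZ (suc B) f = sumZ B f + (f (+ suc B) + f -[1+ B ])

sumZ-cong : ∀ B {f g : ℤ → ℤ} → (∀ i → ∣ i ∣ ℕ.≤ B → f i ≡ g i) → sumZ B f ≡ sumZ B g
sumZ-cong zero p = p (+ 0) z≤n
sumZ-cong (suc B) p = cong₂ _+_ (sumZ-cong B (λ i i≤B → p i (ℕP.m≤n⇒m≤1+n i≤B)))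
  (cong₂ _+_ (p (+ suc B) ℕP.≤-refl) (p -[1+ B ] ℕP.≤-refl))

sumZ-+ : ∀ B f g → sumZ B (λ i → f i + g i) ≡ sumZ B f + sumZ B g
sumZ-+ zero f g = refl
sumZ-+ (suc B) f g = trans (cong₂ _+_ (sumZ-+ B f g) (interchange (f (+ suc B)) (g (+ suc B)) (f -[1+ B ]) (g -[1+ B ]))) (interchange (sumZ B f) (sumZ B g) (f (+ suc B) + f -[1+ B ]) (g (+ suc B) + g -[1+ B ]))

sumZ-*ˡ : ∀ B c f → sumZ B (λ i → c * f i) ≡ c * sumZ B f
sumZ-*ˡ zero c f = refl
sumZ-*ˡ (suc B) c f = trans (cong (λ z → z + (c * f (+ suc B) + c * f -[1+ B ])) (sumZ-*ˡ B c f))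
  (ℤS.solve 4 (λ c a b d → c :* a :+ (c :* b :+ c :* d) := c :* (a :+ (b :+ d))) refl c (sumZ B f) (f (+ suc B)) (f -[1+ B ]))

sumZ-0 : ∀ B → sumZ B (λ _ → + 0) ≡ + 0
sumZ-0 zero = refl
sumZ-0 (suc B) = cong (_+ + 0) (sumZ-0 B)

sumZ-swap : ∀ B C (f : ℤ → ℤ → ℤ) → sumZ B (λ i → sumZ C (f i)) ≡ sumZ C (λ j → sumZ B (λ i → f i j))
sumZ-swap zero C f = refl
sumZ-swap (suc B) C f = trans
  (cong₂ _+_ (sumZ-swap B C f) (sym (sumZ-+ C (f (+ suc B)) (f -[1+ B ]))))
  (sym (sumZ-+ C (λ j → sumZ B (λ i → f i j)) _))

Vanish : ℕ → (ℤ → ℤ) → Set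
Vanish B f = ∀ i → B ℕ.< ∣ i ∣ → f i ≡ + 0

sumZ-extend : ∀ {B f} → Vanish B f → ∀ W → B ℕ.≤ W → sumZ W f ≡ sumZ B f
sumZ-extend {zero} v zero z≤n = refl
sumZ-extend {B} {f} v (suc W) B≤W with ℕP.m≤n⇒m<n∨m≡n B≤W
... | inj₁ (s≤s B≤W′) = trans
      (cong₂ _+_ (sumZ-extend v W B≤W′) (cong₂ _+_ (v (+ suc W) (s≤s B≤W′)) (v -[1+ W ] (s≤s B≤W′))))
      (ℤP.+-identityʳ _)
... | inj₂ refl = refl

sumZ-reflect : ∀ B f → sumZ B (λ i → f (- i)) ≡ sumZ B f
sumZ-reflect zero f = refl
sumZ-reflect (suc B) f = cong₂ _+_ (sumZ-reflect B f) (ℤP.+-comm (f (- (+ suc B))) (f (+ suc B)))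

suc-ℤ : ∀ B → -[1+ B ] + + 1 ≡ - (+ B)
suc-ℤ zero = refl
suc-ℤ (suc B) = refl

-- A translation by one trades the lowest index of the symmetric window for a new highest one; if
-- `f` vanishes at both, the sum is unchanged.
sumZ-edge : ∀ B f → sumZ B (λ i → f (i + + 1)) + f (- (+ B)) ≡ sumZ B f + f (+ suc B)
sumZ-edge zero f = ℤP.+-comm (f (+ 1)) (f (+ 0))
sumZ-edge (suc B) f = begin
  (s′ + (f (+ suc B + + 1) + f (-[1+ B ] + + 1))) + f -[1+ B ]
    ≡⟨ cong₂ (λ x y → (s′ + (f x + f y)) + f -[1+ B ]) (cong +_ (ℕP.+-comm (suc B) 1)) (suc-ℤ B) ⟩
  (s′ + (f (+ suc (suc B)) + f (- (+ B)))) + f -[1+ B ]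
    ≡⟨ ℤS.solve 4 (λ s a b c → (s :+ (a :+ b)) :+ c := (s :+ b) :+ (a :+ c)) refl s′ (f (+ suc (suc B))) (f (- (+ B))) (f -[1+ B ]) ⟩
  (s′ + f (- (+ B))) + (f (+ suc (suc B)) + f -[1+ B ])
    ≡⟨ cong (λ z → z + (f (+ suc (suc B)) + f -[1+ B ])) (sumZ-edge B f) ⟩
  (sumZ B f + f (+ suc B)) + (f (+ suc (suc B)) + f -[1+ B ])
    ≡⟨ ℤS.solve 4 (λ s a b c → (s :+ a) :+ (b :+ c) := (s :+ (a :+ c)) :+ b) refl (sumZ B f) (f (+ suc B)) (f (+ suc (suc B))) (f -[1+ B ]) ⟩
  sumZ (suc B) f + f (+ suc (suc B)) ∎
  where
  open ≡.≡-Reasoning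
  s′ = sumZ B (λ i → f (i + + 1))

Vanish-shift : ∀ {B f} s → Vanish B f → Vanish (B ℕ.+ ∣ s ∣) (λ i → f (i + s))
Vanish-shift {B} s v i B+s<i = v (i + s) (ℕP.+-cancelʳ-< ∣ s ∣ _ _ (ℕP.<-≤-trans B+s<i
  (ℕP.≤-trans (ℕP.≤-reflexive (cong ∣_∣ (ℤS.solve 2 (λ i s → i := (i :+ s) :+ (:- s)) refl i s)))
  (ℕP.≤-trans (ℤP.∣i+j∣≤∣i∣+∣j∣ (i + s) (- s)) (ℕP.≤-reflexive (cong (λ z → ∣ i + s ∣ ℕ.+ z) (ℤP.∣-i∣≡∣i∣ s)))))))

sumZ-shift₁ : ∀ {B f} → Vanish B f → ∀ W → B ℕ.< W → sumZ W (λ i → f (i + + 1)) ≡ sumZ W f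
sumZ-shift₁ {B} {f} v W B<W = begin
  sumZ W (λ i → f (i + + 1))                      ≡⟨ ℤP.+-identityʳ _ ⟨
  sumZ W (λ i → f (i + + 1)) + + 0              ≡⟨ cong (λ z → sumZ W (λ i → f (i + + 1)) + z) (v (- (+ W)) (≡.subst (B ℕ.<_) (sym (ℤP.∣-i∣≡∣i∣ (+ W))) B<W)) ⟨
  sumZ W (λ i → f (i + + 1)) + f (- (+ W))    ≡⟨ sumZ-edge W f ⟩
  sumZ W f + f (+ suc W)                          ≡⟨ cong (λ z → sumZ W f + z) (v (+ suc W) (ℕP.m≤n⇒m≤1+n B<W)) ⟩
  sumZ W f + + 0                                  ≡⟨ ℤP.+-identityʳ _ ⟩
  sumZ W f                                          ∎
  where open ≡.≡-Reasoning

sumZ-shift₊ : ∀ k {B f} → Vanish B f → ∀ W → B ℕ.+ k ℕ.≤ W → sumZ W (λ i → f (i + + k)) ≡ sumZ W f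
sumZ-shift₊ zero {B} {f} v W le = sumZ-cong W (λ i _ → cong f (ℤP.+-identityʳ i))
sumZ-shift₊ (suc k) {B} {f} v W le = trans
  (sumZ-cong W (λ i _ → cong f (ℤS.solve 2 (λ i k → i :+ (con (+ 1) :+ k) := (i :+ k) :+ con (+ 1)) refl i (+ k))))
  (trans (sumZ-shift₊ k (Vanish-shift (+ 1) v) W (≡.subst (ℕ._≤ W) (trans (ℕP.+-suc B k) (cong (ℕ._+ k) (ℕP.+-comm 1 B))) le))
           (sumZ-shift₁ v W (ℕP.<-≤-trans (ℕP.m<m+n B (s≤s z≤n)) le)))

-- A negative translation is undone by a positive one of the translated function, whose support has
-- already grown by `∣ s ∣`; hence the window needs twice that margin.
sumZ-shift : ∀ s {B f} → Vanish B f → ∀ W → B ℕ.+ (∣ s ∣ ℕ.+ ∣ s ∣) ℕ.≤ W → sumZ W (λ i → f (i + s)) ≡ sumZ W f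
sumZ-shift (+ k) {B} v W le = sumZ-shift₊ k v W (ℕP.≤-trans (ℕP.+-monoʳ-≤ B (ℕP.m≤m+n k k)) le)
sumZ-shift s@(-[1+ k ]) {B} {f} v W le = sym (trans
  (sumZ-cong W (λ i _ → cong f (ℤS.solve 2 (λ i s → i := (i :+ (:- s)) :+ s) refl i s)))
  (sumZ-shift₊ (suc k) (Vanish-shift s v) W (≡.subst (ℕ._≤ W) (sym (ℕP.+-assoc B (suc k) (suc k))) le)))

-- Summand `i` has order at least `∣ i ∣ - 10`. The slack 10 absorbs the small translations and
-- negative linear terms that occur later, so that one window `n + 10` serves all sums.
Null : (ℤ → Series) → Set
Null F = ∀ i n → n ℕ.+ 10 ℕ.< ∣ i ∣ → F i n ≡ + 0

-- For a family vanishing as in Null this is the sum over ℤ; otherwise it has no meaning.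
Σℤ : (ℤ → Series) → Series
Σℤ F n = sumZ (n ℕ.+ 10) (λ i → F i n)

Σℤ-window : ∀ {F} → Null F → ∀ n W → n ℕ.+ 10 ℕ.≤ W → sumZ W (λ i → F i n) ≡ Σℤ F n
Σℤ-window null n W = sumZ-extend (λ i → null i n) W

Σℤ-cong : ∀ {F G} → (∀ i → F i ≈ˢ G i) → Σℤ F ≈ˢ Σℤ G
Σℤ-cong p n = sumZ-cong (n ℕ.+ 10) (λ i _ → p i n)

Σℤ-⊕ : ∀ F G → Σℤ (λ i → F i ⊕ G i) ≈ˢ Σℤ F ⊕ Σℤ G
Σℤ-⊕ F G n = sumZ-+ (n ℕ.+ 10) _ _

Σℤ-⋆ : ∀ c F → Σℤ (λ i → c ⋆ F i) ≈ˢ c ⋆ Σℤ F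
Σℤ-⋆ c F n = sumZ-*ˡ (n ℕ.+ 10) c _

-- No vanishing is required: at a given coefficient both orders run over the same finite square of
-- indices.
Σℤ-swap : ∀ (F : ℤ → ℤ → Series) → Σℤ (λ i → Σℤ (F i)) ≈ˢ Σℤ (λ j → Σℤ (λ i → F i j))
Σℤ-swap F n = sumZ-swap (n ℕ.+ 10) (n ℕ.+ 10) (λ i j → F i j n)

Σℤ-reflect : ∀ F → Σℤ (λ i → F (- i)) ≈ˢ Σℤ F
Σℤ-reflect F n = sumZ-reflect (n ℕ.+ 10) (λ i → F i n)

Σℤ-shift : ∀ s F → Null F → Null (λ i → F (i + s)) → Σℤ (λ i → F (i + s)) ≈ˢ Σℤ F
Σℤ-shift s F nF nF′ n = trans (sym (Σℤ-window nF′ n W n+10≤W))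
  (trans (sumZ-shift s (λ i → nF i n) W ℕP.≤-refl) (Σℤ-window nF n W n+10≤W))
  where
  W = n ℕ.+ 10 ℕ.+ (∣ s ∣ ℕ.+ ∣ s ∣)
  n+10≤W = ℕP.m≤m+n (n ℕ.+ 10) (∣ s ∣ ℕ.+ ∣ s ∣)

Σ≤-sumZ-swap : ∀ n B (f : ℕ → ℤ → ℤ) → Σ≤ n (λ k → sumZ B (f k)) ≡ sumZ B (λ i → Σ≤ n (λ k → f k i))
Σ≤-sumZ-swap zero B f = refl
Σ≤-sumZ-swap (suc n) B f = trans (cong (λ z → z + sumZ B (f (suc n))) (Σ≤-sumZ-swap n B f)) (sym (sumZ-+ B (λ i → Σ≤ n (λ k → f k i)) (f (suc n))))

-- The product at `n` uses `F` at all `k ≤ n`, whose own windows are smaller; vanishing allows each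
-- of them to be enlarged to the window of `n`.
Σℤ-⊗ : ∀ {F} → Null F → ∀ g → Σℤ F ⊗ g ≈ˢ Σℤ (λ i → F i ⊗ g)
Σℤ-⊗ {F} null g n = trans
  (Σ≤-cong n (λ k k≤n → trans (cong (_* g (n ℕ.∸ k)) (sym (Σℤ-window null k (n ℕ.+ 10) (ℕP.+-monoˡ-≤ 10 k≤n))))
     (trans (ℤP.*-comm (sumZ (n ℕ.+ 10) (λ i → F i k)) _)
     (trans (sym (sumZ-*ˡ (n ℕ.+ 10) (g (n ℕ.∸ k)) (λ i → F i k))) (sumZ-cong (n ℕ.+ 10) (λ i _ → ℤP.*-comm (g (n ℕ.∸ k)) (F i k)))))))
  (Σ≤-sumZ-swap n (n ℕ.+ 10) (λ k i → F i k * g (n ℕ.∸ k)))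

⊗-Σℤ : ∀ {F} → Null F → ∀ g → g ⊗ Σℤ F ≈ˢ Σℤ (λ i → g ⊗ F i)
⊗-Σℤ {F} null g = ≈-trans (⊗-comm g (Σℤ F)) (≈-trans (Σℤ-⊗ null g) (Σℤ-cong (λ i → ⊗-comm (F i) g)))

-- Orders of vanishing and integer powers of q

Ord : ℤ → Series → Set
Ord e f = ∀ n → + n < e → f n ≡ + 0

Ord-≤ : ∀ {d e f} → d ≤ e → Ord e f → Ord d f
Ord-≤ d≤e ord n n<d = ord n (ℤP.<-≤-trans n<d d≤e)

Ord-⋆ : ∀ {e f} c → Ord e f → Ord e (c ⋆ f)
Ord-⋆ c ord n n<e = trans (cong (c *_) (ord n n<e)) (ℤP.*-zeroʳ c)

Σ≤-0 : ∀ n → Σ≤ n (λ _ → + 0) ≡ + 0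
Σ≤-0 zero = refl
Σ≤-0 (suc n) = cong (_+ + 0) (Σ≤-0 n)

Ord-⊗ : ∀ {e f} → Ord e f → ∀ g → Ord e (f ⊗ g)
Ord-⊗ ord g n n<e = trans (Σ≤-cong n (λ k k≤n → cong (_* g (n ℕ.∸ k)) (ord k (ℤP.≤-<-trans (ℤ.+≤+ k≤n) n<e)))) (Σ≤-0 n)

Ord-Σℤ : ∀ {e F} → (∀ i → Ord e (F i)) → Ord e (Σℤ F)
Ord-Σℤ ord n n<e = trans (sumZ-cong (n ℕ.+ 10) (λ i _ → ord i n n<e)) (sumZ-0 (n ℕ.+ 10))

-- A negative power is given the default value zero. Multiplicativity therefore needs nonnegative
-- exponents, which explains the many side conditions of this kind below.
mono : ℤ → Series
mono (+ k) = q^ k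
mono -[1+ _ ] _ = + 0

Ord-mono : ∀ e → Ord e (mono e)
Ord-mono (+ suc k) zero n<e = refl
Ord-mono (+ suc k) (suc n) (ℤ.+<+ (s≤s n<k)) = Ord-mono (+ k) n (ℤ.+<+ n<k)
Ord-mono (+ zero) n (ℤ.+<+ ())
Ord-mono -[1+ k ] n ()

q^-suc-⊗ : ∀ k f n → (q^ (suc k) ⊗ f) (suc n) ≡ (q^ k ⊗ f) n
q^-suc-⊗ k f n = trans (⊗≡· (q^ (suc k)) f (suc n)) (trans (ℤP.+-identityˡ _) (sym (⊗≡· (q^ k) f n)))

q^-+ : ∀ a b → q^ a ⊗ q^ b ≈ˢ q^ (a ℕ.+ b)
q^-+ zero b = ⊗-identityˡ (q^ b)
q^-+ (suc a) b zero = refl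
q^-+ (suc a) b (suc n) = trans (q^-suc-⊗ a (q^ b) n) (q^-+ a b n)

mono-+ : ∀ {a b} → + 0 ≤ a → + 0 ≤ b → mono a ⊗ mono b ≈ˢ mono (a + b)
mono-+ {+ a} {+ b} _ _ = q^-+ a b

inv-correct : ∀ f → f 0 ≡ + 1 → f ⊗ inv f ≈ˢ one
inv-correct f f0 zero = trans (ℤP.*-identityʳ (f 0)) f0
inv-correct f f0 (suc n) = trans (⊗≡· f (inv f) (suc n)) (trans
  (cong₂ (λ a b → a * b + ((λ i → f (suc i)) · inv f) n) f0 (inv-step f n))
  (ℤS.solve 1 (λ x → con (+ 1) :* (:- x) :+ x := con (+ 0)) refl (((λ i → f (suc i)) · inv f) n)))

-- Geometric series

nn-+ : ∀ {a b} → + 0 ≤ a → + 0 ≤ b → + 0 ≤ a + b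
nn-+ = ℤP.+-mono-≤

nn-* : ∀ {a b} → + 0 ≤ a → + 0 ≤ b → + 0 ≤ a * b
nn-* {+ m} {+ n} _ _ = ≡.subst (+ 0 ≤_) (ℤP.pos-* m n) (ℤ.+≤+ z≤n)

nn : ∀ {n} → + 0 ≤ + n
nn = ℤ.+≤+ z≤n

≤-by : ∀ {a b} d → + 0 ≤ d → b ≡ a + d → a ≤ b
≤-by {a} d 0≤d refl = ≡.subst (_≤ a + d) (ℤP.+-identityʳ a) (ℤP.+-monoʳ-≤ a 0≤d)

≤⇒nn : ∀ {a b} → a ≤ b → + 0 ≤ b - a
≤⇒nn = ℤP.i≤j⇒0≤j-i

sgℕ : ℕ → ℤ
sgℕ zero = + 1
sgℕ (suc n) = - sgℕ n

sg : ℤ → ℤ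
sg i = sgℕ ∣ i ∣

sgℕ² : ∀ n → sgℕ n * sgℕ n ≡ + 1
sgℕ² zero = refl
sgℕ² (suc n) = trans (ℤS.solve 1 (λ x → (:- x) :* (:- x) := x :* x) refl (sgℕ n)) (sgℕ² n)

sg-suc : ∀ i → sg (i + + 1) ≡ - sg i
sg-suc (+ n) = cong sgℕ (ℕP.+-comm n 1)
sg-suc -[1+ n ] = trans (cong sg (suc-ℤ n)) (trans (cong sgℕ (ℤP.∣-i∣≡∣i∣ (+ n))) (sym (ℤP.neg-involutive (sgℕ n))))

sg-+₊ : ∀ i k → sg (i + + k) ≡ sg i * sgℕ k
sg-+₊ i zero = trans (cong sg (ℤP.+-identityʳ i)) (sym (ℤP.*-identityʳ (sg i)))
sg-+₊ i (suc k) = trans (cong sg (ℤS.solve 2 (λ i k → i :+ (con (+ 1) :+ k) := (i :+ k) :+ con (+ 1)) refl i (+ k)))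
  (trans (sg-suc (i + + k)) (trans (cong -_ (sg-+₊ i k)) (ℤP.neg-distribʳ-* (sg i) (sgℕ k))))

sg-+ : ∀ i j → sg (i + j) ≡ sg i * sg j
sg-+ i (+ k) = sg-+₊ i k
sg-+ i j@(-[1+ k ]) = begin
  sg (i + j)                                 ≡⟨ ℤP.*-identityʳ _ ⟨
  sg (i + j) * + 1                         ≡⟨ cong (sg (i + j) *_) (sgℕ² (suc k)) ⟨
  sg (i + j) * (sg j * sg j)             ≡⟨ ℤP.*-assoc (sg (i + j)) (sg j) (sg j) ⟨
  sg (i + j) * sg j * sg j               ≡⟨ cong (_* sg j) (sg-+₊ (i + j) (suc k)) ⟨
  sg (i + j + + suc k) * sg j            ≡⟨ cong (λ z → sg z * sg j) (ℤS.solve 2 (λ i k → i :+ (:- k) :+ k := i) refl i (+ suc k)) ⟩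
  sg i * sg j                                ∎
  where open ≡.≡-Reasoning

sg² : ∀ i → sg i * sg i ≡ + 1
sg² i = sgℕ² ∣ i ∣

sg-neg : ∀ i → sg (- i) ≡ sg i
sg-neg i = cong sgℕ (ℤP.∣-i∣≡∣i∣ i)

Σ≤-*ˡ : ∀ n c f → Σ≤ n (λ i → c * f i) ≡ c * Σ≤ n f
Σ≤-*ˡ zero c f = refl
Σ≤-*ˡ (suc n) c f = trans (cong (λ z → z + c * f (suc n)) (Σ≤-*ˡ n c f)) (sym (ℤP.*-distribˡ-+ c (Σ≤ n f) (f (suc n))))

⋆-⊗ : ∀ c f g → (c ⋆ f) ⊗ g ≈ˢ c ⋆ (f ⊗ g)
⋆-⊗ c f g n = trans (Σ≤-cong n (λ i _ → ℤP.*-assoc c (f i) (g (n ℕ.∸ i)))) (Σ≤-*ˡ n c (λ i → f i * g (n ℕ.∸ i)))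

⊗-⋆ : ∀ c f g → f ⊗ (c ⋆ g) ≈ˢ c ⋆ (f ⊗ g)
⊗-⋆ c f g = ≈-trans (⊗-comm f (c ⋆ g)) (≈-trans (⋆-⊗ c g f) (λ n → cong (c *_) (⊗-comm g f n)))

⋆-cong : ∀ {c d f g} → c ≡ d → f ≈ˢ g → c ⋆ f ≈ˢ d ⋆ g
⋆-cong {c} refl p n = cong (c *_) (p n)

⋆-⋆ : ∀ c d f → c ⋆ (d ⋆ f) ≈ˢ (c * d) ⋆ f
⋆-⋆ c d f n = sym (ℤP.*-assoc c d (f n))

⋆-⊗-⋆ : ∀ c d f g → (c ⋆ f) ⊗ (d ⋆ g) ≈ˢ (c * d) ⋆ (f ⊗ g)
⋆-⊗-⋆ c d f g = ≈-trans (⋆-⊗ c f (d ⋆ g)) (≈-trans (⋆-cong {c} refl (⊗-⋆ d f g)) (⋆-⋆ c d (f ⊗ g)))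

1⋆ : ∀ f → (+ 1) ⋆ f ≈ˢ f
1⋆ f n = ℤP.*-identityˡ (f n)

geo : ℕ → Series
geo k = inv (one ⊖ q^ (suc k))

geo-step : ∀ k → geo k ≈ˢ one ⊕ q^ (suc k) ⊗ geo k
geo-step k = ≈-trans
  (𝕊.solve 2 (λ g q → g =: (1: -: q) *: g +: q *: g) ≈-refl (geo k) (q^ (suc k)))
  (⊕-cong (inv-correct (one ⊖ q^ (suc k)) refl) ≈-refl)

-- The expansion of q^e / (1 - q^ε) in nonnegative powers of q; G e 0 = 0.
G : ℤ → ℤ → Series
G e (+ zero) = λ _ → + 0
G e (+ suc k) = mono e ⊗ geo k
G e -[1+ k ] = ⊝ (mono (e + + suc k) ⊗ geo k)

-- Lower bound for the exponents in `G e ε`. For negative `ε` the expansion is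
-- `- q^(e - ε) / (1 - q^(- ε))`, which starts at `e - ε` and not at `e`.
lead : ℤ → ℤ → ℤ
lead e (+ _) = e
lead e -[1+ k ] = e + + suc k

G-cong : ∀ {e e′ ε ε′} → e ≡ e′ → ε ≡ ε′ → G e ε ≈ˢ G e′ ε′
G-cong refl refl n = refl

Ord-⊝ : ∀ {e f} → Ord e f → Ord e (⊝ f)
Ord-⊝ ord n n<e = cong -_ (ord n n<e)

Ord-G : ∀ e ε → Ord (lead e ε) (G e ε)
Ord-G e (+ zero) n _ = refl
Ord-G e (+ suc k) = Ord-⊗ (Ord-mono e) (geo k)
Ord-G e -[1+ k ] = Ord-⊝ (Ord-⊗ (Ord-mono (e + + suc k)) (geo k))

e≤lead : ∀ e ε → e ≤ lead e ε
e≤lead e (+ _) = ℤP.≤-refl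
e≤lead e -[1+ k ] = ≤-by (+ suc k) nn refl

mono-⊗-geo : ∀ {e} k → + 0 ≤ e → mono e ⊗ geo k ≈ˢ mono e ⊕ mono (e + + suc k) ⊗ geo k
mono-⊗-geo {e} k 0≤e = begin
  mono e ⊗ geo k                                         ≈⟨ ⊗-congˡ {mono e} (geo-step k) ⟩
  mono e ⊗ (one ⊕ q^ (suc k) ⊗ geo k)                    ≈⟨ 𝕊.solve 3 (λ m q g → m *: (1: +: q *: g) =: m +: (m *: q) *: g) ≈-refl (mono e) (q^ (suc k)) (geo k) ⟩
  mono e ⊕ (mono e ⊗ q^ (suc k)) ⊗ geo k                 ≈⟨ ⊕-cong {mono e} ≈-refl (⊗-congʳ {geo k} (mono-+ 0≤e (nn {suc k}))) ⟩
  mono e ⊕ mono (e + + suc k) ⊗ geo k                  ∎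
  where open SetoidReasoning seriesSetoid

-- The functional equation `1 / (1 - x) = 1 + x / (1 - x)` holds in both expansions. This is what
-- lets sums over poles of either sign be treated uniformly.
G-step : ∀ {e} ε → ε ≢ + 0 → + 0 ≤ e → G e ε ≈ˢ mono e ⊕ G (e + ε) ε
G-step (+ zero) ε≢0 0≤e = ⊥-elim (ε≢0 refl)
G-step (+ suc k) ε≢0 0≤e = mono-⊗-geo k 0≤e
G-step {e} ε@(-[1+ k ]) ε≢0 0≤e = begin
  ⊝ (mono (e + + suc k) ⊗ geo k)
    ≈⟨ 𝕊.solve 2 (λ m x → -: x =: m +: -: (m +: x)) ≈-refl (mono e) (mono (e + + suc k) ⊗ geo k) ⟩
  mono e ⊕ ⊝ (mono e ⊕ mono (e + + suc k) ⊗ geo k)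
    ≈⟨ (λ n → cong (λ z → mono e n + - z) (mono-⊗-geo k 0≤e n)) ⟨
  mono e ⊕ ⊝ (mono e ⊗ geo k)
    ≈⟨ (λ n → cong (λ z → mono e n + - ((mono z ⊗ geo k) n)) (ℤS.solve 2 (λ e k → e := (e :+ (:- k)) :+ k) refl e (+ suc k))) ⟩
  mono e ⊕ G (e + ε) ε ∎
  where open SetoidReasoning seriesSetoid

G-mono : ∀ {u e} ε → + 0 ≤ u → + 0 ≤ lead e ε → G (u + e) ε ≈ˢ mono u ⊗ G e ε
G-mono {u} (+ zero) 0≤u 0≤l = ≈-sym (⊗-zeroʳ (mono u))
G-mono {u} {e} (+ suc k) 0≤u 0≤l = ≈-trans (⊗-congʳ {geo k} (≈-sym (mono-+ 0≤u 0≤l))) (⊗-assoc (mono u) (mono e) (geo k))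
G-mono {u} {e} -[1+ k ] 0≤u 0≤l = begin
  ⊝ (mono (u + e + + suc k) ⊗ geo k)       ≈⟨ (λ n → cong (λ z → - ((mono z ⊗ geo k) n)) (ℤP.+-assoc u e (+ suc k))) ⟩
  ⊝ (mono (u + (e + + suc k)) ⊗ geo k)     ≈⟨ (λ n → cong -_ (⊗-congʳ {geo k} (mono-+ 0≤u 0≤l) n)) ⟨
  ⊝ ((mono u ⊗ mono (e + + suc k)) ⊗ geo k)  ≈⟨ 𝕊.solve 3 (λ u m g → -: ((u *: m) *: g) =: u *: (-: (m *: g))) ≈-refl (mono u) (mono (e + + suc k)) (geo k) ⟩
  mono u ⊗ G e -[1+ k ]                        ∎
  where open SetoidReasoning seriesSetoid

ps : ℤ → ℤ
ps (+ suc _) = + 1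
ps (+ zero) = + 0
ps -[1+ _ ] = + 0

ng : ℤ → ℤ
ng (+ _) = + 0
ng -[1+ _ ] = + 1

-- +1 for C ≥ 1, s ≥ 0 and -1 for C ≤ 0, s < 0, so that Σ_s ρ (N - s) s x^s = (1 - x^N) / (1 - x).
ρ : ℤ → ℤ → ℤ
ρ C s = ps C - ng s

δ₀ : ℤ → ℤ
δ₀ (+ zero) = + 1
δ₀ _ = + 0

ps-suc : ∀ x → ps (x + + 1) ≡ ps x + δ₀ x
ps-suc (+ zero) = refl
ps-suc (+ suc n) = refl
ps-suc -[1+ zero ] = refl
ps-suc -[1+ suc n ] = refl

δ : ℤ → ℤ → ℤ
δ N s = δ₀ (N - s)

δ₀-≢ : ∀ i → i ≢ + 0 → δ₀ i ≡ + 0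
δ₀-≢ (+ zero) p = ⊥-elim (p refl)
δ₀-≢ (+ suc n) p = refl
δ₀-≢ -[1+ n ] p = refl

δ-≢ : ∀ N s → N ≢ s → δ N s ≡ + 0
δ-≢ N s N≢s = δ₀-≢ (N - s) (λ e → N≢s (ℤP.i-j≡0⇒i≡j N s e))

δ-refl : ∀ N → δ N N ≡ + 1
δ-refl N = cong δ₀ (ℤP.+-inverseʳ N)

sumZ-single : ∀ B N (f : ℤ → ℤ) → ∣ N ∣ ℕ.≤ B → (∀ i → N ≢ i → f i ≡ + 0) → sumZ B f ≡ f N
sumZ-single zero (+ zero) f N≤B v = refl
sumZ-single (suc B) N f N≤B v with ℕP.m≤n⇒m<n∨m≡n N≤B
... | inj₁ (s≤s N≤B′) = trans (cong₂ _+_ (sumZ-single B N f N≤B′ v)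
      (cong₂ _+_ (v (+ suc B) (λ { refl → ℕP.<-irrefl refl N≤B′ })) (v -[1+ B ] (λ { refl → ℕP.<-irrefl refl N≤B′ }))))
      (ℤP.+-identityʳ (f N))
... | inj₂ N≡B = edge N N≡B v
  where
  inner : ∀ N → ∣ N ∣ ≡ suc B → (∀ i → N ≢ i → f i ≡ + 0) → sumZ B f ≡ + 0
  inner N e v = trans (sumZ-cong B (λ i i≤B → v i (λ { refl → ℕP.<⇒≢ (s≤s i≤B) e }))) (sumZ-0 B)
  edge : ∀ N → ∣ N ∣ ≡ suc B → (∀ i → N ≢ i → f i ≡ + 0) → sumZ (suc B) f ≡ f N
  edge (+ suc B) refl v = trans (cong₂ _+_ (inner (+ suc B) refl v) (cong (λ z → f (+ suc B) + z) (v -[1+ B ] (λ ()))))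
    (trans (ℤP.+-identityˡ (f (+ suc B) + + 0)) (ℤP.+-identityʳ (f (+ suc B))))
  edge -[1+ B ] refl v = trans (cong₂ _+_ (inner -[1+ B ] refl v) (cong (λ z → z + f -[1+ B ]) (v (+ suc B) (λ ()))))
    (trans (ℤP.+-identityˡ (+ 0 + f -[1+ B ])) (ℤP.+-identityˡ (f -[1+ B ])))

Ord-vanish : ∀ {e f} i → + ∣ i ∣ ≤ e + + 10 → Ord e f → ∀ n → n ℕ.+ 10 ℕ.< ∣ i ∣ → f n ≡ + 0
Ord-vanish {e} i i≤e+10 ord n n+10<i = ord n (≡.subst₂ _<_
  (ℤS.solve 1 (λ n → (n :+ con (+ 10)) :- con (+ 10) := n) refl (+ n))
  (ℤS.solve 1 (λ e → (e :+ con (+ 10)) :- con (+ 10) := e) refl e)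
  (ℤP.+-monoˡ-< (- + 10) (ℤP.<-≤-trans (ℤ.+<+ n+10<i) i≤e+10)))

Null-by : ∀ {F} (e : ℤ → ℤ) → (∀ i → Ord (e i) (F i)) → (∀ i → + ∣ i ∣ ≤ e i + + 10) → Null F
Null-by e ord bound i = Ord-vanish i (bound i) (ord i)

Σℤ-δ : ∀ N (F : ℤ → Series) → (∀ n → n ℕ.+ 10 ℕ.< ∣ N ∣ → F N n ≡ + 0) → Σℤ (λ s → δ N s ⋆ F s) ≈ˢ F N
Σℤ-δ N F ord n with ∣ N ∣ ℕ.≤? n ℕ.+ 10
... | yes N≤ = trans (sumZ-single (n ℕ.+ 10) N (λ s → δ N s * F s n) N≤ (λ i N≢i → cong (_* F i n) (δ-≢ N i N≢i)))
      (trans (cong (_* F N n) (δ-refl N)) (ℤP.*-identityˡ (F N n)))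
... | no N≰ = trans (sumZ-cong (n ℕ.+ 10) (λ s s≤ → cong (_* F s n) (δ-≢ N s (λ { refl → N≰ s≤ }))))
      (trans (sumZ-0 (n ℕ.+ 10)) (sym (ord n (ℕP.≰⇒> N≰))))

ρ-suc : ∀ N s → ρ (N + + 1 - s) s ≡ ρ (N - s) s + δ N s
ρ-suc N s = trans (cong (λ z → ps z - ng s) (ℤS.solve 2 (λ N s → (N :+ con (+ 1)) :- s := (N :- s) :+ con (+ 1)) refl N s))
  (trans (cong (_- ng s) (ps-suc (N - s)))
  (ℤS.solve 3 (λ p d n → (p :+ d) :- n := (p :- n) :+ d) refl (ps (N - s)) (δ N s) (ng s)))

ρ-0 : ∀ s → ρ (+ 0 - s) s ≡ + 0
ρ-0 (+ zero) = refl
ρ-0 (+ suc n) = refl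
ρ-0 -[1+ n ] = refl

geomTerm : ℤ → ℤ → ℤ → ℤ → Series
geomTerm e ε N s = ρ (N - s) s ⋆ mono (e + s * ε)

-- For `ε = 0` a finite geometric sum has `N` equal terms, which the difference of two values of
-- `G`, both zero, does not see. This degenerate term becomes the derivative `θ′` in `K-pole`.
correction : ℤ → ℤ → ℤ → Series
correction (+ zero) N e = N ⋆ mono e
correction (+ suc _) N e _ = + 0
correction -[1+ _ ] N e _ = + 0

geomSum : ℤ → ℤ → ℤ → Series
geomSum e ε N = (G e ε ⊖ G (e + N * ε) ε) ⊕ correction ε N e

geomSum-suc : ∀ e ε N → + 0 ≤ e + N * ε → geomSum e ε (N + + 1) ≈ˢ geomSum e ε N ⊕ mono (e + N * ε)
geomSum-suc e ε@(+ zero) N 0≤ n = trans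
  (ℤS.solve 2 (λ N m → (con (+ 0) :- con (+ 0)) :+ (N :+ con (+ 1)) :* m := ((con (+ 0) :- con (+ 0)) :+ N :* m) :+ m) refl N (mono e n))
  (cong (λ z → + 0 + N * mono e n + mono z n) (sym (trans (cong (λ z → e + z) (ℤP.*-zeroʳ N)) (ℤP.+-identityʳ e))))
geomSum-suc e ε@(+ suc _) N 0≤ n = trans
  (cong₂ (λ x z → (G e ε n - G z ε n) + + 0) {x = + 0} refl (ℤS.solve 3 (λ e N ε → e :+ (N :+ con (+ 1)) :* ε := (e :+ N :* ε) :+ ε) refl e N ε))
  (trans (ℤS.solve 3 (λ g m h → (g :- h) :+ con (+ 0) := ((g :- (m :+ h)) :+ con (+ 0)) :+ m) refl (G e ε n) (mono (e + N * ε) n) (G (e + N * ε + ε) ε n))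
  (cong (λ z → ((G e ε n - z) + + 0) + mono (e + N * ε) n) (sym (G-step ε (λ ()) 0≤ n))))
geomSum-suc e ε@(-[1+ _ ]) N 0≤ n = trans
  (cong₂ (λ x z → (G e ε n - G z ε n) + + 0) {x = + 0} refl (ℤS.solve 3 (λ e N ε → e :+ (N :+ con (+ 1)) :* ε := (e :+ N :* ε) :+ ε) refl e N ε))
  (trans (ℤS.solve 3 (λ g m h → (g :- h) :+ con (+ 0) := ((g :- (m :+ h)) :+ con (+ 0)) :+ m) refl (G e ε n) (mono (e + N * ε) n) (G (e + N * ε + ε) ε n))
  (cong (λ z → ((G e ε n - z) + + 0) + mono (e + N * ε) n) (sym (G-step ε (λ ()) 0≤ n))))

geomSum-0 : ∀ e ε → geomSum e ε (+ 0) ≈ˢ λ _ → + 0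
geomSum-0 e ε n = trans (cong (λ z → (G e ε n - G z ε n) + correction ε (+ 0) e n) (ℤP.+-identityʳ e))
  (cong₂ _+_ (ℤP.+-inverseʳ (G e ε n)) (lemma ε))
  where
  lemma : ∀ ε → correction ε (+ 0) e n ≡ + 0
  lemma (+ zero) = refl
  lemma (+ suc _) = refl
  lemma -[1+ _ ] = refl

InRange : ℤ → ℤ → ℤ → Set
InRange e ε s = + ∣ s ∣ ≤ e + s * ε

-- Raising `N` by one switches on the single index `s = N`. The range condition puts this index
-- inside the window of every coefficient where its term is nonzero.
Σgeom-suc : ∀ e ε N → InRange e ε N → Σℤ (geomTerm e ε (N + + 1)) ≈ˢ Σℤ (geomTerm e ε N) ⊕ mono (e + N * ε)
Σgeom-suc e ε N r = begin
  Σℤ (geomTerm e ε (N + + 1))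
    ≈⟨ Σℤ-cong (λ s n → trans (cong (_* F s n) (ρ-suc N s)) (ℤP.*-distribʳ-+ (F s n) (ρ (N - s) s) (δ N s))) ⟩
  Σℤ (λ s → geomTerm e ε N s ⊕ δ N s ⋆ F s)
    ≈⟨ Σℤ-⊕ (geomTerm e ε N) (λ s → δ N s ⋆ F s) ⟩
  Σℤ (geomTerm e ε N) ⊕ Σℤ (λ s → δ N s ⋆ F s)
    ≈⟨ ⊕-cong {Σℤ (geomTerm e ε N)} ≈-refl (Σℤ-δ N F (Ord-vanish N (ℤP.≤-trans r (≤-by (+ 10) nn refl)) (Ord-mono (e + N * ε)))) ⟩
  Σℤ (geomTerm e ε N) ⊕ mono (e + N * ε) ∎
  where
  open SetoidReasoning seriesSetoid
  F : ℤ → Series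
  F s = mono (e + s * ε)

geometric₊ : ∀ e ε k → (∀ s → s ℕ.< k → InRange e ε (+ s)) → Σℤ (geomTerm e ε (+ k)) ≈ˢ geomSum e ε (+ k)
geometric₊ e ε zero r n = trans (sumZ-cong (n ℕ.+ 10) (λ s _ → cong (_* mono (e + s * ε) n) (ρ-0 s))) (trans (sumZ-0 (n ℕ.+ 10)) (sym (geomSum-0 e ε n)))
geometric₊ e ε (suc k) r = ≡.subst (λ N → Σℤ (geomTerm e ε N) ≈ˢ geomSum e ε N) (cong +_ (ℕP.+-comm k 1))
  (≈-trans (Σgeom-suc e ε (+ k) (r k ℕP.≤-refl))
  (≈-trans (⊕-cong {y = geomSum e ε (+ k)} (geometric₊ e ε k (λ s s<k → r s (ℕP.m≤n⇒m≤1+n s<k))) ≈-refl)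
           (≈-sym (geomSum-suc e ε (+ k) (ℤP.≤-trans nn (r k ℕP.≤-refl))))))

-- Starts at `N = 0` as well and reads the step backwards, cancelling the term that it adds.
geometric₋ : ∀ e ε k → (∀ s → s ℕ.< k → InRange e ε -[1+ s ]) → Σℤ (geomTerm e ε (- (+ k))) ≈ˢ geomSum e ε (- (+ k))
geometric₋ e ε zero r = geometric₊ e ε zero (λ _ ())
geometric₋ e ε (suc k) r n = ℤAb.∙-cancelʳ (mono (e + -[1+ k ] * ε) n) _ _ (trans (sym (Σgeom-suc e ε -[1+ k ] (r k ℕP.≤-refl) n))
  (trans (trans (cong (λ N → Σℤ (geomTerm e ε N) n) (suc-ℤ k)) (trans (geometric₋ e ε k (λ s s<k → r s (ℕP.m≤n⇒m≤1+n s<k)) n) (cong (λ N → geomSum e ε N n) (sym (suc-ℤ k)))))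
           (geomSum-suc e ε -[1+ k ] (ℤP.≤-trans nn (r k ℕP.≤-refl)) n)))
  where import Algebra.Properties.AbelianGroup ℤP.+-0-abelianGroup as ℤAb

-- Theta functions, Appell sums and Lambert series

quad : ℤ → ℤ → ℤ
quad b i = + 5 * i * i + b * i

-- The two conditions say that `5 i² + b i` is nonnegative at `i = 1` and `i = - 1`, and this
-- suffices for all integers.
record Small (b : ℤ) : Set where
  constructor small
  field
    lower : + 0 ≤ + 5 + b
    upper : + 0 ≤ + 5 - b

quad-nn : ∀ {b} → Small b → ∀ i → + 0 ≤ quad b i
quad-nn {b} sm (+ zero) = ≡.subst (+ 0 ≤_) (ℤS.solve 1 (λ b → con (+ 0) := con (+ 5) :* con (+ 0) :* con (+ 0) :+ b :* con (+ 0)) refl b) nn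
quad-nn {b} (small lo hi) (+ suc k) = ≡.subst (+ 0 ≤_)
  (ℤS.solve 2 (λ b k → (con (+ 5) :+ b) :* (con (+ 1) :+ k) :+ con (+ 5) :* (con (+ 1) :+ k) :* k
     := con (+ 5) :* (con (+ 1) :+ k) :* (con (+ 1) :+ k) :+ b :* (con (+ 1) :+ k)) refl b (+ k))
  (nn-+ (nn-* lo (nn {suc k})) (nn-* (nn-* (nn {5}) (nn {suc k})) (nn {k})))
quad-nn {b} (small lo hi) -[1+ k ] = ≡.subst (+ 0 ≤_)
  (ℤS.solve 2 (λ b k → (con (+ 5) :- b) :* (con (+ 1) :+ k) :+ con (+ 5) :* (con (+ 1) :+ k) :* k
     := con (+ 5) :* (:- (con (+ 1) :+ k)) :* (:- (con (+ 1) :+ k)) :+ b :* (:- (con (+ 1) :+ k))) refl b (+ k))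
  (nn-+ (nn-* hi (nn {suc k})) (nn-* (nn-* (nn {5}) (nn {suc k})) (nn {k})))

-- The extra 1 is forced by `b = 5` and `b = - 5`, where the exponent is zero at `i = - 1` and
-- `i = 1` respectively.
quad-abs : ∀ {b} → Small b → ∀ i → + ∣ i ∣ ≤ quad b i + + 1
quad-abs {b} sm (+ zero) = ℤP.≤-trans (nn {1}) (≤-by (quad b (+ 0)) (quad-nn sm (+ 0)) (ℤP.+-comm (quad b (+ 0)) (+ 1)))
quad-abs {b} (small lo hi) (+ suc k) = ≤-by _ (nn-+ (nn-* lo (nn {suc k})) (nn-* (nn-+ (nn-* (nn {5}) (nn {k})) (nn {4})) (nn {k})))
  (ℤS.solve 2 (λ b k → (con (+ 5) :* (con (+ 1) :+ k) :* (con (+ 1) :+ k) :+ b :* (con (+ 1) :+ k)) :+ con (+ 1)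
     := (con (+ 1) :+ k) :+ ((con (+ 5) :+ b) :* (con (+ 1) :+ k) :+ (con (+ 5) :* k :+ con (+ 4)) :* k)) refl b (+ k))
quad-abs {b} (small lo hi) -[1+ k ] = ≤-by _ (nn-+ (nn-* hi (nn {suc k})) (nn-* (nn-+ (nn-* (nn {5}) (nn {k})) (nn {4})) (nn {k})))
  (ℤS.solve 2 (λ b k → (con (+ 5) :* (:- (con (+ 1) :+ k)) :* (:- (con (+ 1) :+ k)) :+ b :* (:- (con (+ 1) :+ k))) :+ con (+ 1)
     := (con (+ 1) :+ k) :+ ((con (+ 5) :- b) :* (con (+ 1) :+ k) :+ (con (+ 5) :* k :+ con (+ 4)) :* k)) refl b (+ k))

abs-shift : ∀ i s → + ∣ i ∣ ≤ + ∣ i + s ∣ + + ∣ s ∣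
abs-shift i s = ℤ.+≤+ (ℕP.≤-trans (ℕP.≤-reflexive (cong ∣_∣ (ℤS.solve 2 (λ i s → i := (i :+ s) :+ (:- s)) refl i s)))
  (ℕP.≤-trans (ℤP.∣i+j∣≤∣i∣+∣j∣ (i + s) (- s)) (ℕP.≤-reflexive (cong (λ z → ∣ i + s ∣ ℕ.+ z) (ℤP.∣-i∣≡∣i∣ s)))))

i≤∣i∣ : ∀ i → i ≤ + ∣ i ∣
i≤∣i∣ (+ n) = ℤP.≤-refl
i≤∣i∣ -[1+ n ] = ℤ.-≤+

θ : ℤ → Series
θ b = Σℤ (λ i → sg i ⋆ mono (quad b i))

θ′ : ℤ → Series
θ′ b = Σℤ (λ i → (i * sg i) ⋆ mono (quad b i))

-- An Appell sum. For `b = c` the summand `i = 0` has a pole and drops out, since `G e 0` is zero.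
T : ℤ → ℤ → Series
T c b = Σℤ (λ i → sg i ⋆ G (quad b i) (+ 10 * i + (b - c)))

Λ : ℤ → ℤ → Series
Λ α β = Σℤ (λ i → G (α * i) (+ 10 * i + β))

x≤x+1+9 : ∀ x → x + + 1 ≤ x + + 10
x≤x+1+9 x = ≤-by (+ 9) nn (sym (ℤP.+-assoc x (+ 1) (+ 9)))

θ-Null : ∀ {b} (t : ℤ → ℤ) → Small b → Null (λ i → t i ⋆ mono (quad b i))
θ-Null {b} t sm = Null-by (quad b) (λ i → Ord-⋆ (t i) (Ord-mono (quad b i)))
  (λ i → ℤP.≤-trans (quad-abs sm i) (x≤x+1+9 (quad b i)))

lead-+ : ∀ u e ε → lead (u + e) ε ≡ u + lead e ε
lead-+ u e (+ _) = refl
lead-+ u e -[1+ k ] = ℤP.+-assoc u e (+ suc k)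

e-ε≤lead : ∀ e ε → e - ε ≤ lead e ε
e-ε≤lead e (+ n) = ≤-by (+ n) nn (ℤS.solve 2 (λ e n → e := (e :- n) :+ n) refl e (+ n))
e-ε≤lead e -[1+ k ] = ℤP.≤-refl

-- For `A > 0` the order is at least `α A`; for `A < 0` the reversed expansion gives at least
-- `(10 - α) ∣ A ∣ - β`. Growth in both directions is the reason for the range `1 ≤ α ≤ 9`.
lead-Λ : ∀ {α β} → + 0 ≤ α - + 1 → + 0 ≤ + 9 - α → + 0 ≤ + 10 - α - β →
         ∀ A → + ∣ A ∣ ≤ lead (α * A) (+ 10 * A + β) + + 1
lead-Λ {α} {β} 1≤α α≤9 α+β (+ zero) = ℤP.≤-trans (nn {1}) (ℤP.≤-trans (ℤP.≤-reflexive (cong (_+ + 1) (sym (ℤP.*-zeroʳ α))))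
  (ℤP.+-monoˡ-≤ (+ 1) (e≤lead (α * + 0) (+ 10 * + 0 + β))))
lead-Λ {α} {β} 1≤α α≤9 α+β A@(+ suc k) = ℤP.≤-trans
  (≤-by ((α - + 1) * A + + 1) (nn-+ (nn-* 1≤α (nn {suc k})) (nn {1})) (ℤS.solve 2 (λ α A → α :* A :+ con (+ 1) := A :+ ((α :- con (+ 1)) :* A :+ con (+ 1))) refl α A))
  (ℤP.+-monoˡ-≤ (+ 1) (e≤lead (α * A) (+ 10 * A + β)))
lead-Λ {α} {β} 1≤α α≤9 α+β A@(-[1+ k ]) = ℤP.≤-trans
  (≤-by ((+ 9 - α) * + k + (+ 10 - α - β)) (nn-+ (nn-* α≤9 (nn {k})) α+β)
    (ℤS.solve 3 (λ k α β → (α :* (:- (con (+ 1) :+ k)) :- (con (+ 10) :* (:- (con (+ 1) :+ k)) :+ β)) :+ con (+ 1)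
      := (con (+ 1) :+ k) :+ ((con (+ 9) :- α) :* k :+ (con (+ 10) :- α :- β))) refl (+ k) α β))
  (ℤP.+-monoˡ-≤ (+ 1) (e-ε≤lead (α * A) (+ 10 * A + β)))

lead-Λ-nn : ∀ {α β} → + 0 ≤ α - + 1 → + 0 ≤ + 9 - α → + 0 ≤ + 10 - α - β →
            ∀ A → + 0 ≤ lead (α * A) (+ 10 * A + β)
lead-Λ-nn {α} {β} 1≤α α≤9 α+β A = by-abs A (lead-Λ {α} {β} 1≤α α≤9 α+β A)
  where
  drop1 : ∀ {k x} → + suc k ≤ x + + 1 → + 0 ≤ x
  drop1 {k} {x} h = ℤP.≤-trans (nn {k}) (≡.subst (+ k ≤_) (ℤS.solve 1 (λ x → (x :+ con (+ 1)) :- con (+ 1) := x) refl x) (ℤP.+-monoˡ-≤ (- + 1) h))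
  by-abs : ∀ A → + ∣ A ∣ ≤ lead (α * A) (+ 10 * A + β) + + 1 → + 0 ≤ lead (α * A) (+ 10 * A + β)
  by-abs (+ zero) _ = ℤP.≤-trans (ℤP.≤-reflexive (sym (ℤP.*-zeroʳ α))) (e≤lead (α * + 0) (+ 10 * + 0 + β))
  by-abs (+ suc k) h = drop1 h
  by-abs -[1+ k ] h = drop1 h

θ-⊗-ΣG : ∀ {b} (t f ε : ℤ → ℤ) → Small b → (∀ C → + 0 ≤ lead (f C) (ε C)) → (∀ C → + ∣ C ∣ ≤ lead (f C) (ε C) + + 1) →
         Σℤ (λ M → Σℤ (λ C → (sg M * t C) ⋆ G (quad b M + f C) (ε C))) ≈ˢ θ b ⊗ Σℤ (λ C → t C ⋆ G (f C) (ε C))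
θ-⊗-ΣG {b} t f ε sm nnf absf = ≈-sym (begin
  θ b ⊗ Σℤ F
    ≈⟨ Σℤ-⊗ (θ-Null sg sm) (Σℤ F) ⟩
  Σℤ (λ M → (sg M ⋆ mono (quad b M)) ⊗ Σℤ F)
    ≈⟨ Σℤ-cong (λ M → ⊗-Σℤ F-Null (sg M ⋆ mono (quad b M))) ⟩
  Σℤ (λ M → Σℤ (λ C → (sg M ⋆ mono (quad b M)) ⊗ F C))
    ≈⟨ Σℤ-cong (λ M → Σℤ-cong (λ C → ≈-trans (⋆-⊗-⋆ (sg M) (t C) (mono (quad b M)) (G (f C) (ε C)))
         (⋆-cong {sg M * t C} refl (≈-sym (G-mono (ε C) (quad-nn sm M) (nnf C)))))) ⟩
  Σℤ (λ M → Σℤ (λ C → (sg M * t C) ⋆ G (quad b M + f C) (ε C))) ∎)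
  where
  open SetoidReasoning seriesSetoid
  F : ℤ → Series
  F C = t C ⋆ G (f C) (ε C)
  F-Null : Null F
  F-Null = Null-by (λ C → lead (f C) (ε C)) (λ C → Ord-⋆ (t C) (Ord-G (f C) (ε C)))
    (λ C → ℤP.≤-trans (absf C) (x≤x+1+9 (lead (f C) (ε C))))

correction-0 : ∀ ε N e → ε ≢ + 0 → correction ε N e ≈ˢ λ _ → + 0
correction-0 (+ zero) N e p n = ⊥-elim (p refl)
correction-0 (+ suc _) N e p n = refl
correction-0 -[1+ _ ] N e p n = refl

module _ (α : ℤ) (1≤α : + 0 ≤ α - + 1) (α≤9 : + 0 ≤ + 9 - α) where

  bound₊ : ∀ C m → + 0 ≤ C - + 1 → + m ≤ + m * (+ 10 * C - α)
  bound₊ C m h = ≤-by _ (nn-* (nn {m}) (nn-+ (nn-* (nn {10}) h) α≤9))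
    (ℤS.solve 3 (λ C m α → m :* (con (+ 10) :* C :- α) := m :+ m :* (con (+ 10) :* (C :- con (+ 1)) :+ (con (+ 9) :- α))) refl C (+ m) α)

  bound₋ : ∀ C m → + 0 ≤ - C → + suc m ≤ -[1+ m ] * (+ 10 * C - α)
  bound₋ C m h = ≤-by _ (nn-* (nn {suc m}) (nn-+ (nn-* (nn {10}) h) 1≤α))
    (ℤS.solve 3 (λ C m α → (:- m) :* (con (+ 10) :* C :- α) := m :+ m :* (con (+ 10) :* (:- C) :+ (α :- con (+ 1)))) refl C (+ suc m) α)

  -- As `1 ≤ α ≤ 9`, the number `10 C - α` is positive for `C ≥ 1` and negative for `C ≤ 0`. On the
  -- support of `ρ` the index `s` has a matching sign, so the exponent grows at least like `∣ s ∣`.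
  ρ-bound : ∀ C s → (ρ C s ≡ + 0) ⊎ (+ ∣ s ∣ ≤ s * (+ 10 * C - α))
  ρ-bound (+ suc d) (+ m) = inj₂ (bound₊ (+ suc d) m (nn {d}))
  ρ-bound (+ suc d) -[1+ m ] = inj₁ refl
  ρ-bound (+ zero) (+ m) = inj₁ refl
  ρ-bound (+ zero) -[1+ m ] = inj₂ (bound₋ (+ 0) m nn)
  ρ-bound -[1+ d ] (+ m) = inj₁ refl
  ρ-bound -[1+ d ] -[1+ m ] = inj₂ (bound₋ -[1+ d ] m (nn {suc d}))

  pole≢0 : ∀ C → + 10 * C - α ≢ + 0
  pole≢0 C e with ρ-bound C (+ 1) | ρ-bound C -[1+ 0 ]
  ... | inj₂ h | _ = ℤP.<⇒≱ (ℤ.+<+ (s≤s z≤n)) (≡.subst (λ z → + 1 ≤ + 1 * z) e h)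
  ... | _ | inj₂ h = ℤP.<⇒≱ (ℤ.+<+ (s≤s z≤n)) (≡.subst (λ z → + 1 ≤ -[1+ 0 ] * z) e h)
  pole≢0 (+ suc d) e | inj₁ () | inj₁ _
  pole≢0 (+ zero) e | inj₁ _ | inj₁ ()
  pole≢0 -[1+ d ] e | inj₁ _ | inj₁ ()

  ps-1 : ∀ C → + 0 ≤ C - + 1 → ps C ≡ + 1
  ps-1 (+ suc d) h = refl
  ps-1 (+ zero) ()
  ps-1 -[1+ d ] ()

  ps-0 : ∀ C → + 0 ≤ - C → ps C ≡ + 0
  ps-0 (+ zero) h = refl
  ps-0 -[1+ d ] h = refl
  ps-0 (+ suc d) ()

  -- At each coefficient the full geometric series agrees with a long enough partial one.
  Σρ : ∀ f C → + 0 ≤ f → Σℤ (λ s → ρ C s ⋆ mono (f + s * (+ 10 * C - α))) ≈ˢ G f (+ 10 * C - α)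
  Σρ f C 0≤f n = trans
    (sumZ-cong (n ℕ.+ 10) (λ s s≤ → cong (λ z → (z - ng s) * mono (f + s * ε) n) (samePs C s s≤)))
    (trans (geometric C n)
    (trans (cong₂ _+_ (cong (λ z → G f ε n - z) (Ord-G (f + N * ε) ε n far)) (correction-0 ε N f (pole≢0 C) n))
    (ℤS.solve 1 (λ g → (g :- con (+ 0)) :+ con (+ 0) := g) refl (G f ε n))))
    where
    ε = + 10 * C - α
    bigN : ℤ → ℕ → ℤ
    bigN (+ suc _) n = + (n ℕ.+ 11)
    bigN (+ zero) n = - (+ (n ℕ.+ 11))
    bigN -[1+ _ ] n = - (+ (n ℕ.+ 11))
    N = bigN C n
    s≤′ : ∀ s → ∣ s ∣ ℕ.≤ n ℕ.+ 10 → (+ 0 ≤ + (n ℕ.+ 11) - s - + 1) × (+ 0 ≤ + (n ℕ.+ 11) + s - + 1)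
    s≤′ s s≤ = ≡.subst (+ 0 ≤_) (ℤS.solve 2 (λ n s → (n :+ con (+ 10)) :- s := (n :+ con (+ 11)) :- s :- con (+ 1)) refl (+ n) s)
                  (≤⇒nn {s} {+ (n ℕ.+ 10)} (ℤP.≤-trans (i≤∣i∣ s) (ℤ.+≤+ s≤)))
             , ≡.subst (+ 0 ≤_) (ℤS.solve 2 (λ n s → (n :+ con (+ 10)) :- (:- s) := (n :+ con (+ 11)) :+ s :- con (+ 1)) refl (+ n) s)
                  (≤⇒nn { - s} {+ (n ℕ.+ 10)} (ℤP.≤-trans (i≤∣i∣ (- s)) (ℤ.+≤+ (≡.subst (ℕ._≤ n ℕ.+ 10) (sym (ℤP.∣-i∣≡∣i∣ s)) s≤))))
    neg-side : ∀ s → ∣ s ∣ ℕ.≤ n ℕ.+ 10 → + 0 ≤ - (- (+ (n ℕ.+ 11)) - s)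
    neg-side s s≤ = ≡.subst (+ 0 ≤_) (ℤS.solve 2 (λ n s → (n :+ s :- con (+ 1)) :+ con (+ 1) := :- ((:- n) :- s)) refl (+ (n ℕ.+ 11)) s)
      (nn-+ (proj₂ (s≤′ s s≤)) (nn {1}))
    samePs : ∀ C s → ∣ s ∣ ℕ.≤ n ℕ.+ 10 → ps C ≡ ps (bigN C n - s)
    samePs (+ suc d) s s≤ = sym (ps-1 (+ (n ℕ.+ 11) - s) (proj₁ (s≤′ s s≤)))
    samePs (+ zero) s s≤ = sym (ps-0 (- (+ (n ℕ.+ 11)) - s) (neg-side s s≤))
    samePs -[1+ d ] s s≤ = sym (ps-0 (- (+ (n ℕ.+ 11)) - s) (neg-side s s≤))
    +f : ∀ x → x ≤ f + x
    +f x = ≤-by f 0≤f (ℤP.+-comm f x)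
    geometric : ∀ C m → Σℤ (geomTerm f (+ 10 * C - α) (bigN C n)) m ≡ geomSum f (+ 10 * C - α) (bigN C n) m
    geometric (+ suc d) = geometric₊ f (+ 10 * + suc d - α) (n ℕ.+ 11) (λ s _ → ℤP.≤-trans (bound₊ (+ suc d) s (nn {d})) (+f _))
    geometric (+ zero) = geometric₋ f (+ 10 * + 0 - α) (n ℕ.+ 11) (λ s _ → ℤP.≤-trans (bound₋ (+ 0) s nn) (+f _))
    geometric -[1+ d ] = geometric₋ f (+ 10 * -[1+ d ] - α) (n ℕ.+ 11) (λ s _ → ℤP.≤-trans (bound₋ -[1+ d ] s (nn {suc d})) (+f _))
    n<n+11 : + n < + (n ℕ.+ 11)
    n<n+11 = ℤ.+<+ (ℕP.m<m+n n (s≤s z≤n))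
    Nε : ∀ C → + (n ℕ.+ 11) ≤ bigN C n * (+ 10 * C - α)
    Nε (+ suc d) = bound₊ (+ suc d) (n ℕ.+ 11) (nn {d})
    Nε (+ zero) = ≡.subst (λ a → + a ≤ - (+ a) * (+ 10 * + 0 - α)) (sym (ℕP.+-suc n 10)) (bound₋ (+ 0) (n ℕ.+ 10) nn)
    Nε -[1+ d ] = ≡.subst (λ a → + a ≤ - (+ a) * (+ 10 * -[1+ d ] - α)) (sym (ℕP.+-suc n 10)) (bound₋ -[1+ d ] (n ℕ.+ 10) (nn {suc d}))
    far : + n < lead (f + N * ε) ε
    far = ℤP.<-≤-trans n<n+11 (ℤP.≤-trans (Nε C) (ℤP.≤-trans (≤-by f 0≤f (ℤP.+-comm f (N * ε))) (e≤lead (f + N * ε) ε)))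

-- The partial fraction identity

module KIdentity (b₀ b₁ c : ℤ) (small₀ : Small b₀) (small₁ : Small b₁) (small₀₁ : Small (b₀ + b₁ - c))
                 (1≤α : + 0 ≤ c - b₀ - + 1) (α≤9 : + 0 ≤ + 9 - (c - b₀)) where

  private
    α β b : ℤ
    α = c - b₀
    β = b₁ - c
    b = b₀ + b₁ - c
    ε ε₀ : ℤ → ℤ
    ε A = + 10 * A + β
    ε₀ C = + 10 * C - α
    E : ℤ → ℤ → ℤ
    E A N = quad b₁ A + quad b₀ N
    X Y : ℤ → ℤ → ℤ → Series
    X A N s = (sg A * sg N) ⋆ geomTerm (E A N) (ε A) N s
    Y M C s = (sg M * sg C) ⋆ (ρ C s ⋆ mono (quad b₁ M + quad b₀ C + s * ε₀ C))
    H : ℤ → ℤ → Series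
    H A k = sg k ⋆ G (quad b k + α * A) (ε A)

  open SetoidReasoning seriesSetoid

  -- The heart of the identity: the total exponent is linear in `s` both for fixed `A`, `N` and, up
  -- to the substitution `M = A + s`, `C = N - s`, for fixed `M`, `C`, so each point of view gives a
  -- geometric progression.
  exponent : ∀ A N s → E A N + s * ε A ≡ E (A + s) (N - s) + s * ε₀ (N - s)
  exponent A N s = ℤS.solve 6 (λ A N s b₀ b₁ c →
    ((con (+ 5) :* A :* A :+ b₁ :* A) :+ (con (+ 5) :* N :* N :+ b₀ :* N)) :+ s :* (con (+ 10) :* A :+ (b₁ :- c))
    := ((con (+ 5) :* (A :+ s) :* (A :+ s) :+ b₁ :* (A :+ s)) :+ (con (+ 5) :* (N :- s) :* (N :- s) :+ b₀ :* (N :- s)))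
       :+ s :* (con (+ 10) :* (N :- s) :- (c :- b₀))) refl A N s b₀ b₁ c

  sign : ∀ A N s → sg A * sg N ≡ sg (A + s) * sg (N - s)
  sign A N s = sym (trans (cong₂ _*_ (sg-+ A s) (trans (sg-+ N (- s)) (cong (sg N *_) (sg-neg s))))
    (trans (ℤS.solve 3 (λ a n s → (a :* s) :* (n :* s) := (a :* n) :* (s :* s)) refl (sg A) (sg N) (sg s))
    (trans (cong (λ z → sg A * sg N * z) (sg² s)) (ℤP.*-identityʳ (sg A * sg N)))))

  X≈Y : ∀ A N s → X A N s ≈ˢ Y (A + s) (N - s) s
  X≈Y A N s = ⋆-cong (sign A N s) (λ n → cong (λ z → ρ (N - s) s * mono z n) (exponent A N s))

  E-nn : ∀ A N → + 0 ≤ E A N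
  E-nn A N = nn-+ (quad-nn small₁ A) (quad-nn small₀ N)

  E+ : ∀ A N x → x ≤ E A N + x
  E+ A N x = ≤-by (E A N) (E-nn A N) (ℤP.+-comm (E A N) x)

  -- For `0 ≤ s < N` the new index `C = N - s` is positive, hence the exponent, read in the new
  -- variables, is at least `s`. The case `N ≤ s < 0` is the mirror image.
  finite : ∀ A N → Σℤ (geomTerm (E A N) (ε A) N) ≈ˢ geomSum (E A N) (ε A) N
  finite A (+ k) = geometric₊ (E A (+ k)) (ε A) k (λ s s<k → ≡.subst (+ s ≤_) (sym (exponent A (+ k) (+ s)))
    (ℤP.≤-trans (bound₊ α 1≤α α≤9 (+ k - + s) s
      (≡.subst (+ 0 ≤_) (ℤS.solve 2 (λ k s → k :- (con (+ 1) :+ s) := (k :- s) :- con (+ 1)) refl (+ k) (+ s)) (≤⇒nn (ℤ.+≤+ s<k))))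
      (E+ (A + + s) (+ k - + s) _)))
  finite A -[1+ k ] = geometric₋ (E A -[1+ k ]) (ε A) (suc k) (λ s s<k → ≡.subst (+ suc s ≤_) (sym (exponent A -[1+ k ] -[1+ s ]))
    (ℤP.≤-trans (bound₋ α 1≤α α≤9 (-[1+ k ] - -[1+ s ]) s
      (≡.subst (+ 0 ≤_) (ℤS.solve 2 (λ k s → k :- s := :- ((:- k) :- (:- s))) refl (+ suc k) (+ suc s)) (≤⇒nn (ℤ.+≤+ s<k))))
      (E+ (A + -[1+ s ]) (-[1+ k ] - -[1+ s ]) _)))

  Ord-Y : ∀ M C s e → (+ ∣ s ∣ ≤ s * ε₀ C → e ≤ quad b₁ M + quad b₀ C + s * ε₀ C) → Ord e (Y M C s)
  Ord-Y M C s e h with ρ-bound α 1≤α α≤9 C s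
  ... | inj₁ ρ≡0 = λ n _ → trans (cong (λ z → (sg M * sg C) * (z * mono (quad b₁ M + quad b₀ C + s * ε₀ C) n)) ρ≡0) (ℤP.*-zeroʳ (sg M * sg C))
  ... | inj₂ s≤ = Ord-⋆ (sg M * sg C) (Ord-⋆ (ρ C s) (Ord-≤ (h s≤) (Ord-mono (quad b₁ M + quad b₀ C + s * ε₀ C))))

  sum≤ : ∀ M C s {m} → + ∣ s ∣ ≤ s * ε₀ C → m ≤ (quad b₁ M + + 1) + (quad b₀ C + + 1) + s * ε₀ C →
         m - + 10 ≤ quad b₁ M + quad b₀ C + s * ε₀ C
  sum≤ M C s h m≤ = ℤP.≤-trans (ℤP.+-monoˡ-≤ (- + 10) m≤) (≤-by (+ 8) nn
    (ℤS.solve 3 (λ x y z → x :+ y :+ z := ((x :+ con (+ 1)) :+ (y :+ con (+ 1)) :+ z :- con (+ 10)) :+ con (+ 8)) refl (quad b₁ M) (quad b₀ C) (s * ε₀ C)))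

  Ord-Y-C : ∀ M C s → Ord ((+ ∣ C ∣ + + ∣ s ∣) - + 10) (Y M C s)
  Ord-Y-C M C s = Ord-Y M C s _ (λ h → sum≤ M C s h (ℤP.+-mono-≤
    (ℤP.≤-trans (quad-abs small₀ C) (≤-by _ (nn-+ (quad-nn small₁ M) (nn {1})) (ℤP.+-comm (quad b₁ M + + 1) (quad b₀ C + + 1)))) h))

  Ord-Y-M : ∀ M C s → Ord ((+ ∣ M ∣ + + ∣ s ∣) - + 10) (Y M C s)
  Ord-Y-M M C s = Ord-Y M C s _ (λ h → sum≤ M C s h (ℤP.+-mono-≤
    (ℤP.≤-trans (quad-abs small₁ M) (≤-by _ (nn-+ (quad-nn small₀ C) (nn {1})) refl)) h))

  +10 : ∀ x → x ≡ x - + 10 + + 10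
  +10 = ℤS.solve 1 (λ x → x := (x :- con (+ 10)) :+ con (+ 10)) refl

  Null-≤ : ∀ {F : ℤ → Series} (e : ℤ → ℤ) → (∀ i → Ord (e i - + 10) (F i)) → (∀ i → + ∣ i ∣ ≤ e i) → Null F
  Null-≤ e ord h = Null-by (λ i → e i - + 10) ord (λ i → ℤP.≤-trans (h i) (ℤP.≤-reflexive (+10 (e i))))

  +s≤ : ∀ (i s : ℤ) → + ∣ i ∣ ≤ + ∣ i ∣ + + ∣ s ∣
  +s≤ i s = ≤-by (+ ∣ s ∣) nn refl

  abs-shift⁻ : ∀ i s → + ∣ i ∣ ≤ + ∣ i - s ∣ + + ∣ s ∣
  abs-shift⁻ i s = ≡.subst (λ z → + ∣ i ∣ ≤ + ∣ i - s ∣ + + z) (ℤP.∣-i∣≡∣i∣ s) (abs-shift i (- s))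

  -- For fixed `s` the change of variables is a pair of independent translations. The sum over `s`
  -- is therefore moved to the outside, the translations are made, and it is moved back.
  ΣX≈ΣY : Σℤ (λ A → Σℤ (λ N → Σℤ (X A N))) ≈ˢ Σℤ (λ M → Σℤ (λ C → Σℤ (Y M C)))
  ΣX≈ΣY = begin
    Σℤ (λ A → Σℤ (λ N → Σℤ (X A N)))
      ≈⟨ Σℤ-cong (λ A → Σℤ-swap (X A)) ⟩
    Σℤ (λ A → Σℤ (λ s → Σℤ (λ N → X A N s)))
      ≈⟨ Σℤ-swap (λ A s → Σℤ (λ N → X A N s)) ⟩
    Σℤ (λ s → Σℤ (λ A → Σℤ (λ N → X A N s)))
      ≈⟨ Σℤ-cong (λ s → Σℤ-cong (λ A → Σℤ-cong (λ N → X≈Y A N s))) ⟩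
    Σℤ (λ s → Σℤ (λ A → Σℤ (λ N → Y (A + s) (N - s) s)))
      ≈⟨ Σℤ-cong (λ s → Σℤ-cong (λ A → Σℤ-shift (- s) (λ C → Y (A + s) C s)
           (Null-≤ _ (λ C → Ord-Y-C (A + s) C s) (λ C → +s≤ C s))
           (Null-≤ _ (λ N → Ord-Y-C (A + s) (N - s) s) (λ N → abs-shift⁻ N s)))) ⟩
    Σℤ (λ s → Σℤ (λ A → Σℤ (λ C → Y (A + s) C s)))
      ≈⟨ Σℤ-cong (λ s → Σℤ-shift s (λ M → Σℤ (λ C → Y M C s))
           (Null-≤ _ (λ M → Ord-Σℤ (λ C → Ord-Y-M M C s)) (λ M → +s≤ M s))
           (Null-≤ _ (λ A → Ord-Σℤ (λ C → Ord-Y-M (A + s) C s)) (λ A → abs-shift A s))) ⟩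
    Σℤ (λ s → Σℤ (λ M → Σℤ (λ C → Y M C s)))
      ≈⟨ Σℤ-swap (λ s M → Σℤ (λ C → Y M C s)) ⟩
    Σℤ (λ M → Σℤ (λ s → Σℤ (λ C → Y M C s)))
      ≈⟨ Σℤ-cong (λ M → Σℤ-swap (λ s C → Y M C s)) ⟩
    Σℤ (λ M → Σℤ (λ C → Σℤ (Y M C))) ∎

  -- With `M` and `C` fixed, `s` runs over a half-line, so the geometric progression is complete and
  -- the double sum factors.
  ΣY : Σℤ (λ M → Σℤ (λ C → Σℤ (Y M C))) ≈ˢ θ b₁ ⊗ T c b₀
  ΣY = begin
    Σℤ (λ M → Σℤ (λ C → Σℤ (Y M C)))
      ≈⟨ Σℤ-cong (λ M → Σℤ-cong (λ C → ≈-trans (Σℤ-⋆ (sg M * sg C) (λ s → ρ C s ⋆ mono (E M C + s * ε₀ C)))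
           (⋆-cong {sg M * sg C} refl (≈-trans (Σρ α 1≤α α≤9 (E M C) C (E-nn M C))
             (G-cong {E M C} refl (ℤS.solve 3 (λ C b₀ c → con (+ 10) :* C :- (c :- b₀) := con (+ 10) :* C :+ (b₀ :- c)) refl C b₀ c)))))) ⟩
    Σℤ (λ M → Σℤ (λ C → (sg M * sg C) ⋆ G (quad b₁ M + quad b₀ C) (+ 10 * C + (b₀ - c))))
      ≈⟨ θ-⊗-ΣG sg (quad b₀) (λ C → + 10 * C + (b₀ - c)) small₁
           (λ C → ℤP.≤-trans (quad-nn small₀ C) (e≤lead (quad b₀ C) (+ 10 * C + (b₀ - c))))
           (λ C → ℤP.≤-trans (quad-abs small₀ C) (ℤP.+-monoˡ-≤ (+ 1) (e≤lead (quad b₀ C) (+ 10 * C + (b₀ - c))))) ⟩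
    θ b₁ ⊗ T c b₀ ∎

  first : Σℤ (λ A → Σℤ (λ N → (sg A * sg N) ⋆ G (E A N) (ε A))) ≈ˢ θ b₀ ⊗ T c b₁
  first = begin
    Σℤ (λ A → Σℤ (λ N → (sg A * sg N) ⋆ G (E A N) (ε A)))
      ≈⟨ Σℤ-swap (λ A N → (sg A * sg N) ⋆ G (E A N) (ε A)) ⟩
    Σℤ (λ N → Σℤ (λ A → (sg A * sg N) ⋆ G (E A N) (ε A)))
      ≈⟨ Σℤ-cong (λ N → Σℤ-cong (λ A → ⋆-cong (ℤP.*-comm (sg A) (sg N)) (G-cong {ε = ε A} (ℤP.+-comm (quad b₁ A) (quad b₀ N)) refl))) ⟩
    Σℤ (λ N → Σℤ (λ A → (sg N * sg A) ⋆ G (quad b₀ N + quad b₁ A) (ε A)))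
      ≈⟨ θ-⊗-ΣG sg (quad b₁) ε small₀
           (λ C → ℤP.≤-trans (quad-nn small₁ C) (e≤lead (quad b₁ C) (ε C)))
           (λ C → ℤP.≤-trans (quad-abs small₁ C) (ℤP.+-monoˡ-≤ (+ 1) (e≤lead (quad b₁ C) (ε C)))) ⟩
    θ b₀ ⊗ T c b₁ ∎

  10≥α+β : + 0 ≤ + 10 - α - β
  10≥α+β = ≡.subst (+ 0 ≤_) (ℤS.solve 3 (λ b₀ b₁ c → (con (+ 5) :+ b₀) :+ (con (+ 5) :- b₁) := con (+ 10) :- (c :- b₀) :- (b₁ :- c)) refl b₀ b₁ c)
    (nn-+ (Small.lower small₀) (Small.upper small₁))

  Ord-H : ∀ A k → Ord ((+ ∣ k ∣ + + ∣ A ∣) - + 10) (H A k)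
  Ord-H A k = Ord-⋆ (sg k) (Ord-≤ (ℤP.≤-trans (ℤP.+-monoˡ-≤ (- + 10) (ℤP.+-mono-≤ (quad-abs small₀₁ k) (lead-Λ {α} {β} 1≤α α≤9 10≥α+β A)))
    (≤-by (+ 8) nn (trans (lead-+ (quad b k) (α * A) (ε A))
      (ℤS.solve 2 (λ x y → x :+ y := ((x :+ con (+ 1)) :+ (y :+ con (+ 1)) :- con (+ 10)) :+ con (+ 8)) refl (quad b k) (lead (α * A) (ε A))))))
    (Ord-G (quad b k + α * A) (ε A)))

  -- The upper end of the geometric progression contributes the cross term `10 A N`, which completes
  -- the square in `k = N + A`; afterwards `k` and `A` separate.
  second : Σℤ (λ A → Σℤ (λ N → (sg A * sg N) ⋆ G (E A N + N * ε A) (ε A))) ≈ˢ θ b ⊗ Λ α β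
  second = begin
    Σℤ (λ A → Σℤ (λ N → (sg A * sg N) ⋆ G (E A N + N * ε A) (ε A)))
      ≈⟨ Σℤ-cong (λ A → Σℤ-cong (λ N → ⋆-cong (trans (ℤP.*-comm (sg A) (sg N)) (sym (sg-+ N A))) (G-cong {ε = ε A} (completed A N) refl))) ⟩
    Σℤ (λ A → Σℤ (λ N → H A (N + A)))
      ≈⟨ Σℤ-cong (λ A → Σℤ-shift A (H A)
           (Null-≤ _ (Ord-H A) (λ k → +s≤ k A))
           (Null-≤ _ (λ N → Ord-H A (N + A)) (λ N → abs-shift N A))) ⟩
    Σℤ (λ A → Σℤ (λ k → H A k))
      ≈⟨ Σℤ-swap H ⟩
    Σℤ (λ k → Σℤ (λ A → sg k ⋆ G (quad b k + α * A) (ε A)))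
      ≈⟨ Σℤ-cong (λ k → Σℤ-cong (λ A → ⋆-cong {f = G (quad b k + α * A) (ε A)} (sym (ℤP.*-identityʳ (sg k))) ≈-refl)) ⟩
    Σℤ (λ k → Σℤ (λ A → (sg k * + 1) ⋆ G (quad b k + α * A) (ε A)))
      ≈⟨ θ-⊗-ΣG (λ _ → + 1) (α *_) ε small₀₁ (lead-Λ-nn {α} {β} 1≤α α≤9 10≥α+β) (lead-Λ {α} {β} 1≤α α≤9 10≥α+β) ⟩
    θ b ⊗ Σℤ (λ A → (+ 1) ⋆ G (α * A) (ε A))
      ≈⟨ ⊗-congˡ {θ b} (Σℤ-cong (λ A → 1⋆ (G (α * A) (ε A)))) ⟩
    θ b ⊗ Λ α β ∎
    where
    completed : ∀ A N → E A N + N * ε A ≡ quad b (N + A) + α * A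
    completed A N = ℤS.solve 5 (λ A N b₀ b₁ c →
      ((con (+ 5) :* A :* A :+ b₁ :* A) :+ (con (+ 5) :* N :* N :+ b₀ :* N)) :+ N :* (con (+ 10) :* A :+ (b₁ :- c))
      := (con (+ 5) :* (N :+ A) :* (N :+ A) :+ (b₀ :+ b₁ :- c) :* (N :+ A)) :+ (c :- b₀) :* A) refl A N b₀ b₁ c

  corrections : Series
  corrections = Σℤ (λ A → Σℤ (λ N → (sg A * sg N) ⋆ correction (ε A) N (E A N)))

  -- The triple sum of `X` is evaluated twice: the finite progression in `s` gives its two ends and
  -- the degenerate terms, the regrouped one gives a single Appell sum.
  identity : (θ b₀ ⊗ T c b₁ ⊖ θ b ⊗ Λ α β) ⊕ corrections ≈ˢ θ b₁ ⊗ T c b₀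
  identity = ≈-sym (begin
    θ b₁ ⊗ T c b₀
      ≈⟨ ≈-trans ΣX≈ΣY ΣY ⟨
    Σℤ (λ A → Σℤ (λ N → Σℤ (X A N)))
      ≈⟨ Σℤ-cong (λ A → Σℤ-cong (λ N → ≈-trans (Σℤ-⋆ (sg A * sg N) (geomTerm (E A N) (ε A) N)) (⋆-cong {sg A * sg N} refl (finite A N)))) ⟩
    Σℤ (λ A → Σℤ (λ N → (sg A * sg N) ⋆ geomSum (E A N) (ε A) N))
      ≈⟨ Σℤ-cong (λ A → Σℤ-cong (λ N n → ℤS.solve 4 (λ s x y z → s :* ((x :- y) :+ z) := (s :* x :+ con -[1+ 0 ] :* (s :* y)) :+ s :* z) refl
           (sg A * sg N) (G (E A N) (ε A) n) (G (E A N + N * ε A) (ε A) n) (correction (ε A) N (E A N) n))) ⟩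
    Σℤ (λ A → Σℤ (λ N → (f₁ A N ⊕ -[1+ 0 ] ⋆ f₂ A N) ⊕ f₃ A N))
      ≈⟨ Σℤ-cong (λ A → ≈-trans (Σℤ-⊕ (λ N → f₁ A N ⊕ -[1+ 0 ] ⋆ f₂ A N) (f₃ A)) (⊕-cong {u = Σℤ (f₃ A)} (≈-trans (Σℤ-⊕ (f₁ A) (λ N → -[1+ 0 ] ⋆ f₂ A N)) (⊕-cong {Σℤ (f₁ A)} ≈-refl (Σℤ-⋆ -[1+ 0 ] (f₂ A)))) ≈-refl)) ⟩
    Σℤ (λ A → (Σℤ (f₁ A) ⊕ -[1+ 0 ] ⋆ Σℤ (f₂ A)) ⊕ Σℤ (f₃ A))
      ≈⟨ ≈-trans (Σℤ-⊕ (λ A → Σℤ (f₁ A) ⊕ -[1+ 0 ] ⋆ Σℤ (f₂ A)) (λ A → Σℤ (f₃ A)))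
           (⊕-cong {u = corrections} (≈-trans (Σℤ-⊕ (λ A → Σℤ (f₁ A)) (λ A → -[1+ 0 ] ⋆ Σℤ (f₂ A))) (⊕-cong first (≈-trans (Σℤ-⋆ -[1+ 0 ] (λ A → Σℤ (f₂ A))) (⋆-cong { -[1+ 0 ]} refl second)))) ≈-refl) ⟩
    (θ b₀ ⊗ T c b₁ ⊕ -[1+ 0 ] ⋆ (θ b ⊗ Λ α β)) ⊕ corrections
      ≈⟨ (λ n → cong (λ z → ((θ b₀ ⊗ T c b₁) n + z) + corrections n) (ℤP.-1*i≡-i ((θ b ⊗ Λ α β) n))) ⟩
    (θ b₀ ⊗ T c b₁ ⊖ θ b ⊗ Λ α β) ⊕ corrections ∎)
    where
    f₁ f₂ f₃ : ℤ → ℤ → Series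
    f₁ A N = (sg A * sg N) ⋆ G (E A N) (ε A)
    f₂ A N = (sg A * sg N) ⋆ G (E A N + N * ε A) (ε A)
    f₃ A N = (sg A * sg N) ⋆ correction (ε A) N (E A N)

module _ {b₀ b₁ c : ℤ} (small₀ : Small b₀) (small₁ : Small b₁) (small₀₁ : Small (b₀ + b₁ - c))
         (1≤α : + 0 ≤ c - b₀ - + 1) (α≤9 : + 0 ≤ + 9 - (c - b₀)) where

  open SetoidReasoning seriesSetoid

  K-generic : (∀ A → + 10 * A + (b₁ - c) ≢ + 0) →
              θ b₀ ⊗ T c b₁ ⊖ θ b₁ ⊗ T c b₀ ≈ˢ θ (b₀ + b₁ - c) ⊗ Λ (c - b₀) (b₁ - c)
  K-generic p n = trans (cong (λ z → (θ b₀ ⊗ T c b₁) n - z) (sym (K.identity n)))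
    (trans (cong (λ z → (θ b₀ ⊗ T c b₁) n - ((θ b₀ ⊗ T c b₁ ⊖ θ (b₀ + b₁ - c) ⊗ Λ (c - b₀) (b₁ - c)) n + z)) none)
    (ℤS.solve 2 (λ x y → x :- ((x :- y) :+ con (+ 0)) := y) refl ((θ b₀ ⊗ T c b₁) n) ((θ (b₀ + b₁ - c) ⊗ Λ (c - b₀) (b₁ - c)) n)))
    where
    module K = KIdentity b₀ b₁ c small₀ small₁ small₀₁ 1≤α α≤9
    none : K.corrections n ≡ + 0
    none = trans (sumZ-cong (n ℕ.+ 10) (λ A _ → trans (sumZ-cong (n ℕ.+ 10) (λ N _ →
             trans (cong ((sg A * sg N) *_) (correction-0 (+ 10 * A + (b₁ - c)) N (quad b₁ A + quad b₀ N) (p A) n)) (ℤP.*-zeroʳ (sg A * sg N)))) (sumZ-0 (n ℕ.+ 10))))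
             (sumZ-0 (n ℕ.+ 10))

-- With `b₁ = c` the progression degenerates for `A = 0` only. Its `N` equal terms, summed with
-- signs over `N`, form `θ′ b₀`.
K-pole : ∀ {b₀ c} (small₀ : Small b₀) (small₁ : Small c) (small₀₁ : Small (b₀ + c - c))
         (1≤α : + 0 ≤ c - b₀ - + 1) (α≤9 : + 0 ≤ + 9 - (c - b₀)) →
         (θ b₀ ⊗ T c c ⊖ θ b₀ ⊗ Λ (c - b₀) (+ 0)) ⊕ θ′ b₀ ≈ˢ θ c ⊗ T c b₀
K-pole {b₀} {c} small₀ small₁ small₀₁ 1≤α α≤9 n = trans
  (cong₂ _+_ (cong₂ (λ x y → (θ b₀ ⊗ T c c) n - (θ x ⊗ Λ (c - b₀) y) n)
     (ℤS.solve 2 (λ b c → b := b :+ c :- c) refl b₀ c) (sym (ℤP.+-inverseʳ c))) (sym derivative))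
  (K.identity n)
  where
  module K = KIdentity b₀ c c small₀ small₁ small₀₁ 1≤α α≤9
  pole : ∀ A → + 0 ≢ A → + 10 * A + (c - c) ≢ + 0
  pole A 0≢A e with ℤP.i*j≡0⇒i≡0∨j≡0 (+ 10) {A} (trans (sym (trans (cong (λ z → + 10 * A + z) (ℤP.+-inverseʳ c)) (ℤP.+-identityʳ (+ 10 * A)))) e)
  ... | inj₂ A≡0 = 0≢A (sym A≡0)
  at0 : ∀ N → (sg (+ 0) * sg N) * correction (+ 0 + (c - c)) N (quad c (+ 0) + quad b₀ N) n ≡ (N * sg N) * mono (quad b₀ N) n
  at0 N = trans (cong₂ (λ x y → (+ 1 * sg N) * correction (+ 0 + x) N y n) (ℤP.+-inverseʳ c)
     (trans (cong (λ z → + 0 + z + quad b₀ N) (ℤP.*-zeroʳ c)) (ℤP.+-identityˡ (quad b₀ N))))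
     (ℤS.solve 3 (λ s N m → (con (+ 1) :* s) :* (N :* m) := (N :* s) :* m) refl (sg N) N (mono (quad b₀ N) n))
  derivative : K.corrections n ≡ θ′ b₀ n
  derivative = trans (sumZ-single (n ℕ.+ 10) (+ 0) _ z≤n (λ A 0≢A → trans (sumZ-cong (n ℕ.+ 10) (λ N _ →
      trans (cong ((sg A * sg N) *_) (correction-0 (+ 10 * A + (c - c)) N (quad c A + quad b₀ N) (pole A 0≢A) n)) (ℤP.*-zeroʳ (sg A * sg N)))) (sumZ-0 (n ℕ.+ 10))))
    (sumZ-cong (n ℕ.+ 10) (λ N _ → at0 N))

-- The triple product

infix 4 _≈[_]_
_≈[_]_ : Series → ℕ → Series → Set
f ≈[ k ] g = ∀ n → n ℕ.< k → f n ≡ g n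

agree-⊗ : ∀ {k f f′ g g′} → f ≈[ k ] f′ → g ≈[ k ] g′ → f ⊗ g ≈[ k ] f′ ⊗ g′
agree-⊗ p q n n<k = Σ≤-cong n (λ i i≤n → cong₂ _*_ (p i (ℕP.≤-<-trans i≤n n<k)) (q (n ℕ.∸ i) (ℕP.≤-<-trans (ℕP.m∸n≤m n i) n<k)))

agree-≈ : ∀ {k f g} → f ≈ˢ g → f ≈[ k ] g
agree-≈ p n _ = p n

agree-trans : ∀ {k f g h} → f ≈[ k ] g → g ≈[ k ] h → f ≈[ k ] h
agree-trans p q n n<k = trans (p n n<k) (q n n<k)

agree-sym : ∀ {k f g} → f ≈[ k ] g → g ≈[ k ] f
agree-sym p n n<k = sym (p n n<k)

agree-≤ : ∀ {j k f g} → j ℕ.≤ k → f ≈[ k ] g → f ≈[ j ] g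
agree-≤ j≤k p n n<j = p n (ℕP.<-≤-trans n<j j≤k)

factor : ℤ → ℕ → ℕ → ℕ → Series
factor s a c k = one ⊖ s ⋆ q^ (a ℕ.+ c ℕ.* k)

factor-agree : ∀ s a c k → factor s (suc a) (suc c) k ≈[ suc k ] one
factor-agree s a c k n n<k = trans (cong (λ z → one n - s * z) (Ord-mono (+ (suc a ℕ.+ suc c ℕ.* k)) n
  (ℤ.+<+ (ℕP.<-≤-trans n<k (s≤s (ℕP.≤-trans (ℕP.m≤m+n k (c ℕ.* k)) (ℕP.m≤n+m (k ℕ.+ c ℕ.* k) a)))))))
  (trans (cong (λ z → one n - z) (ℤP.*-zeroʳ s)) (ℤP.+-identityʳ (one n)))

prod<-agree : ∀ {F : ℕ → Series} → (∀ k → F k ≈[ suc k ] one) → ∀ k d → prod< (k ℕ.+ d) F ≈[ suc k ] prod< k F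
prod<-agree {F} h k zero = agree-≈ (λ n → cong (λ z → prod< z F n) (ℕP.+-identityʳ k))
prod<-agree {F} h k (suc d) = agree-trans (agree-≈ (λ n → cong (λ z → prod< z F n) (ℕP.+-suc k d)))
  (agree-trans (agree-⊗ {f = prod< (k ℕ.+ d) F} (λ n _ → refl) (agree-≤ (s≤s (ℕP.m≤m+n k d)) (h (k ℕ.+ d))))
  (agree-trans (agree-≈ (⊗-identityʳ (prod< (k ℕ.+ d) F))) (prod<-agree h k d)))

poch-agree : ∀ s a c k → poch s (suc a) (suc c) ≈[ suc k ] prod< k (factor s (suc a) (suc c))
poch-agree s a c k n (s≤s n≤k) with ℕP.m≤n⇒m<n∨m≡n n≤k
... | inj₂ refl = trans (cong (λ z → prod< z (factor s (suc a) (suc c)) n) (sym (ℕP.+-comm n 1))) (prod<-agree (factor-agree s a c) n 1 n ℕP.≤-refl)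
... | inj₁ n<k = sym (trans (cong (λ z → prod< z (factor s (suc a) (suc c)) n) (sym (ℕP.m+[n∸m]≡n n<k)))
       (prod<-agree (factor-agree s a c) (suc n) (k ℕ.∸ suc n) n (ℕP.m≤n⇒m≤1+n ℕP.≤-refl)))

prod<-constant : ∀ {F : ℕ → Series} → (∀ k → F k 0 ≡ + 1) → ∀ k → prod< k F 0 ≡ + 1
prod<-constant h zero = refl
prod<-constant h (suc k) = cong₂ _*_ (prod<-constant h k) (h k)

-- e j = h j² + (x - h) j, the exponent of the j-th term of (q^x, q^y, q^{x+y}; q^{x+y})_∞ when x + y = 2h.
module TripleProduct (h x y : ℕ) (x+y : x ℕ.+ y ≡ suc h ℕ.+ suc h) where

  c : ℕ
  c = suc (h ℕ.+ suc h)

  b : ℤ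
  b = + x - + suc h

  e : ℤ → ℤ
  e j = + suc h * j * j + b * j

  private
    y≡ : + y ≡ + suc h - b
    y≡ = trans (ℤS.solve 2 (λ x y → y := (x :+ y) :- x) refl (+ x) (+ y))
      (trans (cong (λ z → + z - + x) x+y) (ℤS.solve 2 (λ h x → (h :+ h) :- x := h :- (x :- h)) refl (+ suc h) (+ x)))

    x≡ : + x ≡ + suc h + b
    x≡ = ℤS.solve 2 (λ h x → x := h :+ (x :- h)) refl (+ suc h) (+ x)

  e-nn : ∀ j → + 0 ≤ e j
  e-nn (+ zero) = ≡.subst (+ 0 ≤_) (ℤS.solve 2 (λ h b → con (+ 0) := h :* con (+ 0) :* con (+ 0) :+ b :* con (+ 0)) refl (+ suc h) b) nn
  e-nn (+ suc k) = ≡.subst (+ 0 ≤_) (trans (cong (λ z → z * + suc k + + suc h * + suc k * + k) x≡)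
    (ℤS.solve 3 (λ h b k → (h :+ b) :* (con (+ 1) :+ k) :+ h :* (con (+ 1) :+ k) :* k
       := h :* (con (+ 1) :+ k) :* (con (+ 1) :+ k) :+ b :* (con (+ 1) :+ k)) refl (+ suc h) b (+ k)))
    (nn-+ (nn-* (nn {x}) (nn {suc k})) (nn-* (nn-* (nn {suc h}) (nn {suc k})) (nn {k})))
  e-nn -[1+ k ] = ≡.subst (+ 0 ≤_) (trans (cong (λ z → z * + suc k + + suc h * + suc k * + k) y≡)
    (ℤS.solve 3 (λ h b k → (h :- b) :* (con (+ 1) :+ k) :+ h :* (con (+ 1) :+ k) :* k
       := h :* (:- (con (+ 1) :+ k)) :* (:- (con (+ 1) :+ k)) :+ b :* (:- (con (+ 1) :+ k))) refl (+ suc h) b (+ k)))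
    (nn-+ (nn-* (nn {y}) (nn {suc k})) (nn-* (nn-* (nn {suc h}) (nn {suc k})) (nn {k})))

  e-abs : ∀ j → + ∣ j ∣ ≤ e j + + 1
  e-abs (+ zero) = ℤP.≤-trans (nn {1}) (≤-by (e (+ 0)) (e-nn (+ 0)) (ℤP.+-comm (e (+ 0)) (+ 1)))
  e-abs (+ suc k) = ≤-by (+ x * + suc k + (+ h * + suc k * + k + + k * + k))
    (nn-+ (nn-* (nn {x}) (nn {suc k})) (nn-+ (nn-* (nn-* (nn {h}) (nn {suc k})) (nn {k})) (nn-* (nn {k}) (nn {k}))))
    (trans (ℤS.solve 3 (λ h b k → ((con (+ 1) :+ h) :* (con (+ 1) :+ k) :* (con (+ 1) :+ k) :+ b :* (con (+ 1) :+ k)) :+ con (+ 1)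
       := (con (+ 1) :+ k) :+ (((con (+ 1) :+ h) :+ b) :* (con (+ 1) :+ k) :+ (h :* (con (+ 1) :+ k) :* k :+ k :* k))) refl (+ h) b (+ k))
     (cong (λ z → + suc k + (z * + suc k + (+ h * + suc k * + k + + k * + k))) (sym x≡)))
  e-abs -[1+ k ] = ≤-by (+ y * + suc k + (+ h * + suc k * + k + + k * + k))
    (nn-+ (nn-* (nn {y}) (nn {suc k})) (nn-+ (nn-* (nn-* (nn {h}) (nn {suc k})) (nn {k})) (nn-* (nn {k}) (nn {k}))))
    (trans (ℤS.solve 3 (λ h b k → ((con (+ 1) :+ h) :* (:- (con (+ 1) :+ k)) :* (:- (con (+ 1) :+ k)) :+ b :* (:- (con (+ 1) :+ k))) :+ con (+ 1)
       := (con (+ 1) :+ k) :+ (((con (+ 1) :+ h) :- b) :* (con (+ 1) :+ k) :+ (h :* (con (+ 1) :+ k) :* k :+ k :* k))) refl (+ h) b (+ k))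
     (cong (λ z → + suc k + (z * + suc k + (+ h * + suc k * + k + + k * + k))) (sym y≡)))

  fac : ℕ → Series
  fac n = prod< n (factor (+ 1) c c)

  fac-constant : ∀ n → fac n 0 ≡ + 1
  fac-constant = prod<-constant (λ k → refl)

  ifac : ℤ → Series
  ifac (+ n) = inv (fac n)
  ifac -[1+ n ] _ = + 0

  fac-suc : ∀ n → fac (suc n) ≈ˢ fac n ⊗ (one ⊖ q^ (c ℕ.* suc n))
  fac-suc n = ⊗-congˡ {fac n} (λ m → cong₂ (λ z w → one m - z) (trans (ℤP.*-identityˡ _) (cong (λ z → q^ z m) (sym (ℕP.*-suc c n)))) (refl {x = + 0}))

  ifac-suc : ∀ n → ifac (+ n) ≈ˢ ifac (+ suc n) ⊗ (one ⊖ q^ (c ℕ.* suc n))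
  ifac-suc n = begin
    ifac (+ n)                                    ≈⟨ ⊗-identityʳ (ifac (+ n)) ⟨
    ifac (+ n) ⊗ one                              ≈⟨ ⊗-congˡ {ifac (+ n)} (inv-correct (fac (suc n)) (fac-constant (suc n))) ⟨
    ifac (+ n) ⊗ (fac (suc n) ⊗ ifac (+ suc n))   ≈⟨ ⊗-congˡ {ifac (+ n)} (⊗-congʳ {ifac (+ suc n)} (fac-suc n)) ⟩
    ifac (+ n) ⊗ ((fac n ⊗ (one ⊖ q^ (c ℕ.* suc n))) ⊗ ifac (+ suc n))
      ≈⟨ 𝕊.solve 4 (λ i f g j → i *: ((f *: g) *: j) =: (f *: i) *: (j *: g)) ≈-refl (ifac (+ n)) (fac n) (one ⊖ q^ (c ℕ.* suc n)) (ifac (+ suc n)) ⟩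
    (fac n ⊗ ifac (+ n)) ⊗ (ifac (+ suc n) ⊗ (one ⊖ q^ (c ℕ.* suc n)))
      ≈⟨ ⊗-congʳ {ifac (+ suc n) ⊗ (one ⊖ q^ (c ℕ.* suc n))} (inv-correct (fac n) (fac-constant n)) ⟩
    one ⊗ (ifac (+ suc n) ⊗ (one ⊖ q^ (c ℕ.* suc n))) ≈⟨ ⊗-identityˡ _ ⟩
    ifac (+ suc n) ⊗ (one ⊖ q^ (c ℕ.* suc n))     ∎
    where open SetoidReasoning seriesSetoid

  -- The Gaussian binomial coefficient in base `q^c` if `u + v = m`. It is zero for negative `u` or
  -- `v`, so that a sum over all integers is a finite one.
  B : ℤ → ℤ → ℕ → Series
  B u v m = fac m ⊗ (ifac u ⊗ ifac v)

  B-0ˡ : ∀ k v m → B -[1+ k ] v m ≈ˢ λ _ → + 0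
  B-0ˡ k v m = ≈-trans (⊗-congˡ {fac m} (⊗-zeroˡ (ifac v))) (⊗-zeroʳ (fac m))

  B-0ʳ : ∀ u k m → B u -[1+ k ] m ≈ˢ λ _ → + 0
  B-0ʳ u k m = ≈-trans (⊗-congˡ {fac m} (⊗-zeroʳ (ifac u))) (⊗-zeroʳ (fac m))

  B-comm : ∀ u v m → B u v m ≈ˢ B v u m
  B-comm u v m = ⊗-congˡ {fac m} (⊗-comm (ifac u) (ifac v))

  pascal₀ : ∀ v → B (+ 0) (+ suc v) (suc v) ≈ˢ B (+ 0) (+ v) v
  pascal₀ v = ≈-trans (row (suc v)) (≈-sym (row v))
    where
    row : ∀ v → B (+ 0) (+ v) v ≈ˢ ifac (+ 0)
    row v = ≈-trans (𝕊.solve 3 (λ f i j → f *: (i *: j) =: (f *: j) *: i) ≈-refl (fac v) (ifac (+ 0)) (ifac (+ v)))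
      (≈-trans (⊗-congʳ {ifac (+ 0)} (inv-correct (fac v) (fac-constant v))) (⊗-identityˡ (ifac (+ 0))))

  pascal : ∀ u v m → u + v ≡ + m → B u (v + + 1) (suc m) ≈ˢ B u v m ⊕ mono (+ c * (v + + 1)) ⊗ B (u - + 1) (v + + 1) m
  pascal -[1+ k ] v m _ = ≈-trans (B-0ˡ k (v + + 1) (suc m)) (≈-sym (≈-trans (⊕-cong (B-0ˡ k v m)
    (≈-trans (⊗-congˡ {mono (+ c * (v + + 1))} (B-0ˡ (suc (k ℕ.+ 0)) (v + + 1) m)) (⊗-zeroʳ (mono (+ c * (v + + 1)))))) (λ _ → refl)))
  pascal (+ u) -[1+ suc k ] m _ = ≈-trans (B-0ʳ (+ u) k (suc m)) (≈-sym (≈-trans (⊕-cong (B-0ʳ (+ u) (suc k) m)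
    (≈-trans (⊗-congˡ {mono (+ c * -[1+ k ])} (B-0ʳ (+ u - + 1) k m)) (⊗-zeroʳ (mono (+ c * -[1+ k ]))))) (λ _ → refl)))
  pascal (+ zero) -[1+ zero ] m ()
  pascal (+ suc u) -[1+ zero ] m eq with ℤP.+-injective eq
  ... | refl = ≈-trans (B-comm (+ suc u) (+ 0) (suc u)) (≈-trans (pascal₀ u) (≈-trans (B-comm (+ 0) (+ u) u)
      (≈-sym (≈-trans (⊕-cong (B-0ʳ (+ suc u) 0 u) (≈-trans (⊗-congʳ {B (+ u) (+ 0) u} (λ n → cong (λ z → mono z n) (ℤP.*-zeroʳ (+ c)))) (⊗-identityˡ (B (+ u) (+ 0) u))))
        (λ n → ℤP.+-identityˡ (B (+ u) (+ 0) u n))))))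
  pascal (+ zero) (+ v) m refl = ≈-trans (λ n → cong (λ z → B (+ 0) (+ z) (suc v) n) (ℕP.+-comm v 1)) (≈-trans (pascal₀ v)
      (≈-sym (≈-trans (⊕-cong {B (+ 0) (+ v) v} ≈-refl (≈-trans (⊗-congˡ {mono (+ c * (+ v + + 1))} (B-0ˡ 0 (+ v + + 1) v)) (⊗-zeroʳ (mono (+ c * (+ v + + 1))))))
        (λ n → ℤP.+-identityʳ (B (+ 0) (+ v) v n)))))
  pascal (+ suc u) (+ v) m refl = ≈-trans (λ n → cong (λ z → B (+ suc u) (+ z) (suc m) n) (ℕP.+-comm v 1)) (≈-trans core
      (⊕-cong {B (+ suc u) (+ v) m} ≈-refl (λ n → cong₂ (λ z w → (mono z ⊗ B (+ u) (+ w) m) n) (trans (ℤP.pos-* c (suc v)) (cong (λ z → + c * + z) (sym (ℕP.+-comm v 1)))) (sym (ℕP.+-comm v 1)))))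
    where
    open SetoidReasoning seriesSetoid
    p = q^ (c ℕ.* suc v)
    r = q^ (c ℕ.* suc u)
    core : B (+ suc u) (+ suc v) (suc m) ≈ˢ B (+ suc u) (+ v) m ⊕ p ⊗ B (+ u) (+ suc v) m
    core = begin
      fac (suc m) ⊗ (ifac (+ suc u) ⊗ ifac (+ suc v))
        ≈⟨ ⊗-congʳ {ifac (+ suc u) ⊗ ifac (+ suc v)} (≈-trans (fac-suc m) (⊗-congˡ {fac m} (λ n → cong (λ z → one n - z)
             (trans (cong (λ z → q^ z n) (trans (cong (c ℕ.*_) (sym (ℕP.+-suc (suc u) v))) (ℕP.*-distribˡ-+ c (suc u) (suc v)))) (sym (q^-+ (c ℕ.* suc u) (c ℕ.* suc v) n)))))) ⟩
      (fac m ⊗ (one ⊖ r ⊗ p)) ⊗ (ifac (+ suc u) ⊗ ifac (+ suc v))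
        ≈⟨ 𝕊.solve 5 (λ f r p i j → (f *: (1: -: r *: p)) *: (i *: j)
             =: f *: (i *: (j *: (1: -: p))) +: p *: (f *: ((i *: (1: -: r)) *: j))) ≈-refl (fac m) r p (ifac (+ suc u)) (ifac (+ suc v)) ⟩
      fac m ⊗ (ifac (+ suc u) ⊗ (ifac (+ suc v) ⊗ (one ⊖ p))) ⊕ p ⊗ (fac m ⊗ ((ifac (+ suc u) ⊗ (one ⊖ r)) ⊗ ifac (+ suc v)))
        ≈⟨ ⊕-cong (⊗-congˡ {fac m} (⊗-congˡ {ifac (+ suc u)} (ifac-suc v))) (⊗-congˡ {p} (⊗-congˡ {fac m} (⊗-congʳ {ifac (+ suc v)} (ifac-suc u)))) ⟨
      B (+ suc u) (+ v) m ⊕ p ⊗ B (+ u) (+ suc v) m ∎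

  coefficient : ℕ → ℕ → ℤ → Series
  coefficient N M j = B (+ M + j) (+ N - j) (M ℕ.+ N)

  -- The finite form of the triple product with a weight `t` inserted. Constant weight gives the
  -- product, weight `j` its derivative, and both follow from one recursion.
  F : (ℤ → ℤ) → ℕ → ℕ → Series
  F t N M = Σℤ (λ j → (sg j * t j) ⋆ (mono (e j) ⊗ coefficient N M j))

  F-Null : ∀ (t : ℤ → ℤ) (f : ℤ → Series) → Null (λ j → t j ⋆ (mono (e j) ⊗ f j))
  F-Null t f = Null-by e (λ j → Ord-⋆ (t j) (Ord-⊗ (Ord-mono (e j)) (f j))) (λ j → ℤP.≤-trans (e-abs j) (x≤x+1+9 (e j)))

  step-N : ∀ N M j → mono (e j) ⊗ coefficient (suc N) M j ≈ˢ
           mono (e j) ⊗ coefficient N M j ⊕ q^ (x ℕ.+ c ℕ.* N) ⊗ (mono (e (j - + 1)) ⊗ coefficient N M (j - + 1))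
  step-N N M j = begin
    mono (e j) ⊗ coefficient (suc N) M j
      ≈⟨ ⊗-congˡ {mono (e j)} (λ n → cong₂ (λ v m → B (+ M + j) v m n) v≡ (ℕP.+-suc M N)) ⟩
    mono (e j) ⊗ B (+ M + j) (v + + 1) (suc (M ℕ.+ N))
      ≈⟨ ⊗-congˡ {mono (e j)} (pascal (+ M + j) v (M ℕ.+ N) (ℤS.solve 3 (λ M j N → (M :+ j) :+ (N :- j) := M :+ N) refl (+ M) j (+ N))) ⟩
    mono (e j) ⊗ (coefficient N M j ⊕ p ⊗ B (+ M + j - + 1) (v + + 1) (M ℕ.+ N))
      ≈⟨ 𝕊.solve 4 (λ m a p b → m *: (a +: p *: b) =: m *: a +: (m *: p) *: b) ≈-refl (mono (e j)) (coefficient N M j) p (B (+ M + j - + 1) (v + + 1) (M ℕ.+ N)) ⟩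
    mono (e j) ⊗ coefficient N M j ⊕ (mono (e j) ⊗ p) ⊗ B (+ M + j - + 1) (v + + 1) (M ℕ.+ N)
      ≈⟨ ⊕-cong {mono (e j) ⊗ coefficient N M j} ≈-refl (absorb (v + + 1) refl) ⟩
    mono (e j) ⊗ coefficient N M j ⊕ (q^ (x ℕ.+ c ℕ.* N) ⊗ mono (e (j - + 1))) ⊗ B (+ M + j - + 1) (v + + 1) (M ℕ.+ N)
      ≈⟨ ⊕-cong {mono (e j) ⊗ coefficient N M j} ≈-refl (≈-trans (⊗-assoc (q^ (x ℕ.+ c ℕ.* N)) (mono (e (j - + 1))) (B (+ M + j - + 1) (v + + 1) (M ℕ.+ N)))
           (⊗-congˡ {q^ (x ℕ.+ c ℕ.* N)} (⊗-congˡ {mono (e (j - + 1))} (λ n → cong₂ (λ u v → B u v (M ℕ.+ N) n)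
             (ℤP.+-assoc (+ M) j (- + 1)) (ℤS.solve 2 (λ N j → (N :- j) :+ con (+ 1) := N :- (j :- con (+ 1))) refl (+ N) j))))) ⟩
    mono (e j) ⊗ coefficient N M j ⊕ q^ (x ℕ.+ c ℕ.* N) ⊗ (mono (e (j - + 1)) ⊗ coefficient N M (j - + 1)) ∎
    where
    open SetoidReasoning seriesSetoid
    v = + N - j
    p = mono (+ c * (v + + 1))
    v≡ : + suc N - j ≡ v + + 1
    v≡ = ℤS.solve 2 (λ N j → (con (+ 1) :+ N) :- j := (N :- j) :+ con (+ 1)) refl (+ N) j
    exponents : e j + + c * (v + + 1) ≡ + (x ℕ.+ c ℕ.* N) + e (j - + 1)
    exponents = trans (ℤS.solve 4 (λ h b j N → (h :* j :* j :+ b :* j) :+ (h :+ h) :* ((N :- j) :+ con (+ 1))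
        := ((h :+ b) :+ (h :+ h) :* N) :+ (h :* (j :- con (+ 1)) :* (j :- con (+ 1)) :+ b :* (j :- con (+ 1)))) refl (+ suc h) b j (+ N))
      (cong (λ z → z + e (j - + 1)) (cong₂ _+_ (sym x≡) (sym (ℤP.pos-* c N))))
    absorb : ∀ w → v + + 1 ≡ w → (mono (e j) ⊗ mono (+ c * w)) ⊗ B (+ M + j - + 1) w (M ℕ.+ N)
                     ≈ˢ (q^ (x ℕ.+ c ℕ.* N) ⊗ mono (e (j - + 1))) ⊗ B (+ M + j - + 1) w (M ℕ.+ N)
    absorb (+ w) refl′ = ⊗-congʳ {B (+ M + j - + 1) (+ w) (M ℕ.+ N)} (≈-trans (mono-+ (e-nn j) (nn-* (nn {c}) (nn {w})))
      (≈-trans (λ n → cong (λ z → mono z n) (trans (cong (λ z → e j + + c * z) (sym refl′)) exponents))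
        (≈-sym (mono-+ (nn {x ℕ.+ c ℕ.* N}) (e-nn (j - + 1))))))
    absorb -[1+ k ] _ = ≈-trans (⊗-congˡ {mono (e j) ⊗ mono (+ c * -[1+ k ])} (B-0ʳ (+ M + j - + 1) k (M ℕ.+ N)))
      (≈-trans (⊗-zeroʳ (mono (e j) ⊗ mono (+ c * -[1+ k ])))
      (≈-sym (≈-trans (⊗-congˡ {q^ (x ℕ.+ c ℕ.* N) ⊗ mono (e (j - + 1))} (B-0ʳ (+ M + j - + 1) k (M ℕ.+ N)))
        (⊗-zeroʳ (q^ (x ℕ.+ c ℕ.* N) ⊗ mono (e (j - + 1)))))))

  -- Pascal's rule splits the new coefficient; the second part is the old sum with its index moved
  -- by one, which changes the sign and translates the weight. For constant weight this is
  -- multiplication by one more factor.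
  F-suc-N : ∀ t N M → F t (suc N) M ≈ˢ F t N M ⊖ q^ (x ℕ.+ c ℕ.* N) ⊗ F (λ j → t (j + + 1)) N M
  F-suc-N t N M = begin
    F t (suc N) M
      ≈⟨ Σℤ-cong (λ j → ≈-trans (⋆-cong {sg j * t j} refl (step-N N M j)) (λ n → ℤS.solve 3 (λ s a b → s :* (a :+ b) := s :* a :+ con -[1+ 0 ] :* ((:- s) :* b)) refl
           (sg j * t j) ((mono (e j) ⊗ coefficient N M j) n) ((Q ⊗ (mono (e (j - + 1)) ⊗ coefficient N M (j - + 1))) n))) ⟩
    Σℤ (λ j → (sg j * t j) ⋆ (mono (e j) ⊗ coefficient N M j) ⊕ -[1+ 0 ] ⋆ ((- (sg j * t j)) ⋆ (Q ⊗ (mono (e (j - + 1)) ⊗ coefficient N M (j - + 1)))))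
      ≈⟨ Σℤ-⊕ _ _ ⟩
    F t N M ⊕ Σℤ (λ j → -[1+ 0 ] ⋆ ((- (sg j * t j)) ⋆ (Q ⊗ (mono (e (j - + 1)) ⊗ coefficient N M (j - + 1)))))
      ≈⟨ ⊕-cong {F t N M} ≈-refl (≈-trans (Σℤ-⋆ -[1+ 0 ] _) (λ n → ℤP.-1*i≡-i _)) ⟩
    F t N M ⊖ Σℤ (λ j → (- (sg j * t j)) ⋆ (Q ⊗ (mono (e (j - + 1)) ⊗ coefficient N M (j - + 1))))
      ≈⟨ ⊖-congˡ {F t N M} (Σℤ-cong (λ j → ≈-trans (⋆-cong {f = Q ⊗ g (j - + 1)} (signs j) ≈-refl) (≈-sym (⊗-⋆ (sg (j - + 1) * t (j - + 1 + + 1)) Q (g (j - + 1)))))) ⟩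
    F t N M ⊖ Σℤ (λ j → Q ⊗ ((sg (j - + 1) * t (j - + 1 + + 1)) ⋆ g (j - + 1)))
      ≈⟨ ⊖-congˡ {F t N M} (⊗-Σℤ nullShift Q) ⟨
    F t N M ⊖ Q ⊗ Σℤ (λ j → (sg (j - + 1) * t (j - + 1 + + 1)) ⋆ g (j - + 1))
      ≈⟨ ⊖-congˡ {F t N M} (⊗-congˡ {Q} (Σℤ-shift -[1+ 0 ] (λ j → (sg j * t (j + + 1)) ⋆ g j) (F-Null (λ j → sg j * t (j + + 1)) (coefficient N M)) nullShift)) ⟩
    F t N M ⊖ Q ⊗ F (λ j → t (j + + 1)) N M ∎
    where
    open SetoidReasoning seriesSetoid
    Q = q^ (x ℕ.+ c ℕ.* N)
    g : ℤ → Series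
    g j = mono (e j) ⊗ coefficient N M j
    ⊖-congˡ : ∀ {f g g′} → g ≈ˢ g′ → f ⊖ g ≈ˢ f ⊖ g′
    ⊖-congˡ {f} p n = cong (λ z → f n - z) (p n)
    signs : ∀ j → - (sg j * t j) ≡ sg (j - + 1) * t (j - + 1 + + 1)
    signs j = trans (ℤP.neg-distribˡ-* (sg j) (t j)) (cong₂ _*_ (sym (trans (sg-+ j -[1+ 0 ]) (ℤS.solve 1 (λ s → s :* con -[1+ 0 ] := :- s) refl (sg j))))
      (cong t (ℤS.solve 1 (λ j → j := (j :- con (+ 1)) :+ con (+ 1)) refl j)))
    nullShift : Null (λ j → (sg (j - + 1) * t (j - + 1 + + 1)) ⋆ g (j - + 1))
    nullShift = Null-by (λ j → e (j - + 1)) (λ j → Ord-⋆ (sg (j - + 1) * t (j - + 1 + + 1)) (Ord-⊗ (Ord-mono (e (j - + 1))) (coefficient N M (j - + 1))))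
      (λ j → ℤP.≤-trans (abs-shift j -[1+ 0 ]) (ℤP.≤-trans (ℤP.+-monoˡ-≤ (+ 1) (e-abs (j - + 1)))
        (≤-by (+ 8) nn (ℤS.solve 1 (λ e → e :+ con (+ 10) := (e :+ con (+ 1)) :+ con (+ 1) :+ con (+ 8)) refl (e (j - + 1))))))

  F-0-0 : ∀ t → F t 0 0 ≈ˢ t (+ 0) ⋆ one
  F-0-0 t n = trans (sumZ-single (n ℕ.+ 10) (+ 0) (λ j → ((sg j * t j) ⋆ (mono (e j) ⊗ coefficient 0 0 j)) n) z≤n (λ j 0≢j → trans (cong (λ z → sg j * t j * z) (off j 0≢j n)) (ℤP.*-zeroʳ (sg j * t j))))
    (⋆-cong (ℤP.*-identityˡ (t (+ 0))) at0 n)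
    where
    off : ∀ j → + 0 ≢ j → mono (e j) ⊗ coefficient 0 0 j ≈ˢ λ _ → + 0
    off (+ zero) 0≢0 = ⊥-elim (0≢0 refl)
    off (+ suc k) _ = ≈-trans (⊗-congˡ {mono (e (+ suc k))} (B-0ʳ (+ suc k) k 0)) (⊗-zeroʳ (mono (e (+ suc k))))
    off -[1+ k ] _ = ≈-trans (⊗-congˡ {mono (e -[1+ k ])} (B-0ˡ k (+ suc k) 0)) (⊗-zeroʳ (mono (e -[1+ k ])))
    ifac0 : ifac (+ 0) ≈ˢ one
    ifac0 = ≈-trans (≈-sym (⊗-identityˡ (ifac (+ 0)))) (inv-correct one refl)
    e0 : e (+ 0) ≡ + 0
    e0 = ℤS.solve 2 (λ h b → h :* con (+ 0) :* con (+ 0) :+ b :* con (+ 0) := con (+ 0)) refl (+ suc h) b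
    at0 : mono (e (+ 0)) ⊗ coefficient 0 0 (+ 0) ≈ˢ one
    at0 = ≈-trans (⊗-cong {mono (e (+ 0))} {one} {coefficient 0 0 (+ 0)} {one} (λ n → cong (λ z → mono z n) e0)
      (≈-trans (⊗-identityˡ (ifac (+ 0) ⊗ ifac (+ 0))) (≈-trans (⊗-cong ifac0 ifac0) (⊗-identityˡ one)))) (⊗-identityˡ one)

  E : Series
  E = P c c

  series : (ℤ → ℤ) → Series
  series t = Σℤ (λ j → (sg j * t j) ⋆ mono (e j))

  E-agree : ∀ k → E ≈[ suc k ] fac k
  E-agree k = poch-agree (+ 1) (h ℕ.+ suc h) (h ℕ.+ suc h) k

  E-ifac : ∀ k {j} → j ℕ.≤ suc k → E ⊗ ifac (+ k) ≈[ j ] one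
  E-ifac k j≤ = agree-trans (agree-⊗ {g = ifac (+ k)} (agree-≤ j≤ (E-agree k)) (λ n _ → refl)) (agree-≈ (inv-correct (fac k) (fac-constant k)))

  E-coefficient : ∀ u v j → j ℕ.≤ suc u → j ℕ.≤ suc v → E ⊗ B (+ u) (+ v) (u ℕ.+ v) ≈[ j ] one
  E-coefficient u v j j≤u j≤v = agree-trans (agree-≈ (𝕊.solve 4 (λ e f a b → e *: (f *: (a *: b)) =: (e *: a) *: (f *: b)) ≈-refl E (fac (u ℕ.+ v)) (ifac (+ u)) (ifac (+ v))))
    (agree-trans (agree-⊗ (E-ifac u j≤u) (agree-trans (agree-⊗ {g = ifac (+ v)} {g′ = ifac (+ v)} (agree-≤ j≤v (agree-trans (agree-≈ (λ n → cong (λ z → fac z n) (ℕP.+-comm u v)))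
       (prod<-agree (factor-agree (+ 1) (h ℕ.+ suc h) (h ℕ.+ suc h)) v u))) (λ n _ → refl))
       (agree-≈ (inv-correct (fac v) (fac-constant v)))))
    (agree-≈ (⊗-identityˡ one)))

  -- Below any given degree, `E` times a Gaussian binomial coefficient whose two lower entries are
  -- large is 1.
  limit : ∀ t n → (E ⊗ F t (suc n ℕ.+ (n ℕ.+ 10)) (suc n ℕ.+ (n ℕ.+ 10))) n ≡ series t n
  limit t n = trans (⊗-Σℤ (F-Null (λ j → sg j * t j) (coefficient N N)) E n)
    (sumZ-cong (n ℕ.+ 10) (λ j j≤ → trans (⊗-⋆ (sg j * t j) E (mono (e j) ⊗ coefficient N N j) n) (cong (λ z → sg j * t j * z)
      (trans (𝕊.solve 3 (λ e m c → e *: (m *: c) =: m *: (e *: c)) ≈-refl E (mono (e j)) (coefficient N N j) n)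
      (trans (agree-⊗ {f = mono (e j)} (λ _ _ → refl) (unit j j≤) n ℕP.≤-refl) (⊗-identityʳ (mono (e j)) n))))))
    where
    -- This size keeps both `N + j` and `N - j` above `n` for every `j` in the window of the
    -- coefficient `n`.
    N = suc n ℕ.+ (n ℕ.+ 10)
    unit : ∀ j → ∣ j ∣ ℕ.≤ n ℕ.+ 10 → E ⊗ coefficient N N j ≈[ suc n ] one
    unit j j≤ = ≡.subst₂ (λ u v → E ⊗ B u v (N ℕ.+ N) ≈[ suc n ] one) (sym u≡) (sym v≡)
      (≡.subst (λ m → E ⊗ B (+ u) (+ v) m ≈[ suc n ] one) u+v (E-coefficient u v (suc n) (bound j j≤) (bound (- j) (≡.subst (ℕ._≤ n ℕ.+ 10) (sym (ℤP.∣-i∣≡∣i∣ j)) j≤))))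
      where
      lower : ∀ j → ∣ j ∣ ℕ.≤ n ℕ.+ 10 → + suc n ≤ + N + j
      lower j j≤ = ≤-by (+ (n ℕ.+ 10) - (- j)) (≤⇒nn (ℤP.≤-trans (i≤∣i∣ (- j)) (ℤ.+≤+ (≡.subst (ℕ._≤ n ℕ.+ 10) (sym (ℤP.∣-i∣≡∣i∣ j)) j≤))))
        (ℤS.solve 3 (λ a b j → (a :+ b) :+ j := a :+ (b :- (:- j))) refl (+ suc n) (+ (n ℕ.+ 10)) j)
      u v : ℕ
      u = ∣ + N + j ∣
      v = ∣ + N - j ∣
      u≡ : + N + j ≡ + u
      u≡ = sym (ℤP.0≤i⇒+∣i∣≡i (ℤP.≤-trans nn (lower j j≤)))
      v≡ : + N - j ≡ + v
      v≡ = sym (ℤP.0≤i⇒+∣i∣≡i (ℤP.≤-trans nn (lower (- j) (≡.subst (ℕ._≤ n ℕ.+ 10) (sym (ℤP.∣-i∣≡∣i∣ j)) j≤))))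
      u+v : u ℕ.+ v ≡ N ℕ.+ N
      u+v = ℤP.+-injective (trans (cong₂ _+_ (sym u≡) (sym v≡)) (ℤS.solve 2 (λ N j → (N :+ j) :+ (N :- j) := N :+ N) refl (+ N) j))
      bound : ∀ j → ∣ j ∣ ℕ.≤ n ℕ.+ 10 → suc n ℕ.≤ suc ∣ + N + j ∣
      bound j j≤ = ℕP.m≤n⇒m≤1+n (ℤP.drop‿+≤+ (≡.subst (+ suc n ≤_) (sym (ℤP.0≤i⇒+∣i∣≡i (ℤP.≤-trans nn (lower j j≤)))) (lower j j≤)))

module _ (h x y : ℕ) (x+y : x ℕ.+ y ≡ suc h ℕ.+ suc h) where

  private
    y+x = trans (ℕP.+-comm y x) x+y
    module T₁ = TripleProduct h x y x+y
    module T₂ = TripleProduct h y x y+x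

  open SetoidReasoning seriesSetoid

  -- The reflection `j ↦ - j` exchanges `x` with `y` and `N` with `M`; the recursion in `M` is
  -- thereby the one in `N`.
  F-reflect : ∀ t N M → T₁.F t N M ≈ˢ T₂.F (λ j → t (- j)) M N
  F-reflect t N M = begin
    T₁.F t N M
      ≈⟨ Σℤ-reflect (λ j → (sg j * t j) ⋆ (mono (T₁.e j) ⊗ T₁.coefficient N M j)) ⟨
    Σℤ (λ j → (sg (- j) * t (- j)) ⋆ (mono (T₁.e (- j)) ⊗ T₁.coefficient N M (- j)))
      ≈⟨ Σℤ-cong (λ j → ⋆-cong (cong (_* t (- j)) (sg-neg j)) (⊗-cong {mono (T₁.e (- j))} {mono (T₂.e j)} {T₁.coefficient N M (- j)} {T₂.coefficient M N j} (λ n → cong (λ z → mono z n) (exponents j))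
           (≈-trans (T₁.B-comm (+ M + (- j)) (+ N - (- j)) (M ℕ.+ N)) (λ n → cong₂ (λ u m → T₁.B u (+ M - j) m n) (cong (λ z → + N + z) (ℤP.neg-involutive j)) (ℕP.+-comm M N))))) ⟩
    T₂.F (λ j → t (- j)) M N ∎
    where
    exponents : ∀ j → T₁.e (- j) ≡ T₂.e j
    exponents j = trans (ℤS.solve 3 (λ h x j → h :* (:- j) :* (:- j) :+ (x :- h) :* (:- j) := h :* j :* j :+ ((h :+ h :- x) :- h) :* j) refl (+ suc h) (+ x) j)
      (cong (λ z → + suc h * j * j + (z - + suc h) * j) (trans (cong (λ z → + z - + x) (sym x+y)) (ℤS.solve 2 (λ x y → x :+ y :- x := y) refl (+ x) (+ y))))

  F-suc-M : ∀ t N M → T₁.F t N (suc M) ≈ˢ T₁.F t N M ⊖ q^ (y ℕ.+ T₁.c ℕ.* M) ⊗ T₁.F (λ j → t (j - + 1)) N M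
  F-suc-M t N M = begin
    T₁.F t N (suc M)
      ≈⟨ F-reflect t N (suc M) ⟩
    T₂.F (λ j → t (- j)) (suc M) N
      ≈⟨ T₂.F-suc-N (λ j → t (- j)) M N ⟩
    T₂.F (λ j → t (- j)) M N ⊖ q^ (y ℕ.+ T₁.c ℕ.* M) ⊗ T₂.F (λ j → t (- (j + + 1))) M N
      ≈⟨ (λ n → cong₂ _-_ (F-reflect t N M n) (⊗-congˡ {q^ (y ℕ.+ T₁.c ℕ.* M)} (≈-trans (F-reflect (λ j → t (j - + 1)) N M)
           (Σℤ-cong (λ j → ⋆-cong (cong (λ z → sg j * t z) (ℤS.solve 1 (λ j → :- j :- con (+ 1) := :- (j :+ con (+ 1))) refl j)) ≈-refl))) n)) ⟨
    T₁.F t N M ⊖ q^ (y ℕ.+ T₁.c ℕ.* M) ⊗ T₁.F (λ j → t (j - + 1)) N M ∎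

  private
    1t : ℤ → ℤ
    1t _ = + 1

  ⊖-factor : ∀ f k → f ⊖ q^ k ⊗ f ≈ˢ f ⊗ (one ⊖ (+ 1) ⋆ q^ k)
  ⊖-factor f k = ≈-trans (𝕊.solve 2 (λ f q → f -: q *: f =: f *: (1: -: q)) ≈-refl f (q^ k))
    (⊗-congˡ {f} (λ n → cong (λ z → one n - z) (sym (ℤP.*-identityˡ (q^ k n)))))

  F-1-0 : ∀ M → T₁.F 1t 0 M ≈ˢ prod< M (factor (+ 1) y T₁.c)
  F-1-0 zero = ≈-trans (T₁.F-0-0 1t) (1⋆ one)
  F-1-0 (suc M) = ≈-trans (F-suc-M 1t 0 M) (≈-trans (⊖-factor (T₁.F 1t 0 M) (y ℕ.+ T₁.c ℕ.* M)) (⊗-congʳ {factor (+ 1) y T₁.c M} (F-1-0 M)))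

  F-1 : ∀ N M → T₁.F 1t N M ≈ˢ prod< N (factor (+ 1) x T₁.c) ⊗ prod< M (factor (+ 1) y T₁.c)
  F-1 zero M = ≈-trans (F-1-0 M) (≈-sym (⊗-identityˡ (prod< M (factor (+ 1) y T₁.c))))
  F-1 (suc N) M = ≈-trans (T₁.F-suc-N 1t N M) (≈-trans (⊖-factor (T₁.F 1t N M) (x ℕ.+ T₁.c ℕ.* N)) (≈-trans (⊗-congʳ {factor (+ 1) x T₁.c N} (F-1 N M))
    (𝕊.solve 3 (λ a b c → (a *: b) *: c =: (a *: c) *: b) ≈-refl (prod< N (factor (+ 1) x T₁.c)) (prod< M (factor (+ 1) y T₁.c)) (factor (+ 1) x T₁.c N))))

tripleProduct : ∀ h x y (x+y : suc x ℕ.+ suc y ≡ suc h ℕ.+ suc h) → let module T₁ = TripleProduct h (suc x) (suc y) x+y in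
                T₁.series (λ _ → + 1) ≈ˢ T₁.E ⊗ (P (suc x) T₁.c ⊗ P (suc y) T₁.c)
tripleProduct h x y x+y n = trans (sym (T₁.limit (λ _ → + 1) n))
  (agree-⊗ {f = T₁.E} (λ _ _ → refl) (agree-trans (agree-≈ (F-1 h (suc x) (suc y) x+y N N)) (agree-⊗ (fin x) (fin y))) n ℕP.≤-refl)
  where
  module T₁ = TripleProduct h (suc x) (suc y) x+y
  N = suc n ℕ.+ (n ℕ.+ 10)
  fin : ∀ x → prod< N (factor (+ 1) (suc x) T₁.c) ≈[ suc n ] P (suc x) T₁.c
  fin x = agree-sym (agree-≤ (s≤s (ℕP.≤-trans (ℕP.m≤m+n n (n ℕ.+ 10)) (ℕP.n≤1+n (n ℕ.+ (n ℕ.+ 10))))) (poch-agree (+ 1) x (h ℕ.+ suc h) N))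

module Jacobi = TripleProduct 4 0 10 refl

-- In the case `x = 0` the product contains the factor `1 - q^0`.
F1≈0 : ∀ N M → Jacobi.F (λ _ → + 1) (suc N) M ≈ˢ λ _ → + 0
F1≈0 zero M = ≈-trans (F-1 4 0 10 refl 1 M) (≈-trans (⊗-congʳ {prod< M (factor (+ 1) 10 10)} zero-factor) (⊗-zeroˡ (prod< M (factor (+ 1) 10 10))))
  where
  zero-factor : one ⊗ factor (+ 1) 0 10 0 ≈ˢ λ _ → + 0
  zero-factor = ≈-trans (⊗-identityˡ (factor (+ 1) 0 10 0)) (λ n → trans (cong (λ z → one n - z) (ℤP.*-identityˡ (one n))) (ℤP.+-inverseʳ (one n)))
F1≈0 (suc N) M = ≈-trans (Jacobi.F-suc-N (λ _ → + 1) (suc N) M) (≈-trans (λ n → cong₂ _-_ (F1≈0 N M n) (⊗-congˡ {q^ (10 ℕ.* suc N)} (F1≈0 N M) n))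
  (λ n → trans (cong (λ z → + 0 - z) (⊗-zeroʳ (q^ (10 ℕ.* suc N)) n)) refl))

-- The derivative of the triple product at a zero. The step through the vanishing factor turns the
-- weight `j` into the constant weight `- 1`; from then on the unweighted sums vanish, so each step
-- multiplies by one factor.
jacobi : Jacobi.series (λ j → j) ≈ˢ ⊝ (P 10 10 ⊗ (P 10 10 ⊗ P 10 10))
jacobi n = trans (sym (J.limit (λ j → j) n))
  (trans (⊗-congˡ {P 10 10} (F-id (n ℕ.+ (n ℕ.+ 10)) N) n)
  (trans (agree-⊗ {f = P 10 10} (λ _ _ → refl) (λ m m<n → cong -_ (agree-⊗ (fin (n ℕ.+ (n ℕ.+ 10)) (ℕP.m≤m+n n (n ℕ.+ 10))) (fin N (ℕP.≤-trans (ℕP.m≤m+n n (n ℕ.+ 10)) (ℕP.n≤1+n (n ℕ.+ (n ℕ.+ 10))))) m m<n)) n ℕP.≤-refl)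
  (𝕊.solve 1 (λ e → e *: (-: (e *: e)) =: -: (e *: (e *: e))) ≈-refl (P 10 10) n)))
  where
  module J = Jacobi
  N = suc n ℕ.+ (n ℕ.+ 10)
  p : ℕ → Series
  p N = prod< N (factor (+ 1) 10 10)
  fin : ∀ k → n ℕ.≤ k → p k ≈[ suc n ] P 10 10
  fin k n≤k = agree-sym (agree-≤ (s≤s n≤k) (poch-agree (+ 1) 9 9 k))
  split : ∀ N M → J.F (λ j → j + + 1) N M ≈ˢ J.F (λ j → j) N M ⊕ J.F (λ _ → + 1) N M
  split N M = ≈-trans (Σℤ-cong (λ j n → ℤS.solve 3 (λ s j m → s :* (j :+ con (+ 1)) :* m := s :* j :* m :+ s :* con (+ 1) :* m) refl (sg j) j ((mono (J.e j) ⊗ J.coefficient N M j) n)))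
    (Σℤ-⊕ (λ j → (sg j * j) ⋆ (mono (J.e j) ⊗ J.coefficient N M j)) (λ j → (sg j * + 1) ⋆ (mono (J.e j) ⊗ J.coefficient N M j)))
  F-id : ∀ N M → J.F (λ j → j) (suc N) M ≈ˢ ⊝ (p N ⊗ p M)
  F-id zero M = ≈-trans (J.F-suc-N (λ j → j) 0 M) (≈-trans (λ n → cong (λ z → J.F (λ j → j) 0 M n - z)
      (trans (⊗-identityˡ (J.F (λ j → j + + 1) 0 M) n) (split 0 M n)))
    (≈-trans (𝕊.solve 2 (λ f g → f -: (f +: g) =: -: (1: *: g)) ≈-refl (J.F (λ j → j) 0 M) (J.F (λ _ → + 1) 0 M))
    (λ n → cong -_ (⊗-congˡ {one} (F-1-0 4 0 10 refl M) n))))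
  F-id (suc N) M = ≈-trans (J.F-suc-N (λ j → j) (suc N) M) (≈-trans (λ n → cong (λ z → J.F (λ j → j) (suc N) M n - z)
      (⊗-congˡ {q^ (10 ℕ.* suc N)} (≈-trans (split (suc N) M) (≈-trans (⊕-cong {J.F (λ j → j) (suc N) M} ≈-refl (F1≈0 N M)) (λ n → ℤP.+-identityʳ (J.F (λ j → j) (suc N) M n)))) n))
    (≈-trans (⊖-factor 4 0 10 refl (J.F (λ j → j) (suc N) M) (10 ℕ.* suc N))
    (≈-trans (⊗-cong {J.F (λ j → j) (suc N) M} {⊝ (p N ⊗ p M)} {one ⊖ (+ 1) ⋆ q^ (10 ℕ.* suc N)} {factor (+ 1) 10 10 N} (F-id N M) (λ n → cong (λ z → one n - + 1 * q^ z n) (ℕP.*-suc 10 N)))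
    (𝕊.solve 3 (λ a b f → (-: (a *: b)) *: f =: -: ((a *: f) *: b)) ≈-refl (p N) (p M) (factor (+ 1) 10 10 N)))))

-- Reflections

-- The relation `1 / (1 - x⁻¹) = - x / (1 - x)`. Both sides are the same expansion, because the sign
-- of the exponent and not its position decides how `G` expands.
G-flip : ∀ e ε → G e (- ε) ≈ˢ ⊝ G (e + ε) ε
G-flip e (+ zero) n = refl
G-flip e (+ suc k) n = refl
G-flip e -[1+ k ] n = trans (cong (λ z → (mono z ⊗ geo k) n) (ℤS.solve 2 (λ e k → e := (e :+ (:- k)) :+ k) refl e (+ suc k))) (sym (ℤP.neg-involutive _))

-⋆⊝ : ∀ s f → (- s) ⋆ ⊝ f ≈ˢ s ⋆ f
-⋆⊝ s f n = ℤS.solve 2 (λ s f → (:- s) :* (:- f) := s :* f) refl s (f n)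

⋆⊝ : ∀ s f → s ⋆ ⊝ f ≈ˢ ⊝ (s ⋆ f)
⋆⊝ s f n = sym (ℤP.neg-distribʳ-* s (f n))

Σℤ-⊝ : ∀ F → Σℤ (λ i → ⊝ F i) ≈ˢ ⊝ Σℤ F
Σℤ-⊝ F = ≈-trans (Σℤ-cong (λ i n → sym (ℤP.-1*i≡-i (F i n)))) (≈-trans (Σℤ-⋆ -[1+ 0 ] F) (λ n → ℤP.-1*i≡-i (Σℤ F n)))

quad-neg : ∀ b i → quad b (- i) ≡ quad (- b) i
quad-neg b i = ℤS.solve 2 (λ b i → con (+ 5) :* (:- i) :* (:- i) :+ b :* (:- i) := con (+ 5) :* i :* i :+ (:- b) :* i) refl b i

θ-neg : ∀ b → θ (- b) ≈ˢ θ b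
θ-neg b = ≈-trans (Σℤ-cong (λ i n → cong₂ (λ s z → s * mono z n) (sym (sg-neg i)) (sym (quad-neg b i)))) (Σℤ-reflect (λ i → sg i ⋆ mono (quad b i)))

θ′-neg : ∀ b → θ′ (- b) ≈ˢ ⊝ θ′ b
θ′-neg b = ≈-trans (Σℤ-cong (λ i n → trans (cong₂ (λ s z → (i * s) * mono z n) (sym (sg-neg i)) (sym (quad-neg b i)))
    (ℤS.solve 3 (λ i s m → i :* s :* m := :- ((:- i) :* s :* m)) refl i (sg (- i)) (mono (quad b (- i)) n))))
  (≈-trans (Σℤ-⊝ (λ i → ((- i) * sg (- i)) ⋆ mono (quad b (- i)))) (⊝-cong (Σℤ-reflect (λ i → (i * sg i) ⋆ mono (quad b i)))))

T-term : ℤ → ℤ → ℤ → Series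
T-term c b i = sg i ⋆ G (quad b i) (+ 10 * i + (b - c))

T-Null : ∀ {b} c → Small b → Null (T-term c b)
T-Null {b} c sm = Null-by (quad b) (λ i → Ord-⋆ (sg i) (Ord-≤ (e≤lead (quad b i) (+ 10 * i + (b - c))) (Ord-G (quad b i) (+ 10 * i + (b - c)))))
  (λ i → ℤP.≤-trans (quad-abs sm i) (x≤x+1+9 (quad b i)))

-- The substitution `i ↦ 1 - i` reverses the denominators; the power of `q` is the constant term of
-- the new exponent.
T-reflect : ∀ {b} c → Small b → + 0 ≤ + 5 - c → mono (+ 5 - c) ⊗ T c b ≈ˢ T (+ 10 - c) (- b)
T-reflect {b} c sm 0≤u = begin
  mono u ⊗ T c b
    ≈⟨ ⊗-Σℤ (T-Null c sm) (mono u) ⟩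
  Σℤ (λ i → mono u ⊗ T-term c b i)
    ≈⟨ Σℤ-cong (λ i → ≈-trans (⊗-⋆ (sg i) (mono u) (G (quad b i) (ε i))) (⋆-cong {sg i} refl (≈-sym (G-mono (ε i) 0≤u (ℤP.≤-trans (quad-nn sm i) (e≤lead (quad b i) (ε i))))))) ⟩
  Σℤ U
    ≈⟨ Σℤ-reflect U ⟨
  Σℤ (λ i → U (- i))
    ≈⟨ Σℤ-shift -[1+ 0 ] (λ i → U (- i)) (λ i n h → U-Null (- i) n (≡.subst (n ℕ.+ 10 ℕ.<_) (sym (ℤP.∣-i∣≡∣i∣ i)) h)) shifted-Null ⟨
  Σℤ (λ i → U (- (i + -[1+ 0 ])))
    ≈⟨ Σℤ-cong flipped ⟩
  T (+ 10 - c) (- b) ∎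
  where
  open SetoidReasoning seriesSetoid
  u = + 5 - c
  ε : ℤ → ℤ
  ε i = + 10 * i + (b - c)
  U : ℤ → Series
  U i = sg i ⋆ G (u + quad b i) (ε i)
  U-Ord : ∀ i → Ord (u + quad b i) (U i)
  U-Ord i = Ord-⋆ (sg i) (Ord-≤ (e≤lead (u + quad b i) (ε i)) (Ord-G (u + quad b i) (ε i)))
  bound : ∀ i → + ∣ i ∣ ≤ u + quad b i + + 1
  bound i = ℤP.≤-trans (quad-abs sm i) (≤-by u 0≤u (ℤS.solve 2 (λ u q → u :+ q :+ con (+ 1) := q :+ con (+ 1) :+ u) refl u (quad b i)))
  U-Null : Null U
  U-Null = Null-by (λ i → u + quad b i) U-Ord (λ i → ℤP.≤-trans (bound i) (x≤x+1+9 (u + quad b i)))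
  shifted-Null : Null (λ i → U (- (i + -[1+ 0 ])))
  shifted-Null = Null-by (λ i → u + quad b (- (i + -[1+ 0 ]))) (λ i → U-Ord (- (i + -[1+ 0 ])))
    (λ i → ℤP.≤-trans (abs-shift i -[1+ 0 ]) (ℤP.≤-trans (ℤP.+-monoˡ-≤ (+ 1) (≡.subst (λ z → + z ≤ u + quad b (- (i + -[1+ 0 ])) + + 1) (ℤP.∣-i∣≡∣i∣ (i + -[1+ 0 ])) (bound (- (i + -[1+ 0 ])))))
      (≤-by (+ 8) nn (ℤS.solve 1 (λ e → e :+ con (+ 10) := e :+ con (+ 1) :+ con (+ 1) :+ con (+ 8)) refl (u + quad b (- (i + -[1+ 0 ])))))))
  flipped : ∀ i → U (- (i + -[1+ 0 ])) ≈ˢ T-term (+ 10 - c) (- b) i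
  flipped i = ≈-trans (⋆-cong {f = G (u + quad b (- (i + -[1+ 0 ]))) (ε (- (i + -[1+ 0 ])))}
      (trans (sg-neg (i + -[1+ 0 ])) (trans (sg-+ i -[1+ 0 ]) (ℤS.solve 1 (λ s → s :* con -[1+ 0 ] := :- s) refl (sg i))))
      (≈-trans (G-cong {u + quad b (- (i + -[1+ 0 ]))} refl (ℤS.solve 3 (λ i b c → con (+ 10) :* (:- (i :- con (+ 1))) :+ (b :- c) := :- (con (+ 10) :* i :+ ((:- b) :- (con (+ 10) :- c)))) refl i b c))
        (G-flip (u + quad b (- (i + -[1+ 0 ]))) (+ 10 * i + (- b - (+ 10 - c))))))
    (≈-trans (-⋆⊝ (sg i) _) (⋆-cong {sg i} refl (G-cong {ε = + 10 * i + (- b - (+ 10 - c))}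
      (ℤS.solve 3 (λ i b c → ((con (+ 5) :- c) :+ (con (+ 5) :* (:- (i :- con (+ 1))) :* (:- (i :- con (+ 1))) :+ b :* (:- (i :- con (+ 1))))) :+ (con (+ 10) :* i :+ ((:- b) :- (con (+ 10) :- c)))
         := con (+ 5) :* i :* i :+ (:- b) :* i) refl i b c) refl)))

noPole : ∀ k β → ∣ β ∣ ≡ suc k → suc k ℕ.< 10 → ∀ A → + 10 * A + β ≢ + 0
noPole k β β≡ k<10 A e = small-multiple ∣ A ∣ (trans (sym (ℤP.abs-* (+ 10) A)) (trans (cong ∣_∣ 10A≡) (trans (ℤP.∣-i∣≡∣i∣ β) β≡)))
  where
  10A≡ : + 10 * A ≡ - β
  10A≡ = trans (ℤS.solve 2 (λ A β → con (+ 10) :* A := (con (+ 10) :* A :+ β) :- β) refl A β) (trans (cong (_- β) e) (ℤP.+-identityˡ (- β)))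
  small-multiple : ∀ a → 10 ℕ.* a ≢ suc k
  small-multiple zero ()
  small-multiple (suc a) e = ℕP.<⇒≱ k<10 (≡.subst (10 ℕ.≤_) e (ℕP.≤-trans (ℕP.m≤m*n 10 (suc a)) ℕP.≤-refl))

-- Under `i ↦ - i` the second sum becomes `- q^e x / (1 - x)` next to the `q^e / (1 - x)` of the
-- first, and together these are `q^e`.
T-odd : ∀ {b} c → Small b → (∀ i → + 10 * i + (b - c) ≢ + 0) → T c b ⊕ T (- c) (- b) ≈ˢ θ b
T-odd {b} c sm p = begin
  T c b ⊕ T (- c) (- b)
    ≈⟨ ⊕-cong {T c b} ≈-refl (≈-sym (Σℤ-reflect (T-term (- c) (- b)))) ⟩
  T c b ⊕ Σℤ (λ i → T-term (- c) (- b) (- i))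
    ≈⟨ Σℤ-⊕ (T-term c b) (λ i → T-term (- c) (- b) (- i)) ⟨
  Σℤ (λ i → T-term c b i ⊕ T-term (- c) (- b) (- i))
    ≈⟨ Σℤ-cong (λ i → ≈-trans (⊕-cong {T-term c b i} ≈-refl (reflected i)) (≈-trans (λ n → cong (λ z → sg i * z + sg i * - G (quad b i + ε i) (ε i) n) (G-step (ε i) (p i) (quad-nn sm i) n))
         (λ n → ℤS.solve 3 (λ s m g → s :* (m :+ g) :+ s :* (:- g) := s :* m) refl (sg i) (mono (quad b i) n) (G (quad b i + ε i) (ε i) n)))) ⟩
  θ b ∎
  where
  open SetoidReasoning seriesSetoid
  ε : ℤ → ℤ
  ε i = + 10 * i + (b - c)
  reflected : ∀ i → T-term (- c) (- b) (- i) ≈ˢ sg i ⋆ ⊝ G (quad b i + ε i) (ε i)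
  reflected i = ⋆-cong (sg-neg i) (≈-trans (G-cong (trans (quad-neg (- b) i) (cong (λ z → quad z i) (ℤP.neg-involutive b)))
    (ℤS.solve 3 (λ i b c → con (+ 10) :* (:- i) :+ ((:- b) :- (:- c)) := :- (con (+ 10) :* i :+ (b :- c))) refl i b c)) (G-flip (quad b i) (ε i)))

-- At `i = 0` both polar summands have been set to zero instead of adding up to 1, which accounts
-- for the subtracted `one`.
T-odd-pole : ∀ {c} → Small c → T c c ⊕ T (- c) (- c) ≈ˢ θ c ⊖ one
T-odd-pole {c} sm n = trans (cong (λ z → T c c n + z) (sym (Σℤ-reflect (T-term (- c) (- c)) n)))
  (trans (sym (Σℤ-⊕ (T-term c c) (λ i → T-term (- c) (- c) (- i)) n))
  (ℤAb.∙-cancelʳ (one n) _ _ (trans (cong (λ z → Σℤ f n + z) (sym (trans (Σℤ-δ (+ 0) (λ _ → one) (λ m ()) n) refl)))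
  (trans (sym (Σℤ-⊕ f (λ i → δ (+ 0) i ⋆ one) n)) (trans (Σℤ-cong pointwise n) (ℤS.solve 2 (λ t o → t := t :- o :+ o) refl (θ c n) (one n)))))))
  where
  import Algebra.Properties.AbelianGroup ℤP.+-0-abelianGroup as ℤAb
  ε : ℤ → ℤ
  ε i = + 10 * i + (c - c)
  f : ℤ → Series
  f i = T-term c c i ⊕ T-term (- c) (- c) (- i)
  reflected : ∀ i → T-term (- c) (- c) (- i) ≈ˢ sg i ⋆ ⊝ G (quad c i + ε i) (ε i)
  reflected i = ⋆-cong (sg-neg i) (≈-trans (G-cong (trans (quad-neg (- c) i) (cong (λ z → quad z i) (ℤP.neg-involutive c)))
    (ℤS.solve 2 (λ i c → con (+ 10) :* (:- i) :+ ((:- c) :- (:- c)) := :- (con (+ 10) :* i :+ (c :- c))) refl i c)) (G-flip (quad c i) (ε i)))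
  ε≢0 : ∀ i → + 0 ≢ i → ε i ≢ + 0
  ε≢0 i 0≢i e with ℤP.i*j≡0⇒i≡0∨j≡0 (+ 10) {i} (trans (sym (trans (cong (λ z → + 10 * i + z) (ℤP.+-inverseʳ c)) (ℤP.+-identityʳ (+ 10 * i)))) e)
  ... | inj₂ i≡0 = 0≢i (sym i≡0)
  generic : ∀ i → + 0 ≢ i → f i ⊕ δ (+ 0) i ⋆ one ≈ˢ sg i ⋆ mono (quad c i)
  generic i 0≢i m = trans (cong₂ _+_ (cong₂ _+_ (cong (sg i *_) (G-step (ε i) (ε≢0 i 0≢i) (quad-nn sm i) m)) (reflected i m)) (cong (_* one m) (δ-≢ (+ 0) i 0≢i)))
    (ℤS.solve 3 (λ s m g → s :* (m :+ g) :+ s :* (:- g) :+ con (+ 0) := s :* m) refl (sg i) (mono (quad c i) m) (G (quad c i + ε i) (ε i) m))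
  pointwise : ∀ i → f i ⊕ δ (+ 0) i ⋆ one ≈ˢ sg i ⋆ mono (quad c i)
  pointwise i@(+ suc _) = generic i (λ ())
  pointwise i@(-[1+ _ ]) = generic i (λ ())
  pointwise (+ zero) m = trans (cong₂ (λ x y → + 1 * x + y + + 1 * one m) (G-cong {quad c (+ 0)} {quad c (+ 0)} refl (ε0 c) m)
      (trans (reflected (+ 0) m) (cong (λ z → + 1 * - z) (G-cong {quad c (+ 0) + ε (+ 0)} refl (ε0 c) m))))
    (trans (ℤS.solve 1 (λ x → con (+ 1) :* con (+ 0) :+ con (+ 1) :* (:- con (+ 0)) :+ con (+ 1) :* x := con (+ 1) :* x) refl (one m))
      (cong (λ z → + 1 * mono z m) (sym (ℤS.solve 1 (λ c → con (+ 5) :* con (+ 0) :* con (+ 0) :+ c :* con (+ 0) := con (+ 0)) refl c))))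
    where
    ε0 : ∀ c → + 10 * + 0 + (c - c) ≡ + 0
    ε0 c = trans (ℤP.+-identityˡ (c - c)) (ℤP.+-inverseʳ c)

Λ-term : ℤ → ℤ → ℤ → Series
Λ-term α β i = G (α * i) (+ 10 * i + β)

Λ-Null : ∀ {α β} → + 0 ≤ α - + 1 → + 0 ≤ + 9 - α → + 0 ≤ + 10 - α - β → Null (Λ-term α β)
Λ-Null {α} {β} h₁ h₂ h₃ = Null-by (λ i → lead (α * i) (+ 10 * i + β)) (λ i → Ord-G (α * i) (+ 10 * i + β))
  (λ i → ℤP.≤-trans (lead-Λ {α} {β} h₁ h₂ h₃ i) (x≤x+1+9 (lead (α * i) (+ 10 * i + β))))

Λ-shift : ∀ {α β} → + 0 ≤ α - + 1 → + 0 ≤ + 9 - α → + 0 ≤ - α - β → Λ α β ≈ˢ mono α ⊗ Λ α (β + + 10)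
Λ-shift {α} {β} h₁ h₂ h₃ = begin
  Λ α β
    ≈⟨ Σℤ-shift (+ 1) (Λ-term α β) (Λ-Null {α} {β} h₁ h₂ h₄)
         (Null-by (λ i → lead (α * (i + + 1)) (+ 10 * (i + + 1) + β)) (λ i → Ord-G (α * (i + + 1)) (+ 10 * (i + + 1) + β))
           (λ i → ℤP.≤-trans (abs-shift i (+ 1)) (ℤP.≤-trans (ℤP.+-monoˡ-≤ (+ 1) (lead-Λ {α} {β} h₁ h₂ h₄ (i + + 1)))
              (≤-by (+ 8) nn (ℤS.solve 1 (λ e → e :+ con (+ 10) := e :+ con (+ 1) :+ con (+ 1) :+ con (+ 8)) refl (lead (α * (i + + 1)) (+ 10 * (i + + 1) + β))))))) ⟨
  Σℤ (λ i → Λ-term α β (i + + 1))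
    ≈⟨ Σℤ-cong (λ i → ≈-trans (G-cong (ℤS.solve 2 (λ α i → α :* (i :+ con (+ 1)) := α :+ α :* i) refl α i) (ℤS.solve 2 (λ i β → con (+ 10) :* (i :+ con (+ 1)) :+ β := con (+ 10) :* i :+ (β :+ con (+ 10))) refl i β))
         (G-mono {α} {α * i} (+ 10 * i + (β + + 10)) (≡.subst (+ 0 ≤_) (ℤS.solve 1 (λ α → α :- con (+ 1) :+ con (+ 1) := α) refl α) (nn-+ h₁ (nn {1}))) (lead-Λ-nn {α} {β + + 10} h₁ h₂ h₅ i))) ⟩
  Σℤ (λ i → mono α ⊗ Λ-term α (β + + 10) i)
    ≈⟨ ⊗-Σℤ (Λ-Null {α} {β + + 10} h₁ h₂ h₅) (mono α) ⟨
  mono α ⊗ Λ α (β + + 10) ∎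
  where
  open SetoidReasoning seriesSetoid
  h₄ : + 0 ≤ + 10 - α - β
  h₄ = ≡.subst (+ 0 ≤_) (ℤS.solve 2 (λ α β → con (+ 10) :+ ((:- α) :- β) := con (+ 10) :- α :- β) refl α β) (nn-+ (nn {10}) h₃)
  h₅ : + 0 ≤ + 10 - α - (β + + 10)
  h₅ = ≡.subst (+ 0 ≤_) (ℤS.solve 2 (λ α β → (:- α) :- β := con (+ 10) :- α :- (β :+ con (+ 10))) refl α β) h₃

-- Again `i ↦ - i` with `G-flip`; the numerator `q^(- α i)` combines with the denominator exponent
-- into `(10 - α) i + γ`.
Λ-reflect : ∀ {α} γ → + 0 ≤ α - + 1 → + 0 ≤ + 9 - α → + 0 ≤ γ → + 0 ≤ α - γ → Λ α (- γ) ≈ˢ ⊝ (mono γ ⊗ Λ (+ 10 - α) γ)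
Λ-reflect {α} γ h₁ h₂ 0≤γ h₃ = begin
  Λ α (- γ)
    ≈⟨ Σℤ-reflect (Λ-term α (- γ)) ⟨
  Σℤ (λ i → Λ-term α (- γ) (- i))
    ≈⟨ Σℤ-cong (λ i → ≈-trans (G-cong {α * (- i)} refl (ℤS.solve 2 (λ i γ → con (+ 10) :* (:- i) :+ (:- γ) := :- (con (+ 10) :* i :+ γ)) refl i γ))
         (≈-trans (G-flip (α * (- i)) (+ 10 * i + γ)) (⊝-cong (≈-trans
           (G-cong {ε = + 10 * i + γ} (ℤS.solve 3 (λ α i γ → α :* (:- i) :+ (con (+ 10) :* i :+ γ) := γ :+ (con (+ 10) :- α) :* i) refl α i γ) refl)
           (G-mono {γ} {(+ 10 - α) * i} (+ 10 * i + γ) 0≤γ (lead-Λ-nn {+ 10 - α} {γ} g₁ g₂ g₃ i)))))) ⟩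
  Σℤ (λ i → ⊝ (mono γ ⊗ Λ-term (+ 10 - α) γ i))
    ≈⟨ Σℤ-⊝ (λ i → mono γ ⊗ Λ-term (+ 10 - α) γ i) ⟩
  ⊝ Σℤ (λ i → mono γ ⊗ Λ-term (+ 10 - α) γ i)
    ≈⟨ ⊝-cong (⊗-Σℤ (Λ-Null {+ 10 - α} {γ} g₁ g₂ g₃) (mono γ)) ⟨
  ⊝ (mono γ ⊗ Λ (+ 10 - α) γ) ∎
  where
  open SetoidReasoning seriesSetoid
  g₁ : + 0 ≤ + 10 - α - + 1
  g₁ = ≡.subst (+ 0 ≤_) (ℤS.solve 1 (λ α → con (+ 9) :- α := con (+ 10) :- α :- con (+ 1)) refl α) h₂
  g₂ : + 0 ≤ + 9 - (+ 10 - α)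
  g₂ = ≡.subst (+ 0 ≤_) (ℤS.solve 1 (λ α → α :- con (+ 1) := con (+ 9) :- (con (+ 10) :- α)) refl α) h₁
  g₃ : + 0 ≤ + 10 - (+ 10 - α) - γ
  g₃ = ≡.subst (+ 0 ≤_) (ℤS.solve 2 (λ α γ → α :- γ := con (+ 10) :- (con (+ 10) :- α) :- γ) refl α γ) h₃

-- Monomials in q-products

record Unit (f : Series) : Set where
  constructor is-unit
  field
    at-0 : f 0 ≡ + 1

Unit-⊗ : ∀ {f g} → Unit f → Unit g → Unit (f ⊗ g)
Unit-⊗ (is-unit p) (is-unit q) = is-unit (cong₂ _*_ p q)

Unit-^ : ∀ {f} → Unit f → ∀ n → Unit (f ^ˢ n)
Unit-^ p zero = is-unit refl
Unit-^ p (suc n) = Unit-⊗ p (Unit-^ p n)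

inv-right : ∀ {f} → Unit f → f ⊗ inv f ≈ˢ one
inv-right {f} u = inv-correct f (Unit.at-0 u)

inv-unique : ∀ {f g} → Unit f → f ⊗ g ≈ˢ one → inv f ≈ˢ g
inv-unique {f} {g} u fg≈1 = begin
  inv f              ≈⟨ ⊗-identityʳ (inv f) ⟨
  inv f ⊗ one        ≈⟨ ⊗-congˡ {inv f} fg≈1 ⟨
  inv f ⊗ (f ⊗ g)    ≈⟨ 𝕊.solve 3 (λ i f g → i *: (f *: g) =: (f *: i) *: g) ≈-refl (inv f) f g ⟩
  (f ⊗ inv f) ⊗ g    ≈⟨ ⊗-congʳ {g} (inv-right u) ⟩
  one ⊗ g            ≈⟨ ⊗-identityˡ g ⟩
  g                  ∎
  where open SetoidReasoning seriesSetoid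

⊗-cancelˡ : ∀ {f} → Unit f → ∀ g h → f ⊗ g ≈ˢ f ⊗ h → g ≈ˢ h
⊗-cancelˡ {f} u g h p = ≈-trans (≈-sym (undo g)) (≈-trans (⊗-congˡ {inv f} p) (undo h))
  where
  undo : ∀ g → inv f ⊗ (f ⊗ g) ≈ˢ g
  undo g = ≈-trans (𝕊.solve 3 (λ i f g → i *: (f *: g) =: (f *: i) *: g) ≈-refl (inv f) f g)
    (≈-trans (⊗-congʳ {g} (inv-right u)) (⊗-identityˡ g))

q^-cancelˡ : ∀ k {g h} → q^ k ⊗ g ≈ˢ q^ k ⊗ h → g ≈ˢ h
q^-cancelˡ zero {g} {h} p = ≈-trans (≈-sym (⊗-identityˡ g)) (≈-trans p (⊗-identityˡ h))
q^-cancelˡ (suc k) {g} {h} p = q^-cancelˡ k (λ n → trans (sym (q^-suc-⊗ k g n)) (trans (p (suc n)) (q^-suc-⊗ k h n)))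

pw : Series → ℤ → Series
pw f (+ n) = f ^ˢ n
pw f -[1+ n ] = inv f ^ˢ suc n

module _ {f : Series} (u : Unit f) where

  pw-suc : ∀ e → pw f (e + + 1) ≈ˢ pw f e ⊗ f
  pw-suc (+ n) = ≈-trans (λ m → cong (λ z → (f ^ˢ z) m) (ℕP.+-comm n 1)) (⊗-comm f (f ^ˢ n))
  pw-suc -[1+ zero ] = ≈-sym (≈-trans (⊗-congʳ {f} (⊗-identityʳ (inv f))) (≈-trans (⊗-comm (inv f) f) (inv-right u)))
  pw-suc -[1+ suc n ] = ≈-sym (≈-trans (𝕊.solve 3 (λ i p f → (i *: p) *: f =: (f *: i) *: p) ≈-refl (inv f) (inv f ^ˢ suc n) f)
    (≈-trans (⊗-congʳ {inv f ^ˢ suc n} (inv-right u)) (⊗-identityˡ (inv f ^ˢ suc n))))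

  pw-+₊ : ∀ e k → pw f (e + + k) ≈ˢ pw f e ⊗ f ^ˢ k
  pw-+₊ e zero = ≈-trans (λ n → cong (λ z → pw f z n) (ℤP.+-identityʳ e)) (≈-sym (⊗-identityʳ (pw f e)))
  pw-+₊ e (suc k) = ≈-trans (λ n → cong (λ z → pw f z n) (ℤS.solve 2 (λ e k → e :+ (con (+ 1) :+ k) := (e :+ k) :+ con (+ 1)) refl e (+ k)))
    (≈-trans (pw-suc (e + + k)) (≈-trans (⊗-congʳ {f} (pw-+₊ e k)) (𝕊.solve 3 (λ p g f → (p *: g) *: f =: p *: (f *: g)) ≈-refl (pw f e) (f ^ˢ k) f)))

  ^-inv : ∀ k → f ^ˢ k ⊗ inv f ^ˢ k ≈ˢ one
  ^-inv zero = ⊗-identityˡ one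
  ^-inv (suc k) = ≈-trans (𝕊.solve 4 (λ f g i j → (f *: g) *: (i *: j) =: (f *: i) *: (g *: j)) ≈-refl f (f ^ˢ k) (inv f) (inv f ^ˢ k))
    (≈-trans (⊗-cong (inv-right u) (^-inv k)) (⊗-identityˡ one))

  pw-+ : ∀ e d → pw f (e + d) ≈ˢ pw f e ⊗ pw f d
  pw-+ e (+ k) = pw-+₊ e k
  pw-+ e d@(-[1+ k ]) = begin
    pw f (e + d)                                    ≈⟨ ⊗-identityʳ (pw f (e + d)) ⟨
    pw f (e + d) ⊗ one                              ≈⟨ ⊗-congˡ {pw f (e + d)} (^-inv (suc k)) ⟨
    pw f (e + d) ⊗ (f ^ˢ suc k ⊗ inv f ^ˢ suc k)    ≈⟨ ⊗-assoc (pw f (e + d)) (f ^ˢ suc k) (inv f ^ˢ suc k) ⟨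
    (pw f (e + d) ⊗ f ^ˢ suc k) ⊗ inv f ^ˢ suc k    ≈⟨ ⊗-congʳ {inv f ^ˢ suc k} (pw-+₊ (e + d) (suc k)) ⟨
    pw f (e + d + + suc k) ⊗ inv f ^ˢ suc k       ≈⟨ ⊗-congʳ {inv f ^ˢ suc k} (λ n → cong (λ z → pw f z n) (ℤS.solve 2 (λ e k → e :+ (:- k) :+ k := e) refl e (+ suc k))) ⟩
    pw f e ⊗ pw f d                                   ∎
    where open SetoidReasoning seriesSetoid

evalV : ∀ {n} → (Fin n → Series) → Vec ℤ n → Series
evalV U [] = one
evalV U (e ∷ v) = pw (U zero) e ⊗ evalV (U ∘ suc) v

infixl 6 _+ᵛ_
_+ᵛ_ : ∀ {n} → Vec ℤ n → Vec ℤ n → Vec ℤ n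
_+ᵛ_ = Vec.zipWith _+_

evalV-+ : ∀ {n} {U : Fin n → Series} → (∀ i → Unit (U i)) → ∀ v w → evalV U (v +ᵛ w) ≈ˢ evalV U v ⊗ evalV U w
evalV-+ u [] [] = ≈-sym (⊗-identityˡ one)
evalV-+ {U = U} u (e ∷ v) (d ∷ w) = ≈-trans (⊗-cong (pw-+ (u zero) e d) (evalV-+ (u ∘ suc) v w))
  (𝕊.solve 4 (λ a b c d → (a *: b) *: (c *: d) =: (a *: c) *: (b *: d)) ≈-refl (pw (U zero) e) (pw (U zero) d) (evalV (U ∘ suc) v) (evalV (U ∘ suc) w))

0ᵛ : ∀ {n} → Vec ℤ n
0ᵛ = Vec.replicate _ (+ 0)

evalV-0 : ∀ {n} (U : Fin n → Series) → evalV U 0ᵛ ≈ˢ one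
evalV-0 {zero} U = ≈-refl
evalV-0 {suc n} U = ≈-trans (⊗-identityˡ (evalV (U ∘ suc) 0ᵛ)) (evalV-0 (U ∘ suc))

unitᵛ : ∀ {n} → Fin n → Vec ℤ n
unitᵛ zero = + 1 ∷ 0ᵛ
unitᵛ (suc i) = + 0 ∷ unitᵛ i

evalV-unit : ∀ {n} (U : Fin n → Series) i → evalV U (unitᵛ i) ≈ˢ U i
evalV-unit U zero = ≈-trans (⊗-cong (⊗-identityʳ (U zero)) (evalV-0 (U ∘ suc))) (⊗-identityʳ (U zero))
evalV-unit U (suc i) = ≈-trans (⊗-identityˡ (evalV (U ∘ suc) (unitᵛ i))) (evalV-unit (U ∘ suc) i)

infix 8 -ᵛ_
-ᵛ_ : ∀ {n} → Vec ℤ n → Vec ℤ n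
-ᵛ_ = Vec.map (-_)

+ᵛ-inverse : ∀ {n} (v : Vec ℤ n) → v +ᵛ -ᵛ v ≡ 0ᵛ
+ᵛ-inverse [] = refl
+ᵛ-inverse (e ∷ v) = cong₂ _∷_ (ℤP.+-inverseʳ e) (+ᵛ-inverse v)

Unit-pw : ∀ {f} → Unit f → ∀ e → Unit (pw f e)
Unit-pw u (+ n) = Unit-^ u n
Unit-pw {f} u -[1+ n ] = Unit-^ {inv f} (is-unit refl) (suc n)

Unit-evalV : ∀ {n} {U : Fin n → Series} → (∀ i → Unit (U i)) → ∀ v → Unit (evalV U v)
Unit-evalV u [] = is-unit refl
Unit-evalV {U = U} u (e ∷ v) = Unit-⊗ {pw (U zero) e} (Unit-pw {U zero} (u zero) e) (Unit-evalV (u ∘ suc) v)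

inv-cong : ∀ {f g} → Unit f → f ≈ˢ g → inv f ≈ˢ inv g
inv-cong {f} {g} u p = inv-unique u (≈-trans (⊗-congʳ {inv g} p) (inv-right {g} (is-unit (trans (sym (p 0)) (Unit.at-0 u)))))

-- Every q-product of the theorem is a monomial in the (q^a; q^10)_∞ with 1 ≤ a ≤ 10.
Pᵢ : Fin 10 → Series
Pᵢ i = P (suc (toℕ i)) 10

Exponents : Set
Exponents = Vec ℤ 10

Pᵢ-unit : ∀ i → Unit (Pᵢ i)
Pᵢ-unit i = is-unit refl

opaque
  -- Opaque, so that comparing two products means comparing their exponent vectors and never unfolds
  -- the infinite products.
  monomial : Exponents → Series
  monomial = evalV Pᵢ

  monomial-+ : ∀ v w → monomial (v +ᵛ w) ≈ˢ monomial v ⊗ monomial w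
  monomial-+ = evalV-+ Pᵢ-unit

  monomial-0 : monomial 0ᵛ ≈ˢ one
  monomial-0 = evalV-0 Pᵢ

  monomial-gen : ∀ i → monomial (unitᵛ i) ≈ˢ Pᵢ i
  monomial-gen = evalV-unit Pᵢ

  monomial-unit : ∀ v → Unit (monomial v)
  monomial-unit = Unit-evalV Pᵢ-unit

prod<-* : ∀ n (F G : ℕ → Series) → prod< n (λ k → F k ⊗ G k) ≈ˢ prod< n F ⊗ prod< n G
prod<-* zero F G = ≈-sym (⊗-identityˡ one)
prod<-* (suc n) F G = ≈-trans (⊗-congʳ {F n ⊗ G n} (prod<-* n F G))
  (𝕊.solve 4 (λ a b c d → (a *: b) *: (c *: d) =: (a *: c) *: (b *: d)) ≈-refl (prod< n F) (prod< n G) (F n) (G n))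

prod<-cong : ∀ n {F G : ℕ → Series} → (∀ k → F k ≈ˢ G k) → prod< n F ≈ˢ prod< n G
prod<-cong zero p = ≈-refl
prod<-cong (suc n) p = ⊗-cong (prod<-cong n p) (p n)

prod<-+ : ∀ m n (F : ℕ → Series) → prod< (m ℕ.+ n) F ≈ˢ prod< m F ⊗ prod< n (λ k → F (m ℕ.+ k))
prod<-+ m zero F = ≈-trans (λ n → cong (λ z → prod< z F n) (ℕP.+-identityʳ m)) (≈-sym (⊗-identityʳ (prod< m F)))
prod<-+ m (suc n) F = ≈-trans (λ k → cong (λ z → prod< z F k) (ℕP.+-suc m n))
  (≈-trans (⊗-congʳ {F (m ℕ.+ n)} (prod<-+ m n F)) (⊗-assoc (prod< m F) (prod< n (λ k → F (m ℕ.+ k))) (F (m ℕ.+ n))))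

prod<-1 : ∀ n → prod< n (λ _ → one) ≈ˢ one
prod<-1 zero = ≈-refl
prod<-1 (suc n) = ≈-trans (⊗-identityʳ (prod< n (λ _ → one))) (prod<-1 n)

prod<-blocks : ∀ m N (F : ℕ → Series) → prod< (N ℕ.* m) F ≈ˢ prod< m (λ i → prod< N (λ k → F (k ℕ.* m ℕ.+ i)))
prod<-blocks m zero F = ≈-sym (prod<-1 m)
prod<-blocks m (suc N) F = begin
  prod< (m ℕ.+ N ℕ.* m) F
    ≈⟨ (λ n → cong (λ z → prod< z F n) (ℕP.+-comm m (N ℕ.* m))) ⟩
  prod< (N ℕ.* m ℕ.+ m) F
    ≈⟨ prod<-+ (N ℕ.* m) m F ⟩
  prod< (N ℕ.* m) F ⊗ prod< m (λ i → F (N ℕ.* m ℕ.+ i))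
    ≈⟨ ⊗-congʳ {prod< m (λ i → F (N ℕ.* m ℕ.+ i))} (prod<-blocks m N F) ⟩
  prod< m (λ i → prod< N (λ k → F (k ℕ.* m ℕ.+ i))) ⊗ prod< m (λ i → F (N ℕ.* m ℕ.+ i))
    ≈⟨ prod<-* m _ _ ⟨
  prod< m (λ i → prod< (suc N) (λ k → F (k ℕ.* m ℕ.+ i))) ∎
  where open SetoidReasoning seriesSetoid

agree-prod< : ∀ m {k} {F G : ℕ → Series} → (∀ i → F i ≈[ k ] G i) → prod< m F ≈[ k ] prod< m G
agree-prod< zero p _ _ = refl
agree-prod< (suc m) p = agree-⊗ (agree-prod< m p) (p m)

-- The factors are sorted by the residue of their index modulo `suc m`.
poch-split : ∀ s a c m → poch s (suc a) (suc c) ≈ˢ prod< (suc m) (λ i → poch s (suc a ℕ.+ suc c ℕ.* i) (suc c ℕ.* suc m))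
poch-split s a c m n = trans (agree-≤ (s≤s (ℕP.m≤m*n n (suc m))) (poch-agree s a c (n ℕ.* suc m)) n ℕP.≤-refl)
  (trans (prod<-blocks (suc m) n (factor s (suc a) (suc c)) n)
  (agree-prod< (suc m) (λ i → agree-trans (agree-≈ (prod<-cong n (λ k l → cong (λ z → one l - s * q^ z l) (index i k))))
     (agree-sym (poch-agree s (a ℕ.+ suc c ℕ.* i) (m ℕ.+ c ℕ.* suc m) n))) n ℕP.≤-refl))
  where
  index : ∀ i k → suc a ℕ.+ suc c ℕ.* (k ℕ.* suc m ℕ.+ i) ≡ suc (a ℕ.+ suc c ℕ.* i) ℕ.+ suc (m ℕ.+ c ℕ.* suc m) ℕ.* k
  index i k = N.solve 5 (λ a c k m i → a N.:+ c N.:* (k N.:* m N.:+ i) N.:= (a N.:+ c N.:* i) N.:+ (c N.:* m) N.:* k) refl (suc a) (suc c) k (suc m) i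

-- Factor by factor this is `(1 + x) (1 - x) = 1 - x²`.
poch-± : ∀ a c → poch (- + 1) (suc a) (suc c) ⊗ P (suc a) (suc c) ≈ˢ P (suc a ℕ.+ suc a) (suc c ℕ.+ suc c)
poch-± a c n = trans (agree-⊗ (poch-agree (- + 1) a c n) (poch-agree (+ 1) a c n) n ℕP.≤-refl)
  (trans (sym (prod<-* n (factor (- + 1) (suc a) (suc c)) (factor (+ 1) (suc a) (suc c)) n))
  (trans (prod<-cong n square n) (sym (poch-agree (+ 1) (a ℕ.+ suc a) (c ℕ.+ suc c) n n ℕP.≤-refl))))
  where
  square : ∀ k → factor (- + 1) (suc a) (suc c) k ⊗ factor (+ 1) (suc a) (suc c) k ≈ˢ factor (+ 1) (suc a ℕ.+ suc a) (suc c ℕ.+ suc c) k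
  square k = begin
    (one ⊖ (- + 1) ⋆ x) ⊗ (one ⊖ (+ 1) ⋆ x)
      ≈⟨ ⊗-cong {one ⊖ (- + 1) ⋆ x} {one ⊕ x} {one ⊖ (+ 1) ⋆ x} {one ⊖ x} (λ n → ℤS.solve 2 (λ o x → o :- con -[1+ 0 ] :* x := o :+ x) refl (one n) (x n)) (λ n → cong (λ z → one n - z) (ℤP.*-identityˡ (x n))) ⟩
    (one ⊕ x) ⊗ (one ⊖ x)
      ≈⟨ 𝕊.solve 1 (λ x → (1: +: x) *: (1: -: x) =: 1: -: x *: x) ≈-refl x ⟩
    one ⊖ x ⊗ x
      ≈⟨ (λ n → cong (λ z → one n - z) (trans (q^-+ e e n) (trans (cong (λ z → q^ z n) doubled) (sym (ℤP.*-identityˡ (q^ (suc a ℕ.+ suc a ℕ.+ (suc c ℕ.+ suc c) ℕ.* k) n)))))) ⟩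
    factor (+ 1) (suc a ℕ.+ suc a) (suc c ℕ.+ suc c) k ∎
    where
    open SetoidReasoning seriesSetoid
    e = suc a ℕ.+ suc c ℕ.* k
    x = q^ e
    doubled : e ℕ.+ e ≡ suc a ℕ.+ suc a ℕ.+ (suc c ℕ.+ suc c) ℕ.* k
    doubled = N.solve 3 (λ a c k → (a N.:+ c N.:* k) N.:+ (a N.:+ c N.:* k) N.:= (a N.:+ a) N.:+ (c N.:+ c) N.:* k) refl (suc a) (suc c) k

infixl 7 _⊡_
infixr 9 _⟨^⟩_
-- Syntax for the q-products that occur. Once such a product is read as an exponent vector,
-- identities between products hold by computation.
data UnitExpr : Set where
  ⟨1⟩ : UnitExpr
  gen : Fin 10 → UnitExpr
  p11 p12 p22 p55 n55 n15 n25 n35 n45 : UnitExpr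
  _⊡_ : UnitExpr → UnitExpr → UnitExpr
  _⟨^⟩_ : UnitExpr → ℕ → UnitExpr

⟦_⟧ : UnitExpr → Series
⟦ ⟨1⟩ ⟧ = one
⟦ gen i ⟧ = Pᵢ i
⟦ p11 ⟧ = P 1 1
⟦ p12 ⟧ = P 1 2
⟦ p22 ⟧ = P 2 2
⟦ p55 ⟧ = P 5 5
⟦ n55 ⟧ = Pn 5 5
⟦ n15 ⟧ = Pn 1 5
⟦ n25 ⟧ = Pn 2 5
⟦ n35 ⟧ = Pn 3 5
⟦ n45 ⟧ = Pn 4 5
⟦ e ⊡ f ⟧ = ⟦ e ⟧ ⊗ ⟦ f ⟧
⟦ e ⟨^⟩ n ⟧ = ⟦ e ⟧ ^ˢ n

scaleᵛ : ℕ → Exponents → Exponents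
scaleᵛ zero v = 0ᵛ
scaleᵛ (suc n) v = v +ᵛ scaleᵛ n v

-- The negative entries come from `(-q^a; q^5)_∞ = (q^(2a); q^10)_∞ / (q^a; q^5)_∞`, the denominator
-- being split modulo 10.
exponents : UnitExpr → Exponents
exponents ⟨1⟩ = 0ᵛ
exponents (gen i) = unitᵛ i
exponents p11 = Vec.replicate 10 (+ 1)
exponents p12 = + 1 ∷ + 0 ∷ + 1 ∷ + 0 ∷ + 1 ∷ + 0 ∷ + 1 ∷ + 0 ∷ + 1 ∷ + 0 ∷ []
exponents p22 = + 0 ∷ + 1 ∷ + 0 ∷ + 1 ∷ + 0 ∷ + 1 ∷ + 0 ∷ + 1 ∷ + 0 ∷ + 1 ∷ []
exponents p55 = + 0 ∷ + 0 ∷ + 0 ∷ + 0 ∷ + 1 ∷ + 0 ∷ + 0 ∷ + 0 ∷ + 0 ∷ + 1 ∷ []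
exponents n55 = + 0 ∷ + 0 ∷ + 0 ∷ + 0 ∷ -[1+ 0 ] ∷ + 0 ∷ + 0 ∷ + 0 ∷ + 0 ∷ + 0 ∷ []
exponents n15 = -[1+ 0 ] ∷ + 1 ∷ + 0 ∷ + 0 ∷ + 0 ∷ -[1+ 0 ] ∷ + 0 ∷ + 0 ∷ + 0 ∷ + 0 ∷ []
exponents n25 = + 0 ∷ -[1+ 0 ] ∷ + 0 ∷ + 1 ∷ + 0 ∷ + 0 ∷ -[1+ 0 ] ∷ + 0 ∷ + 0 ∷ + 0 ∷ []
exponents n35 = + 0 ∷ + 0 ∷ -[1+ 0 ] ∷ + 0 ∷ + 0 ∷ + 1 ∷ + 0 ∷ -[1+ 0 ] ∷ + 0 ∷ + 0 ∷ []
exponents n45 = + 0 ∷ + 0 ∷ + 0 ∷ -[1+ 0 ] ∷ + 0 ∷ + 0 ∷ + 0 ∷ + 1 ∷ -[1+ 0 ] ∷ + 0 ∷ []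
exponents (e ⊡ f) = exponents e +ᵛ exponents f
exponents (e ⟨^⟩ n) = scaleᵛ n (exponents e)

unit : ∀ e → Unit ⟦ e ⟧
unit ⟨1⟩ = is-unit refl
unit (gen i) = is-unit refl
unit p11 = is-unit refl
unit p12 = is-unit refl
unit p22 = is-unit refl
unit p55 = is-unit refl
unit n55 = is-unit refl
unit n15 = is-unit refl
unit n25 = is-unit refl
unit n35 = is-unit refl
unit n45 = is-unit refl
unit (e ⊡ f) = Unit-⊗ {⟦ e ⟧} (unit e) (unit f)
unit (e ⟨^⟩ n) = Unit-^ {⟦ e ⟧} (unit e) n

monomial-scale : ∀ n v → monomial (scaleᵛ n v) ≈ˢ monomial v ^ˢ n
monomial-scale zero v = monomial-0
monomial-scale (suc n) v = ≈-trans (monomial-+ v (scaleᵛ n v)) (⊗-congˡ {monomial v} (monomial-scale n v))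

^ˢ-cong : ∀ n {f g} → f ≈ˢ g → f ^ˢ n ≈ˢ g ^ˢ n
^ˢ-cong zero p = ≈-refl
^ˢ-cong (suc n) p = ⊗-cong p (^ˢ-cong n p)

quotient : ∀ {f g h} v w → Unit g → f ⊗ g ≈ˢ h → g ≈ˢ monomial v → h ≈ˢ monomial w → f ≈ˢ monomial (w +ᵛ -ᵛ v)
quotient {f} {g} {h} v w u fg≈h gv hw = ⊗-cancelˡ {g} u f (monomial (w +ᵛ -ᵛ v)) (begin
  g ⊗ f                                     ≈⟨ ⊗-comm g f ⟩
  f ⊗ g                                     ≈⟨ fg≈h ⟩
  h                                         ≈⟨ hw ⟩
  monomial w                                ≈⟨ ⊗-identityˡ (monomial w) ⟨
  one ⊗ monomial w                          ≈⟨ ⊗-congʳ {monomial w} (monomial-0) ⟨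
  monomial 0ᵛ ⊗ monomial w                  ≈⟨ ⊗-congʳ {monomial w} (λ n → cong (λ z → monomial z n) (+ᵛ-inverse v)) ⟨
  monomial (v +ᵛ -ᵛ v) ⊗ monomial w         ≈⟨ ⊗-congʳ {monomial w} (monomial-+ v (-ᵛ v)) ⟩
  (monomial v ⊗ monomial (-ᵛ v)) ⊗ monomial w ≈⟨ 𝕊.solve 3 (λ a b c → (a *: b) *: c =: a *: (c *: b)) ≈-refl (monomial v) (monomial (-ᵛ v)) (monomial w) ⟩
  monomial v ⊗ (monomial w ⊗ monomial (-ᵛ v)) ≈⟨ ⊗-cong (≈-sym gv) (≈-sym (monomial-+ w (-ᵛ v))) ⟩
  g ⊗ monomial (w +ᵛ -ᵛ v)                  ∎)
  where open SetoidReasoning seriesSetoid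

gens : List (Fin 10) → UnitExpr
gens [] = ⟨1⟩
gens (i ∷ is) = gens is ⊡ gen i

sound-gens : ∀ is → ⟦ gens is ⟧ ≈ˢ monomial (exponents (gens is))
sound-gens [] = ≈-sym (monomial-0)
sound-gens (i ∷ is) = ≈-trans (⊗-cong (sound-gens is) (≈-sym (monomial-gen i))) (≈-sym (monomial-+ (exponents (gens is)) (unitᵛ i)))

sound : ∀ e → ⟦ e ⟧ ≈ˢ monomial (exponents e)
sound ⟨1⟩ = ≈-sym (monomial-0)
sound (gen i) = ≈-sym (monomial-gen i)
sound p11 = ≈-trans (poch-split (+ 1) 0 0 9) (sound-gens (# 9 ∷ # 8 ∷ # 7 ∷ # 6 ∷ # 5 ∷ # 4 ∷ # 3 ∷ # 2 ∷ # 1 ∷ # 0 ∷ []))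
sound p12 = ≈-trans (poch-split (+ 1) 0 1 4) (sound-gens (# 8 ∷ # 6 ∷ # 4 ∷ # 2 ∷ # 0 ∷ []))
sound p22 = ≈-trans (poch-split (+ 1) 1 1 4) (sound-gens (# 9 ∷ # 7 ∷ # 5 ∷ # 3 ∷ # 1 ∷ []))
sound p55 = ≈-trans (poch-split (+ 1) 4 4 1) (sound-gens (# 9 ∷ # 4 ∷ []))
sound n55 = quotient {h = P 10 10} (exponents (gens (# 9 ∷ # 4 ∷ []))) (unitᵛ (# 9)) (is-unit refl) (poch-± 4 4) (≈-trans (poch-split (+ 1) 4 4 1) (sound-gens (# 9 ∷ # 4 ∷ []))) (≈-sym (monomial-gen (# 9)))
sound n15 = quotient {h = P 2 10} (exponents (gens (# 5 ∷ # 0 ∷ []))) (unitᵛ (# 1)) (is-unit refl) (poch-± 0 4) (≈-trans (poch-split (+ 1) 0 4 1) (sound-gens (# 5 ∷ # 0 ∷ []))) (≈-sym (monomial-gen (# 1)))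
sound n25 = quotient {h = P 4 10} (exponents (gens (# 6 ∷ # 1 ∷ []))) (unitᵛ (# 3)) (is-unit refl) (poch-± 1 4) (≈-trans (poch-split (+ 1) 1 4 1) (sound-gens (# 6 ∷ # 1 ∷ []))) (≈-sym (monomial-gen (# 3)))
sound n35 = quotient {h = P 6 10} (exponents (gens (# 7 ∷ # 2 ∷ []))) (unitᵛ (# 5)) (is-unit refl) (poch-± 2 4) (≈-trans (poch-split (+ 1) 2 4 1) (sound-gens (# 7 ∷ # 2 ∷ []))) (≈-sym (monomial-gen (# 5)))
sound n45 = quotient {h = P 8 10} (exponents (gens (# 8 ∷ # 3 ∷ []))) (unitᵛ (# 7)) (is-unit refl) (poch-± 3 4) (≈-trans (poch-split (+ 1) 3 4 1) (sound-gens (# 8 ∷ # 3 ∷ []))) (≈-sym (monomial-gen (# 7)))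
sound (e ⊡ f) = ≈-trans (⊗-cong (sound e) (sound f)) (≈-sym (monomial-+ (exponents e) (exponents f)))
sound (e ⟨^⟩ n) = ≈-trans (^ˢ-cong n (sound e)) (≈-sym (monomial-scale n (exponents e)))

-- Theta functions and Lambert series as products

Small-abs : ∀ {b} → ∣ b ∣ ℕ.≤ 5 → Small b
Small-abs {b} h = small
  (≡.subst (+ 0 ≤_) (ℤS.solve 1 (λ b → con (+ 5) :- (:- b) := con (+ 5) :+ b) refl b) (≤⇒nn (ℤP.≤-trans (i≤∣i∣ (- b)) (ℤ.+≤+ (≡.subst (ℕ._≤ 5) (sym (ℤP.∣-i∣≡∣i∣ b)) h)))))
  (≤⇒nn (ℤP.≤-trans (i≤∣i∣ b) (ℤ.+≤+ h)))

not-pole : ∀ β → True (0 ℕ.<? ∣ β ∣) → True (∣ β ∣ ℕ.<? 10) → ∀ A → + 10 * A + β ≢ + 0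
not-pole β 0<β β<10 with ∣ β ∣ in eq
... | suc k = noPole k β eq (toWitness β<10)

-- The conditions of `K-generic` are decided on numerals, so that an instance is given by its three
-- parameters.
K : ∀ b₀ b₁ c → {_ : True (∣ b₀ ∣ ℕ.≤? 5)} {_ : True (∣ b₁ ∣ ℕ.≤? 5)} {_ : True (∣ b₀ + b₁ - c ∣ ℕ.≤? 5)}
    {_ : True (+ 0 ℤ.≤? c - b₀ - + 1)} {_ : True (+ 0 ℤ.≤? + 9 - (c - b₀))}
    {_ : True (0 ℕ.<? ∣ b₁ - c ∣)} {_ : True (∣ b₁ - c ∣ ℕ.<? 10)} →
    θ b₀ ⊗ T c b₁ ⊖ θ b₁ ⊗ T c b₀ ≈ˢ θ (b₀ + b₁ - c) ⊗ Λ (c - b₀) (b₁ - c)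
K b₀ b₁ c {h₁} {h₂} {h₃} {h₄} {h₅} {h₆} {h₇} = K-generic {b₀} {b₁} {c} (Small-abs {b₀} (toWitness h₁)) (Small-abs {b₁} (toWitness h₂)) (Small-abs {b₀ + b₁ - c} (toWitness h₃))
  (toWitness h₄) (toWitness h₅) (not-pole (b₁ - c) h₆ h₇)

K⁰ : ∀ b₀ c → {_ : True (∣ b₀ ∣ ℕ.≤? 5)} {_ : True (∣ c ∣ ℕ.≤? 5)} {_ : True (∣ b₀ + c - c ∣ ℕ.≤? 5)}
     {_ : True (+ 0 ℤ.≤? c - b₀ - + 1)} {_ : True (+ 0 ℤ.≤? + 9 - (c - b₀))} →
     (θ b₀ ⊗ T c c ⊖ θ b₀ ⊗ Λ (c - b₀) (+ 0)) ⊕ θ′ b₀ ≈ˢ θ c ⊗ T c b₀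
K⁰ b₀ c {h₁} {h₂} {h₃} {h₄} {h₅} = K-pole {b₀} {c} (Small-abs {b₀} (toWitness h₁)) (Small-abs {c} (toWitness h₂)) (Small-abs {b₀ + c - c} (toWitness h₃)) (toWitness h₄) (toWitness h₅)

-- Exponent vectors symmetric under a ↔ 10 - a: the arguments are the exponents of
-- (q^10; q^10)_∞, (q^5; q^10)_∞ and (q^a, q^{10-a}; q^10)_∞ for a = 1, 2, 3, 4.
ex : ℤ → ℤ → ℤ → ℤ → ℤ → ℤ → Exponents
ex E p₅ j₁ j₂ j₃ j₄ = j₁ ∷ j₂ ∷ j₃ ∷ j₄ ∷ p₅ ∷ j₄ ∷ j₃ ∷ j₂ ∷ j₁ ∷ E ∷ []

θv : ℕ → Exponents
θv 0 = ex (+ 1) (+ 2) (+ 0) (+ 0) (+ 0) (+ 0)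
θv 1 = ex (+ 1) (+ 0) (+ 0) (+ 0) (+ 0) (+ 1)
θv 2 = ex (+ 1) (+ 0) (+ 0) (+ 0) (+ 1) (+ 0)
θv 3 = ex (+ 1) (+ 0) (+ 0) (+ 1) (+ 0) (+ 0)
θv _ = ex (+ 1) (+ 0) (+ 1) (+ 0) (+ 0) (+ 0)

θ-product : ∀ x y (x+y : suc x ℕ.+ suc y ≡ 10) → θ (+ suc x - + 5) ≈ˢ P 10 10 ⊗ (P (suc x) 10 ⊗ P (suc y) 10)
θ-product x y x+y = ≈-trans (Σℤ-cong (λ i n → cong (λ z → z * mono (quad (+ suc x - + 5) i) n) (sym (ℤP.*-identityʳ (sg i)))))
  (tripleProduct 4 x y x+y)

θ₀ : θ (+ 0) ≈ˢ monomial (θv 0)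
θ₀ = ≈-trans (θ-product 4 4 refl) (sound (gen (# 9) ⊡ (gen (# 4) ⊡ gen (# 4))))

θ₁ : θ (+ 1) ≈ˢ monomial (θv 1)
θ₁ = ≈-trans (θ-product 5 3 refl) (sound (gen (# 9) ⊡ (gen (# 5) ⊡ gen (# 3))))

θ₂ : θ (+ 2) ≈ˢ monomial (θv 2)
θ₂ = ≈-trans (θ-product 6 2 refl) (sound (gen (# 9) ⊡ (gen (# 6) ⊡ gen (# 2))))

θ₃ : θ (+ 3) ≈ˢ monomial (θv 3)
θ₃ = ≈-trans (θ-product 7 1 refl) (sound (gen (# 9) ⊡ (gen (# 7) ⊡ gen (# 1))))

θ₄ : θ (+ 4) ≈ˢ monomial (θv 4)
θ₄ = ≈-trans (θ-product 8 0 refl) (sound (gen (# 9) ⊡ (gen (# 8) ⊡ gen (# 0))))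

θ-monomial : ∀ b → {_ : True (∣ b ∣ ℕ.≤? 4)} → θ b ≈ˢ monomial (θv ∣ b ∣)
θ-monomial (+ 0) = θ₀
θ-monomial (+ 1) = θ₁
θ-monomial (+ 2) = θ₂
θ-monomial (+ 3) = θ₃
θ-monomial (+ 4) = θ₄
θ-monomial -[1+ 0 ] = ≈-trans (θ-neg (+ 1)) θ₁
θ-monomial -[1+ 1 ] = ≈-trans (θ-neg (+ 2)) θ₂
θ-monomial -[1+ 2 ] = ≈-trans (θ-neg (+ 3)) θ₃
θ-monomial -[1+ 3 ] = ≈-trans (θ-neg (+ 4)) θ₄
θ-monomial (+ suc (suc (suc (suc (suc _))))) {()}
θ-monomial -[1+ suc (suc (suc (suc _))) ] {()}

-- At this zero of `θ` both forms of the partial fraction identity lose their terms with `θ b₀`.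
-- What remains of the polar form is `θ′₋₅`, known from `jacobi`, and eliminating `T c b₀` leaves a
-- Lambert series as a product.
θ₋₅ : θ -[1+ 4 ] ≈ˢ λ _ → + 0
θ₋₅ n = trans (Σℤ-cong (λ i n → cong (λ z → z * mono (quad -[1+ 4 ] i) n) (sym (ℤP.*-identityʳ (sg i)))) n)
  (trans (sym (Jacobi.limit (λ _ → + 1) n)) (trans (⊗-congˡ {P 10 10} (F1≈0 (n ℕ.+ (n ℕ.+ 10)) (suc n ℕ.+ (n ℕ.+ 10))) n) (⊗-zeroʳ (P 10 10) n)))

θ₅ : θ (+ 5) ≈ˢ λ _ → + 0
θ₅ = ≈-trans (≈-sym (θ-neg (+ 5))) θ₋₅

θ′₋₅ : θ′ -[1+ 4 ] ≈ˢ ⊝ (P 10 10 ⊗ (P 10 10 ⊗ P 10 10))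
θ′₋₅ = ≈-trans (Σℤ-cong (λ i n → cong (λ z → z * mono (quad -[1+ 4 ] i) n) (ℤP.*-comm i (sg i)))) jacobi

E³ : Exponents
E³ = ex (+ 3) (+ 0) (+ 0) (+ 0) (+ 0) (+ 0)

zero-⊗ : ∀ {f} g → f ≈ˢ (λ _ → + 0) → f ⊗ g ≈ˢ λ _ → + 0
zero-⊗ g p = ≈-trans (⊗-congʳ {g} p) (⊗-zeroˡ g)

cancel-monomial : ∀ v {f} w → monomial v ⊗ f ≈ˢ monomial w → f ≈ˢ monomial (w +ᵛ -ᵛ v)
cancel-monomial v {f} w p = ≈-sym (quotient-lemma)
  where
  quotient-lemma : monomial (w +ᵛ -ᵛ v) ≈ˢ f
  quotient-lemma = ⊗-cancelˡ (monomial-unit v) (monomial (w +ᵛ -ᵛ v)) f (≈-sym (≈-trans p (≈-sym (≈-trans (⊗-comm (monomial v) (monomial (w +ᵛ -ᵛ v)))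
    (≈-trans (⊗-congʳ {monomial v} (monomial-+ w (-ᵛ v))) (≈-trans (⊗-assoc (monomial w) (monomial (-ᵛ v)) (monomial v))
    (≈-trans (⊗-congˡ {monomial w} (≈-trans (⊗-comm (monomial (-ᵛ v)) (monomial v)) (≈-trans (≈-sym (monomial-+ v (-ᵛ v))) (≈-trans (λ n → cong (λ z → monomial z n) (+ᵛ-inverse v)) (monomial-0)))))
      (⊗-identityʳ (monomial w)))))))))

-- Lambert series as products; here α = c + 5 and β = b₁ - c.
Λ-monomial : ∀ c b₁ → {_ : True (∣ c ∣ ℕ.≤? 4)} {_ : True (∣ b₁ ∣ ℕ.≤? 4)} {_ : True (∣ -[1+ 4 ] + b₁ - c ∣ ℕ.≤? 4)}
             {_ : True (∣ c ∣ ℕ.≤? 5)} {_ : True (∣ b₁ ∣ ℕ.≤? 5)} {_ : True (∣ -[1+ 4 ] + b₁ - c ∣ ℕ.≤? 5)} {_ : True (∣ -[1+ 4 ] + c - c ∣ ℕ.≤? 5)}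
             {_ : True (+ 0 ℤ.≤? c - -[1+ 4 ] - + 1)} {_ : True (+ 0 ℤ.≤? + 9 - (c - -[1+ 4 ]))}
             {_ : True (0 ℕ.<? ∣ b₁ - c ∣)} {_ : True (∣ b₁ - c ∣ ℕ.<? 10)} →
             Λ (c - -[1+ 4 ]) (b₁ - c) ≈ˢ monomial ((θv ∣ b₁ ∣ +ᵛ E³) +ᵛ -ᵛ (θv ∣ c ∣ +ᵛ θv ∣ -[1+ 4 ] + b₁ - c ∣))
Λ-monomial c b₁ {hc} {hb} {hd} {hc5} {hb5} {hd5} {h5} {h₁} {h₂} {h₃} {h₄} =
  cancel-monomial (θv ∣ c ∣ +ᵛ θv ∣ d ∣) (θv ∣ b₁ ∣ +ᵛ E³) (begin
    monomial (θv ∣ c ∣ +ᵛ θv ∣ d ∣) ⊗ Λ α β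
      ≈⟨ ⊗-congʳ {Λ α β} (≈-trans (monomial-+ (θv ∣ c ∣) (θv ∣ d ∣)) (⊗-cong (≈-sym (θ-monomial c {hc})) (≈-sym (θ-monomial d {hd})))) ⟩
    (θ c ⊗ θ d) ⊗ Λ α β
      ≈⟨ ⊗-assoc (θ c) (θ d) (Λ α β) ⟩
    θ c ⊗ (θ d ⊗ Λ α β)
      ≈⟨ ⊗-congˡ {θ c} (≈-sym (K -[1+ 4 ] b₁ c {_} {hb5} {hd5} {h₁} {h₂} {h₃} {h₄})) ⟩
    θ c ⊗ (θ -[1+ 4 ] ⊗ T c b₁ ⊖ θ b₁ ⊗ T c -[1+ 4 ])
      ≈⟨ ⊗-congˡ {θ c} (λ n → trans (cong (λ z → z - (θ b₁ ⊗ T c -[1+ 4 ]) n) (zero-⊗ (T c b₁) θ₋₅ n)) (ℤP.+-identityˡ (- (θ b₁ ⊗ T c -[1+ 4 ]) n))) ⟩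
    θ c ⊗ (⊝ (θ b₁ ⊗ T c -[1+ 4 ]))
      ≈⟨ 𝕊.solve 3 (λ x y z → x *: (-: (y *: z)) =: -: (y *: (x *: z))) ≈-refl (θ c) (θ b₁) (T c -[1+ 4 ]) ⟩
    ⊝ (θ b₁ ⊗ (θ c ⊗ T c -[1+ 4 ]))
      ≈⟨ ⊝-cong (⊗-congˡ {θ b₁} (≈-trans (≈-sym (K⁰ -[1+ 4 ] c {_} {hc5} {h5} {h₁} {h₂})) (λ n → trans (cong₂ (λ x y → x - y + θ′ -[1+ 4 ] n) (zero-⊗ (T c c) θ₋₅ n) (zero-⊗ (Λ α (+ 0)) θ₋₅ n)) (trans (ℤP.+-identityˡ (θ′ -[1+ 4 ] n)) (θ′₋₅ n))))) ⟩
    ⊝ (θ b₁ ⊗ (⊝ (P 10 10 ⊗ (P 10 10 ⊗ P 10 10))))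
      ≈⟨ 𝕊.solve 2 (λ x y → -: (x *: (-: y)) =: x *: y) ≈-refl (θ b₁) (P 10 10 ⊗ (P 10 10 ⊗ P 10 10)) ⟩
    θ b₁ ⊗ (P 10 10 ⊗ (P 10 10 ⊗ P 10 10))
      ≈⟨ ⊗-cong (θ-monomial b₁ {hb}) (sound (gen (# 9) ⊡ (gen (# 9) ⊡ gen (# 9)))) ⟩
    monomial (θv ∣ b₁ ∣) ⊗ monomial E³
      ≈⟨ monomial-+ (θv ∣ b₁ ∣) E³ ⟨
    monomial (θv ∣ b₁ ∣ +ᵛ E³) ∎)
  where
  open SetoidReasoning seriesSetoid
  α = c - -[1+ 4 ]
  β = b₁ - c
  d = -[1+ 4 ] + b₁ - c

-- Terms with a coefficient and a power of q; instances of the partial fraction identity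

record Term : Set where
  constructor term
  field
    coefficientₜ : ℤ
    degree : ℕ
    exps : Exponents

⟦_⟧ₜ : Term → Series
⟦ term c k v ⟧ₜ = c ⋆ (q^ k ⊗ monomial v)

infixl 7 _·ₜ_
_·ₜ_ : Term → Term → Term
term c k v ·ₜ term d l w = term (c * d) (k ℕ.+ l) (v +ᵛ w)

·ₜ-sound : ∀ t s → ⟦ t ·ₜ s ⟧ₜ ≈ˢ ⟦ t ⟧ₜ ⊗ ⟦ s ⟧ₜ
·ₜ-sound (term c k v) (term d l w) = ≈-sym (≈-trans (⋆-⊗-⋆ c d (q^ k ⊗ monomial v) (q^ l ⊗ monomial w)) (⋆-cong {c * d} refl
  (≈-trans (𝕊.solve 4 (λ a b c d → (a *: b) *: (c *: d) =: (a *: c) *: (b *: d)) ≈-refl (q^ k) (monomial v) (q^ l) (monomial w))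
    (⊗-cong (q^-+ k l) (≈-sym (monomial-+ v w))))))

monomialₜ : ∀ v → monomial v ≈ˢ ⟦ term (+ 1) 0 v ⟧ₜ
monomialₜ v = ≈-sym (≈-trans (1⋆ (one ⊗ monomial v)) (⊗-identityˡ (monomial v)))

θₜ : ℕ → Term
θₜ b = term (+ 1) 0 (θv b)

θ-term : ∀ b → {_ : True (∣ b ∣ ℕ.≤? 4)} → θ b ≈ˢ ⟦ θₜ ∣ b ∣ ⟧ₜ
θ-term b {h} = ≈-trans (θ-monomial b {h}) (monomialₜ (θv ∣ b ∣))

-- The indices are `α` and `β`. The vector for `Λ α β` comes from `Λ-monomial` at `c = α - 5` and
-- `b₁ = c + β`.
v₂₂ : Exponents
v₂₂ = ex (+ 2) (+ 0) (+ 0) -[1+ 1 ] (+ 0) (+ 1)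

Λ₂₂ : Λ (+ 2) (+ 2) ≈ˢ ⟦ term (+ 1) 0 v₂₂ ⟧ₜ
Λ₂₂ = ≈-trans (Λ-monomial -[1+ 2 ] -[1+ 0 ]) (monomialₜ v₂₂)

v₂₄ : Exponents
v₂₄ = ex (+ 2) (+ 0) (+ 0) -[1+ 0 ] (+ 0) (+ 0)

Λ₂₄ : Λ (+ 2) (+ 4) ≈ˢ ⟦ term (+ 1) 0 v₂₄ ⟧ₜ
Λ₂₄ = ≈-trans (Λ-monomial -[1+ 2 ] (+ 1)) (monomialₜ v₂₄)

v₂₆ : Exponents
v₂₆ = ex (+ 2) (+ 0) (+ 0) (+ 0) (+ 0) -[1+ 0 ]

Λ₂₆ : Λ (+ 2) (+ 6) ≈ˢ ⟦ term (+ 1) 0 v₂₆ ⟧ₜ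
Λ₂₆ = ≈-trans (Λ-monomial -[1+ 2 ] (+ 3)) (monomialₜ v₂₆)

v₆₂ : Exponents
v₆₂ = ex (+ 2) (+ 0) (+ 0) (+ 0) (+ 0) -[1+ 0 ]

Λ₆₂ : Λ (+ 6) (+ 2) ≈ˢ ⟦ term (+ 1) 0 v₆₂ ⟧ₜ
Λ₆₂ = ≈-trans (Λ-monomial (+ 1) (+ 3)) (monomialₜ v₆₂)

v₄₄ : Exponents
v₄₄ = ex (+ 2) (+ 0) (+ 0) (+ 1) (+ 0) -[1+ 1 ]

Λ₄₄ : Λ (+ 4) (+ 4) ≈ˢ ⟦ term (+ 1) 0 v₄₄ ⟧ₜ
Λ₄₄ = ≈-trans (Λ-monomial -[1+ 0 ] (+ 3)) (monomialₜ v₄₄)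

v₄₂ : Exponents
v₄₂ = ex (+ 2) (+ 0) (+ 0) -[1+ 0 ] (+ 0) (+ 0)

Λ₄₂ : Λ (+ 4) (+ 2) ≈ˢ ⟦ term (+ 1) 0 v₄₂ ⟧ₜ
Λ₄₂ = ≈-trans (Λ-monomial -[1+ 0 ] (+ 1)) (monomialₜ v₄₂)

v₂₁ : Exponents
v₂₁ = ex (+ 2) (+ 0) -[1+ 0 ] -[1+ 0 ] (+ 1) (+ 0)

Λ₂₁ : Λ (+ 2) (+ 1) ≈ˢ ⟦ term (+ 1) 0 v₂₁ ⟧ₜ
Λ₂₁ = ≈-trans (Λ-monomial -[1+ 2 ] -[1+ 1 ]) (monomialₜ v₂₁)

v₁₁ : Exponents
v₁₁ = ex (+ 2) (+ 0) -[1+ 1 ] (+ 1) (+ 0) (+ 0)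

Λ₁₁ : Λ (+ 1) (+ 1) ≈ˢ ⟦ term (+ 1) 0 v₁₁ ⟧ₜ
Λ₁₁ = ≈-trans (Λ-monomial -[1+ 3 ] -[1+ 2 ]) (monomialₜ v₁₁)

v₁₂ : Exponents
v₁₂ = ex (+ 2) (+ 0) -[1+ 0 ] -[1+ 0 ] (+ 1) (+ 0)

Λ₁₂ : Λ (+ 1) (+ 2) ≈ˢ ⟦ term (+ 1) 0 v₁₂ ⟧ₜ
Λ₁₂ = ≈-trans (Λ-monomial -[1+ 3 ] -[1+ 1 ]) (monomialₜ v₁₂)

v₁₈ : Exponents
v₁₈ = ex (+ 2) (+ 0) (+ 0) -[1+ 0 ] (+ 0) (+ 0)

Λ₁₈ : Λ (+ 1) (+ 8) ≈ˢ ⟦ term (+ 1) 0 v₁₈ ⟧ₜ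
Λ₁₈ = ≈-trans (Λ-monomial -[1+ 3 ] (+ 4)) (monomialₜ v₁₈)

v₃₁ : Exponents
v₃₁ = ex (+ 2) (+ 0) -[1+ 0 ] (+ 0) -[1+ 0 ] (+ 1)

Λ₃₁ : Λ (+ 3) (+ 1) ≈ˢ ⟦ term (+ 1) 0 v₃₁ ⟧ₜ
Λ₃₁ = ≈-trans (Λ-monomial -[1+ 1 ] -[1+ 0 ]) (monomialₜ v₃₁)

v₂₇ : Exponents
v₂₇ = ex (+ 2) (+ 0) (+ 1) -[1+ 0 ] -[1+ 0 ] (+ 0)

Λ₂₇ : Λ (+ 2) (+ 7) ≈ˢ ⟦ term (+ 1) 0 v₂₇ ⟧ₜ
Λ₂₇ = ≈-trans (Λ-monomial -[1+ 2 ] (+ 4)) (monomialₜ v₂₇)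

⊗ₜ : ∀ {f g} t s → f ≈ˢ ⟦ t ⟧ₜ → g ≈ˢ ⟦ s ⟧ₜ → f ⊗ g ≈ˢ ⟦ t ·ₜ s ⟧ₜ
⊗ₜ t s p q = ≈-trans (⊗-cong p q) (≈-sym (·ₜ-sound t s))

q^ₜ : ∀ k → q^ k ≈ˢ ⟦ term (+ 1) k 0ᵛ ⟧ₜ
q^ₜ k = ≈-sym (≈-trans (1⋆ (q^ k ⊗ monomial 0ᵛ)) (≈-trans (⊗-congˡ {q^ k} monomial-0) (⊗-identityʳ (q^ k))))

⊝ₜ : ∀ c k v → ⊝ ⟦ term c k v ⟧ₜ ≈ˢ ⟦ term (- c) k v ⟧ₜ
⊝ₜ c k v n = ℤP.neg-distribˡ-* c ((q^ k ⊗ monomial v) n)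

⊖-cong : ∀ {f f′ g g′} → f ≈ˢ f′ → g ≈ˢ g′ → f ⊖ g ≈ˢ f′ ⊖ g′
⊖-cong p q n = cong₂ _-_ (p n) (q n)

-- The direct instances for `K₂₋₄`, `K₄₋₂` and `K₄₋₄` would involve `θ b` with `b` equal to `- 6` or
-- `- 8`, where the exponents become negative. Reflecting `c` to `10 - c` brings `b` back into range
-- at the price of a power of `q`, which is cancelled afterwards.
K-reflected : ∀ k {θ₀ θ₁ T₀ T₁ T₀′ T₁′ X Y} → q^ k ⊗ T₀ ≈ˢ T₀′ → q^ k ⊗ T₁ ≈ˢ T₁′ → θ₀ ⊗ T₁′ ⊖ θ₁ ⊗ T₀′ ≈ˢ X → X ≈ˢ q^ k ⊗ Y → θ₀ ⊗ T₁ ⊖ θ₁ ⊗ T₀ ≈ˢ Y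
K-reflected k {θ₀} {θ₁} {T₀} {T₁} p₀ p₁ pX pY = q^-cancelˡ k (≈-trans
  (𝕊.solve 5 (λ q a b c d → q *: (a *: c -: b *: d) =: a *: (q *: c) -: b *: (q *: d)) ≈-refl (q^ k) θ₀ θ₁ T₁ T₀)
  (≈-trans (⊖-cong (⊗-congˡ {θ₀} p₁) (⊗-congˡ {θ₁} p₀)) (≈-trans pX pY)))

K₂₄ : θ (+ 0) ⊗ T (+ 2) (+ 4) ⊖ θ (+ 4) ⊗ T (+ 2) (+ 0) ≈ˢ ⟦ term (+ 1) 0 (ex (+ 3) (+ 0) (+ 0) -[1+ 1 ] (+ 1) (+ 1)) ⟧ₜ
K₂₄ = ≈-trans (K (+ 0) (+ 4) (+ 2)) (⊗ₜ (θₜ 2) (term (+ 1) 0 v₂₂) (θ-term (+ 2)) Λ₂₂)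

Λ-reflected : ∀ g k v → g ≈ˢ ⟦ term (+ 1) 0 v ⟧ₜ → ⊝ (q^ k ⊗ g) ≈ˢ ⟦ term -[1+ 0 ] k (0ᵛ +ᵛ v) ⟧ₜ
Λ-reflected g k v p = ≈-trans (⊝-cong (⊗ₜ (term (+ 1) k 0ᵛ) (term (+ 1) 0 v) (q^ₜ k) p)) (≈-trans (⊝ₜ (+ 1) (k ℕ.+ 0) (0ᵛ +ᵛ v)) (λ n → cong (λ z → ⟦ term -[1+ 0 ] z (0ᵛ +ᵛ v) ⟧ₜ n) (ℕP.+-identityʳ k)))

q^-term : ∀ k c l v → ⟦ term c (k ℕ.+ l) v ⟧ₜ ≈ˢ q^ k ⊗ ⟦ term c l v ⟧ₜ
q^-term k c l v = ≈-sym (≈-trans (⊗-⋆ c (q^ k) (q^ l ⊗ monomial v)) (⋆-cong {c} refl (≈-trans (≈-sym (⊗-assoc (q^ k) (q^ l) (monomial v))) (⊗-congʳ {monomial v} (q^-+ k l)))))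

K₂₋₄ : θ (+ 0) ⊗ T (+ 2) -[1+ 3 ] ⊖ θ (+ 4) ⊗ T (+ 2) (+ 0) ≈ˢ ⟦ term -[1+ 0 ] 1 (ex (+ 3) (+ 0) (+ 1) -[1+ 0 ] (+ 0) (+ 0)) ⟧ₜ
K₂₋₄ = K-reflected 3 {θ (+ 0)} {θ (+ 4)} {T (+ 2) (+ 0)} {T (+ 2) -[1+ 3 ]} (T-reflect {+ 0} (+ 2) (small nn nn) nn) (T-reflect { -[1+ 3 ]} (+ 2) (small nn nn) nn) (K (+ 0) (+ 4) (+ 8))
  (≈-trans (⊗ₜ (θₜ 4) (term -[1+ 0 ] 4 (0ᵛ +ᵛ v₂₄)) (θ-term -[1+ 3 ]) (≈-trans (Λ-reflect {+ 8} (+ 4) nn nn nn nn) (Λ-reflected (Λ (+ 2) (+ 4)) 4 v₂₄ Λ₂₄)))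
    (q^-term 3 -[1+ 0 ] 1 (θv 4 +ᵛ (0ᵛ +ᵛ v₂₄))))

K₂₋₂ : θ (+ 0) ⊗ T (+ 2) -[1+ 1 ] ⊖ θ (+ 2) ⊗ T (+ 2) (+ 0) ≈ˢ ⟦ term (+ 1) 2 (ex (+ 3) (+ 0) (+ 1) (+ 0) (+ 0) -[1+ 0 ]) ⟧ₜ
K₂₋₂ = ≈-trans (⊖-cong {θ (+ 0) ⊗ T (+ 2) -[1+ 1 ]} ≈-refl (⊗-congʳ {T (+ 2) (+ 0)} (≈-sym (θ-neg (+ 2))))) (≈-trans (K (+ 0) -[1+ 1 ] (+ 2))
  (⊗ₜ (θₜ 4) (term (+ 1) 2 (0ᵛ +ᵛ v₂₆)) (θ-term -[1+ 3 ]) (≈-trans (Λ-shift {+ 2} { -[1+ 3 ]} nn nn nn) (⊗ₜ (term (+ 1) 2 0ᵛ) (term (+ 1) 0 v₂₆) (q^ₜ 2) Λ₂₆))))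

K₄₂ : θ (+ 0) ⊗ T (+ 4) (+ 2) ⊖ θ (+ 2) ⊗ T (+ 4) (+ 0) ≈ˢ ⟦ term -[1+ 0 ] 2 (ex (+ 3) (+ 0) (+ 0) (+ 0) (+ 1) -[1+ 0 ]) ⟧ₜ
K₄₂ = ≈-trans (K (+ 0) (+ 2) (+ 4))
  (⊗ₜ (θₜ 2) (term -[1+ 0 ] 2 (0ᵛ +ᵛ v₆₂)) (θ-term -[1+ 1 ]) (≈-trans (Λ-reflect {+ 4} (+ 2) nn nn nn nn) (Λ-reflected (Λ (+ 6) (+ 2)) 2 v₆₂ Λ₆₂)))

K₄₋₂ : θ (+ 0) ⊗ T (+ 4) -[1+ 1 ] ⊖ θ (+ 2) ⊗ T (+ 4) (+ 0) ≈ˢ ⟦ term -[1+ 0 ] 3 (ex (+ 3) (+ 0) (+ 1) (+ 1) (+ 0) -[1+ 1 ]) ⟧ₜ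
K₄₋₂ = K-reflected 1 {θ (+ 0)} {θ (+ 2)} {T (+ 4) (+ 0)} {T (+ 4) -[1+ 1 ]} (T-reflect {+ 0} (+ 4) (small nn nn) nn) (T-reflect { -[1+ 1 ]} (+ 4) (small nn nn) nn) (K (+ 0) (+ 2) (+ 6))
  (≈-trans (⊗ₜ (θₜ 4) (term -[1+ 0 ] 4 (0ᵛ +ᵛ v₄₄)) (θ-term -[1+ 3 ]) (≈-trans (Λ-reflect {+ 6} (+ 4) nn nn nn nn) (Λ-reflected (Λ (+ 4) (+ 4)) 4 v₄₄ Λ₄₄)))
    (q^-term 1 -[1+ 0 ] 3 (θv 4 +ᵛ (0ᵛ +ᵛ v₄₄))))

K₄₋₄ : θ (+ 0) ⊗ T (+ 4) -[1+ 3 ] ⊖ θ (+ 4) ⊗ T (+ 4) (+ 0) ≈ˢ ⟦ term -[1+ 0 ] 1 (ex (+ 3) (+ 0) (+ 0) -[1+ 0 ] (+ 1) (+ 0)) ⟧ₜ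
K₄₋₄ = K-reflected 1 {θ (+ 0)} {θ (+ 4)} {T (+ 4) (+ 0)} {T (+ 4) -[1+ 3 ]} (T-reflect {+ 0} (+ 4) (small nn nn) nn) (T-reflect { -[1+ 3 ]} (+ 4) (small nn nn) nn) (K (+ 0) (+ 4) (+ 6))
  (≈-trans (⊗ₜ (θₜ 2) (term -[1+ 0 ] 2 (0ᵛ +ᵛ v₄₂)) (θ-term -[1+ 1 ]) (≈-trans (Λ-reflect {+ 6} (+ 2) nn nn nn nn) (Λ-reflected (Λ (+ 4) (+ 2)) 2 v₄₂ Λ₄₂)))
    (q^-term 1 -[1+ 0 ] 1 (θv 2 +ᵛ (0ᵛ +ᵛ v₄₂))))

double-cancel : ∀ x → x + x ≡ + 0 → x ≡ + 0
double-cancel (+ zero) e = refl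

self-neg : ∀ {f} → f ≈ˢ ⊝ f → f ≈ˢ λ _ → + 0
self-neg {f} p n = double-cancel (f n) (trans (cong (λ z → f n + z) (p n)) (ℤP.+-inverseʳ (f n)))

θ′₀ : θ′ (+ 0) ≈ˢ λ _ → + 0
θ′₀ = self-neg (θ′-neg (+ 0))

K⁰₂ : θ (+ 0) ⊗ T (+ 2) (+ 2) ⊖ θ (+ 2) ⊗ T (+ 2) (+ 0) ≈ˢ θ (+ 0) ⊗ Λ (+ 2) (+ 0)
K⁰₂ n = trans (cong (λ z → (θ (+ 0) ⊗ T (+ 2) (+ 2)) n - z) (trans (sym (K⁰ (+ 0) (+ 2) n)) (cong (λ z → (θ (+ 0) ⊗ T (+ 2) (+ 2)) n - (θ (+ 0) ⊗ Λ (+ 2) (+ 0)) n + z) (θ′₀ n))))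
  (ℤS.solve 2 (λ x y → x :- (x :- y :+ con (+ 0)) := y) refl ((θ (+ 0) ⊗ T (+ 2) (+ 2)) n) ((θ (+ 0) ⊗ Λ (+ 2) (+ 0)) n))

K⁰₄ : θ (+ 0) ⊗ T (+ 4) (+ 4) ⊖ θ (+ 4) ⊗ T (+ 4) (+ 0) ≈ˢ θ (+ 0) ⊗ Λ (+ 4) (+ 0)
K⁰₄ n = trans (cong (λ z → (θ (+ 0) ⊗ T (+ 4) (+ 4)) n - z) (trans (sym (K⁰ (+ 0) (+ 4) n)) (cong (λ z → (θ (+ 0) ⊗ T (+ 4) (+ 4)) n - (θ (+ 0) ⊗ Λ (+ 4) (+ 0)) n + z) (θ′₀ n))))
  (ℤS.solve 2 (λ x y → x :- (x :- y :+ con (+ 0)) := y) refl ((θ (+ 0) ⊗ T (+ 4) (+ 4)) n) ((θ (+ 0) ⊗ Λ (+ 4) (+ 0)) n))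

module LogDerivative (b : ℤ) (α : ℤ) (h₊ : (θ b ⊗ T (+ 5) (+ 5) ⊖ θ b ⊗ Λ α (+ 0)) ⊕ θ′ b ≈ˢ θ (+ 5) ⊗ T (+ 5) b)
                     (h₋ : (θ (- b) ⊗ T (+ 5) (+ 5) ⊖ θ (- b) ⊗ Λ (+ 10 - α) (+ 0)) ⊕ θ′ (- b) ≈ˢ θ (+ 5) ⊗ T (+ 5) (- b))
                     (refl-Λ : Λ α (+ 0) ≈ˢ ⊝ (one ⊗ Λ (+ 10 - α) (+ 0))) where

  -- Since `θ (+ 5)` is zero, both polar identities have right side zero. Their difference loses
  -- `T (+ 5) (+ 5)` and is twice the claim, the Lambert series being odd under `α ↦ 10 - α`.
  result : θ′ b ≈ˢ θ b ⊗ Λ α (+ 0)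
  result n = ℤP.i-j≡0⇒i≡j (θ′ b n) (l n) (double-cancel (θ′ b n - l n) (trans
    (ℤS.solve 3 (λ t l d → (d :- l) :+ (d :- l) := (t :- l :+ d) :- (t :+ l :- d)) refl (t n) (l n) (θ′ b n))
    (cong₂ _-_ (trans (h₊ n) (zero-⊗ (T (+ 5) b) θ₅ n)) (trans (sym eq₋) (trans (h₋ n) (zero-⊗ (T (+ 5) (- b)) θ₅ n))))))
    where
    t l : Series
    t = θ b ⊗ T (+ 5) (+ 5)
    l = θ b ⊗ Λ α (+ 0)
    eq₋ : ((θ (- b) ⊗ T (+ 5) (+ 5) ⊖ θ (- b) ⊗ Λ (+ 10 - α) (+ 0)) ⊕ θ′ (- b)) n ≡ t n + l n - θ′ b n
    eq₋ = cong₂ _+_ (cong₂ _+_ (⊗-congʳ {T (+ 5) (+ 5)} (θ-neg b) n) (trans (cong -_ (⊗-congʳ {Λ (+ 10 - α) (+ 0)} (θ-neg b) n))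
        (sym (trans (⊗-congˡ {θ b} refl-Λ n) (𝕊.solve 2 (λ x y → x *: (-: (1: *: y)) =: -: (x *: y)) ≈-refl (θ b) (Λ (+ 10 - α) (+ 0)) n)))))
      (θ′-neg b n)

θ′₁ : θ′ (+ 1) ≈ˢ θ (+ 1) ⊗ Λ (+ 4) (+ 0)
θ′₁ = LogDerivative.result (+ 1) (+ 4) (K⁰ (+ 1) (+ 5)) (K⁰ -[1+ 0 ] (+ 5)) (Λ-reflect {+ 4} (+ 0) nn nn nn nn)

θ′₃ : θ′ (+ 3) ≈ˢ θ (+ 3) ⊗ Λ (+ 2) (+ 0)
θ′₃ = LogDerivative.result (+ 3) (+ 2) (K⁰ (+ 3) (+ 5)) (K⁰ -[1+ 2 ] (+ 5)) (Λ-reflect {+ 2} (+ 0) nn nn nn nn)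

-- Relations satisfied by κ

drop : ∀ {x y} → x ≈ˢ y → ∀ a c → a ⊕ c ⊗ (x ⊖ y) ≈ˢ a
drop {x} {y} p a c = ≈-trans (⊕-cong {a} ≈-refl (≈-trans (⊗-congˡ {c} (λ n → ℤP.i≡j⇒i-j≡0 (p n))) (⊗-zeroʳ c))) (λ n → ℤP.+-identityʳ (a n))

L₂ L₄ : Series
L₂ = Λ (+ 2) (+ 0)
L₄ = Λ (+ 4) (+ 0)


-- At `c = 3`, the polar identities with bases 1 and - 1 and the generic one between these bases are
-- three equations in three Appell sums; eliminating the sums leaves `θ′₁`, which is a Lambert
-- series too.
lambert-B′ : θ (+ 1) ⊗ (θ (+ 1) ⊗ (L₄ ⊕ L₄ ⊕ L₄ ⊖ L₂)) ≈ˢ ⊝ (θ (+ 3) ⊗ (θ (+ 3) ⊗ Λ (+ 2) -[1+ 3 ]))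
lambert-B′ = ≈-trans
  (𝕊.solve 9 (λ t₁ t₃ T₃₃ T₃₁ T₃₋ L₂ L₄ D X →
     t₁ *: (t₁ *: (L₄ +: L₄ +: L₄ -: L₂))
     =: (((-: (t₃ *: (t₃ *: X))
        +: t₁ *: ((t₁ *: T₃₃ -: t₁ *: L₂ +: D) -: t₃ *: T₃₁))
        +: (-: t₁) *: ((t₁ *: T₃₃ -: t₁ *: L₄ +: -: D) -: t₃ *: T₃₋))
        +: (-: t₃) *: ((t₁ *: T₃₋ -: t₁ *: T₃₁) -: t₃ *: X))
        +: (-: (t₁ +: t₁)) *: (D -: t₁ *: L₄)) ≈-refl
     t₁ t₃ (T (+ 3) (+ 3)) (T (+ 3) (+ 1)) (T (+ 3) -[1+ 0 ]) L₂ L₄ (θ′ (+ 1)) X)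
  (≈-trans (drop θ′₁ _ (⊝ (t₁ ⊕ t₁)))
  (≈-trans (drop h₃ _ (⊝ t₃))
  (≈-trans (drop h₂ _ (⊝ t₁))
           (drop (K⁰ (+ 1) (+ 3)) _ t₁))))
  where
  t₁ t₃ X : Series
  t₁ = θ (+ 1)
  t₃ = θ (+ 3)
  X = Λ (+ 2) -[1+ 3 ]
  h₂ : (t₁ ⊗ T (+ 3) (+ 3) ⊖ t₁ ⊗ L₄) ⊕ ⊝ θ′ (+ 1) ≈ˢ t₃ ⊗ T (+ 3) -[1+ 0 ]
  h₂ = ≈-trans (≈-sym (⊕-cong {u = θ′ -[1+ 0 ]} (⊖-cong (⊗-congʳ {T (+ 3) (+ 3)} (θ-neg (+ 1))) (⊗-congʳ {L₄} (θ-neg (+ 1)))) (θ′-neg (+ 1)))) (K⁰ -[1+ 0 ] (+ 3))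
  h₃ : t₁ ⊗ T (+ 3) -[1+ 0 ] ⊖ t₁ ⊗ T (+ 3) (+ 1) ≈ˢ t₃ ⊗ X
  h₃ = ≈-trans (⊖-cong {t₁ ⊗ T (+ 3) -[1+ 0 ]} ≈-refl (⊗-congʳ {T (+ 3) (+ 1)} (≈-sym (θ-neg (+ 1))))) (≈-trans (K (+ 1) -[1+ 0 ] (+ 3)) (⊗-congʳ {X} (θ-neg (+ 3))))

-- Here sums with `c = 1` and `c = - 1` are linked by `T-odd` and `T-odd-pole`; the `one` on the
-- left is the missing polar term of the latter.
lambert-A′ : (θ (+ 1) ⊗ θ (+ 3)) ⊗ (L₂ ⊕ L₂ ⊕ L₂ ⊕ L₄ ⊕ one) ≈ˢ θ (+ 1) ⊗ (θ (+ 1) ⊗ Λ (+ 2) (+ 2))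
lambert-A′ = ≈-trans
  (𝕊.solve 12 (λ t₁ t₃ T₁₁ T₋ T₁₋ T₁₃ T₋₃ L₂ L₄ D₁ D₃ V →
     (t₁ *: t₃) *: (L₂ +: L₂ +: L₂ +: L₄ +: 1:)
     =: ((((((t₁ *: (t₁ *: V)
        +: (-: t₃) *: ((t₁ *: T₁₁ -: t₁ *: L₂ +: -: D₁) -: t₁ *: T₁₋))
        +: (-: t₁) *: ((t₃ *: T₋ -: t₃ *: L₂ +: -: D₃) -: t₁ *: T₋₃))
        +: (t₁ *: t₃) *: ((T₁₁ +: T₋) -: (t₁ -: 1:)))
        +: (-: (t₁ *: t₁)) *: ((T₁₃ +: T₋₃) -: t₃))
        +: t₁ *: ((t₁ *: T₁₃ -: t₃ *: T₁₋) -: t₁ *: V))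
        +: (-: t₃) *: (D₁ -: t₁ *: L₄))
        +: (-: t₁) *: (D₃ -: t₃ *: L₂)) ≈-refl
     t₁ t₃ (T (+ 1) (+ 1)) (T -[1+ 0 ] -[1+ 0 ]) (T (+ 1) -[1+ 0 ]) (T (+ 1) (+ 3)) (T -[1+ 0 ] -[1+ 2 ]) L₂ L₄ (θ′ (+ 1)) (θ′ (+ 3)) (Λ (+ 2) (+ 2)))
  (≈-trans (drop θ′₃ _ (⊝ t₁))
  (≈-trans (drop θ′₁ _ (⊝ t₃))
  (≈-trans (drop g₅ _ t₁)
  (≈-trans (drop g₄ _ (⊝ (t₁ ⊗ t₁)))
  (≈-trans (drop (T-odd-pole {+ 1} (small nn nn)) _ (t₁ ⊗ t₃))
  (≈-trans (drop g₂ _ (⊝ t₁))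
           (drop g₁ _ (⊝ t₃))))))))
  where
  t₁ t₃ : Series
  t₁ = θ (+ 1)
  t₃ = θ (+ 3)
  g₁ : (t₁ ⊗ T (+ 1) (+ 1) ⊖ t₁ ⊗ L₂) ⊕ ⊝ θ′ (+ 1) ≈ˢ t₁ ⊗ T (+ 1) -[1+ 0 ]
  g₁ = ≈-trans (≈-sym (⊕-cong {u = θ′ -[1+ 0 ]} (⊖-cong (⊗-congʳ {T (+ 1) (+ 1)} (θ-neg (+ 1))) (⊗-congʳ {L₂} (θ-neg (+ 1)))) (θ′-neg (+ 1)))) (K⁰ -[1+ 0 ] (+ 1))
  g₂ : (t₃ ⊗ T -[1+ 0 ] -[1+ 0 ] ⊖ t₃ ⊗ L₂) ⊕ ⊝ θ′ (+ 3) ≈ˢ t₁ ⊗ T -[1+ 0 ] -[1+ 2 ]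
  g₂ = ≈-trans (≈-sym (⊕-cong {u = θ′ -[1+ 2 ]} (⊖-cong (⊗-congʳ {T -[1+ 0 ] -[1+ 0 ]} (θ-neg (+ 3))) (⊗-congʳ {L₂} (θ-neg (+ 3)))) (θ′-neg (+ 3))))
    (≈-trans (K⁰ -[1+ 2 ] -[1+ 0 ]) (⊗-congʳ {T -[1+ 0 ] -[1+ 2 ]} (θ-neg (+ 1))))
  g₄ : T (+ 1) (+ 3) ⊕ T -[1+ 0 ] -[1+ 2 ] ≈ˢ t₃
  g₄ = T-odd {+ 3} (+ 1) (small nn nn) (not-pole (+ 2) _ _)
  g₅ : t₁ ⊗ T (+ 1) (+ 3) ⊖ t₃ ⊗ T (+ 1) -[1+ 0 ] ≈ˢ t₁ ⊗ Λ (+ 2) (+ 2)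
  g₅ = ≈-trans (⊖-cong (⊗-congʳ {T (+ 1) (+ 3)} (≈-sym (θ-neg (+ 1)))) ≈-refl) (K -[1+ 0 ] (+ 3) (+ 1))

cancelₜ : ∀ v {f} c k w → monomial v ⊗ f ≈ˢ ⟦ term c k w ⟧ₜ → f ≈ˢ ⟦ term c k (w +ᵛ -ᵛ v) ⟧ₜ
cancelₜ v {f} c k w p = ⊗-cancelˡ (monomial-unit v) f ⟦ term c k (w +ᵛ -ᵛ v) ⟧ₜ (≈-trans p (≈-sym (begin
  monomial v ⊗ ⟦ term c k (w +ᵛ -ᵛ v) ⟧ₜ
    ≈⟨ ⊗-⋆ c (monomial v) (q^ k ⊗ monomial (w +ᵛ -ᵛ v)) ⟩
  c ⋆ (monomial v ⊗ (q^ k ⊗ monomial (w +ᵛ -ᵛ v)))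
    ≈⟨ ⋆-cong {c} refl (≈-trans (⊗-congˡ {monomial v} (⊗-congˡ {q^ k} (monomial-+ w (-ᵛ v))))
         (𝕊.solve 4 (λ v q w i → v *: (q *: (w *: i)) =: (q *: w) *: (v *: i)) ≈-refl (monomial v) (q^ k) (monomial w) (monomial (-ᵛ v)))) ⟩
  c ⋆ ((q^ k ⊗ monomial w) ⊗ (monomial v ⊗ monomial (-ᵛ v)))
    ≈⟨ ⋆-cong {c} refl (≈-trans (⊗-congˡ {q^ k ⊗ monomial w} (≈-trans (≈-sym (monomial-+ v (-ᵛ v))) (≈-trans (λ n → cong (λ z → monomial z n) (+ᵛ-inverse v)) monomial-0))) (⊗-identityʳ (q^ k ⊗ monomial w))) ⟩
  ⟦ term c k w ⟧ₜ ∎)))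
  where open SetoidReasoning seriesSetoid

-- Neither `L₂` nor `L₄` is used as a product by itself. This combination and the one in `lambert-A`
-- span those that the zeroth sections of the two rank equations require, see `ℓ₁₂` and `ℓ₀₂`.
lambert-B : L₄ ⊕ L₄ ⊕ L₄ ⊖ L₂ ≈ˢ ⟦ term -[1+ 0 ] 2 (ex (+ 2) (+ 0) (+ 0) (+ 2) (+ 0) -[1+ 2 ]) ⟧ₜ
lambert-B = cancelₜ (θv 1 +ᵛ θv 1) -[1+ 0 ] 2 (θv 3 +ᵛ (θv 3 +ᵛ (0ᵛ +ᵛ v₂₆)))
  (≈-trans (⊗-congʳ {L₄ ⊕ L₄ ⊕ L₄ ⊖ L₂} (≈-trans (monomial-+ (θv 1) (θv 1)) (⊗-cong (≈-sym θ₁) (≈-sym θ₁))))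
  (≈-trans (⊗-assoc (θ (+ 1)) (θ (+ 1)) (L₄ ⊕ L₄ ⊕ L₄ ⊖ L₂))
  (≈-trans lambert-B′
  (≈-trans (⊝-cong (⊗ₜ (θₜ 3) (term (+ 1) 2 (θv 3 +ᵛ (0ᵛ +ᵛ v₂₆))) (θ-term (+ 3)) (⊗ₜ (θₜ 3) (term (+ 1) 2 (0ᵛ +ᵛ v₂₆)) (θ-term (+ 3))
      (≈-trans (Λ-shift {+ 2} { -[1+ 3 ]} nn nn nn) (⊗ₜ (term (+ 1) 2 0ᵛ) (term (+ 1) 0 v₂₆) (q^ₜ 2) Λ₂₆)))))
    (⊝ₜ (+ 1) 2 (θv 3 +ᵛ (θv 3 +ᵛ (0ᵛ +ᵛ v₂₆))))))))

lambert-A : L₂ ⊕ L₂ ⊕ L₂ ⊕ L₄ ⊕ one ≈ˢ ⟦ term (+ 1) 0 (ex (+ 2) (+ 0) (+ 0) -[1+ 2 ] (+ 0) (+ 2)) ⟧ₜ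
lambert-A = cancelₜ (θv 1 +ᵛ θv 3) (+ 1) 0 (θv 1 +ᵛ (θv 1 +ᵛ v₂₂))
  (≈-trans (⊗-congʳ {L₂ ⊕ L₂ ⊕ L₂ ⊕ L₄ ⊕ one} (≈-trans (monomial-+ (θv 1) (θv 3)) (⊗-cong (≈-sym θ₁) (≈-sym θ₃))))
  (≈-trans lambert-A′ (⊗ₜ (θₜ 1) (term (+ 1) 0 (θv 1 +ᵛ v₂₂)) (θ-term (+ 1)) (⊗ₜ (θₜ 1) (term (+ 1) 0 v₂₂) (θ-term (+ 1)) Λ₂₂))))

-- Eliminating the three T c bᵢ from three instances of K leaves a three-term theta relation.
weierstrass : ∀ {t₀ t₁ t₂ T₀ T₁ T₂} m₁₂ m₀₂ m₀₁ → t₁ ⊗ T₂ ⊖ t₂ ⊗ T₁ ≈ˢ ⟦ m₁₂ ⟧ₜ → t₀ ⊗ T₂ ⊖ t₂ ⊗ T₀ ≈ˢ ⟦ m₀₂ ⟧ₜ → t₀ ⊗ T₁ ⊖ t₁ ⊗ T₀ ≈ˢ ⟦ m₀₁ ⟧ₜ →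
  ∀ s₀ s₁ s₂ → t₀ ≈ˢ ⟦ s₀ ⟧ₜ → t₁ ≈ˢ ⟦ s₁ ⟧ₜ → t₂ ≈ˢ ⟦ s₂ ⟧ₜ → ⟦ s₀ ·ₜ m₁₂ ⟧ₜ ⊕ ⟦ s₂ ·ₜ m₀₁ ⟧ₜ ≈ˢ ⟦ s₁ ·ₜ m₀₂ ⟧ₜ
weierstrass {t₀} {t₁} {t₂} {T₀} {T₁} {T₂} m₁₂ m₀₂ m₀₁ p₁₂ p₀₂ p₀₁ s₀ s₁ s₂ e₀ e₁ e₂ =
  ≈-trans (⊕-cong (≈-sym (⊗ₜ s₀ m₁₂ e₀ p₁₂)) (≈-sym (⊗ₜ s₂ m₀₁ e₂ p₀₁)))
  (≈-trans (𝕊.solve 6 (λ t₀ t₁ t₂ T₀ T₁ T₂ → t₀ *: (t₁ *: T₂ -: t₂ *: T₁) +: t₂ *: (t₀ *: T₁ -: t₁ *: T₀) =: t₁ *: (t₀ *: T₂ -: t₂ *: T₀)) ≈-refl t₀ t₁ t₂ T₀ T₁ T₂)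
  (⊗ₜ s₁ m₀₂ e₁ p₀₂))

shiftₜ : Exponents → Term → Term
shiftₜ v (term c k w) = term c k (w +ᵛ v)

shiftₜ-sound : ∀ v t → ⟦ shiftₜ v t ⟧ₜ ≈ˢ monomial v ⊗ ⟦ t ⟧ₜ
shiftₜ-sound v (term c k w) = ≈-sym (≈-trans (⊗-⋆ c (monomial v) (q^ k ⊗ monomial w)) (⋆-cong {c} refl
  (≈-trans (𝕊.solve 3 (λ v q w → v *: (q *: w) =: q *: (w *: v)) ≈-refl (monomial v) (q^ k) (monomial w)) (⊗-congˡ {q^ k} (≈-sym (monomial-+ w v))))))

divide : ∀ v t₁ t₂ t₃ → ⟦ t₁ ⟧ₜ ⊕ ⟦ t₂ ⟧ₜ ≈ˢ ⟦ t₃ ⟧ₜ → ⟦ shiftₜ v t₁ ⟧ₜ ⊕ ⟦ shiftₜ v t₂ ⟧ₜ ≈ˢ ⟦ shiftₜ v t₃ ⟧ₜ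
divide v t₁ t₂ t₃ p = ≈-trans (⊕-cong (shiftₜ-sound v t₁) (shiftₜ-sound v t₂)) (≈-trans (≈-sym (⊗-distribˡ-⊕ (monomial v) ⟦ t₁ ⟧ₜ ⟦ t₂ ⟧ₜ))
  (≈-trans (⊗-congˡ {monomial v} p) (≈-sym (shiftₜ-sound v t₃))))

-- k = q (q, q^2, q^8, q^9; q^10)_∞ / (q^3, q^4, q^6, q^7; q^10)_∞, and products equal to polynomials in it.
vk va vb vc vd : Exponents
vk = ex (+ 0) (+ 0) (+ 1) (+ 1) -[1+ 0 ] -[1+ 0 ]
va = ex (+ 0) (+ 2) -[1+ 0 ] (+ 2) (+ 0) -[1+ 1 ]
vb = ex (+ 0) (+ 2) (+ 1) -[1+ 0 ] -[1+ 1 ] (+ 1)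
vc = ex (+ 0) (+ 0) -[1+ 0 ] (+ 3) -[1+ 2 ] (+ 1)
vd = ex (+ 0) (+ 4) (+ 4) (+ 3) (+ 2) (+ 1)

κ : Series
κ = ⟦ term (+ 1) 1 vk ⟧ₜ

oneₜ : ⟦ term (+ 1) 0 0ᵛ ⟧ₜ ≈ˢ one
oneₜ = ≈-trans (1⋆ (one ⊗ monomial 0ᵛ)) (≈-trans (⊗-identityˡ (monomial 0ᵛ)) monomial-0)

Λ₁₋₂ : Λ (+ 1) -[1+ 1 ] ≈ˢ ⟦ term (+ 1) 1 v₁₈ ⟧ₜ
Λ₁₋₂ = ≈-trans (Λ-shift {+ 1} { -[1+ 1 ]} nn nn nn) (⊗ₜ (term (+ 1) 1 0ᵛ) (term (+ 1) 0 v₁₈) (q^ₜ 1) Λ₁₈)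

Λ₂₋₃ : Λ (+ 2) -[1+ 2 ] ≈ˢ ⟦ term (+ 1) 2 v₂₇ ⟧ₜ
Λ₂₋₃ = ≈-trans (Λ-shift {+ 2} { -[1+ 2 ]} nn nn nn) (⊗ₜ (term (+ 1) 2 0ᵛ) (term (+ 1) 0 v₂₇) (q^ₜ 2) Λ₂₇)

-- The three-term relation with bases - 1, - 2, 1 at `c = 0`, divided by its first term.
relation-a : monomial va ≈ˢ one ⊕ κ
relation-a = ≈-trans (monomialₜ va) (≈-trans (≈-sym (divide (-ᵛ (θv 1 +ᵛ (θv 1 +ᵛ v₂₁)))
    (θₜ 1 ·ₜ (θₜ 1 ·ₜ term (+ 1) 0 v₂₁)) (θₜ 1 ·ₜ (θₜ 3 ·ₜ term (+ 1) 1 v₁₈)) (θₜ 2 ·ₜ (θₜ 0 ·ₜ term (+ 1) 0 v₁₁))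
    (weierstrass {θ -[1+ 0 ]} {θ -[1+ 1 ]} {θ (+ 1)} {T (+ 0) -[1+ 0 ]} {T (+ 0) -[1+ 1 ]} {T (+ 0) (+ 1)}
      (θₜ 1 ·ₜ (term (+ 1) 0 v₂₁)) (θₜ 0 ·ₜ (term (+ 1) 0 v₁₁)) (θₜ 3 ·ₜ (term (+ 1) 1 v₁₈))
      (≈-trans (K -[1+ 1 ] (+ 1) (+ 0)) (⊗ₜ (θₜ 1) (term (+ 1) 0 v₂₁) (θ-term -[1+ 0 ]) Λ₂₁))
      (≈-trans (K -[1+ 0 ] (+ 1) (+ 0)) (⊗ₜ (θₜ 0) (term (+ 1) 0 v₁₁) (θ-term (+ 0)) Λ₁₁))
      (≈-trans (K -[1+ 0 ] -[1+ 1 ] (+ 0)) (⊗ₜ (θₜ 3) (term (+ 1) 1 v₁₈) (θ-term -[1+ 2 ]) Λ₁₋₂))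
      (θₜ 1) (θₜ 2) (θₜ 1) (θ-term -[1+ 0 ]) (θ-term -[1+ 1 ]) (θ-term (+ 1)))))
  (⊕-cong oneₜ ≈-refl))

-- Bases - 1, - 2, 2 at `c = 0`, now divided by the right side, since there the term in `κ` is one
-- of the two summands on the left.
relation-b : monomial vb ⊕ κ ≈ˢ one
relation-b = ≈-trans (⊕-cong (monomialₜ vb) ≈-refl) (≈-trans (divide (-ᵛ (θv 2 +ᵛ (θv 1 +ᵛ v₁₂)))
    (θₜ 1 ·ₜ (θₜ 0 ·ₜ term (+ 1) 0 v₂₂)) (θₜ 2 ·ₜ (θₜ 3 ·ₜ term (+ 1) 1 v₁₈)) (θₜ 2 ·ₜ (θₜ 1 ·ₜ term (+ 1) 0 v₁₂))
    (weierstrass {θ -[1+ 0 ]} {θ -[1+ 1 ]} {θ (+ 2)} {T (+ 0) -[1+ 0 ]} {T (+ 0) -[1+ 1 ]} {T (+ 0) (+ 2)}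
      (θₜ 0 ·ₜ (term (+ 1) 0 v₂₂)) (θₜ 1 ·ₜ (term (+ 1) 0 v₁₂)) (θₜ 3 ·ₜ (term (+ 1) 1 v₁₈))
      (≈-trans (K -[1+ 1 ] (+ 2) (+ 0)) (⊗ₜ (θₜ 0) (term (+ 1) 0 v₂₂) (θ-term (+ 0)) Λ₂₂))
      (≈-trans (K -[1+ 0 ] (+ 2) (+ 0)) (⊗ₜ (θₜ 1) (term (+ 1) 0 v₁₂) (θ-term (+ 1)) Λ₁₂))
      (≈-trans (K -[1+ 0 ] -[1+ 1 ] (+ 0)) (⊗ₜ (θₜ 3) (term (+ 1) 1 v₁₈) (θ-term -[1+ 2 ]) Λ₁₋₂))
      (θₜ 1) (θₜ 2) (θₜ 2) (θ-term -[1+ 0 ]) (θ-term -[1+ 1 ]) (θ-term (+ 2))))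
  oneₜ)

-- Bases - 1, - 2, 2 at `c = 1`, scaled so that the right side becomes `va`; together with
-- `relation-a` this expresses `vc` as `1 + κ - κ²`.
relation-c : monomial vc ⊕ ⟦ term (+ 1) 2 (vk +ᵛ vk) ⟧ₜ ≈ˢ monomial va
relation-c = ≈-trans (⊕-cong (monomialₜ vc) ≈-refl) (≈-trans (divide (va +ᵛ -ᵛ (θv 2 +ᵛ (θv 0 +ᵛ v₂₁)))
    (θₜ 1 ·ₜ (θₜ 1 ·ₜ term (+ 1) 0 v₃₁)) (θₜ 2 ·ₜ (θₜ 4 ·ₜ term (+ 1) 2 v₂₇)) (θₜ 2 ·ₜ (θₜ 0 ·ₜ term (+ 1) 0 v₂₁))
    (weierstrass {θ -[1+ 0 ]} {θ -[1+ 1 ]} {θ (+ 2)} {T (+ 1) -[1+ 0 ]} {T (+ 1) -[1+ 1 ]} {T (+ 1) (+ 2)}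
      (θₜ 1 ·ₜ (term (+ 1) 0 v₃₁)) (θₜ 0 ·ₜ (term (+ 1) 0 v₂₁)) (θₜ 4 ·ₜ (term (+ 1) 2 v₂₇))
      (≈-trans (K -[1+ 1 ] (+ 2) (+ 1)) (⊗ₜ (θₜ 1) (term (+ 1) 0 v₃₁) (θ-term -[1+ 0 ]) Λ₃₁))
      (≈-trans (K -[1+ 0 ] (+ 2) (+ 1)) (⊗ₜ (θₜ 0) (term (+ 1) 0 v₂₁) (θ-term (+ 0)) Λ₂₁))
      (≈-trans (K -[1+ 0 ] -[1+ 1 ] (+ 1)) (⊗ₜ (θₜ 4) (term (+ 1) 2 v₂₇) (θ-term -[1+ 3 ]) Λ₂₋₃))
      (θₜ 1) (θₜ 2) (θₜ 2) (θ-term -[1+ 0 ]) (θ-term -[1+ 1 ]) (θ-term (+ 2))))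
  (≈-sym (monomialₜ va)))

-- Dissection of sums modulo 5 and the square of φ(-q)

fifth : (ℤ → ℤ) → ℤ → ℤ
fifth f m = f (+ 5 * m + -[1+ 1 ]) + f (+ 5 * m + -[1+ 0 ]) + f (+ 5 * m + + 0) + f (+ 5 * m + + 1) + f (+ 5 * m + + 2)

-- With the symmetric residues from - 2 to 2, the indices `5 m + r` with `∣ m ∣ ≤ B` fill the window
-- `5 B + 2` exactly.
sumZ-fifth : ∀ B f → sumZ (2 ℕ.+ B ℕ.* 5) f ≡ sumZ B (fifth f)
sumZ-fifth zero f = ℤS.solve 5 (λ a b c d e → a :+ (b :+ c) :+ (d :+ e) := e :+ c :+ a :+ b :+ d) refl (f (+ 0)) (f (+ 1)) (f -[1+ 0 ]) (f (+ 2)) (f -[1+ 1 ])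
sumZ-fifth (suc B) f = begin
  s + (f (at 3) + f (neg 3)) + (f (at 4) + f (neg 4)) + (f (at 5) + f (neg 5)) + (f (at 6) + f (neg 6)) + (f (at 7) + f (neg 7))
    ≡⟨ ℤS.solve 11 (λ s a b c d e a′ b′ c′ d′ e′ → s :+ (a :+ a′) :+ (b :+ b′) :+ (c :+ c′) :+ (d :+ d′) :+ (e :+ e′)
         := s :+ ((a :+ b :+ c :+ d :+ e) :+ (e′ :+ d′ :+ c′ :+ b′ :+ a′))) refl s
         (f (at 3)) (f (at 4)) (f (at 5)) (f (at 6)) (f (at 7)) (f (neg 3)) (f (neg 4)) (f (neg 5)) (f (neg 6)) (f (neg 7)) ⟩
  s + ((f (at 3) + f (at 4) + f (at 5) + f (at 6) + f (at 7)) + (f (neg 7) + f (neg 6) + f (neg 5) + f (neg 4) + f (neg 3)))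
    ≡⟨ cong₂ _+_ (sumZ-fifth B f) (cong₂ _+_
         (cong₅ (pos 3) (pos 4) (pos 5) (pos 6) (pos 7)) (cong₅ (minus 7) (minus 6) (minus 5) (minus 4) (minus 3))) ⟩
  sumZ B (fifth f) + (fifth f (+ suc B) + fifth f -[1+ B ]) ∎
  where
  open ≡.≡-Reasoning
  s = sumZ (2 ℕ.+ B ℕ.* 5) f
  at neg : ℕ → ℤ
  at k = + (k ℕ.+ B ℕ.* 5)
  neg k = - (at k)
  pos : ∀ k → at k ≡ + 5 * + suc B + (+ k - + 5)
  pos k = trans (cong (λ z → + k + z) (ℤP.pos-* B 5)) (ℤS.solve 2 (λ k b → k :+ b :* con (+ 5) := con (+ 5) :* (con (+ 1) :+ b) :+ (k :- con (+ 5))) refl (+ k) (+ B))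
  minus : ∀ k → neg k ≡ + 5 * -[1+ B ] + (+ 5 - + k)
  minus k = trans (cong (λ z → - (+ k + z)) (ℤP.pos-* B 5)) (ℤS.solve 2 (λ k b → :- (k :+ b :* con (+ 5)) := con (+ 5) :* (:- (con (+ 1) :+ b)) :+ (con (+ 5) :- k)) refl (+ k) (+ B))
  cong₅ : ∀ {a b c d e a′ b′ c′ d′ e′} → a ≡ a′ → b ≡ b′ → c ≡ c′ → d ≡ d′ → e ≡ e′ → f a + f b + f c + f d + f e ≡ f a′ + f b′ + f c′ + f d′ + f e′
  cong₅ refl refl refl refl refl = refl

n+10≤ : ∀ n → n ℕ.+ 10 ℕ.≤ 2 ℕ.+ (n ℕ.+ 10) ℕ.* 5
n+10≤ n = ℕP.≤-trans (ℕP.m≤m*n (n ℕ.+ 10) 5) (ℕP.m≤n+m ((n ℕ.+ 10) ℕ.* 5) 2)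

Σℤ-fifth : ∀ {F} → Null F → Σℤ F ≈ˢ λ n → Σℤ (λ m → F (+ 5 * m + -[1+ 1 ])) n + Σℤ (λ m → F (+ 5 * m + -[1+ 0 ])) n + Σℤ (λ m → F (+ 5 * m + + 0)) n
                                   + Σℤ (λ m → F (+ 5 * m + + 1)) n + Σℤ (λ m → F (+ 5 * m + + 2)) n
Σℤ-fifth {F} null n = begin
  Σℤ F n                               ≡⟨ Σℤ-window null n (2 ℕ.+ (n ℕ.+ 10) ℕ.* 5) (n+10≤ n) ⟨
  sumZ (2 ℕ.+ (n ℕ.+ 10) ℕ.* 5) (λ i → F i n)  ≡⟨ sumZ-fifth (n ℕ.+ 10) (λ i → F i n) ⟩
  sumZ (n ℕ.+ 10) (fifth (λ i → F i n))
    ≡⟨ trans (sumZ-+ B _ (g (+ 2))) (cong (_+ sumZ B (g (+ 2))) (trans (sumZ-+ B _ (g (+ 1))) (cong (_+ sumZ B (g (+ 1)))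
        (trans (sumZ-+ B _ (g (+ 0))) (cong (_+ sumZ B (g (+ 0))) (sumZ-+ B (g -[1+ 1 ]) (g -[1+ 0 ]))))))) ⟩
  _ ∎
  where
  open ≡.≡-Reasoning
  B = n ℕ.+ 10
  g : ℤ → ℤ → ℤ
  g r m = F (+ 5 * m + r) n

square : ∀ n → n * n ≡ + (∣ n ∣ ℕ.* ∣ n ∣)
square (+ n) = sym (ℤP.pos-* n n)
square -[1+ n ] = refl

abs≤square : ∀ n → + ∣ n ∣ ≤ n * n
abs≤square n = ≡.subst (+ ∣ n ∣ ≤_) (sym (square n)) (ℤ.+≤+ (lemma ∣ n ∣))
  where
  lemma : ∀ k → k ℕ.≤ k ℕ.* k
  lemma zero = z≤n
  lemma (suc k) = ℕP.m≤m*n (suc k) (suc k)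

square-nn : ∀ n → + 0 ≤ n * n
square-nn n = ≡.subst (+ 0 ≤_) (sym (square n)) nn

double≤square : ∀ n → + ∣ + 2 * n ∣ ≤ n * n + + 1
double≤square n = ≡.subst₂ (λ a b → + a ≤ b + + 1) (sym (ℤP.abs-* (+ 2) n)) (sym (square n)) (ℤ.+≤+ (lemma ∣ n ∣))
  where
  lemma : ∀ k → 2 ℕ.* k ℕ.≤ k ℕ.* k ℕ.+ 1
  lemma zero = z≤n
  lemma (suc zero) = ℕP.≤-refl
  lemma (suc (suc k)) = ℕP.≤-trans (ℕP.*-monoˡ-≤ (suc (suc k)) {2} {suc (suc k)} (s≤s (s≤s z≤n))) (ℕP.m≤m+n (suc (suc k) ℕ.* suc (suc k)) 1)

φ : Series
φ = Σℤ (λ n → sg n ⋆ mono (n * n))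

square-Null : ∀ (t : ℤ → ℤ) → Null (λ n → t n ⋆ mono (n * n))
square-Null t = Null-by (λ n → n * n) (λ n → Ord-⋆ (t n) (Ord-mono (n * n))) (λ n → ℤP.≤-trans (abs≤square n) (≤-by (+ 10) nn refl))

Σmono-⊗ : ∀ (s t e f : ℤ → ℤ) → Null (λ i → s i ⋆ mono (e i)) → Null (λ j → t j ⋆ mono (f j)) → (∀ i → + 0 ≤ e i) → (∀ j → + 0 ≤ f j) →
          Σℤ (λ i → s i ⋆ mono (e i)) ⊗ Σℤ (λ j → t j ⋆ mono (f j)) ≈ˢ Σℤ (λ i → Σℤ (λ j → (s i * t j) ⋆ mono (e i + f j)))
Σmono-⊗ s t e f ne nf 0≤e 0≤f = ≈-trans (Σℤ-⊗ ne (Σℤ (λ j → t j ⋆ mono (f j)))) (Σℤ-cong (λ i → ≈-trans (⊗-Σℤ nf (s i ⋆ mono (e i)))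
  (Σℤ-cong (λ j → ≈-trans (⋆-⊗-⋆ (s i) (t j) (mono (e i)) (mono (f j))) (⋆-cong {s i * t j} refl (mono-+ (0≤e i) (0≤f j)))))))

sg-double : ∀ n → sg (+ 2 * n) ≡ + 1
sg-double n = trans (cong sg (ℤS.solve 1 (λ n → con (+ 2) :* n := n :+ n) refl n)) (trans (sg-+ n n) (sg² n))

-- φ² is the theta series of ℤ[i] with signs; the five classes modulo 2 + i
-- (m + n i with m - 2 n ≡ t mod 5) give the five terms.
module Gaussian where

  Z : ℤ → ℤ → Series
  Z m n = (sg m * sg n) ⋆ mono (m * m + n * n)

  Ord-Z : ∀ m n → Ord (m * m + n * n) (Z m n)
  Ord-Z m n = Ord-⋆ (sg m * sg n) (Ord-mono (m * m + n * n))

  class : ℤ → ℤ → ℤ → Series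
  class t u n = Z (+ 5 * u + t + + 2 * n) n

  m≤ : ∀ m n → + ∣ m ∣ ≤ (m * m + n * n) + + 10
  m≤ m n = ℤP.≤-trans (abs≤square m) (≤-by (n * n + + 10) (nn-+ (square-nn n) (nn {10})) (ℤP.+-assoc (m * m) (n * n) (+ 10)))

  n≤ : ∀ m n → + ∣ n ∣ ≤ (m * m + n * n) + + 10
  n≤ m n = ℤP.≤-trans (abs≤square n) (≤-by (m * m + + 10) (nn-+ (square-nn m) (nn {10})) (ℤS.solve 2 (λ a b → a :+ b :+ con (+ 10) := b :+ (a :+ con (+ 10))) refl (m * m) (n * n)))

  sheared≤ : ∀ m n → + ∣ m ∣ ≤ ((m + + 2 * n) * (m + + 2 * n) + n * n) + + 10
  sheared≤ m n = ℤP.≤-trans (abs-shift m (+ 2 * n)) (ℤP.≤-trans (ℤP.+-mono-≤ (abs≤square (m + + 2 * n)) (double≤square n))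
    (≤-by (+ 9) nn (ℤS.solve 2 (λ a b → a :+ b :+ con (+ 10) := a :+ (b :+ con (+ 1)) :+ con (+ 9)) refl ((m + + 2 * n) * (m + + 2 * n)) (n * n))))

  -- Replacing `m` by `m + 2 n` makes the first index the invariant `m - 2 n` of the class, so that
  -- the dissection modulo 5 applies to the outer sum alone.
  sheared : φ ⊗ φ ≈ˢ Σℤ (λ m → Σℤ (λ n → Z (m + + 2 * n) n))
  sheared = begin
    φ ⊗ φ
      ≈⟨ Σmono-⊗ sg sg (λ n → n * n) (λ n → n * n) (square-Null sg) (square-Null sg) square-nn square-nn ⟩
    Σℤ (λ m → Σℤ (λ n → Z m n))
      ≈⟨ Σℤ-swap Z ⟩
    Σℤ (λ n → Σℤ (λ m → Z m n))
      ≈⟨ Σℤ-cong (λ n → Σℤ-shift (+ 2 * n) (λ m → Z m n)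
           (Null-by (λ m → m * m + n * n) (λ m → Ord-Z m n) (λ m → m≤ m n))
           (Null-by (λ m → (m + + 2 * n) * (m + + 2 * n) + n * n) (λ m → Ord-Z (m + + 2 * n) n) (λ m → sheared≤ m n))) ⟨
    Σℤ (λ n → Σℤ (λ m → Z (m + + 2 * n) n))
      ≈⟨ Σℤ-swap (λ n m → Z (m + + 2 * n) n) ⟩
    Σℤ (λ m → Σℤ (λ n → Z (m + + 2 * n) n)) ∎
    where open SetoidReasoning seriesSetoid

  piece : ∀ t τ b b′ e (s : ℤ) → Small b → Small b′ → + 0 ≤ e →
    (∀ u n → (+ 5 * u + t + + 2 * (n - (+ 2 * u + τ))) * (+ 5 * u + t + + 2 * (n - (+ 2 * u + τ))) + (n - (+ 2 * u + τ)) * (n - (+ 2 * u + τ))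
           ≡ e + (quad b′ u + quad b n)) →
    (∀ u n → sg (+ 5 * u + t + + 2 * (n - (+ 2 * u + τ))) * sg (n - (+ 2 * u + τ)) ≡ s * (sg u * sg n)) →
    Σℤ (λ u → Σℤ (class t u)) ≈ˢ s ⋆ (mono e ⊗ (θ b′ ⊗ θ b))
  piece t τ b b′ e s sm sm′ 0≤e exponent sign = begin
    Σℤ (λ u → Σℤ (class t u))
      ≈⟨ Σℤ-cong (λ u → Σℤ-shift (- (+ 2 * u + τ)) (class t u)
           (Null-by (λ n → (+ 5 * u + t + + 2 * n) * (+ 5 * u + t + + 2 * n) + n * n) (λ n → Ord-Z (+ 5 * u + t + + 2 * n) n) (λ n → n≤ (+ 5 * u + t + + 2 * n) n))
           (Null-by (λ n → e + (quad b′ u + quad b n)) (λ n → ≡.subst (λ z → Ord z (class t u (n - (+ 2 * u + τ)))) (exponent u n) (Ord-Z (+ 5 * u + t + + 2 * (n - (+ 2 * u + τ))) (n - (+ 2 * u + τ))))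
             (λ n → ℤP.≤-trans (quad-abs sm n) (≤-by (e + quad b′ u + + 9) (nn-+ (nn-+ 0≤e (quad-nn sm′ u)) (nn {9}))
               (ℤS.solve 3 (λ e x y → e :+ (x :+ y) :+ con (+ 10) := y :+ con (+ 1) :+ (e :+ x :+ con (+ 9))) refl e (quad b′ u) (quad b n)))))) ⟨
    Σℤ (λ u → Σℤ (λ n → class t u (n - (+ 2 * u + τ))))
      ≈⟨ Σℤ-cong (λ u → Σℤ-cong (λ n → ≈-trans (⋆-cong {s * (sg u * sg n)} refl (≈-sym (mono-+ 0≤e (nn-+ (quad-nn sm′ u) (quad-nn sm n)))) ⟸ ⋆-cong (sign u n) (λ m → cong (λ z → mono z m) (exponent u n)))
           (≈-trans (≈-sym (⋆-⋆ s (sg u * sg n) (mono e ⊗ mono (quad b′ u + quad b n)))) (⋆-cong {s} refl (≈-sym (⊗-⋆ (sg u * sg n) (mono e) (mono (quad b′ u + quad b n)))))))) ⟩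
    Σℤ (λ u → Σℤ (λ n → s ⋆ (mono e ⊗ f u n)))
      ≈⟨ Σℤ-cong (λ u → ≈-trans (Σℤ-⋆ s (λ n → mono e ⊗ f u n)) (⋆-cong {s} refl (≈-sym (⊗-Σℤ (f-Null u) (mono e))))) ⟩
    Σℤ (λ u → s ⋆ (mono e ⊗ Σℤ (f u)))
      ≈⟨ ≈-trans (Σℤ-⋆ s (λ u → mono e ⊗ Σℤ (f u))) (⋆-cong {s} refl (≈-sym (⊗-Σℤ F-Null (mono e)))) ⟩
    s ⋆ (mono e ⊗ Σℤ (λ u → Σℤ (f u)))
      ≈⟨ ⋆-cong {s} refl (⊗-congˡ {mono e} (≈-sym (Σmono-⊗ sg sg (quad b′) (quad b) (θ-Null sg sm′) (θ-Null sg sm) (quad-nn sm′) (quad-nn sm)))) ⟩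
    s ⋆ (mono e ⊗ (θ b′ ⊗ θ b)) ∎
    where
    open SetoidReasoning seriesSetoid
    _⟸_ : ∀ {f g h : Series} → g ≈ˢ h → f ≈ˢ g → f ≈ˢ h
    p ⟸ q = ≈-trans q p
    f : ℤ → ℤ → Series
    f u n = (sg u * sg n) ⋆ mono (quad b′ u + quad b n)
    f-Null : ∀ u → Null (f u)
    f-Null u = Null-by (λ n → quad b′ u + quad b n) (λ n → Ord-⋆ (sg u * sg n) (Ord-mono (quad b′ u + quad b n)))
      (λ n → ℤP.≤-trans (quad-abs sm n) (≤-by (quad b′ u + + 9) (nn-+ (quad-nn sm′ u) (nn {9})) (ℤS.solve 2 (λ x y → x :+ y :+ con (+ 10) := y :+ con (+ 1) :+ (x :+ con (+ 9))) refl (quad b′ u) (quad b n))))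
    F-Null : Null (λ u → Σℤ (f u))
    F-Null = Null-by (quad b′) (λ u → Ord-Σℤ (λ n → Ord-⋆ (sg u * sg n) (Ord-≤ (≤-by (quad b n) (quad-nn sm n) refl) (Ord-mono (quad b′ u + quad b n)))))
      (λ u → ℤP.≤-trans (quad-abs sm′ u) (x≤x+1+9 (quad b′ u)))

  signs : ∀ t τ u n → sg (+ 5 * u + t + + 2 * (n - (+ 2 * u + τ))) * sg (n - (+ 2 * u + τ)) ≡ sg (t - τ) * (sg u * sg n)
  signs t τ u n = begin
    sg (+ 5 * u + t + + 2 * (n - (+ 2 * u + τ))) * sg (n - (+ 2 * u + τ))
      ≡⟨ sym (sg-+ (+ 5 * u + t + + 2 * (n - (+ 2 * u + τ))) (n - (+ 2 * u + τ))) ⟩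
    sg ((+ 5 * u + t + + 2 * (n - (+ 2 * u + τ))) + (n - (+ 2 * u + τ)))
      ≡⟨ cong sg (ℤS.solve 4 (λ u t n τ → (con (+ 5) :* u :+ t :+ con (+ 2) :* (n :- (con (+ 2) :* u :+ τ))) :+ (n :- (con (+ 2) :* u :+ τ))
           := con (+ 2) :* (n :- u :- τ) :+ ((t :- τ) :+ (u :+ n))) refl u t n τ) ⟩
    sg (+ 2 * (n - u - τ) + ((t - τ) + (u + n)))
      ≡⟨ trans (sg-+ (+ 2 * (n - u - τ)) ((t - τ) + (u + n))) (trans (cong (_* sg ((t - τ) + (u + n))) (sg-double (n - u - τ))) (ℤP.*-identityˡ (sg ((t - τ) + (u + n))))) ⟩
    sg ((t - τ) + (u + n))
      ≡⟨ trans (sg-+ (t - τ) (u + n)) (cong (sg (t - τ) *_) (sg-+ u n)) ⟩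
    sg (t - τ) * (sg u * sg n) ∎
    where open ≡.≡-Reasoning

  -- The translation of `n` by `2 u + τ` removes the mixed term of the quadratic form, since
  -- multiplication by `2 + i` scales the norm by 5; a product of two theta functions remains.
  exponent : ∀ t τ u n → (+ 5 * u + t + + 2 * (n - (+ 2 * u + τ))) * (+ 5 * u + t + + 2 * (n - (+ 2 * u + τ))) + (n - (+ 2 * u + τ)) * (n - (+ 2 * u + τ))
           ≡ ((t - + 2 * τ) * (t - + 2 * τ) + τ * τ) + (quad (+ 2 * t) u + quad (+ 4 * t - + 10 * τ) n)
  exponent t τ u n = ℤS.solve 4 (λ t τ u n →
      (con (+ 5) :* u :+ t :+ con (+ 2) :* (n :- (con (+ 2) :* u :+ τ))) :* (con (+ 5) :* u :+ t :+ con (+ 2) :* (n :- (con (+ 2) :* u :+ τ))) :+ (n :- (con (+ 2) :* u :+ τ)) :* (n :- (con (+ 2) :* u :+ τ))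
      := ((t :- con (+ 2) :* τ) :* (t :- con (+ 2) :* τ) :+ τ :* τ) :+ ((con (+ 5) :* u :* u :+ (con (+ 2) :* t) :* u) :+ (con (+ 5) :* n :* n :+ (con (+ 4) :* t :- con (+ 10) :* τ) :* n))) refl t τ u n

  -- The free integer `τ` serves to bring the linear coefficient `4 t - 10 τ` into the admissible
  -- range: it is needed for `t = 2` and `t = - 2`, and zero otherwise.
  classes : ∀ t τ → {_ : True (∣ + 4 * t - + 10 * τ ∣ ℕ.≤? 5)} {_ : True (∣ + 2 * t ∣ ℕ.≤? 5)} →
    Σℤ (λ u → Σℤ (class t u)) ≈ˢ sg (t - τ) ⋆ (mono ((t - + 2 * τ) * (t - + 2 * τ) + τ * τ) ⊗ (θ (+ 2 * t) ⊗ θ (+ 4 * t - + 10 * τ)))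
  classes t τ {h} {h′} = piece t τ (+ 4 * t - + 10 * τ) (+ 2 * t) ((t - + 2 * τ) * (t - + 2 * τ) + τ * τ) (sg (t - τ))
    (Small-abs {+ 4 * t - + 10 * τ} (toWitness h)) (Small-abs {+ 2 * t} (toWitness h′)) (nn-+ (square-nn (t - + 2 * τ)) (square-nn τ)) (exponent t τ) (signs t τ)

  φ² : φ ⊗ φ ≈ˢ θ (+ 0) ⊗ θ (+ 0) ⊖ (+ 4) ⋆ (q^ 1 ⊗ (θ (+ 2) ⊗ θ (+ 4)))
  φ² n = trans (sheared n) (trans (Σℤ-fifth rows n) (trans
    (cong₂ _+_ (cong₂ _+_ (cong₂ _+_ (cong₂ _+_ (cl₋₂ n) (cl₋₁ n)) (cl₀ n)) (cl₁ n)) (cl₂ n))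
    (ℤS.solve 2 (λ x y → (con -[1+ 0 ] :* y :+ con -[1+ 0 ] :* y :+ x :+ con -[1+ 0 ] :* y :+ con -[1+ 0 ] :* y) := x :- con (+ 4) :* y) refl ((θ (+ 0) ⊗ θ (+ 0)) n) ((q^ 1 ⊗ (θ (+ 2) ⊗ θ (+ 4))) n))))
    where
    rows : Null (λ m → Σℤ (λ n → Z (m + + 2 * n) n))
    rows i n h = trans (sumZ-cong (n ℕ.+ 10) (λ j _ → Ord-vanish i (sheared≤ i j) (Ord-Z (i + + 2 * j) j) n h)) (sumZ-0 (n ℕ.+ 10))
    cl₀ : Σℤ (λ u → Σℤ (class (+ 0) u)) ≈ˢ θ (+ 0) ⊗ θ (+ 0)
    cl₀ = ≈-trans (classes (+ 0) (+ 0)) (≈-trans (1⋆ (one ⊗ (θ (+ 0) ⊗ θ (+ 0)))) (⊗-identityˡ (θ (+ 0) ⊗ θ (+ 0))))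
    to : ∀ {b b′} {f g} → θ b ≈ˢ f → θ b′ ≈ˢ g → -[1+ 0 ] ⋆ (q^ 1 ⊗ (θ b ⊗ θ b′)) ≈ˢ -[1+ 0 ] ⋆ (q^ 1 ⊗ (f ⊗ g))
    to p q = ⋆-cong { -[1+ 0 ]} refl (⊗-congˡ {q^ 1} (⊗-cong p q))
    swap : -[1+ 0 ] ⋆ (q^ 1 ⊗ (θ (+ 4) ⊗ θ (+ 2))) ≈ˢ -[1+ 0 ] ⋆ (q^ 1 ⊗ (θ (+ 2) ⊗ θ (+ 4)))
    swap = ⋆-cong { -[1+ 0 ]} refl (⊗-congˡ {q^ 1} (⊗-comm (θ (+ 4)) (θ (+ 2))))
    cl₁ : Σℤ (λ u → Σℤ (class (+ 1) u)) ≈ˢ -[1+ 0 ] ⋆ (q^ 1 ⊗ (θ (+ 2) ⊗ θ (+ 4)))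
    cl₁ = classes (+ 1) (+ 0)
    cl₋₁ : Σℤ (λ u → Σℤ (class -[1+ 0 ] u)) ≈ˢ -[1+ 0 ] ⋆ (q^ 1 ⊗ (θ (+ 2) ⊗ θ (+ 4)))
    cl₋₁ = ≈-trans (classes -[1+ 0 ] (+ 0)) (to { -[1+ 1 ]} { -[1+ 3 ]} (θ-neg (+ 2)) (θ-neg (+ 4)))
    cl₂ : Σℤ (λ u → Σℤ (class (+ 2) u)) ≈ˢ -[1+ 0 ] ⋆ (q^ 1 ⊗ (θ (+ 2) ⊗ θ (+ 4)))
    cl₂ = ≈-trans (classes (+ 2) (+ 1)) (≈-trans (to {+ 4} { -[1+ 1 ]} ≈-refl (θ-neg (+ 2))) swap)
    cl₋₂ : Σℤ (λ u → Σℤ (class -[1+ 1 ] u)) ≈ˢ -[1+ 0 ] ⋆ (q^ 1 ⊗ (θ (+ 2) ⊗ θ (+ 4)))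
    cl₋₂ = ≈-trans (classes -[1+ 1 ] -[1+ 0 ]) (≈-trans (to { -[1+ 3 ]} {+ 2} (θ-neg (+ 4)) ≈-refl) swap)

φ-product : φ ≈ˢ P 2 2 ⊗ (P 1 2 ⊗ P 1 2)
φ-product = ≈-trans (Σℤ-cong (λ i n → cong₂ (λ s z → s * mono z n) (sym (ℤP.*-identityʳ (sg i)))
    (ℤS.solve 1 (λ i → i :* i := con (+ 1) :* i :* i :+ con (+ 0) :* i) refl i))) (tripleProduct 0 0 0 refl)

φv : Exponents
φv = exponents (p22 ⊡ (p12 ⊡ p12))

-- The vector `vd` is that of `φ² (1 + κ) (1 - κ) / θ₀²`. In `Gaussian.φ²` the quotient
-- `q θ₂ θ₄ / θ₀²` times `1 - κ²` is again `κ`.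
relation-d : monomial vd ≈ˢ one ⊖ (+ 4) ⋆ κ ⊖ κ ⊗ κ
relation-d = ⊗-cancelˡ (monomial-unit (θv 0 +ᵛ θv 0)) (monomial vd) (one ⊖ (+ 4) ⋆ κ ⊖ κ ⊗ κ) (begin
  monomial (θv 0 +ᵛ θv 0) ⊗ monomial vd
    ≈⟨ monomial-+ (θv 0 +ᵛ θv 0) vd ⟨
  monomial ((φv +ᵛ φv) +ᵛ (va +ᵛ vb))
    ≈⟨ monomial-+ (φv +ᵛ φv) (va +ᵛ vb) ⟩
  monomial (φv +ᵛ φv) ⊗ monomial (va +ᵛ vb)
    ≈⟨ ⊗-congʳ {monomial (va +ᵛ vb)} (≈-trans (monomial-+ φv φv) (≈-trans (⊗-cong (≈-sym φ-monomial) (≈-sym φ-monomial)) Gaussian.φ²)) ⟩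
  (θ (+ 0) ⊗ θ (+ 0) ⊖ (+ 4) ⋆ (q^ 1 ⊗ (θ (+ 2) ⊗ θ (+ 4)))) ⊗ monomial (va +ᵛ vb)
    ≈⟨ ⊗-congʳ {monomial (va +ᵛ vb)} (⊖-cong (≈-trans (⊗-cong θ₀ θ₀) (≈-sym (monomial-+ (θv 0) (θv 0)))) (⋆-cong {+ 4} refl (⊗-congˡ {q^ 1} (≈-trans (⊗-cong θ₂ θ₄) (≈-sym (monomial-+ (θv 2) (θv 4))))))) ⟩
  (Θ ⊖ (+ 4) ⋆ (q^ 1 ⊗ monomial (θv 2 +ᵛ θv 4))) ⊗ monomial (va +ᵛ vb)
    ≈⟨ 𝕊.solve 4 (λ t x v f → (t -: f) *: v =: t *: v -: f *: v) ≈-refl Θ (q^ 1) (monomial (va +ᵛ vb)) ((+ 4) ⋆ (q^ 1 ⊗ monomial (θv 2 +ᵛ θv 4))) ⟩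
  Θ ⊗ monomial (va +ᵛ vb) ⊖ ((+ 4) ⋆ (q^ 1 ⊗ monomial (θv 2 +ᵛ θv 4))) ⊗ monomial (va +ᵛ vb)
    ≈⟨ ⊖-cong (⊗-congˡ {Θ} ab) (≈-trans (⋆-⊗ (+ 4) (q^ 1 ⊗ monomial (θv 2 +ᵛ θv 4)) (monomial (va +ᵛ vb)))
         (⋆-cong {+ 4} refl (≈-trans (⊗-assoc (q^ 1) (monomial (θv 2 +ᵛ θv 4)) (monomial (va +ᵛ vb)))
           (≈-trans (⊗-congˡ {q^ 1} (≈-trans (≈-sym (monomial-+ (θv 2 +ᵛ θv 4) (va +ᵛ vb))) (monomial-+ (θv 0 +ᵛ θv 0) vk)))
           (≈-trans (𝕊.solve 3 (λ q t k → q *: (t *: k) =: t *: (q *: k)) ≈-refl (q^ 1) Θ (monomial vk)) (⊗-congˡ {Θ} (≈-sym (1⋆ (q^ 1 ⊗ monomial vk))))))))) ⟩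
  Θ ⊗ ((one ⊕ κ) ⊗ (one ⊖ κ)) ⊖ (+ 4) ⋆ (Θ ⊗ κ)
    ≈⟨ ⊖-cong (≈-refl {Θ ⊗ ((one ⊕ κ) ⊗ (one ⊖ κ))}) (≈-sym (⊗-⋆ (+ 4) Θ κ)) ⟩
  Θ ⊗ ((one ⊕ κ) ⊗ (one ⊖ κ)) ⊖ Θ ⊗ ((+ 4) ⋆ κ)
    ≈⟨ 𝕊.solve 3 (λ t k f → t *: ((1: +: k) *: (1: -: k)) -: t *: f =: t *: (1: -: f -: k *: k)) ≈-refl Θ κ ((+ 4) ⋆ κ) ⟩
  Θ ⊗ (one ⊖ (+ 4) ⋆ κ ⊖ κ ⊗ κ) ∎)
  where
  open SetoidReasoning seriesSetoid
  Θ = monomial (θv 0 +ᵛ θv 0)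
  φ-monomial : φ ≈ˢ monomial φv
  φ-monomial = ≈-trans φ-product (sound (p22 ⊡ (p12 ⊡ p12)))
  ab : monomial (va +ᵛ vb) ≈ˢ (one ⊕ κ) ⊗ (one ⊖ κ)
  ab = ≈-trans (monomial-+ va vb) (⊗-cong relation-a (≈-trans (𝕊.solve 2 (λ b k → b =: (b +: k) -: k) ≈-refl (monomial vb) κ) (⊖-cong relation-b (≈-refl {κ}))))

-- Polynomial identities in κ

infixl 6 _⊞_ _⊟_
infixl 7 _⊠_ _⧄_
infixr 8 _⟨⋆⟩_
data Expr : Set where
  ⟨q^_⟩ : ℕ → Expr
  ⟨_⟩ : UnitExpr → Expr
  ⟨_⟩ₜ : Term → Expr
  _⟨⋆⟩_ : ℤ → Expr → Expr
  _⧄_ : Expr → UnitExpr → Expr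
  _⊠_ _⊞_ _⊟_ : Expr → Expr → Expr

⟪_⟫ : Expr → Series
⟪ ⟨q^ k ⟩ ⟫ = q^ k
⟪ ⟨ u ⟩ ⟫ = ⟦ u ⟧
⟪ ⟨ t ⟩ₜ ⟫ = ⟦ t ⟧ₜ
⟪ c ⟨⋆⟩ e ⟫ = c ⋆ ⟪ e ⟫
⟪ e ⧄ u ⟫ = ⟪ e ⟫ ÷ ⟦ u ⟧
⟪ e ⊠ f ⟫ = ⟪ e ⟫ ⊗ ⟪ f ⟫
⟪ e ⊞ f ⟫ = ⟪ e ⟫ ⊕ ⟪ f ⟫
⟪ e ⊟ f ⟫ = ⟪ e ⟫ ⊖ ⟪ f ⟫

total : List Term → Series
total [] = λ _ → + 0
total (t ∷ ts) = ⟦ t ⟧ₜ ⊕ total ts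

scaleₜ : ℤ → Term → Term
scaleₜ c (term d k v) = term (c * d) k v

expand : Expr → List Term
expand ⟨q^ k ⟩ = term (+ 1) k 0ᵛ ∷ []
expand ⟨ u ⟩ = term (+ 1) 0 (exponents u) ∷ []
expand ⟨ t ⟩ₜ = t ∷ []
expand (c ⟨⋆⟩ e) = List.map (scaleₜ c) (expand e)
expand (e ⧄ u) = List.map (term (+ 1) 0 (-ᵛ exponents u) ·ₜ_) (expand e)
expand (e ⊠ f) = List.concatMap (λ t → List.map (t ·ₜ_) (expand f)) (expand e)
expand (e ⊞ f) = expand e ++ expand f
expand (e ⊟ f) = expand e ++ List.map (scaleₜ -[1+ 0 ]) (expand f)

total-++ : ∀ ts us → total (ts ++ us) ≈ˢ total ts ⊕ total us
total-++ [] us n = sym (ℤP.+-identityˡ (total us n))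
total-++ (t ∷ ts) us n = trans (cong (λ z → ⟦ t ⟧ₜ n + z) (total-++ ts us n)) (sym (ℤP.+-assoc (⟦ t ⟧ₜ n) (total ts n) (total us n)))

total-scale : ∀ c ts → total (List.map (scaleₜ c) ts) ≈ˢ c ⋆ total ts
total-scale c [] n = sym (ℤP.*-zeroʳ c)
total-scale c (term d k v ∷ ts) n = trans (cong₂ _+_ (ℤP.*-assoc c d ((q^ k ⊗ monomial v) n)) (total-scale c ts n))
  (sym (ℤP.*-distribˡ-+ c (⟦ term d k v ⟧ₜ n) (total ts n)))

total-· : ∀ t ts → total (List.map (t ·ₜ_) ts) ≈ˢ ⟦ t ⟧ₜ ⊗ total ts
total-· t [] = ≈-sym (⊗-zeroʳ ⟦ t ⟧ₜ)
total-· t (s ∷ ts) = ≈-trans (⊕-cong (·ₜ-sound t s) (total-· t ts)) (≈-sym (⊗-distribˡ-⊕ ⟦ t ⟧ₜ ⟦ s ⟧ₜ (total ts)))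

total-·· : ∀ ts us → total (List.concatMap (λ t → List.map (t ·ₜ_) us) ts) ≈ˢ total ts ⊗ total us
total-·· [] us = ≈-sym (⊗-zeroˡ (total us))
total-·· (t ∷ ts) us = ≈-trans (total-++ (List.map (t ·ₜ_) us) (List.concatMap (λ t → List.map (t ·ₜ_) us) ts))
  (≈-trans (⊕-cong (total-· t us) (total-·· ts us)) (𝕊.solve 3 (λ t u v → t *: v +: u *: v =: (t +: u) *: v) ≈-refl ⟦ t ⟧ₜ (total ts) (total us)))

total-[] : ∀ {f t} → f ≈ˢ ⟦ t ⟧ₜ → f ≈ˢ total (t ∷ [])
total-[] {t = t} p n = trans (p n) (sym (ℤP.+-identityʳ (⟦ t ⟧ₜ n)))

inv-monomial : ∀ v → inv (monomial v) ≈ˢ monomial (-ᵛ v)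
inv-monomial v = inv-unique (monomial-unit v) (≈-trans (≈-sym (monomial-+ v (-ᵛ v))) (≈-trans (λ n → cong (λ z → monomial z n) (+ᵛ-inverse v)) monomial-0))

expand-sound : ∀ e → ⟪ e ⟫ ≈ˢ total (expand e)
expand-sound ⟨q^ k ⟩ = total-[] {t = term (+ 1) k 0ᵛ} (q^ₜ k)
expand-sound ⟨ u ⟩ = total-[] {t = term (+ 1) 0 (exponents u)} (≈-trans (sound u) (monomialₜ (exponents u)))
expand-sound ⟨ t ⟩ₜ = total-[] {t = t} ≈-refl
expand-sound (c ⟨⋆⟩ e) = ≈-trans (⋆-cong {c} refl (expand-sound e)) (≈-sym (total-scale c (expand e)))
expand-sound (e ⧄ u) = ≈-trans (⊗-cong (expand-sound e) (≈-trans (inv-cong (unit u) (sound u)) (≈-trans (inv-monomial (exponents u)) (monomialₜ (-ᵛ exponents u)))))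
  (≈-trans (⊗-comm (total (expand e)) ⟦ t ⟧ₜ) (≈-sym (total-· t (expand e))))
  where t = term (+ 1) 0 (-ᵛ exponents u)
expand-sound (e ⊠ f) = ≈-trans (⊗-cong (expand-sound e) (expand-sound f)) (≈-sym (total-·· (expand e) (expand f)))
expand-sound (e ⊞ f) = ≈-trans (⊕-cong (expand-sound e) (expand-sound f)) (≈-sym (total-++ (expand e) (expand f)))
expand-sound (e ⊟ f) = ≈-trans (⊖-cong (expand-sound e) (expand-sound f)) (≈-sym (≈-trans (total-++ (expand e) (List.map (scaleₜ -[1+ 0 ]) (expand f)))
  (λ n → cong (λ z → total (expand e) n + z) (trans (total-scale -[1+ 0 ] (expand f) n) (ℤP.-1*i≡-i (total (expand f) n))))))

Poly : Set
Poly = List ℤ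

evalₚ : Poly → Series
evalₚ [] = λ _ → + 0
evalₚ (c ∷ p) = c ⋆ one ⊕ κ ⊗ evalₚ p

infixl 6 _+ₚ_
infixl 7 _*ₚ_
infixr 8 _*ₛ_
_+ₚ_ : Poly → Poly → Poly
[] +ₚ q = q
(c ∷ p) +ₚ [] = c ∷ p
(c ∷ p) +ₚ (d ∷ q) = c + d ∷ p +ₚ q

_*ₛ_ : ℤ → Poly → Poly
c *ₛ p = List.map (λ d → c * d) p

_*ₚ_ : Poly → Poly → Poly
[] *ₚ q = []
(c ∷ p) *ₚ q = c *ₛ q +ₚ (+ 0 ∷ p *ₚ q)

_^ₚ_ : Poly → ℕ → Poly
p ^ₚ zero = + 1 ∷ []
p ^ₚ suc n = p *ₚ (p ^ₚ n)

evalₚ-+ : ∀ p q → evalₚ (p +ₚ q) ≈ˢ evalₚ p ⊕ evalₚ q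
evalₚ-+ [] q n = sym (ℤP.+-identityˡ (evalₚ q n))
evalₚ-+ (c ∷ p) [] n = sym (ℤP.+-identityʳ (evalₚ (c ∷ p) n))
evalₚ-+ (c ∷ p) (d ∷ q) = ≈-trans (⊕-cong (λ n → ℤP.*-distribʳ-+ (one n) c d) (⊗-congˡ {κ} (evalₚ-+ p q)))
  (𝕊.solve 5 (λ c d k p q → (c +: d) +: k *: (p +: q) =: (c +: k *: p) +: (d +: k *: q)) ≈-refl (c ⋆ one) (d ⋆ one) κ (evalₚ p) (evalₚ q))

evalₚ-*ₛ : ∀ c p → evalₚ (c *ₛ p) ≈ˢ c ⋆ evalₚ p
evalₚ-*ₛ c [] n = sym (ℤP.*-zeroʳ c)
evalₚ-*ₛ c (d ∷ p) = ≈-trans (⊕-cong {(c * d) ⋆ one} {c ⋆ (d ⋆ one)} (λ n → ℤP.*-assoc c d (one n)) (≈-trans (⊗-congˡ {κ} (evalₚ-*ₛ c p)) (⊗-⋆ c κ (evalₚ p))))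
  (λ n → sym (ℤP.*-distribˡ-+ c (d * one n) ((κ ⊗ evalₚ p) n)))

evalₚ-* : ∀ p q → evalₚ (p *ₚ q) ≈ˢ evalₚ p ⊗ evalₚ q
evalₚ-* [] q = ≈-sym (⊗-zeroˡ (evalₚ q))
evalₚ-* (c ∷ p) q = ≈-trans (evalₚ-+ (c *ₛ q) (+ 0 ∷ p *ₚ q)) (≈-trans (⊕-cong
    (≈-trans (evalₚ-*ₛ c q) (≈-sym (≈-trans (⋆-⊗ c one (evalₚ q)) (⋆-cong {c} refl (⊗-identityˡ (evalₚ q))))))
    (≈-trans (λ n → ℤP.+-identityˡ ((κ ⊗ evalₚ (p *ₚ q)) n)) (⊗-congˡ {κ} (evalₚ-* p q))))
  (𝕊.solve 4 (λ c k p q → c *: q +: k *: (p *: q) =: (c +: k *: p) *: q) ≈-refl (c ⋆ one) κ (evalₚ p) (evalₚ q)))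

evalₚ-^ : ∀ p n {f} → f ≈ˢ evalₚ p → f ^ˢ n ≈ˢ evalₚ (p ^ₚ n)
evalₚ-^ p zero e = ≈-sym (λ n → trans (cong₂ _+_ (ℤP.*-identityˡ (one n)) (⊗-zeroʳ κ n)) (ℤP.+-identityʳ (one n)))
evalₚ-^ p (suc n) e = ≈-trans (⊗-cong e (evalₚ-^ p n e)) (≈-sym (evalₚ-* p (p ^ₚ n)))

pk pa pb pc pd : Poly
pk = + 0 ∷ + 1 ∷ []
pa = + 1 ∷ + 1 ∷ []
pb = + 1 ∷ -[1+ 0 ] ∷ []
pc = + 1 ∷ + 1 ∷ -[1+ 0 ] ∷ []
pd = + 1 ∷ -[1+ 3 ] ∷ -[1+ 0 ] ∷ []

evalₚ₁ : ∀ c → evalₚ (c ∷ []) ≈ˢ c ⋆ one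
evalₚ₁ c n = trans (cong (λ z → c * one n + z) (⊗-zeroʳ κ n)) (ℤP.+-identityʳ (c * one n))

evalₚ₂ : ∀ c d → evalₚ (c ∷ d ∷ []) ≈ˢ c ⋆ one ⊕ d ⋆ κ
evalₚ₂ c d = ⊕-cong {c ⋆ one} ≈-refl (≈-trans (⊗-congˡ {κ} (evalₚ₁ d)) (≈-trans (⊗-⋆ d κ one) (⋆-cong {d} refl (⊗-identityʳ κ))))

evalₚ₃ : ∀ c d e → evalₚ (c ∷ d ∷ e ∷ []) ≈ˢ c ⋆ one ⊕ (d ⋆ κ ⊕ e ⋆ (κ ⊗ κ))
evalₚ₃ c d e = ⊕-cong {c ⋆ one} ≈-refl (≈-trans (⊗-congˡ {κ} (evalₚ₂ d e)) (≈-trans (⊗-distribˡ-⊕ κ (d ⋆ one) (e ⋆ κ))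
  (⊕-cong (≈-trans (⊗-⋆ d κ one) (⋆-cong {d} refl (⊗-identityʳ κ))) (⊗-⋆ e κ κ))))

κ-poly : κ ≈ˢ evalₚ pk
κ-poly = ≈-sym (≈-trans (evalₚ₂ (+ 0) (+ 1)) (λ n → ℤS.solve 2 (λ o k → con (+ 0) :* o :+ con (+ 1) :* k := k) refl (one n) (κ n)))

a-poly : monomial va ≈ˢ evalₚ pa
a-poly = ≈-trans relation-a (≈-sym (≈-trans (evalₚ₂ (+ 1) (+ 1)) (λ n → ℤS.solve 2 (λ o k → con (+ 1) :* o :+ con (+ 1) :* k := o :+ k) refl (one n) (κ n))))

b-poly : monomial vb ≈ˢ evalₚ pb
b-poly = ≈-sym (≈-trans (evalₚ₂ (+ 1) -[1+ 0 ]) (λ n → trans (cong (λ z → + 1 * z + -[1+ 0 ] * κ n) (sym (relation-b n)))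
  (ℤS.solve 2 (λ o k → con (+ 1) :* (o :+ k) :+ con -[1+ 0 ] :* k := o) refl (monomial vb n) (κ n))))

κκ : ⟦ term (+ 1) 2 (vk +ᵛ vk) ⟧ₜ ≈ˢ κ ⊗ κ
κκ = ·ₜ-sound (term (+ 1) 1 vk) (term (+ 1) 1 vk)

c-poly : monomial vc ≈ˢ evalₚ pc
c-poly = ≈-sym (≈-trans (evalₚ₃ (+ 1) (+ 1) -[1+ 0 ]) (λ n → trans
  (ℤS.solve 3 (λ o k l → con (+ 1) :* o :+ (con (+ 1) :* k :+ con -[1+ 0 ] :* l) := (o :+ k) :- l) refl (one n) (κ n) ((κ ⊗ κ) n))
  (trans (cong₂ _-_ (sym (trans (relation-c n) (relation-a n))) (sym (κκ n)))
    (ℤS.solve 2 (λ c l → c :+ l :- l := c) refl (monomial vc n) (⟦ term (+ 1) 2 (vk +ᵛ vk) ⟧ₜ n)))))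

d-poly : monomial vd ≈ˢ evalₚ pd
d-poly = ≈-trans relation-d (≈-sym (≈-trans (evalₚ₃ (+ 1) -[1+ 3 ] -[1+ 0 ]) (λ n →
  ℤS.solve 3 (λ o k l → con (+ 1) :* o :+ (con -[1+ 3 ] :* k :+ con -[1+ 0 ] :* l) := o :- con (+ 4) :* k :- l) refl (one n) (κ n) ((κ ⊗ κ) n))))

-- Exponents of κ, 1 + κ, 1 - κ, 1 + κ - κ² and 1 - 4κ - κ².
record Factors : Set where
  constructor factors
  field
    ek ea eb ec ed : ℕ

-- A product of powers of `κ` and its four polynomials is itself a monomial. It is stored as one, so
-- that it can be recognised in an expanded expression by comparing vectors.
factored : Term → ℤ → Factors → Term
factored (term c k v) s (factors ek ea eb ec ed) =
  term s (k ℕ.+ ek) (v +ᵛ (scaleᵛ ek vk +ᵛ (scaleᵛ ea va +ᵛ (scaleᵛ eb vb +ᵛ (scaleᵛ ec vc +ᵛ scaleᵛ ed vd)))))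

factorsₚ : Factors → Poly
factorsₚ (factors ek ea eb ec ed) = (pk ^ₚ ek) *ₚ ((pa ^ₚ ea) *ₚ ((pb ^ₚ eb) *ₚ ((pc ^ₚ ec) *ₚ (pd ^ₚ ed))))

scale-poly : ∀ n v p → monomial v ≈ˢ evalₚ p → monomial (scaleᵛ n v) ≈ˢ evalₚ (p ^ₚ n)
scale-poly n v p e = ≈-trans (monomial-scale n v) (evalₚ-^ p n e)

κ^ : ∀ n → ⟦ term (+ 1) n (scaleᵛ n vk) ⟧ₜ ≈ˢ evalₚ (pk ^ₚ n)
κ^ n = ≈-trans (go n) (evalₚ-^ pk n κ-poly)
  where
  go : ∀ n → ⟦ term (+ 1) n (scaleᵛ n vk) ⟧ₜ ≈ˢ κ ^ˢ n
  go zero = oneₜ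
  go (suc n) = ≈-trans (·ₜ-sound (term (+ 1) 1 vk) (term (+ 1) n (scaleᵛ n vk))) (⊗-congˡ {κ} (go n))

⊗ₚ : ∀ {v w p q} → monomial v ≈ˢ evalₚ p → monomial w ≈ˢ evalₚ q → monomial (v +ᵛ w) ≈ˢ evalₚ (p *ₚ q)
⊗ₚ {v} {w} {p} {q} e f = ≈-trans (monomial-+ v w) (≈-trans (⊗-cong e f) (≈-sym (evalₚ-* p q)))

factored-sound : ∀ k v s F → ⟦ factored (term (+ 1) k v) s F ⟧ₜ ≈ˢ ⟦ term (+ 1) k v ⟧ₜ ⊗ evalₚ (s *ₛ factorsₚ F)
factored-sound k v s F@(factors ek ea eb ec ed) = begin
  ⟦ term s (k ℕ.+ ek) (v +ᵛ (scaleᵛ ek vk +ᵛ rest)) ⟧ₜ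
    ≈⟨ ⋆-cong {s} refl (≈-trans (⊗-cong (≈-sym (q^-+ k ek)) (≈-trans (monomial-+ v (scaleᵛ ek vk +ᵛ rest)) (⊗-congˡ {monomial v} (monomial-+ (scaleᵛ ek vk) rest))))
        (𝕊.solve 5 (λ q r v k m → (q *: r) *: (v *: (k *: m)) =: (q *: v) *: ((r *: k) *: m)) ≈-refl (q^ k) (q^ ek) (monomial v) (monomial (scaleᵛ ek vk)) (monomial rest))) ⟩
  s ⋆ ((q^ k ⊗ monomial v) ⊗ ((q^ ek ⊗ monomial (scaleᵛ ek vk)) ⊗ monomial rest))
    ≈⟨ ≈-sym (⊗-⋆ s (q^ k ⊗ monomial v) ((q^ ek ⊗ monomial (scaleᵛ ek vk)) ⊗ monomial rest)) ⟩
  (q^ k ⊗ monomial v) ⊗ (s ⋆ ((q^ ek ⊗ monomial (scaleᵛ ek vk)) ⊗ monomial rest))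
    ≈⟨ ⊗-cong (≈-sym (1⋆ (q^ k ⊗ monomial v))) (⋆-cong {s} refl (⊗-cong (≈-trans (≈-sym (1⋆ (q^ ek ⊗ monomial (scaleᵛ ek vk)))) (κ^ ek))
        (⊗ₚ {scaleᵛ ea va} {p = pa ^ₚ ea} {(pb ^ₚ eb) *ₚ ((pc ^ₚ ec) *ₚ (pd ^ₚ ed))} (scale-poly ea va pa a-poly) (⊗ₚ {scaleᵛ eb vb} {p = pb ^ₚ eb} {(pc ^ₚ ec) *ₚ (pd ^ₚ ed)} (scale-poly eb vb pb b-poly) (⊗ₚ {scaleᵛ ec vc} {p = pc ^ₚ ec} {pd ^ₚ ed} (scale-poly ec vc pc c-poly) (scale-poly ed vd pd d-poly)))))) ⟩
  ⟦ term (+ 1) k v ⟧ₜ ⊗ (s ⋆ (evalₚ (pk ^ₚ ek) ⊗ evalₚ P₁))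
    ≈⟨ ⊗-congˡ {⟦ term (+ 1) k v ⟧ₜ} (≈-trans (⋆-cong {s} refl (≈-sym (evalₚ-* (pk ^ₚ ek) P₁))) (≈-sym (evalₚ-*ₛ s (factorsₚ F)))) ⟩
  ⟦ term (+ 1) k v ⟧ₜ ⊗ evalₚ (s *ₛ factorsₚ F) ∎
  where
  open SetoidReasoning seriesSetoid
  rest = scaleᵛ ea va +ᵛ (scaleᵛ eb vb +ᵛ (scaleᵛ ec vc +ᵛ scaleᵛ ed vd))
  P₁ = (pa ^ₚ ea) *ₚ ((pb ^ₚ eb) *ₚ ((pc ^ₚ ec) *ₚ (pd ^ₚ ed)))

total-factored : ∀ k v (sF : List (ℤ × Factors)) →
  total (List.map (λ { (s , F) → factored (term (+ 1) k v) s F }) sF) ≈ˢ ⟦ term (+ 1) k v ⟧ₜ ⊗ evalₚ (List.foldr (λ { (s , F) p → s *ₛ factorsₚ F +ₚ p }) [] sF)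
total-factored k v [] = ≈-sym (⊗-zeroʳ ⟦ term (+ 1) k v ⟧ₜ)
total-factored k v ((s , F) ∷ sF) = ≈-trans (⊕-cong (factored-sound k v s F) (total-factored k v sF))
  (≈-trans (≈-sym (⊗-distribˡ-⊕ ⟦ term (+ 1) k v ⟧ₜ (evalₚ (s *ₛ factorsₚ F)) (evalₚ rest))) (⊗-congˡ {⟦ term (+ 1) k v ⟧ₜ} (≈-sym (evalₚ-+ (s *ₛ factorsₚ F) rest))))
  where rest = List.foldr (λ { (s , F) p → s *ₛ factorsₚ F +ₚ p }) [] sF

evalₚ-0 : ∀ n → evalₚ (List.replicate n (+ 0)) ≈ˢ λ _ → + 0
evalₚ-0 zero _ = refl
evalₚ-0 (suc n) m = trans (ℤP.+-identityˡ ((κ ⊗ evalₚ (List.replicate n (+ 0))) m)) (trans (⊗-congˡ {κ} (evalₚ-0 n) m) (⊗-zeroʳ κ m))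

-- A certificate: `sF` lists, in the order of the expansion, how each term arises from the common
-- term `(k , v)`. Both equations hold by computation; the second compares with a list of `n` zeros
-- because polynomial arithmetic does not trim trailing zeros.
vanishes : ∀ e k v (sF : List (ℤ × Factors)) n → expand e ≡ List.map (λ { (s , F) → factored (term (+ 1) k v) s F }) sF →
           List.foldr (λ { (s , F) p → s *ₛ factorsₚ F +ₚ p }) [] sF ≡ List.replicate n (+ 0) → ⟪ e ⟫ ≈ˢ λ _ → + 0
vanishes e k v sF n p₁ p₂ = ≈-trans (expand-sound e) (≈-trans (λ m → cong (λ z → total z m) p₁)
  (≈-trans (total-factored k v sF) (≈-trans (⊗-congˡ {⟦ term (+ 1) k v ⟧ₜ} (λ m → trans (cong (λ z → evalₚ z m) p₂) (evalₚ-0 n m))) (⊗-zeroʳ ⟦ term (+ 1) k v ⟧ₜ))))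

-- The claimed products and their five linear relations

rowₑ : Expr → Expr → Expr → Expr
rowₑ f g h = ⟨ θₜ 0 ⟩ₜ ⊠ f ⊟ (⟨ θₜ 2 ⟩ₜ ⊠ g ⊞ ⟨ θₜ 2 ⟩ₜ ⊠ g) ⊞ (⟨ θₜ 4 ⟩ₜ ⊠ h ⊞ ⟨ θₜ 4 ⟩ₜ ⊠ h)

k₂₄ k₂₋₄ k₂₋₂ k₄₂ k₄₋₂ k₄₋₄ ℓA ℓB : Term
k₂₄ = term (+ 1) 0 (ex (+ 3) (+ 0) (+ 0) -[1+ 1 ] (+ 1) (+ 1))
k₂₋₄ = term -[1+ 0 ] 1 (ex (+ 3) (+ 0) (+ 1) -[1+ 0 ] (+ 0) (+ 0))
k₂₋₂ = term (+ 1) 2 (ex (+ 3) (+ 0) (+ 1) (+ 0) (+ 0) -[1+ 0 ])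
k₄₂ = term -[1+ 0 ] 2 (ex (+ 3) (+ 0) (+ 0) (+ 0) (+ 1) -[1+ 0 ])
k₄₋₂ = term -[1+ 0 ] 3 (ex (+ 3) (+ 0) (+ 1) (+ 1) (+ 0) -[1+ 1 ])
k₄₋₄ = term -[1+ 0 ] 1 (ex (+ 3) (+ 0) (+ 0) -[1+ 0 ] (+ 1) (+ 0))
ℓA = term (+ 1) 0 (ex (+ 2) (+ 0) (+ 0) -[1+ 2 ] (+ 0) (+ 2))
ℓB = term -[1+ 0 ] 2 (ex (+ 2) (+ 0) (+ 0) (+ 2) (+ 0) -[1+ 2 ])

-- These expressions are written so that `⟪_⟫` unfolds to the products in the theorem; the indices 0
-- to 4 stand for `d`, the letter `r` for `R_12`, the letter `s` for `R_02`, and the Appell parts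
-- and the `- 1` are left out.
r₀ : Expr
r₀ = (+ 10) ⟨⋆⟩ ⟨q^ 2 ⟩ ⊠ ⟨ (gen (# 9)) ⟨^⟩ 4 ⟩ ⊠ ⟨ gen (# 0) ⟩ ⊠ ⟨ gen (# 1) ⟩ ⊠ ⟨ gen (# 7) ⟩ ⊠ ⟨ gen (# 8) ⟩ ⧄ (p11 ⟨^⟩ 3 ⊡ p12) ⊞ (+ 2) ⟨⋆⟩ ⟨q^ 1 ⟩ ⊠ ⟨ p55 ⟩ ⧄ (p12 ⟨^⟩ 5 ⊡ gen (# 2) ⊡ gen (# 3) ⊡ gen (# 5) ⊡ gen (# 6))

r₁₀ : Expr
r₁₀ = (+ 4) ⟨⋆⟩ ⟨q^ 1 ⟩ ⊠ ⟨ (gen (# 9)) ⟨^⟩ 2 ⟩ ⧄ (p12 ⟨^⟩ 5 ⊡ gen (# 3) ⊡ gen (# 5) ⊡ p55)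

r₁₁ : Expr
r₁₁ = (+ 20) ⟨⋆⟩ ⟨q^ 3 ⟩ ⊠ ⟨ (gen (# 9)) ⟨^⟩ 7 ⟩ ⊠ ⟨ (gen (# 0) ⊡ gen (# 8)) ⟨^⟩ 2 ⟩ ⊠ ⟨ (gen (# 1) ⊡ gen (# 7)) ⟨^⟩ 3 ⟩ ⧄ (p11 ⟨^⟩ 4 ⊡ p55 ⟨^⟩ 2)

r₁ : Expr
r₁ = r₁₀ ⊞ r₁₁

r₂ : Expr
r₂ = (+ 10) ⟨⋆⟩ ⟨q^ 1 ⟩ ⊠ ⟨ (gen (# 9)) ⟨^⟩ 3 ⟩ ⧄ (p11 ⟨^⟩ 2 ⊡ (gen (# 2) ⊡ gen (# 6)) ⟨^⟩ 3 ⊡ gen (# 0) ⊡ gen (# 1) ⊡ gen (# 7) ⊡ gen (# 8))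

r₃ : Expr
r₃ = (+ 10) ⟨⋆⟩ ⟨ (gen (# 9)) ⟨^⟩ 3 ⟩ ⧄ (p11 ⟨^⟩ 2 ⊡ gen (# 2) ⊡ gen (# 3) ⊡ gen (# 5) ⊡ gen (# 6) ⊡ (gen (# 0) ⊡ gen (# 8)) ⟨^⟩ 3) ⊟ (+ 8) ⟨⋆⟩ ⟨ p55 ⟩ ⧄ (p12 ⟨^⟩ 5 ⊡ gen (# 1) ⊡ gen (# 2) ⊡ gen (# 6) ⊡ gen (# 7))

r₄ : Expr
r₄ = (+ 4) ⟨⋆⟩ ⟨ p22 ⟩ ⧄ (p12 ⟨^⟩ 4 ⊡ (gen (# 1) ⊡ gen (# 2) ⊡ gen (# 6) ⊡ gen (# 7)) ⟨^⟩ 3)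

s₀₀ : Expr
s₀₀ = ⟨ p55 ⟨^⟩ 6 ⟩ ⧄ (p12 ⟨^⟩ 6 ⊡ gen (# 2) ⊡ gen (# 3) ⊡ gen (# 5) ⊡ gen (# 6) ⊡ (gen (# 9)) ⟨^⟩ 5)

s₀₁ : Expr
s₀₁ = ⟨q^ 2 ⟩ ⊠ ⟨ p11 ⟩ ⊠ ⟨ gen (# 9) ⟩ ⧄ ((gen (# 2) ⊡ gen (# 3) ⊡ gen (# 5) ⊡ gen (# 6)) ⟨^⟩ 3 ⊡ p55)

s₀₂ : Expr
s₀₂ = (+ 4) ⟨⋆⟩ ⟨q^ 1 ⟩ ⊠ ⟨ p55 ⟨^⟩ 2 ⟩ ⊠ ⟨ gen (# 0) ⟩ ⊠ ⟨ gen (# 8) ⟩ ⧄ (p12 ⟨^⟩ 6 ⊡ gen (# 3) ⊡ gen (# 5) ⊡ gen (# 9))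

s₀₃ : Expr
s₀₃ = (+ 10) ⟨⋆⟩ ⟨q^ 2 ⟩ ⊠ ⟨ (gen (# 9)) ⟨^⟩ 3 ⟩ ⧄ (p11 ⟨^⟩ 2 ⊡ gen (# 1) ⊡ gen (# 7) ⊡ (gen (# 2) ⊡ gen (# 6)) ⟨^⟩ 4)

s₀ : Expr
s₀ = s₀₀ ⊞ s₀₁ ⊞ s₀₂ ⊟ s₀₃

s₁₀ : Expr
s₁₀ = (+ 2) ⟨⋆⟩ ⟨ p55 ⟨^⟩ 4 ⟩ ⧄ (p12 ⟨^⟩ 6 ⊡ gen (# 3) ⊡ gen (# 5) ⊡ (gen (# 9)) ⟨^⟩ 3)

s₁₁ : Expr
s₁₁ = (+ 2) ⟨⋆⟩ ⟨q^ 2 ⟩ ⊠ ⟨ p11 ⟩ ⊠ ⟨ (gen (# 9)) ⟨^⟩ 3 ⟩ ⧄ ((gen (# 2) ⊡ gen (# 6)) ⟨^⟩ 2 ⊡ (gen (# 3) ⊡ gen (# 5)) ⟨^⟩ 3 ⊡ p55 ⟨^⟩ 3)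

s₁ : Expr
s₁ = s₁₀ ⊞ s₁₁

s₂ : Expr
s₂ = (+ 4) ⟨⋆⟩ ⟨ gen (# 2) ⟩ ⊠ ⟨ gen (# 6) ⟩ ⊠ ⟨ p55 ⟨^⟩ 2 ⟩ ⧄ (p12 ⟨^⟩ 6 ⊡ gen (# 3) ⊡ gen (# 5) ⊡ gen (# 9)) ⊟ (+ 10) ⟨⋆⟩ ⟨q^ 1 ⟩ ⊠ ⟨ (gen (# 9)) ⟨^⟩ 3 ⟩ ⧄ (p11 ⟨^⟩ 2 ⊡ (gen (# 2) ⊡ gen (# 6)) ⟨^⟩ 3 ⊡ gen (# 0) ⊡ gen (# 1) ⊡ gen (# 7) ⊡ gen (# 8))

s₃ : Expr
s₃ = (+ 4) ⟨⋆⟩ ⟨ p55 ⟩ ⧄ (p12 ⟨^⟩ 5 ⊡ gen (# 1) ⊡ gen (# 2) ⊡ gen (# 6) ⊡ gen (# 7))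

-- Multiplied by `q`, because two of the products in `R_02(4)` have `q` in the denominator.
qs₄₀ : Expr
qs₄₀ = (+ 10) ⟨⋆⟩ ⟨q^ 1 ⟩ ⊠ ⟨ (gen (# 9)) ⟨^⟩ 3 ⟩ ⊠ ⟨ p55 ⟩ ⊠ ⟨ gen (# 3) ⟩ ⊠ ⟨ gen (# 5) ⟩ ⧄ (gen (# 0) ⊡ gen (# 8) ⊡ p11 ⟨^⟩ 3 ⊡ gen (# 2) ⊡ gen (# 6))

qs₄₁ : Expr
qs₄₁ = (+ 2) ⟨⋆⟩ ⟨ gen (# 9) ⟩ ⊠ ⟨ n25 ⟩ ⊠ ⟨ n35 ⟩ ⧄ (n15 ⊡ n45 ⊡ gen (# 0) ⊡ gen (# 1) ⊡ gen (# 7) ⊡ gen (# 8))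

qs₄₂ : Expr
qs₄₂ = (+ 2) ⟨⋆⟩ ⟨ p55 ⟨^⟩ 2 ⟩ ⊠ ⟨ (gen (# 1) ⊡ gen (# 7)) ⟨^⟩ 5 ⟩ ⊠ ⟨ (gen (# 9)) ⟨^⟩ 2 ⟩ ⧄ (p12 ⟨^⟩ 4 ⊡ (gen (# 0) ⊡ gen (# 8)) ⟨^⟩ 4 ⊡ p22 ⟨^⟩ 3)

qs₄ : Expr
qs₄ = -[1+ 0 ] ⟨⋆⟩ qs₄₀ ⊟ qs₄₁ ⊞ qs₄₂

-- The equations for `d = 0, 2, 3` contain Appell sums. Multiplying by `θ₀` turns these into
-- `T c (+ 0)`, which the Appell parts of the values cancel, and into the products `k`; only those
-- products are left here. The equations for `d = 1, 4` are homogeneous.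
r-section₀ : ⟪ ⟨ θₜ 0 ⟩ₜ ⊠ rowₑ r₀ (⟨q^ 1 ⟩ ⊠ r₄) (⟨q^ 1 ⟩ ⊠ r₁) ⊟ (-[1+ 1 ] ⟨⋆⟩ ⟨ k₂₋₂ ⟩ₜ ⊞ (+ 6) ⟨⋆⟩ ⟨ k₄₋₄ ⟩ₜ ⊞ ⟨ θₜ 0 ⟩ₜ ⊠ (+ 2) ⟨⋆⟩ ⟨ ℓB ⟩ₜ) ⟫ ≈ˢ λ _ → + 0
r-section₀ = vanishes (⟨ θₜ 0 ⟩ₜ ⊠ rowₑ r₀ (⟨q^ 1 ⟩ ⊠ r₄) (⟨q^ 1 ⟩ ⊠ r₁) ⊟ (-[1+ 1 ] ⟨⋆⟩ ⟨ k₂₋₂ ⟩ₜ ⊞ (+ 6) ⟨⋆⟩ ⟨ k₄₋₄ ⟩ₜ ⊞ ⟨ θₜ 0 ⟩ₜ ⊠ (+ 2) ⟨⋆⟩ ⟨ ℓB ⟩ₜ)) 1 (ex (+ 3) -[1+ 3 ] -[1+ 3 ] -[1+ 3 ] -[1+ 0 ] -[1+ 0 ])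
  ((+ 10 , factors 1 1 1 0 0) ∷ (+ 2 , factors 0 1 1 1 0) ∷ (-[1+ 3 ] , factors 0 0 1 1 0) ∷ (-[1+ 3 ] , factors 0 0 1 1 0) ∷ (+ 4 , factors 1 0 0 1 0) ∷ (+ 20 , factors 3 0 0 0 0) ∷ (+ 4 , factors 1 0 0 1 0) ∷ (+ 20 , factors 3 0 0 0 0) ∷ (+ 2 , factors 1 0 0 0 1) ∷ (+ 6 , factors 0 0 0 0 1) ∷ (+ 2 , factors 1 1 0 0 1) ∷ [])
  5 refl refl

r-section₁ : ⟪ rowₑ r₁ r₀ (⟨q^ 1 ⟩ ⊠ r₂) ⟫ ≈ˢ λ _ → + 0
r-section₁ = vanishes (rowₑ r₁ r₀ (⟨q^ 1 ⟩ ⊠ r₂)) 1 (ex (+ 2) -[1+ 3 ] -[1+ 3 ] -[1+ 2 ] -[1+ 1 ] -[1+ 1 ])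
  ((+ 4 , factors 0 0 0 1 0) ∷ (+ 20 , factors 2 0 0 0 0) ∷ (-[1+ 9 ] , factors 1 0 0 0 0) ∷ (-[1+ 1 ] , factors 0 0 0 1 0) ∷ (-[1+ 9 ] , factors 1 0 0 0 0) ∷ (-[1+ 1 ] , factors 0 0 0 1 0) ∷ (+ 10 , factors 1 0 1 0 0) ∷ (+ 10 , factors 1 0 1 0 0) ∷ [])
  3 refl refl

r-section₂ : ⟪ ⟨q^ 1 ⟩ ⊠ (⟨ θₜ 0 ⟩ₜ ⊠ rowₑ r₂ r₁ (⟨q^ 1 ⟩ ⊠ r₃)) ⊟ -[1+ 5 ] ⟨⋆⟩ (⟨ k₄₂ ⟩ₜ ⊞ ⟨ k₄₋₂ ⟩ₜ) ⟫ ≈ˢ λ _ → + 0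
r-section₂ = vanishes (⟨q^ 1 ⟩ ⊠ (⟨ θₜ 0 ⟩ₜ ⊠ rowₑ r₂ r₁ (⟨q^ 1 ⟩ ⊠ r₃)) ⊟ -[1+ 5 ] ⟨⋆⟩ (⟨ k₄₂ ⟩ₜ ⊞ ⟨ k₄₋₂ ⟩ₜ)) 2 (ex (+ 3) -[1+ 3 ] -[1+ 3 ] -[1+ 2 ] -[1+ 0 ] -[1+ 1 ])
  ((+ 10 , factors 0 1 2 0 0) ∷ (-[1+ 3 ] , factors 0 0 0 1 0) ∷ (-[1+ 19 ] , factors 2 0 0 0 0) ∷ (-[1+ 3 ] , factors 0 0 0 1 0) ∷ (-[1+ 19 ] , factors 2 0 0 0 0) ∷ (+ 10 , factors 0 1 1 0 0) ∷ (-[1+ 7 ] , factors 0 0 1 1 0) ∷ (+ 10 , factors 0 1 1 0 0) ∷ (-[1+ 7 ] , factors 0 0 1 1 0) ∷ (-[1+ 5 ] , factors 0 0 0 0 1) ∷ (-[1+ 5 ] , factors 1 0 0 0 1) ∷ [])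
  4 refl refl

r-section₃ : ⟪ ⟨ θₜ 0 ⟩ₜ ⊠ rowₑ r₃ r₂ (⟨q^ 1 ⟩ ⊠ r₄) ⊟ (+ 2) ⟨⋆⟩ (⟨ k₂₄ ⟩ₜ ⊞ ⟨ k₂₋₄ ⟩ₜ) ⟫ ≈ˢ λ _ → + 0
r-section₃ = vanishes (⟨ θₜ 0 ⟩ₜ ⊠ rowₑ r₃ r₂ (⟨q^ 1 ⟩ ⊠ r₄) ⊟ (+ 2) ⟨⋆⟩ (⟨ k₂₄ ⟩ₜ ⊞ ⟨ k₂₋₄ ⟩ₜ)) 0 (ex (+ 3) -[1+ 3 ] -[1+ 3 ] -[1+ 4 ] -[1+ 0 ] (+ 0))
  ((+ 10 , factors 0 2 1 0 0) ∷ (-[1+ 7 ] , factors 0 1 1 1 0) ∷ (-[1+ 9 ] , factors 1 1 1 0 0) ∷ (-[1+ 9 ] , factors 1 1 1 0 0) ∷ (+ 4 , factors 1 0 1 1 0) ∷ (+ 4 , factors 1 0 1 1 0) ∷ (-[1+ 1 ] , factors 0 0 0 0 1) ∷ (+ 2 , factors 1 0 0 0 1) ∷ [])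
  5 refl refl

r-section₄ : ⟪ rowₑ (⟨q^ 1 ⟩ ⊠ r₄) (⟨q^ 1 ⟩ ⊠ r₃) (⟨q^ 1 ⟩ ⊠ r₀) ⟫ ≈ˢ λ _ → + 0
r-section₄ = vanishes (rowₑ (⟨q^ 1 ⟩ ⊠ r₄) (⟨q^ 1 ⟩ ⊠ r₃) (⟨q^ 1 ⟩ ⊠ r₀)) 1 (ex (+ 2) -[1+ 3 ] -[1+ 3 ] -[1+ 3 ] -[1+ 1 ] -[1+ 0 ])
  ((+ 4 , factors 0 0 1 1 0) ∷ (-[1+ 9 ] , factors 0 1 0 0 0) ∷ (+ 8 , factors 0 0 0 1 0) ∷ (-[1+ 9 ] , factors 0 1 0 0 0) ∷ (+ 8 , factors 0 0 0 1 0) ∷ (+ 10 , factors 2 0 0 0 0) ∷ (+ 2 , factors 1 0 0 1 0) ∷ (+ 10 , factors 2 0 0 0 0) ∷ (+ 2 , factors 1 0 0 1 0) ∷ [])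
  4 refl refl

s-section₀ : ⟪ ⟨ θₜ 0 ⟩ₜ ⊠ rowₑ s₀ qs₄ (⟨q^ 1 ⟩ ⊠ s₁) ⊟ ((+ 4) ⟨⋆⟩ ⟨ k₂₋₂ ⟩ₜ ⊞ -[1+ 1 ] ⟨⋆⟩ ⟨ k₄₋₄ ⟩ₜ ⊞ ⟨ θₜ 0 ⟩ₜ ⊠ (⟨ ℓA ⟩ₜ ⊟ ⟨ ℓB ⟩ₜ)) ⟫ ≈ˢ λ _ → + 0
s-section₀ = vanishes (⟨ θₜ 0 ⟩ₜ ⊠ rowₑ s₀ qs₄ (⟨q^ 1 ⟩ ⊠ s₁) ⊟ ((+ 4) ⟨⋆⟩ ⟨ k₂₋₂ ⟩ₜ ⊞ -[1+ 1 ] ⟨⋆⟩ ⟨ k₄₋₄ ⟩ₜ ⊞ ⟨ θₜ 0 ⟩ₜ ⊠ (⟨ ℓA ⟩ₜ ⊟ ⟨ ℓB ⟩ₜ))) 0 (ex (+ 3) -[1+ 3 ] -[1+ 4 ] -[1+ 4 ] (+ 0) (+ 0))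
  ((+ 1 , factors 0 2 2 1 0) ∷ (+ 1 , factors 2 1 1 0 1) ∷ (+ 4 , factors 1 1 1 1 0) ∷ (-[1+ 9 ] , factors 2 1 2 0 0) ∷ (+ 10 , factors 1 1 1 0 0) ∷ (+ 2 , factors 0 0 1 0 1) ∷ (-[1+ 1 ] , factors 0 2 0 1 0) ∷ (+ 10 , factors 1 1 1 0 0) ∷ (+ 2 , factors 0 0 1 0 1) ∷ (-[1+ 1 ] , factors 0 2 0 1 0) ∷ (+ 2 , factors 1 1 1 1 0) ∷ (+ 2 , factors 3 0 0 0 1) ∷ (+ 2 , factors 1 1 1 1 0) ∷ (+ 2 , factors 3 0 0 0 1) ∷ (-[1+ 3 ] , factors 2 0 0 0 1) ∷ (-[1+ 1 ] , factors 1 0 0 0 1) ∷ (-[1+ 0 ] , factors 0 0 1 0 1) ∷ (-[1+ 0 ] , factors 2 1 0 0 1) ∷ [])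
  7 refl refl

s-section₁ : ⟪ rowₑ s₁ s₀ (⟨q^ 1 ⟩ ⊠ s₂) ⟫ ≈ˢ λ _ → + 0
s-section₁ = vanishes (rowₑ s₁ s₀ (⟨q^ 1 ⟩ ⊠ s₂)) 0 (ex (+ 2) -[1+ 3 ] -[1+ 4 ] -[1+ 3 ] -[1+ 0 ] -[1+ 0 ])
  ((+ 2 , factors 0 1 1 1 0) ∷ (+ 2 , factors 2 0 0 0 1) ∷ (-[1+ 0 ] , factors 0 1 1 1 0) ∷ (-[1+ 0 ] , factors 2 0 0 0 1) ∷ (-[1+ 3 ] , factors 1 0 0 1 0) ∷ (+ 10 , factors 2 0 1 0 0) ∷ (-[1+ 0 ] , factors 0 1 1 1 0) ∷ (-[1+ 0 ] , factors 2 0 0 0 1) ∷ (-[1+ 3 ] , factors 1 0 0 1 0) ∷ (+ 10 , factors 2 0 1 0 0) ∷ (+ 4 , factors 1 0 0 1 0) ∷ (-[1+ 9 ] , factors 2 0 1 0 0) ∷ (+ 4 , factors 1 0 0 1 0) ∷ (-[1+ 9 ] , factors 2 0 1 0 0) ∷ [])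
  5 refl refl

s-section₂ : ⟪ ⟨q^ 1 ⟩ ⊠ (⟨ θₜ 0 ⟩ₜ ⊠ rowₑ s₂ s₁ (⟨q^ 1 ⟩ ⊠ s₃)) ⊟ (+ 2) ⟨⋆⟩ (⟨ k₄₂ ⟩ₜ ⊞ ⟨ k₄₋₂ ⟩ₜ) ⟫ ≈ˢ λ _ → + 0
s-section₂ = vanishes (⟨q^ 1 ⟩ ⊠ (⟨ θₜ 0 ⟩ₜ ⊠ rowₑ s₂ s₁ (⟨q^ 1 ⟩ ⊠ s₃)) ⊟ (+ 2) ⟨⋆⟩ (⟨ k₄₂ ⟩ₜ ⊞ ⟨ k₄₋₂ ⟩ₜ)) 1 (ex (+ 3) -[1+ 3 ] -[1+ 4 ] -[1+ 3 ] (+ 0) -[1+ 0 ])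
  ((+ 4 , factors 0 1 1 1 0) ∷ (-[1+ 9 ] , factors 1 1 2 0 0) ∷ (-[1+ 1 ] , factors 0 1 1 1 0) ∷ (-[1+ 1 ] , factors 2 0 0 0 1) ∷ (-[1+ 1 ] , factors 0 1 1 1 0) ∷ (-[1+ 1 ] , factors 2 0 0 0 1) ∷ (+ 4 , factors 1 0 1 1 0) ∷ (+ 4 , factors 1 0 1 1 0) ∷ (+ 2 , factors 1 0 0 0 1) ∷ (+ 2 , factors 2 0 0 0 1) ∷ [])
  5 refl refl

s-section₃ : ⟪ ⟨ θₜ 0 ⟩ₜ ⊠ rowₑ s₃ s₂ qs₄ ⊟ -[1+ 3 ] ⟨⋆⟩ (⟨ k₂₄ ⟩ₜ ⊞ ⟨ k₂₋₄ ⟩ₜ) ⟫ ≈ˢ λ _ → + 0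
s-section₃ = vanishes (⟨ θₜ 0 ⟩ₜ ⊠ rowₑ s₃ s₂ qs₄ ⊟ -[1+ 3 ] ⟨⋆⟩ (⟨ k₂₄ ⟩ₜ ⊞ ⟨ k₂₋₄ ⟩ₜ)) 0 (ex (+ 3) -[1+ 3 ] -[1+ 3 ] -[1+ 4 ] -[1+ 0 ] (+ 0))
  ((+ 4 , factors 0 1 1 1 0) ∷ (-[1+ 3 ] , factors 0 1 0 1 0) ∷ (+ 10 , factors 1 1 1 0 0) ∷ (-[1+ 3 ] , factors 0 1 0 1 0) ∷ (+ 10 , factors 1 1 1 0 0) ∷ (-[1+ 9 ] , factors 1 1 1 0 0) ∷ (-[1+ 1 ] , factors 0 0 1 0 1) ∷ (+ 2 , factors 0 2 0 1 0) ∷ (-[1+ 9 ] , factors 1 1 1 0 0) ∷ (-[1+ 1 ] , factors 0 0 1 0 1) ∷ (+ 2 , factors 0 2 0 1 0) ∷ (+ 4 , factors 0 0 0 0 1) ∷ (-[1+ 3 ] , factors 1 0 0 0 1) ∷ [])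
  5 refl refl

s-section₄ : ⟪ rowₑ qs₄ (⟨q^ 1 ⟩ ⊠ s₃) (⟨q^ 1 ⟩ ⊠ s₀) ⟫ ≈ˢ λ _ → + 0
s-section₄ = vanishes (rowₑ qs₄ (⟨q^ 1 ⟩ ⊠ s₃) (⟨q^ 1 ⟩ ⊠ s₀)) 0 (ex (+ 2) -[1+ 3 ] -[1+ 4 ] -[1+ 4 ] -[1+ 0 ] (+ 0))
  ((-[1+ 9 ] , factors 1 1 1 0 0) ∷ (-[1+ 1 ] , factors 0 0 1 0 1) ∷ (+ 2 , factors 0 2 0 1 0) ∷ (-[1+ 3 ] , factors 1 0 0 1 0) ∷ (-[1+ 3 ] , factors 1 0 0 1 0) ∷ (+ 1 , factors 1 1 1 1 0) ∷ (+ 1 , factors 3 0 0 0 1) ∷ (+ 4 , factors 2 0 0 1 0) ∷ (-[1+ 9 ] , factors 3 0 1 0 0) ∷ (+ 1 , factors 1 1 1 1 0) ∷ (+ 1 , factors 3 0 0 0 1) ∷ (+ 4 , factors 2 0 0 1 0) ∷ (-[1+ 9 ] , factors 3 0 1 0 0) ∷ [])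
  6 refl refl

-- Sections modulo 5

sec : ℕ → Series → Series
sec d F n = F (5 ℕ.* n ℕ.+ d)

5*suc : ∀ n d → 5 ℕ.* suc n ℕ.+ d ≡ 5 ℕ.+ (5 ℕ.* n ℕ.+ d)
5*suc n d = cong (ℕ._+ d) (ℕP.*-suc 5 n)

sec-q⁵ : ∀ {d} → d ℕ.≤ 4 → ∀ F → sec d (q^ 5 ⊗ F) ≈ˢ q^ 1 ⊗ sec d F
sec-q⁵ {d} d≤4 F zero = trans (Ord-⊗ {+ 5} {q^ 5} (Ord-mono (+ 5)) F d (ℤ.+<+ (s≤s d≤4))) (sym (Ord-⊗ {+ 1} {q^ 1} (Ord-mono (+ 1)) (sec d F) 0 (ℤ.+<+ (s≤s z≤n))))
sec-q⁵ {d} d≤4 F (suc n) = begin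
  (q^ 5 ⊗ F) (5 ℕ.* suc n ℕ.+ d)            ≡⟨ cong (q^ 5 ⊗ F) (5*suc n d) ⟩
  (q^ 5 ⊗ F) (5 ℕ.+ (5 ℕ.* n ℕ.+ d))        ≡⟨ q^-suc-⊗ 4 F (4 ℕ.+ (5 ℕ.* n ℕ.+ d)) ⟩
  (q^ 4 ⊗ F) (4 ℕ.+ (5 ℕ.* n ℕ.+ d))        ≡⟨ q^-suc-⊗ 3 F (3 ℕ.+ (5 ℕ.* n ℕ.+ d)) ⟩
  (q^ 3 ⊗ F) (3 ℕ.+ (5 ℕ.* n ℕ.+ d))        ≡⟨ q^-suc-⊗ 2 F (2 ℕ.+ (5 ℕ.* n ℕ.+ d)) ⟩
  (q^ 2 ⊗ F) (2 ℕ.+ (5 ℕ.* n ℕ.+ d))        ≡⟨ q^-suc-⊗ 1 F (1 ℕ.+ (5 ℕ.* n ℕ.+ d)) ⟩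
  (q^ 1 ⊗ F) (1 ℕ.+ (5 ℕ.* n ℕ.+ d))        ≡⟨ q^-suc-⊗ 0 F (5 ℕ.* n ℕ.+ d) ⟩
  (one ⊗ F) (5 ℕ.* n ℕ.+ d)                 ≡⟨ ⊗-identityˡ F (5 ℕ.* n ℕ.+ d) ⟩
  sec d F n                                 ≡⟨ ⊗-identityˡ (sec d F) n ⟨
  (one ⊗ sec d F) n                         ≡⟨ q^-suc-⊗ 0 (sec d F) n ⟨
  (q^ 1 ⊗ sec d F) (suc n)                  ∎
  where open ≡.≡-Reasoning

sec-shift : ∀ {d} → d ℕ.≤ 4 → ∀ k F → sec d (q^ (k ℕ.* 5) ⊗ F) ≈ˢ q^ k ⊗ sec d F
sec-shift {d} d≤4 zero F = λ n → trans (⊗-identityˡ F (5 ℕ.* n ℕ.+ d)) (sym (⊗-identityˡ (sec d F) n))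
sec-shift {d} d≤4 (suc k) F n = begin
  (q^ (5 ℕ.+ k ℕ.* 5) ⊗ F) m           ≡⟨ ≈-trans (⊗-congʳ {F} (≈-sym (q^-+ 5 (k ℕ.* 5)))) (⊗-assoc (q^ 5) (q^ (k ℕ.* 5)) F) m ⟩
  (q^ 5 ⊗ (q^ (k ℕ.* 5) ⊗ F)) m        ≡⟨ sec-q⁵ d≤4 (q^ (k ℕ.* 5) ⊗ F) n ⟩
  (q^ 1 ⊗ sec d (q^ (k ℕ.* 5) ⊗ F)) n  ≡⟨ ⊗-congˡ {q^ 1} (sec-shift d≤4 k F) n ⟩
  (q^ 1 ⊗ (q^ k ⊗ sec d F)) n          ≡⟨ ≈-trans (≈-sym (⊗-assoc (q^ 1) (q^ k) (sec d F))) (⊗-congʳ {sec d F} (q^-+ 1 k)) n ⟩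
  (q^ (suc k) ⊗ sec d F) n               ∎
  where
  open ≡.≡-Reasoning
  m = 5 ℕ.* n ℕ.+ d

sec-mono : ∀ {d} → d ℕ.≤ 4 → ∀ {Q} → + 0 ≤ Q → ∀ s F → sec d (mono (+ 5 * Q + + s) ⊗ F) ≈ˢ mono Q ⊗ sec d (q^ s ⊗ F)
sec-mono {d} d≤4 {+ k} 0≤Q s F n = trans
  (⊗-congʳ {F} (λ m → trans (cong (λ z → mono z m) (cong (_+ + s) (trans (sym (ℤP.pos-* 5 k)) (cong +_ (ℕP.*-comm 5 k))))) (sym (q^-+ (k ℕ.* 5) s m))) (5 ℕ.* n ℕ.+ d))
  (trans (⊗-assoc (q^ (k ℕ.* 5)) (q^ s) F (5 ℕ.* n ℕ.+ d)) (sec-shift d≤4 k (q^ s ⊗ F) n))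

sec-q^ : ∀ {d s} → s ℕ.≤ 4 → sec d (q^ s) ≈ˢ q^ s d ⋆ one
sec-q^ {d} {s} s≤4 zero = sym (ℤP.*-identityʳ (q^ s d))
sec-q^ {d} {s} s≤4 (suc n) = trans (cong (q^ s) (5*suc n d)) (trans (large s s≤4) (sym (ℤP.*-zeroʳ (q^ s d))))
  where
  large : ∀ s → s ℕ.≤ 4 → q^ s (5 ℕ.+ (5 ℕ.* n ℕ.+ d)) ≡ + 0
  large 0 _ = refl
  large 1 _ = refl
  large 2 _ = refl
  large 3 _ = refl
  large 4 _ = refl
  large (suc (suc (suc (suc (suc _))))) (s≤s (s≤s (s≤s (s≤s ()))))

-- Multiplication by `1 - q^(k + 1)` commutes with taking sections if the exponent is scaled by 5.
-- It reduces the series to `q^s`, which meets the section `d` only for `s = d`.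
sec-geo : ∀ {d s} → d ℕ.≤ 4 → s ℕ.≤ 4 → ∀ k k₅ → suc k₅ ≡ suc k ℕ.* 5 → sec d (q^ s ⊗ geo k₅) ≈ˢ q^ s d ⋆ geo k
sec-geo {d} {s} d≤4 s≤4 k k₅ eq = ⊗-cancelˡ {one ⊖ q^ (suc k)} (is-unit refl) Y (q^ s d ⋆ geo k) (begin
  (one ⊖ q^ (suc k)) ⊗ Y
    ≈⟨ 𝕊.solve 2 (λ q y → (1: -: q) *: y =: y -: q *: y) ≈-refl (q^ (suc k)) Y ⟩
  Y ⊖ q^ (suc k) ⊗ Y
    ≈⟨ ⊖-cong {Y} ≈-refl (≈-sym (sec-shift d≤4 (suc k) X)) ⟩
  sec d (X ⊖ q^ (suc k ℕ.* 5) ⊗ X)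
    ≈⟨ (λ n → trans (cong (λ z → (X ⊖ q^ z ⊗ X) (5 ℕ.* n ℕ.+ d)) (sym eq))
         (𝕊.solve 3 (λ s g q → s *: g -: q *: (s *: g) =: s *: ((1: -: q) *: g)) ≈-refl (q^ s) (geo k₅) (q^ (suc k₅)) (5 ℕ.* n ℕ.+ d))) ⟩
  sec d (q^ s ⊗ ((one ⊖ q^ (suc k₅)) ⊗ geo k₅))
    ≈⟨ (λ n → ≈-trans (⊗-congˡ {q^ s} (inv-correct (one ⊖ q^ (suc k₅)) refl)) (⊗-identityʳ (q^ s)) (5 ℕ.* n ℕ.+ d)) ⟩
  sec d (q^ s)
    ≈⟨ sec-q^ s≤4 ⟩
  q^ s d ⋆ one
    ≈⟨ ⋆-cong {q^ s d} refl (inv-correct (one ⊖ q^ (suc k)) refl) ⟨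
  q^ s d ⋆ ((one ⊖ q^ (suc k)) ⊗ geo k)
    ≈⟨ ⊗-⋆ (q^ s d) (one ⊖ q^ (suc k)) (geo k) ⟨
  (one ⊖ q^ (suc k)) ⊗ (q^ s d ⋆ geo k) ∎)
  where
  open SetoidReasoning seriesSetoid
  X = q^ s ⊗ geo k₅
  Y = sec d X

sec-G : ∀ {d s} → d ℕ.≤ 4 → s ℕ.≤ 4 → ∀ Q ε → + 0 ≤ lead Q ε → sec d (G (+ 5 * Q + + s) (+ 5 * ε)) ≈ˢ q^ s d ⋆ G Q ε
sec-G {d} {s} d≤4 s≤4 Q (+ zero) 0≤l n = sym (ℤP.*-zeroʳ (q^ s d))
sec-G {d} {s} d≤4 s≤4 Q (+ suc k) 0≤l n = trans (sec-mono d≤4 0≤l s (geo _) n)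
  (trans (⊗-congˡ {mono Q} (sec-geo d≤4 s≤4 k _ (ℕP.*-comm 5 (suc k))) n) (⊗-⋆ (q^ s d) (mono Q) (geo k) n))
sec-G {d} {s} d≤4 s≤4 Q -[1+ k ] 0≤l n = trans (cong -_
  (trans (cong (λ z → (mono z ⊗ geo k₅) (5 ℕ.* n ℕ.+ d)) shifted)
  (trans (sec-mono d≤4 0≤l s (geo k₅) n)
  (trans (⊗-congˡ {mono (Q + + suc k)} (sec-geo d≤4 s≤4 k k₅ (ℕP.*-comm 5 (suc k))) n) (⊗-⋆ (q^ s d) (mono (Q + + suc k)) (geo k) n)))))
  (ℤP.neg-distribʳ-* (q^ s d) ((mono (Q + + suc k) ⊗ geo k) n))
  where
  k₅ = k ℕ.+ 4 ℕ.* suc k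
  shifted : + 5 * Q + + s + + suc k₅ ≡ + 5 * (Q + + suc k) + + s
  shifted = trans (cong (λ z → + 5 * Q + + s + z) (ℤP.pos-* 5 (suc k)))
    (ℤS.solve 3 (λ q s k → con (+ 5) :* q :+ s :+ con (+ 5) :* k := con (+ 5) :* (q :+ k) :+ s) refl Q (+ s) (+ suc k))

abs-5m : ∀ m r → 5 ℕ.* ∣ m ∣ ℕ.≤ ∣ + 5 * m + r ∣ ℕ.+ ∣ r ∣
abs-5m m r = ℕP.≤-trans (ℕP.≤-reflexive (sym (ℤP.abs-* (+ 5) m))) (ℤP.drop‿+≤+ (abs-shift (+ 5 * m) r))

-- The window of the dissected sum at `5 n + d` lies within five times that at `n`: from
-- `∣ m ∣ ≥ n + 11` follows `∣ 5 m + r ∣ ≥ 5 n + 53`, well above `5 n + 14`.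
sec-window : ∀ {d r m n} → d ℕ.≤ 4 → ∣ r ∣ ℕ.≤ 2 → n ℕ.+ 10 ℕ.< ∣ m ∣ → 5 ℕ.* n ℕ.+ d ℕ.+ 10 ℕ.< ∣ + 5 * m + r ∣
sec-window {d} {r} {m} {n} d≤4 r≤2 n<m = ℕP.+-cancelʳ-≤ 2 _ _ (begin
  suc (5 ℕ.* n ℕ.+ d ℕ.+ 10) ℕ.+ 2    ≤⟨ ℕP.+-monoˡ-≤ 2 (s≤s (ℕP.+-monoˡ-≤ 10 (ℕP.+-monoʳ-≤ (5 ℕ.* n) d≤4))) ⟩
  suc (5 ℕ.* n ℕ.+ 4 ℕ.+ 10) ℕ.+ 2    ≡⟨ N.solve 1 (λ n → N.con 1 N.:+ (N.con 5 N.:* n N.:+ N.con 4 N.:+ N.con 10) N.:+ N.con 2 N.:= N.con 5 N.:* n N.:+ N.con 17) refl n ⟩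
  5 ℕ.* n ℕ.+ 17                      ≤⟨ ℕP.+-monoʳ-≤ (5 ℕ.* n) (toWitness {a? = 17 ℕ.≤? 55} _) ⟩
  5 ℕ.* n ℕ.+ 55                      ≡⟨ N.solve 1 (λ n → N.con 5 N.:* n N.:+ N.con 55 N.:= N.con 5 N.:* (N.con 1 N.:+ (n N.:+ N.con 10))) refl n ⟩
  5 ℕ.* suc (n ℕ.+ 10)                ≤⟨ ℕP.*-monoʳ-≤ 5 n<m ⟩
  5 ℕ.* ∣ m ∣                         ≤⟨ abs-5m m r ⟩
  ∣ + 5 * m + r ∣ ℕ.+ ∣ r ∣        ≤⟨ ℕP.+-monoʳ-≤ ∣ + 5 * m + r ∣ r≤2 ⟩
  ∣ + 5 * m + r ∣ ℕ.+ 2            ∎)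
  where
  open ℕP.≤-Reasoning

sec-Σℤ : ∀ {d} → d ℕ.≤ 4 → ∀ {F} → Null F → sec d (Σℤ F) ≈ˢ λ n →
  Σℤ (λ m → sec d (F (+ 5 * m + -[1+ 1 ]))) n + Σℤ (λ m → sec d (F (+ 5 * m + -[1+ 0 ]))) n + Σℤ (λ m → sec d (F (+ 5 * m + + 0))) n
    + Σℤ (λ m → sec d (F (+ 5 * m + + 1))) n + Σℤ (λ m → sec d (F (+ 5 * m + + 2))) n
sec-Σℤ {d} d≤4 {F} null n = trans (Σℤ-fifth null (5 ℕ.* n ℕ.+ d))
  (cong₂ _+_ (cong₂ _+_ (cong₂ _+_ (cong₂ _+_ (part -[1+ 1 ] (s≤s (s≤s z≤n))) (part -[1+ 0 ] (s≤s z≤n))) (part (+ 0) z≤n)) (part (+ 1) (s≤s z≤n))) (part (+ 2) (s≤s (s≤s z≤n))))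
  where
  part : ∀ r → ∣ r ∣ ℕ.≤ 2 → Σℤ (λ m → F (+ 5 * m + r)) (5 ℕ.* n ℕ.+ d) ≡ Σℤ (λ m → sec d (F (+ 5 * m + r))) n
  part r r≤2 = sumZ-extend (λ m n<m → null (+ 5 * m + r) (5 ℕ.* n ℕ.+ d) (sec-window {r = r} {m} d≤4 r≤2 n<m)) (5 ℕ.* n ℕ.+ d ℕ.+ 10)
    (ℕP.+-monoˡ-≤ 10 (ℕP.≤-trans (ℕP.m≤m+n n (4 ℕ.* n)) (ℕP.m≤m+n (5 ℕ.* n) d)))

sg-5m : ∀ m r → sg (+ 5 * m + r) ≡ sg r * sg m
sg-5m m r = trans (cong sg (ℤS.solve 2 (λ m r → con (+ 5) :* m :+ r := (r :+ m) :+ con (+ 4) :* m) refl m r)) (trans (sg-+ (r + m) (+ 4 * m))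
  (trans (cong (λ z → sg (r + m) * z) (trans (cong sg (ℤS.solve 1 (λ m → con (+ 4) :* m := con (+ 2) :* (con (+ 2) :* m)) refl m)) (sg-double (+ 2 * m))))
    (trans (ℤP.*-identityʳ (sg (r + m))) (sg-+ r m))))

module _ {d} (d≤4 : d ℕ.≤ 4) (F : Series) where

  private
    part : ∀ b r s → Small b → b ≡ r + r → r * r ≡ + s →
           Σℤ (λ m → sec d ((sg (+ 5 * m + r) ⋆ mono ((+ 5 * m + r) * (+ 5 * m + r))) ⊗ F)) ≈ˢ sg r ⋆ (θ b ⊗ sec d (q^ s ⊗ F))
    part b r s sm refl r²≡s = begin
      Σℤ (λ m → sec d ((sg (+ 5 * m + r) ⋆ mono ((+ 5 * m + r) * (+ 5 * m + r))) ⊗ F))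
        ≈⟨ Σℤ-cong (λ m n → trans (⋆-⊗ (sg (+ 5 * m + r)) (mono ((+ 5 * m + r) * (+ 5 * m + r))) F (5 ℕ.* n ℕ.+ d))
             (cong₂ _*_ (sg-5m m r) (trans (cong (λ z → (mono z ⊗ F) (5 ℕ.* n ℕ.+ d)) (exponent m)) (sec-mono d≤4 (quad-nn sm m) s F n)))) ⟩
      Σℤ (λ m → (sg r * sg m) ⋆ (mono (quad b m) ⊗ sec d (q^ s ⊗ F)))
        ≈⟨ Σℤ-cong (λ m → ≈-trans (≈-sym (⋆-⋆ (sg r) (sg m) (mono (quad b m) ⊗ sec d (q^ s ⊗ F)))) (⋆-cong {sg r} refl (≈-sym (⋆-⊗ (sg m) (mono (quad b m)) (sec d (q^ s ⊗ F)))))) ⟩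
      Σℤ (λ m → sg r ⋆ ((sg m ⋆ mono (quad b m)) ⊗ sec d (q^ s ⊗ F)))
        ≈⟨ Σℤ-⋆ (sg r) (λ m → (sg m ⋆ mono (quad b m)) ⊗ sec d (q^ s ⊗ F)) ⟩
      sg r ⋆ Σℤ (λ m → (sg m ⋆ mono (quad b m)) ⊗ sec d (q^ s ⊗ F))
        ≈⟨ ⋆-cong {sg r} refl (≈-sym (Σℤ-⊗ (θ-Null sg sm) (sec d (q^ s ⊗ F)))) ⟩
      sg r ⋆ (θ b ⊗ sec d (q^ s ⊗ F)) ∎
      where
      open SetoidReasoning seriesSetoid
      exponent : ∀ m → (+ 5 * m + r) * (+ 5 * m + r) ≡ + 5 * quad (r + r) m + + s
      exponent m = trans (ℤS.solve 2 (λ m r → (con (+ 5) :* m :+ r) :* (con (+ 5) :* m :+ r) := con (+ 5) :* (con (+ 5) :* m :* m :+ (r :+ r) :* m) :+ r :* r) refl m r)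
        (cong (λ z → + 5 * quad (r + r) m + z) r²≡s)

  -- From `(5 m + r)² = 5 (5 m² + 2 r m) + r²`, the residues 1 and - 1 give `θ (+ 2)` with remainder
  -- 1, the residues 2 and - 2 give `θ (+ 4)` with remainder 4.
  sec-φ : sec d (φ ⊗ F) ≈ˢ θ (+ 0) ⊗ sec d F ⊖ (+ 2) ⋆ (θ (+ 2) ⊗ sec d (q^ 1 ⊗ F)) ⊕ (+ 2) ⋆ (θ (+ 4) ⊗ sec d (q^ 4 ⊗ F))
  sec-φ n = trans (Σℤ-⊗ (square-Null sg) F (5 ℕ.* n ℕ.+ d)) (trans (sec-Σℤ d≤4 {λ i → (sg i ⋆ mono (i * i)) ⊗ F} null n)
    (trans (cong₂ _+_ (cong₂ _+_ (cong₂ _+_ (cong₂ _+_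
        (trans (part -[1+ 3 ] -[1+ 1 ] 4 (small nn nn) refl refl n) (cong (λ z → + 1 * z) (⊗-congʳ {sec d (q^ 4 ⊗ F)} (θ-neg (+ 4)) n)))
        (trans (part -[1+ 1 ] -[1+ 0 ] 1 (small nn nn) refl refl n) (cong (λ z → -[1+ 0 ] * z) (⊗-congʳ {sec d (q^ 1 ⊗ F)} (θ-neg (+ 2)) n))))
        (trans (part (+ 0) (+ 0) 0 (small nn nn) refl refl n) (cong (λ z → + 1 * z) (⊗-congˡ {θ (+ 0)} (λ m → ⊗-identityˡ F (5 ℕ.* m ℕ.+ d)) n))))
        (part (+ 2) (+ 1) 1 (small nn nn) refl refl n))
        (part (+ 4) (+ 2) 4 (small nn nn) refl refl n))
      (ℤS.solve 3 (λ a b c → con (+ 1) :* c :+ con -[1+ 0 ] :* b :+ con (+ 1) :* a :+ con -[1+ 0 ] :* b :+ con (+ 1) :* c := a :- con (+ 2) :* b :+ con (+ 2) :* c) refl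
        ((θ (+ 0) ⊗ sec d F) n) ((θ (+ 2) ⊗ sec d (q^ 1 ⊗ F)) n) ((θ (+ 4) ⊗ sec d (q^ 4 ⊗ F)) n))))
    where
    null : Null (λ i → (sg i ⋆ mono (i * i)) ⊗ F)
    null = Null-by (λ n → n * n) (λ n → Ord-⊗ (Ord-⋆ (sg n) (Ord-mono (n * n))) F) (λ n → ℤP.≤-trans (abs≤square n) (≤-by (+ 10) nn refl))

lambertTerm : ℤ → ℤ → Series
lambertTerm a n = sg n ⋆ G (n * n + (a + a) * n) (+ 10 * n)

-- The summand `n = 0` is zero since `G e 0` is, so this is the sum over nonzero `n` of the
-- overview.
lambert : ℤ → Series
lambert a = Σℤ (lambertTerm a)

lambert-lead : ∀ {a} → + 0 ≤ a → + 0 ≤ + 5 - a → ∀ n → + ∣ n ∣ ≤ lead (n * n + (a + a) * n) (+ 10 * n)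
lambert-lead {a} 0≤a a≤5 (+ zero) = ≤-by (+ 0) nn (ℤS.solve 1 (λ a → con (+ 0) :* con (+ 0) :+ (a :+ a) :* con (+ 0) := con (+ 0) :+ con (+ 0)) refl a)
lambert-lead {a} 0≤a a≤5 (+ suc k) = ≤-by (+ k * + suc k + (a + a) * + suc k) (nn-+ (nn-* (nn {k}) (nn {suc k})) (nn-* (nn-+ 0≤a 0≤a) (nn {suc k})))
  (ℤS.solve 2 (λ a k → (con (+ 1) :+ k) :* (con (+ 1) :+ k) :+ (a :+ a) :* (con (+ 1) :+ k) := (con (+ 1) :+ k) :+ (k :* (con (+ 1) :+ k) :+ (a :+ a) :* (con (+ 1) :+ k))) refl a (+ k))
lambert-lead {a} 0≤a a≤5 -[1+ k ] = ≤-by (+ k * + suc k + ((+ 5 - a) + (+ 5 - a)) * + suc k) (nn-+ (nn-* (nn {k}) (nn {suc k})) (nn-* (nn-+ a≤5 a≤5) (nn {suc k})))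
  (trans (cong (λ z → -[1+ k ] * -[1+ k ] + (a + a) * -[1+ k ] + z) (ℤP.pos-* 10 (suc k)))
  (ℤS.solve 2 (λ a k → (:- (con (+ 1) :+ k)) :* (:- (con (+ 1) :+ k)) :+ (a :+ a) :* (:- (con (+ 1) :+ k)) :+ con (+ 10) :* (con (+ 1) :+ k)
    := (con (+ 1) :+ k) :+ (k :* (con (+ 1) :+ k) :+ ((con (+ 5) :- a) :+ (con (+ 5) :- a)) :* (con (+ 1) :+ k))) refl a (+ k)))

lambertTerm-Null : ∀ {a} → + 0 ≤ a → + 0 ≤ + 5 - a → ∀ t → ∣ t ∣ ℕ.≤ 10 → Null (λ n → lambertTerm a (n + t))
lambertTerm-Null {a} 0≤a a≤5 t t≤10 = Null-by (λ n → ℓ (n + t)) (λ n → Ord-⋆ (sg (n + t)) (Ord-G ((n + t) * (n + t) + (a + a) * (n + t)) (+ 10 * (n + t))))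
  (λ n → ℤP.≤-trans (abs-shift n t) (ℤP.+-mono-≤ (lambert-lead 0≤a a≤5 (n + t)) (ℤ.+≤+ t≤10)))
  where
  ℓ : ℤ → ℤ
  ℓ n = lead (n * n + (a + a) * n) (+ 10 * n)

lead-5 : ∀ Q ε s → lead (+ 5 * Q + + s) (+ 5 * ε) ≡ + 5 * lead Q ε + + s
lead-5 Q (+ zero) s = refl
lead-5 Q (+ suc k) s = refl
lead-5 Q -[1+ k ] s = trans (cong (λ z → + 5 * Q + + s + z) (ℤP.pos-* 5 (suc k)))
    (ℤS.solve 3 (λ q s k → con (+ 5) :* q :+ s :+ con (+ 5) :* k := con (+ 5) :* (q :+ k) :+ s) refl Q (+ s) (+ suc k))

nn-5 : ∀ {s} x → s ℕ.≤ 4 → + 0 ≤ + 5 * x + + s → + 0 ≤ x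
nn-5 (+ _) _ _ = nn
nn-5 {s} -[1+ k ] s≤4 h with ℤP.≤-trans h (ℤP.+-mono-≤ (ℤP.*-monoˡ-≤-nonNeg (+ 5) (ℤ.-≤- { k} {0} z≤n)) (ℤ.+≤+ s≤4))
... | ()

module LambertSections {d a} (d≤4 : d ℕ.≤ 4) (0≤a : + 0 ≤ a) (a≤5 : + 0 ≤ + 5 - a) where

  -- The exponent `r′² + 2 a r′` may be as low as - 4, so that its quotient `u` by 5 is - 1. The
  -- factor `q^ 1` keeps all powers nonnegative.
  part : ∀ t r r′ b u s → r + t ≡ r′ → b ≡ (r′ + r′) + (a + a) → r′ * r′ + (a + a) * r′ ≡ + 5 * u + + s → s ℕ.≤ 4 →
         + 0 ≤ + 1 + u → Small b →
         q^ 1 ⊗ Σℤ (λ m → sec d (lambertTerm a (+ 5 * m + r + t))) ≈ˢ (q^ s d * sg r′) ⋆ (mono (+ 1 + u) ⊗ T (a + a) b)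
  part t r r′ b u s r+t b≡ u≡ s≤4 0≤u sm = begin
    q^ 1 ⊗ Σℤ (λ m → sec d (lambertTerm a (+ 5 * m + r + t)))
      ≈⟨ ⊗-congˡ {q^ 1} (Σℤ-cong (λ m n → trans (cong₂ _*_ (trans (cong sg (trans (ℤP.+-assoc (+ 5 * m) r t) (cong (λ z → + 5 * m + z) r+t))) (sg-5m m r′))
           (trans (G-cong (exponent m) (denominator m) (5 ℕ.* n ℕ.+ d)) (sec-G d≤4 s≤4 (quad b m + u) (ε m) (lead-nn m) n)))
           (rearrange (sg r′) (sg m) (q^ s d) (G (quad b m + u) (ε m) n)))) ⟩
    q^ 1 ⊗ Σℤ (λ m → (q^ s d * sg r′) ⋆ X m)
      ≈⟨ ≈-trans (⊗-congˡ {q^ 1} (Σℤ-⋆ (q^ s d * sg r′) X)) (⊗-⋆ (q^ s d * sg r′) (q^ 1) (Σℤ X)) ⟩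
    (q^ s d * sg r′) ⋆ (q^ 1 ⊗ Σℤ X)
      ≈⟨ ⋆-cong {q^ s d * sg r′} refl (≈-trans (⊗-Σℤ null (q^ 1)) (≈-trans (Σℤ-cong pull) (≈-sym (⊗-Σℤ (T-Null (a + a) sm) (mono (+ 1 + u)))))) ⟩
    (q^ s d * sg r′) ⋆ (mono (+ 1 + u) ⊗ T (a + a) b) ∎
    where
    open SetoidReasoning seriesSetoid
    ε : ℤ → ℤ
    ε m = + 10 * m + (b - (a + a))
    X : ℤ → Series
    X m = sg m ⋆ G (quad b m + u) (ε m)
    rearrange : ∀ p m k g → (p * m) * (k * g) ≡ (k * p) * (m * g)
    rearrange = ℤS.solve 4 (λ p m k g → (p :* m) :* (k :* g) := (k :* p) :* (m :* g)) refl
    at : ∀ m → + 5 * m + r + t ≡ + 5 * m + r′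
    at m = trans (ℤP.+-assoc (+ 5 * m) r t) (cong (λ z → + 5 * m + z) r+t)
    exponent : ∀ m → (+ 5 * m + r + t) * (+ 5 * m + r + t) + (a + a) * (+ 5 * m + r + t) ≡ + 5 * (quad b m + u) + + s
    exponent m = trans (cong (λ z → z * z + (a + a) * z) (at m)) (trans
      (ℤS.solve 3 (λ m r a → (con (+ 5) :* m :+ r) :* (con (+ 5) :* m :+ r) :+ (a :+ a) :* (con (+ 5) :* m :+ r)
        := con (+ 5) :* (con (+ 5) :* m :* m :+ ((r :+ r) :+ (a :+ a)) :* m) :+ (r :* r :+ (a :+ a) :* r)) refl m r′ a)
      (trans (cong₂ (λ x y → + 5 * (quad x m) + y) (sym b≡) u≡)
        (ℤS.solve 3 (λ q u s → con (+ 5) :* q :+ (con (+ 5) :* u :+ s) := con (+ 5) :* (q :+ u) :+ s) refl (quad b m) u (+ s))))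
    denominator : ∀ m → + 10 * (+ 5 * m + r + t) ≡ + 5 * ε m
    denominator m = trans (cong (λ z → + 10 * z) (at m)) (trans
      (ℤS.solve 3 (λ m r a → con (+ 10) :* (con (+ 5) :* m :+ r) := con (+ 5) :* (con (+ 10) :* m :+ (((r :+ r) :+ (a :+ a)) :- (a :+ a)))) refl m r′ a)
      (cong (λ z → + 5 * (+ 10 * m + (z - (a + a)))) (sym b≡)))
    lead-nn : ∀ m → + 0 ≤ lead (quad b m + u) (ε m)
    lead-nn m = nn-5 (lead (quad b m + u) (ε m)) s≤4 (≡.subst (+ 0 ≤_) (trans (cong₂ lead (exponent m) (denominator m)) (lead-5 (quad b m + u) (ε m) s))
      (ℤP.≤-trans nn (lambert-lead 0≤a a≤5 (+ 5 * m + r + t))))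
    null : Null X
    null = Null-by (λ m → quad b m + u) (λ m → Ord-⋆ (sg m) (Ord-≤ (e≤lead (quad b m + u) (ε m)) (Ord-G (quad b m + u) (ε m))))
      (λ m → ℤP.≤-trans (quad-abs sm m) (≤-by (+ 8 + (+ 1 + u)) (nn-+ (nn {8}) 0≤u) (ℤS.solve 2 (λ q u → q :+ u :+ con (+ 10) := q :+ con (+ 1) :+ (con (+ 8) :+ (con (+ 1) :+ u))) refl (quad b m) u)))
    pull : ∀ m → q^ 1 ⊗ X m ≈ˢ mono (+ 1 + u) ⊗ T-term (a + a) b m
    pull m = ≈-trans (⊗-⋆ (sg m) (q^ 1) (G (quad b m + u) (ε m))) (≈-trans (⋆-cong {sg m} refl (≈-trans (≈-sym (G-mono {+ 1} {quad b m + u} (ε m) nn (lead-nn m)))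
      (≈-trans (G-cong {ε = ε m} (ℤS.solve 2 (λ q u → con (+ 1) :+ (q :+ u) := (con (+ 1) :+ u) :+ q) refl (quad b m) u) refl)
        (G-mono {+ 1 + u} {quad b m} (ε m) 0≤u (ℤP.≤-trans (quad-nn sm m) (e≤lead (quad b m) (ε m)))))))
      (≈-sym (⊗-⋆ (sg m) (mono (+ 1 + u)) (G (quad b m) (ε m)))))

  sec-lambert : ∀ t → ∣ t ∣ ℕ.≤ 10 → sec d (lambert a) ≈ˢ λ n →
    Σℤ (λ m → sec d (lambertTerm a (+ 5 * m + -[1+ 1 ] + t))) n + Σℤ (λ m → sec d (lambertTerm a (+ 5 * m + -[1+ 0 ] + t))) n + Σℤ (λ m → sec d (lambertTerm a (+ 5 * m + + 0 + t))) n
      + Σℤ (λ m → sec d (lambertTerm a (+ 5 * m + + 1 + t))) n + Σℤ (λ m → sec d (lambertTerm a (+ 5 * m + + 2 + t))) n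
  sec-lambert t t≤10 n = trans (sym (Σℤ-shift t (lambertTerm a) null₀ null (5 ℕ.* n ℕ.+ d))) (sec-Σℤ d≤4 null n)
    where
    null = lambertTerm-Null 0≤a a≤5 t t≤10
    null₀ : Null (lambertTerm a)
    null₀ i n h = trans (sym (cong (λ z → lambertTerm a z n) (ℤP.+-identityʳ i))) (lambertTerm-Null 0≤a a≤5 (+ 0) z≤n i n h)

  q-sum : ∀ {f g h j k f′ g′ h′ j′ k′ : Series} → q^ 1 ⊗ f ≈ˢ f′ → q^ 1 ⊗ g ≈ˢ g′ → q^ 1 ⊗ h ≈ˢ h′ → q^ 1 ⊗ j ≈ˢ j′ → q^ 1 ⊗ k ≈ˢ k′ →
          q^ 1 ⊗ (f ⊕ g ⊕ h ⊕ j ⊕ k) ≈ˢ f′ ⊕ g′ ⊕ h′ ⊕ j′ ⊕ k′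
  q-sum {f} {g} {h} {j} {k} p₁ p₂ p₃ p₄ p₅ = ≈-trans
    (𝕊.solve 6 (λ q f g h j k → q *: (f +: g +: h +: j +: k) =: q *: f +: q *: g +: q *: h +: q *: j +: q *: k) ≈-refl (q^ 1) f g h j k)
    (⊕-cong (⊕-cong (⊕-cong (⊕-cong p₁ p₂) p₃) p₄) p₅)

-- Translating the index by `- a` centres the residues: class `r` then leads to `T (a + a) b` with
-- `b = 2 r`, and all five `b` lie between - 4 and 4.
lambert₁-sections : ∀ {d} → d ℕ.≤ 4 → q^ 1 ⊗ sec d (lambert (+ 1)) ≈ˢ
  (q^ 3 d * -[1+ 0 ]) ⋆ (q^ 1 ⊗ T (+ 2) -[1+ 3 ]) ⊕ (q^ 0 d * + 1) ⋆ (q^ 1 ⊗ T (+ 2) -[1+ 1 ]) ⊕ (q^ 4 d * -[1+ 0 ]) ⋆ (one ⊗ T (+ 2) (+ 0))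
    ⊕ (q^ 0 d * + 1) ⋆ (q^ 1 ⊗ T (+ 2) (+ 2)) ⊕ (q^ 3 d * -[1+ 0 ]) ⋆ (q^ 1 ⊗ T (+ 2) (+ 4))
lambert₁-sections {d} d≤4 = ≈-trans (⊗-congˡ {q^ 1} (sec-lambert -[1+ 0 ] (s≤s z≤n)))
  (q-sum {piece -[1+ 1 ]} {piece -[1+ 0 ]} {piece (+ 0)} {piece (+ 1)} {piece (+ 2)}
    (part -[1+ 0 ] -[1+ 1 ] -[1+ 2 ] -[1+ 3 ] (+ 0) 3 refl refl refl (toWitness {a? = 3 ℕ.≤? 4} _) nn (small nn nn))
    (part -[1+ 0 ] -[1+ 0 ] -[1+ 1 ] -[1+ 1 ] (+ 0) 0 refl refl refl z≤n nn (small nn nn))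
    (part -[1+ 0 ] (+ 0) -[1+ 0 ] (+ 0) -[1+ 0 ] 4 refl refl refl ℕP.≤-refl nn (small nn nn))
    (part -[1+ 0 ] (+ 1) (+ 0) (+ 2) (+ 0) 0 refl refl refl z≤n nn (small nn nn))
    (part -[1+ 0 ] (+ 2) (+ 1) (+ 4) (+ 0) 3 refl refl refl (toWitness {a? = 3 ℕ.≤? 4} _) nn (small nn nn)))
  where
  open LambertSections {a = + 1} d≤4 nn nn
  piece : ℤ → Series
  piece r = Σℤ (λ m → sec d (lambertTerm (+ 1) (+ 5 * m + r + -[1+ 0 ])))

lambert₂-sections : ∀ {d} → d ℕ.≤ 4 → q^ 1 ⊗ sec d (lambert (+ 2)) ≈ˢ
  (q^ 0 d * + 1) ⋆ (q^ 1 ⊗ T (+ 4) -[1+ 3 ]) ⊕ (q^ 2 d * -[1+ 0 ]) ⋆ (one ⊗ T (+ 4) -[1+ 1 ]) ⊕ (q^ 1 d * + 1) ⋆ (one ⊗ T (+ 4) (+ 0))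
    ⊕ (q^ 2 d * -[1+ 0 ]) ⋆ (one ⊗ T (+ 4) (+ 2)) ⊕ (q^ 0 d * + 1) ⋆ (q^ 1 ⊗ T (+ 4) (+ 4))
lambert₂-sections {d} d≤4 = ≈-trans (⊗-congˡ {q^ 1} (sec-lambert -[1+ 1 ] (s≤s (s≤s z≤n))))
  (q-sum {piece -[1+ 1 ]} {piece -[1+ 0 ]} {piece (+ 0)} {piece (+ 1)} {piece (+ 2)}
    (part -[1+ 1 ] -[1+ 1 ] -[1+ 3 ] -[1+ 3 ] (+ 0) 0 refl refl refl z≤n nn (small nn nn))
    (part -[1+ 1 ] -[1+ 0 ] -[1+ 2 ] -[1+ 1 ] -[1+ 0 ] 2 refl refl refl (toWitness {a? = 2 ℕ.≤? 4} _) nn (small nn nn))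
    (part -[1+ 1 ] (+ 0) -[1+ 1 ] (+ 0) -[1+ 0 ] 1 refl refl refl (toWitness {a? = 1 ℕ.≤? 4} _) nn (small nn nn))
    (part -[1+ 1 ] (+ 1) -[1+ 0 ] (+ 2) -[1+ 0 ] 2 refl refl refl (toWitness {a? = 2 ℕ.≤? 4} _) nn (small nn nn))
    (part -[1+ 1 ] (+ 2) (+ 0) (+ 4) (+ 0) 0 refl refl refl z≤n nn (small nn nn)))
  where
  open LambertSections {a = + 2} d≤4 nn nn
  piece : ℤ → Series
  piece r = Σℤ (λ m → sec d (lambertTerm (+ 2) (+ 5 * m + r + -[1+ 1 ])))

-- The linear system for the R_st(d)

Θ : ℕ → Series
Θ b = ⟦ θₜ b ⟧ₜ

Θ-0 : ∀ b → Θ b 0 ≡ + 1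
Θ-0 b = trans (ℤP.*-identityˡ (+ 1 * monomial (θv b) 0)) (trans (ℤP.*-identityˡ (monomial (θv b) 0)) (Unit.at-0 (monomial-unit (θv b))))

Row : Series → Series → Series → Series
Row f g h = Θ 0 ⊗ f ⊖ (Θ 2 ⊗ g ⊕ Θ 2 ⊗ g) ⊕ (Θ 4 ⊗ h ⊕ Θ 4 ⊗ h)

Zero : Series → Set
Zero f = f ≈ˢ λ _ → + 0

-- The five sections of an equation φ f = s, with y = q x₄ in place of x₄.
record System (x₀ x₁ x₂ x₃ y s₀ s₁ s₂ s₃ s₄ : Series) : Set where
  constructor system
  field
    row₀ : Row x₀ y (q^ 1 ⊗ x₁) ≈ˢ s₀
    row₁ : Row x₁ x₀ (q^ 1 ⊗ x₂) ≈ˢ s₁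
    row₂ : Row x₂ x₁ (q^ 1 ⊗ x₃) ≈ˢ s₂
    row₃ : Row x₃ x₂ y ≈ˢ s₃
    row₄ : Row y (q^ 1 ⊗ x₃) (q^ 1 ⊗ x₀) ≈ˢ s₄

Row-⊖ : ∀ f g h f′ g′ h′ → Row (f ⊖ f′) (g ⊖ g′) (h ⊖ h′) ≈ˢ Row f g h ⊖ Row f′ g′ h′
Row-⊖ f g h f′ g′ h′ = 𝕊.solve 9 (λ t x y f g h f′ g′ h′ → t *: (f -: f′) -: (x *: (g -: g′) +: x *: (g -: g′)) +: (y *: (h -: h′) +: y *: (h -: h′))
  =: (t *: f -: (x *: g +: x *: g) +: (y *: h +: y *: h)) -: (t *: f′ -: (x *: g′ +: x *: g′) +: (y *: h′ +: y *: h′)))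
  ≈-refl (Θ 0) (Θ 2) (Θ 4) f g h f′ g′ h′

Below : ℕ → Series → Set
Below n f = ∀ k → k ℕ.< n → f k ≡ + 0

⊗-lowest : ∀ θ′ {n f} → Below n f → (θ′ ⊗ f) n ≡ θ′ 0 * f n
⊗-lowest θ′ {zero} below = refl
⊗-lowest θ′ {suc n} {f} below = trans (Σ≤-head n (λ i → θ′ i * f (suc n ℕ.∸ i))) (trans
  (cong (λ z → θ′ 0 * f (suc n) + z) (trans (Σ≤-cong n (λ i i≤n → trans (cong (λ z → θ′ (suc i) * z) (below (n ℕ.∸ i) (s≤s (ℕP.m∸n≤m n i)))) (ℤP.*-zeroʳ (θ′ (suc i))))) (Σ≤-0 n)))
  (ℤP.+-identityʳ (θ′ 0 * f (suc n))))

q⊗-lowest : ∀ {n f} → Below n f → (q^ 1 ⊗ f) n ≡ + 0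
q⊗-lowest {n} {f} below = trans (⊗-lowest (q^ 1) {n} {f} below) refl

Row-lowest : ∀ {n f g h} → Below n f → Below n g → Below n h → Row f g h n ≡ f n - (g n + g n) + (h n + h n)
Row-lowest {n} {f} {g} {h} bf bg bh = cong₂ _+_ (cong₂ _-_ (at f (Θ 0) (Θ-0 0) bf) (cong₂ _+_ (at g (Θ 2) (Θ-0 2) bg) (at g (Θ 2) (Θ-0 2) bg)))
  (cong₂ _+_ (at h (Θ 4) (Θ-0 4) bh) (at h (Θ 4) (Θ-0 4) bh))
  where
  at : ∀ f t → t 0 ≡ + 1 → Below n f → (t ⊗ f) n ≡ f n
  at f t t0 b = trans (⊗-lowest t b) (trans (cong (_* f n) t0) (ℤP.*-identityˡ (f n)))

module _ {x₀ x₁ x₂ x₃ y : Series} (S : System x₀ x₁ x₂ x₃ y (λ _ → + 0) (λ _ → + 0) (λ _ → + 0) (λ _ → + 0) (λ _ → + 0)) where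
  open System S

  record BelowAll (n : ℕ) : Set where
    constructor belowAll
    field
      b₀ : Below n x₀
      b₁ : Below n x₁
      b₂ : Below n x₂
      b₃ : Below n x₃
      by : Below n y

  step : ∀ {n} (f : Series) → Below n f → f n ≡ + 0 → Below (suc n) f
  step {n} f below fn k k<sn with ℕP.m≤n⇒m<n∨m≡n (ℕP.≤-pred k<sn)
  ... | inj₁ k<n = below k k<n
  ... | inj₂ refl = fn

  leading : ∀ {n f g h} → Below n f → Below n g → Below n h → Row f g h ≈ˢ (λ _ → + 0) → g n ≡ + 0 → h n ≡ + 0 → f n ≡ + 0
  leading {n} {f} {g} {h} bf bg bh row gn hn = trans (trans (ℤS.solve 1 (λ f → f := f :- (con (+ 0) :+ con (+ 0)) :+ (con (+ 0) :+ con (+ 0))) refl (f n))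
    (cong₂ (λ a b → f n - (a + a) + (b + b)) (sym gn) (sym hn))) (trans (sym (Row-lowest {n} {f} {g} {h} bf bg bh)) (row n))

  q-below : ∀ {n f} → Below n f → Below n (q^ 1 ⊗ f)
  q-below {n} {f} b k k<n = q⊗-lowest {k} {f} (λ j j<k → b j (ℕP.<-trans j<k k<n))

  -- At the lowest remaining coefficient every unknown multiplied by `q` drops out. The system
  -- becomes unitriangular in the order `y`, `x₀`, `x₁`, `x₂`, `x₃`.
  vanishing : ∀ n → BelowAll n
  vanishing zero = belowAll (λ _ ()) (λ _ ()) (λ _ ()) (λ _ ()) (λ _ ())
  vanishing (suc n) with vanishing n
  ... | belowAll b₀ b₁ b₂ b₃ by = belowAll (step x₀ b₀ z₀) (step x₁ b₁ z₁) (step x₂ b₂ z₂) (step x₃ b₃ z₃) (step y by zy)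
    where
    qz : ∀ f → Below n f → (q^ 1 ⊗ f) n ≡ + 0
    qz f b = q⊗-lowest {n} {f} b
    zy = leading {n} {y} {q^ 1 ⊗ x₃} {q^ 1 ⊗ x₀} by (q-below {n} {x₃} b₃) (q-below {n} {x₀} b₀) row₄ (qz x₃ b₃) (qz x₀ b₀)
    z₀ = leading {n} {x₀} {y} {q^ 1 ⊗ x₁} b₀ by (q-below {n} {x₁} b₁) row₀ zy (qz x₁ b₁)
    z₁ = leading {n} {x₁} {x₀} {q^ 1 ⊗ x₂} b₁ b₀ (q-below {n} {x₂} b₂) row₁ z₀ (qz x₂ b₂)
    z₂ = leading {n} {x₂} {x₁} {q^ 1 ⊗ x₃} b₂ b₁ (q-below {n} {x₃} b₃) row₂ z₁ (qz x₃ b₃)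
    z₃ = leading {n} {x₃} {x₂} {y} b₃ b₂ by row₃ z₂ zy

⊖-zero : ∀ {f g} → (∀ n → f n - g n ≡ + 0) → f ≈ˢ g
⊖-zero {f} {g} z n = ℤP.i-j≡0⇒i≡j (f n) (g n) (z n)

module Uniqueness {x₀ x₁ x₂ x₃ y x₀′ x₁′ x₂′ x₃′ y′ s₀ s₁ s₂ s₃ s₄ : Series}
                  (S : System x₀ x₁ x₂ x₃ y s₀ s₁ s₂ s₃ s₄) (S′ : System x₀′ x₁′ x₂′ x₃′ y′ s₀ s₁ s₂ s₃ s₄) where
  private
    module S = System S
    module S′ = System S′
    q⊖ : ∀ f g → q^ 1 ⊗ (f ⊖ g) ≈ˢ q^ 1 ⊗ f ⊖ q^ 1 ⊗ g
    q⊖ f g = 𝕊.solve 3 (λ q f g → q *: (f -: g) =: q *: f -: q *: g) ≈-refl (q^ 1) f g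
    Row-cong : ∀ f {g g′ h h′} → g ≈ˢ g′ → h ≈ˢ h′ → Row f g h ≈ˢ Row f g′ h′
    Row-cong f p q = ⊕-cong (⊖-cong (≈-refl {Θ 0 ⊗ f}) (⊕-cong (⊗-congˡ {Θ 2} p) (⊗-congˡ {Θ 2} p))) (⊕-cong (⊗-congˡ {Θ 4} q) (⊗-congˡ {Θ 4} q))
    equal : ∀ {f g s} → f ≈ˢ s → g ≈ˢ s → f ⊖ g ≈ˢ λ _ → + 0
    equal {f} {g} p q n = trans (cong (_- g n) (trans (p n) (sym (q n)))) (ℤP.+-inverseʳ (g n))
    difference : System (x₀ ⊖ x₀′) (x₁ ⊖ x₁′) (x₂ ⊖ x₂′) (x₃ ⊖ x₃′) (y ⊖ y′) (λ _ → + 0) (λ _ → + 0) (λ _ → + 0) (λ _ → + 0) (λ _ → + 0)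
    difference = system
      (≈-trans (Row-cong (x₀ ⊖ x₀′) (≈-refl {y ⊖ y′}) (q⊖ x₁ x₁′)) (≈-trans (Row-⊖ x₀ y (q^ 1 ⊗ x₁) x₀′ y′ (q^ 1 ⊗ x₁′)) (equal S.row₀ S′.row₀)))
      (≈-trans (Row-cong (x₁ ⊖ x₁′) (≈-refl {x₀ ⊖ x₀′}) (q⊖ x₂ x₂′)) (≈-trans (Row-⊖ x₁ x₀ (q^ 1 ⊗ x₂) x₁′ x₀′ (q^ 1 ⊗ x₂′)) (equal S.row₁ S′.row₁)))
      (≈-trans (Row-cong (x₂ ⊖ x₂′) (≈-refl {x₁ ⊖ x₁′}) (q⊖ x₃ x₃′)) (≈-trans (Row-⊖ x₂ x₁ (q^ 1 ⊗ x₃) x₂′ x₁′ (q^ 1 ⊗ x₃′)) (equal S.row₂ S′.row₂)))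
      (≈-trans (Row-⊖ x₃ x₂ y x₃′ x₂′ y′) (equal S.row₃ S′.row₃))
      (≈-trans (Row-cong (y ⊖ y′) (q⊖ x₃ x₃′) (q⊖ x₀ x₀′)) (≈-trans (Row-⊖ y (q^ 1 ⊗ x₃) (q^ 1 ⊗ x₀) y′ (q^ 1 ⊗ x₃′) (q^ 1 ⊗ x₀′)) (equal S.row₄ S′.row₄)))
    open module B n = BelowAll (vanishing difference (suc n))

  unique₀ : x₀ ≈ˢ x₀′
  unique₀ = ⊖-zero (λ n → b₀ n n ℕP.≤-refl)
  unique₁ : x₁ ≈ˢ x₁′
  unique₁ = ⊖-zero (λ n → b₁ n n ℕP.≤-refl)
  unique₂ : x₂ ≈ˢ x₂′
  unique₂ = ⊖-zero (λ n → b₂ n n ℕP.≤-refl)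
  unique₃ : x₃ ≈ˢ x₃′
  unique₃ = ⊖-zero (λ n → b₃ n n ℕP.≤-refl)
  unique-y : y ≈ˢ y′
  unique-y = ⊖-zero (λ n → by n n ℕP.≤-refl)

-- The bilateral sums of the theorem as Appell sums

-1^ : ∀ n → (- + 1) ℤ.^ n ≡ sg (+ n)
-1^ zero = refl
-1^ (suc n) = trans (cong (λ z → (- + 1) * z) (-1^ n)) (trans (ℤP.-1*i≡-i (sg (+ n))) (trans (sym (sg-suc (+ n))) (cong (λ z → sg (+ z)) (ℕP.+-comm n 1))))

5m²-bound : ∀ {a} k → a ℕ.≤ 4 → suc k ℕ.+ a ℕ.≤ 5 ℕ.* suc k ℕ.* suc k
5m²-bound {a} k a≤4 = ℕP.≤-trans (ℕP.+-monoʳ-≤ (suc k) a≤4) (ℕP.≤-trans (ℕP.m≤m+n (suc k ℕ.+ 4) (9 ℕ.* k ℕ.+ 5 ℕ.* k ℕ.* k))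
  (ℕP.≤-reflexive (N.solve 1 (λ k → (N.con 1 N.:+ k) N.:+ N.con 4 N.:+ (N.con 9 N.:* k N.:+ N.con 5 N.:* k N.:* k) N.:= N.con 5 N.:* (N.con 1 N.:+ k) N.:* (N.con 1 N.:+ k)) refl k)))

bilTerm-Ord : ∀ {a} → a ℕ.≤ 4 → ∀ i → Ord (+ ∣ i ∣) (bilTerm a i)
bilTerm-Ord {a} a≤4 (+ n) = Ord-⋆ ((- + 1) ℤ.^ n) (Ord-≤ (ℤ.+≤+ (ℕP.≤-trans (ℕP.m≤n*m n 10) (ℕP.m≤n+m (10 ℕ.* n) (5 ℕ.* n ℕ.* n))))
  (Ord-⊗ (Ord-mono (+ (5 ℕ.* n ℕ.* n ℕ.+ 10 ℕ.* n))) (inv (one ⊖ q^ (10 ℕ.* n ℕ.+ a)))))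
bilTerm-Ord {a} a≤4 -[1+ k ] = Ord-⋆ (- ((- + 1) ℤ.^ suc k)) (Ord-≤ (ℤ.+≤+ (ℕP.m+n≤o⇒m≤o∸n (suc k) (5m²-bound k a≤4)))
  (Ord-⊗ (Ord-mono (+ (5 ℕ.* suc k ℕ.* suc k ℕ.∸ a))) (inv (one ⊖ q^ (10 ℕ.* suc k ℕ.∸ a)))))

bilTerm-Null : ∀ {a} → a ℕ.≤ 4 → Null (bilTerm a)
bilTerm-Null a≤4 = Null-by (λ i → + ∣ i ∣) (bilTerm-Ord a≤4) (λ i → ≤-by (+ 10) nn refl)

S-sumZ : ∀ a N → S a N ≡ sumZ N (λ i → bilTerm a i N)
S-sumZ a N = trans (S-expand a N) (go N)
  where
  go : ∀ k → bilTerm a (+ 0) N + S-partial a N k ≡ sumZ k (λ i → bilTerm a i N)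
  go zero = ℤP.+-identityʳ (bilTerm a (+ 0) N)
  go (suc k) = trans (sym (ℤP.+-assoc (bilTerm a (+ 0) N) (S-partial a N k) (bilTerm a (+ suc k) N + bilTerm a -[1+ k ] N)))
    (cong (_+ (bilTerm a (+ suc k) N + bilTerm a -[1+ k ] N)) (go k))

S-Σℤ : ∀ {a} → a ℕ.≤ 4 → S a ≈ˢ Σℤ (bilTerm a)
S-Σℤ {a} a≤4 n = trans (S-sumZ a n) (sym (sumZ-extend (λ i n<i → bilTerm-Ord a≤4 i n (ℤ.+<+ n<i)) (n ℕ.+ 10) (ℕP.m≤m+n n 10)))

∸-suc : ∀ {m n} → m ℕ.< n → n ℕ.∸ m ≡ suc (n ℕ.∸ suc m)
∸-suc {zero} {suc n} _ = refl
∸-suc {suc m} {suc n} (s≤s m<n) = ∸-suc m<n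

-- The summand of `S` at `- i` has denominator `1 - q^(- ε)`, where `ε = 10 i - a` is the exponent
-- in `T-term`. `G-flip` explains the sign, and the factor `q^a` compensates for the linear term of
-- the exponent.
bilTerm-T : ∀ a′ → suc a′ ℕ.≤ 4 → ∀ i → q^ (suc a′) ⊗ bilTerm (suc a′) (- i) ≈ˢ ⊝ T-term (+ suc a′) (+ 0) i
bilTerm-T a′ a≤4 i = ≈-trans (flip (- i)) (λ n → cong (λ z → - T-term (+ suc a′) (+ 0) z n) (ℤP.neg-involutive i))
  where
  a = suc a′
  exponent : ∀ n m → n * n ≡ + m * + m → quad (+ 0) n ≡ + (5 ℕ.* m ℕ.* m)
  exponent n m sq = trans (ℤS.solve 1 (λ n → con (+ 5) :* n :* n :+ con (+ 0) :* n := con (+ 5) :* (n :* n)) refl n)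
    (trans (cong (λ z → + 5 * z) (trans sq (sym (ℤP.pos-* m m)))) (trans (sym (ℤP.pos-* 5 (m ℕ.* m))) (cong +_ (sym (ℕP.*-assoc 5 m m)))))
  flip : ∀ i → q^ a ⊗ bilTerm a i ≈ˢ ⊝ T-term (+ a) (+ 0) (- i)
  flip (+ n) = begin
    q^ a ⊗ (((- + 1) ℤ.^ n) ⋆ (q^ (E ℕ.+ 10 ℕ.* n) ⊗ inv (one ⊖ q^ (10 ℕ.* n ℕ.+ a))))
      ≈⟨ ⊗-⋆ ((- + 1) ℤ.^ n) (q^ a) (q^ (E ℕ.+ 10 ℕ.* n) ⊗ inv (one ⊖ q^ (10 ℕ.* n ℕ.+ a))) ⟩
    ((- + 1) ℤ.^ n) ⋆ (q^ a ⊗ (q^ (E ℕ.+ 10 ℕ.* n) ⊗ inv (one ⊖ q^ (10 ℕ.* n ℕ.+ a))))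
      ≈⟨ ⋆-cong (trans (-1^ n) (sym (sg-neg (+ n)))) (≈-trans (≈-sym (⊗-assoc (q^ a) (q^ (E ℕ.+ 10 ℕ.* n)) (inv (one ⊖ q^ (10 ℕ.* n ℕ.+ a)))))
           (⊗-cong (λ m → trans (q^-+ a (E ℕ.+ 10 ℕ.* n) m) (cong (λ z → q^ z m) (N.solve 3 (λ a e n → (N.con 1 N.:+ a) N.:+ (e N.:+ n) N.:= e N.:+ (N.con 1 N.:+ (n N.:+ a))) refl a′ E (10 ℕ.* n))))
             (λ m → cong (λ z → inv (one ⊖ q^ z) m) (ℕP.+-suc (10 ℕ.* n) a′)))) ⟩
    sg (- + n) ⋆ (mono (+ E + + suc g) ⊗ geo g)
      ≈⟨ 𝕊.solve 1 (λ x → x =: -: (-: x)) ≈-refl (sg (- + n) ⋆ (mono (+ E + + suc g) ⊗ geo g)) ⟩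
    ⊝ (⊝ (sg (- + n) ⋆ (mono (+ E + + suc g) ⊗ geo g)))
      ≈⟨ ⊝-cong (≈-sym (⋆⊝ (sg (- + n)) (mono (+ E + + suc g) ⊗ geo g))) ⟩
    ⊝ (sg (- + n) ⋆ G (+ E) -[1+ g ])
      ≈⟨ ⊝-cong (⋆-cong {sg (- + n)} refl (G-cong (sym (exponent (- + n) n (ℤS.solve 1 (λ n → (:- n) :* (:- n) := n :* n) refl (+ n)))) (sym pole))) ⟩
    ⊝ T-term (+ a) (+ 0) (- + n) ∎
    where
    open SetoidReasoning seriesSetoid
    E = 5 ℕ.* n ℕ.* n
    g = 10 ℕ.* n ℕ.+ a′
    pole : + 10 * (- + n) + (+ 0 - + a) ≡ -[1+ g ]
    pole = trans (ℤS.solve 2 (λ n a → con (+ 10) :* (:- n) :+ (con (+ 0) :- a) := :- (con (+ 10) :* n :+ a)) refl (+ n) (+ a))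
      (cong -_ (trans (cong (_+ + a) (sym (ℤP.pos-* 10 n))) (cong +_ (ℕP.+-suc (10 ℕ.* n) a′))))
  flip -[1+ k ] = begin
    q^ a ⊗ ((- ((- + 1) ℤ.^ m)) ⋆ (q^ (E ℕ.∸ a) ⊗ inv (one ⊖ q^ (10 ℕ.* m ℕ.∸ a))))
      ≈⟨ ⊗-⋆ (- ((- + 1) ℤ.^ m)) (q^ a) (q^ (E ℕ.∸ a) ⊗ inv (one ⊖ q^ (10 ℕ.* m ℕ.∸ a))) ⟩
    (- ((- + 1) ℤ.^ m)) ⋆ (q^ a ⊗ (q^ (E ℕ.∸ a) ⊗ inv (one ⊖ q^ (10 ℕ.* m ℕ.∸ a))))
      ≈⟨ ⋆-cong (cong -_ (-1^ m)) (≈-trans (≈-sym (⊗-assoc (q^ a) (q^ (E ℕ.∸ a)) (inv (one ⊖ q^ (10 ℕ.* m ℕ.∸ a)))))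
           (⊗-cong (λ n → trans (q^-+ a (E ℕ.∸ a) n) (cong (λ z → q^ z n) (ℕP.m+[n∸m]≡n a≤E))) (λ n → cong (λ z → inv (one ⊖ q^ z) n) (∸-suc a<10m)))) ⟩
    (- sg (+ m)) ⋆ (mono (+ E) ⊗ geo g)
      ≈⟨ (λ n → sym (ℤP.neg-distribˡ-* (sg (+ m)) ((mono (+ E) ⊗ geo g) n))) ⟩
    ⊝ (sg (+ m) ⋆ G (+ E) (+ suc g))
      ≈⟨ ⊝-cong (⋆-cong {sg (+ m)} refl (G-cong (sym (exponent (+ m) m refl)) (sym pole))) ⟩
    ⊝ T-term (+ a) (+ 0) (+ m) ∎
    where
    open SetoidReasoning seriesSetoid
    m = suc k
    E = 5 ℕ.* m ℕ.* m
    g = 10 ℕ.* m ℕ.∸ suc a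
    a≤E : a ℕ.≤ E
    a≤E = ℕP.≤-trans (ℕP.m≤n+m a m) (5m²-bound k a≤4)
    a<10m : a ℕ.< 10 ℕ.* m
    a<10m = ℕP.≤-trans (s≤s a≤4) (ℕP.≤-trans (toWitness {a? = 5 ℕ.≤? 10} _) (ℕP.m≤m*n 10 m))
    pole : + 10 * + m + (+ 0 - + a) ≡ + suc g
    pole = trans (cong₂ _+_ (sym (ℤP.pos-* 10 m)) (ℤP.+-identityˡ (- + a))) (trans (ℤP.m-n≡m⊖n (10 ℕ.* m) a)
      (trans (ℤP.⊖-≥ (ℕP.<⇒≤ a<10m)) (cong +_ (∸-suc a<10m))))

S-T : ∀ a′ → suc a′ ℕ.≤ 4 → q^ (suc a′) ⊗ S (suc a′) ≈ˢ ⊝ T (+ suc a′) (+ 0)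
S-T a′ a≤4 = ≈-trans (⊗-congˡ {q^ (suc a′)} (≈-trans (S-Σℤ a≤4) (≈-sym (Σℤ-reflect (bilTerm (suc a′))))))
  (≈-trans (⊗-Σℤ null (q^ (suc a′))) (≈-trans (Σℤ-cong (bilTerm-T a′ a≤4)) (Σℤ-⊝ (T-term (+ suc a′) (+ 0)))))
  where
  null : Null (λ i → bilTerm (suc a′) (- i))
  null i n h = bilTerm-Null a≤4 (- i) n (≡.subst (n ℕ.+ 10 ℕ.<_) (sym (ℤP.∣-i∣≡∣i∣ i)) h)

-- The Appell part that occurs in `R_st(1)` for `a = 4` and, up to the outer power of `q`, in
-- `R_st(4)` for `a = 2`.
mock : ℕ → Series
mock a = (q^ (a ℕ.∸ 1) ⊗ Pn 5 5 ⊗ S a) ÷ P 5 5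

-- The prefactor of the bilateral sum is the reciprocal of `θ₀`, because
-- `(q^5; q^5)_∞ / (-q^5; q^5)_∞` is `(q^5, q^5, q^10; q^10)_∞`.
θ₀-mock : ∀ a′ → suc a′ ℕ.≤ 4 → θ (+ 0) ⊗ (q^ 1 ⊗ mock (suc a′)) ≈ˢ ⊝ T (+ suc a′) (+ 0)
θ₀-mock a′ a≤4 = begin
  θ (+ 0) ⊗ (q^ 1 ⊗ ((q^ a′ ⊗ Pn 5 5 ⊗ S a) ⊗ inv (P 5 5)))
    ≈⟨ 𝕊.solve 6 (λ t q r n s p → t *: (q *: ((r *: n *: s) *: p)) =: (t *: (n *: p)) *: ((q *: r) *: s)) ≈-refl (θ (+ 0)) (q^ 1) (q^ a′) (Pn 5 5) (S a) (inv (P 5 5)) ⟩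
  (θ (+ 0) ⊗ (Pn 5 5 ÷ P 5 5)) ⊗ ((q^ 1 ⊗ q^ a′) ⊗ S a)
    ≈⟨ ⊗-cong trivial (⊗-congʳ {S a} (q^-+ 1 a′)) ⟩
  one ⊗ (q^ a ⊗ S a)
    ≈⟨ ≈-trans (⊗-identityˡ (q^ a ⊗ S a)) (S-T a′ a≤4) ⟩
  ⊝ T (+ a) (+ 0) ∎
  where
  open SetoidReasoning seriesSetoid
  a = suc a′
  trivial : θ (+ 0) ⊗ (Pn 5 5 ÷ P 5 5) ≈ˢ one
  trivial = ≈-trans (⊗-congʳ {Pn 5 5 ÷ P 5 5} (θ-term (+ 0))) (≈-trans (expand-sound (⟨ θₜ 0 ⟩ₜ ⊠ (⟨ n55 ⟩ ⧄ p55))) (λ n → trans (ℤP.+-identityʳ (⟦ term (+ 1) 0 0ᵛ ⟧ₜ n)) (oneₜ n)))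

Zero-⊕ : ∀ {f g} → Zero f → Zero g → Zero (f ⊕ g)
Zero-⊕ z w n = cong₂ _+_ (z n) (w n)

multiple : ∀ c {f g} → f ≈ˢ g → Zero (c ⊗ (f ⊖ g))
multiple c {f} {g} p = ≈-trans (⊗-congˡ {c} (λ n → trans (cong (_- g n) (p n)) (ℤP.+-inverseʳ (g n)))) (⊗-zeroʳ c)

modulo : ∀ {f g z} → f ≈ˢ g ⊕ z → Zero z → f ≈ˢ g
modulo {g = g} p z n = trans (p n) (trans (cong (λ w → g n + w) (z n)) (ℤP.+-identityʳ (g n)))

T₂₀ T₂₂ T₂₄ T₂₋₂ T₂₋₄ T₄₀ T₄₂ T₄₄ T₄₋₂ T₄₋₄ : Series
T₂₀ = T (+ 2) (+ 0)
T₂₂ = T (+ 2) (+ 2)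
T₂₄ = T (+ 2) (+ 4)
T₂₋₂ = T (+ 2) -[1+ 1 ]
T₂₋₄ = T (+ 2) -[1+ 3 ]
T₄₀ = T (+ 4) (+ 0)
T₄₂ = T (+ 4) (+ 2)
T₄₄ = T (+ 4) (+ 4)
T₄₋₂ = T (+ 4) -[1+ 1 ]
T₄₋₄ = T (+ 4) -[1+ 3 ]

K-Θ : ∀ b T₁ T₀ {k : Series} → {_ : True (∣ b ∣ ℕ.≤? 4)} → θ (+ 0) ⊗ T₁ ⊖ θ b ⊗ T₀ ≈ˢ k → Θ 0 ⊗ T₁ ⊖ Θ ∣ b ∣ ⊗ T₀ ≈ˢ k
K-Θ b T₁ T₀ {_} {h} p = ≈-trans (⊖-cong (⊗-congʳ {T₁} (≈-sym (θ-term (+ 0)))) (⊗-congʳ {T₀} (≈-sym (θ-term b {h})))) p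

Θ₀-unit : Unit (Θ 0)
Θ₀-unit = is-unit (Θ-0 0)

Θ₀-mock : ∀ a′ → suc a′ ℕ.≤ 4 → Θ 0 ⊗ (q^ 1 ⊗ mock (suc a′)) ≈ˢ ⊝ T (+ suc a′) (+ 0)
Θ₀-mock a′ h = ≈-trans (⊗-congʳ {q^ 1 ⊗ mock (suc a′)} (≈-sym (θ-term (+ 0)))) (θ₀-mock a′ h)

module Solution (A B C r₀ r₁ r₂ r₃ p₄ ℓ : Series)
  (h₀ : Θ 0 ⊗ Row r₀ p₄ (q^ 1 ⊗ r₁) ≈ˢ A ⊗ ⟦ k₂₋₂ ⟧ₜ ⊕ B ⊗ ⟦ k₄₋₄ ⟧ₜ ⊕ Θ 0 ⊗ ℓ)
  (hℓ : ℓ ≈ˢ A ⊗ L₂ ⊕ B ⊗ L₄ ⊕ C)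
  (h₁ : Zero (Row r₁ r₀ (q^ 1 ⊗ r₂)))
  (h₂ : q^ 1 ⊗ (Θ 0 ⊗ Row r₂ r₁ (q^ 1 ⊗ r₃)) ≈ˢ ⊝ (B ⊗ (⟦ k₄₂ ⟧ₜ ⊕ ⟦ k₄₋₂ ⟧ₜ)))
  (h₃ : Θ 0 ⊗ Row r₃ r₂ p₄ ≈ˢ ⊝ (A ⊗ (⟦ k₂₄ ⟧ₜ ⊕ ⟦ k₂₋₄ ⟧ₜ)))
  (h₄ : Zero (Row p₄ (q^ 1 ⊗ r₃) (q^ 1 ⊗ r₀))) where

  -- Appell parts are placed at `d = 1` and `d = 4` only, since these are the sections whose right
  -- sides are a single `T (+ 4) (+ 0)` or `T (+ 2) (+ 0)`.
  x₁ y m₂ m₄ : Series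
  m₂ = mock 2
  m₄ = mock 4
  x₁ = r₁ ⊖ B ⊗ m₄
  y = p₄ ⊕ A ⊗ (q^ 1 ⊗ m₂)

  private
    μ₂ : Θ 0 ⊗ (q^ 1 ⊗ m₂) ≈ˢ ⊝ T₂₀
    μ₂ = Θ₀-mock 1 (s≤s (s≤s z≤n))
    μ₄ : Θ 0 ⊗ (q^ 1 ⊗ m₄) ≈ˢ ⊝ T₄₀
    μ₄ = Θ₀-mock 3 ℕP.≤-refl

  -- After multiplication by `θ₀`, each Appell sum is replaced through an instance of `K` or `K⁰`,
  -- and the sums `T c (+ 0)` that this produces cancel against `mock`. The Lambert series left over
  -- by `K⁰₂` and `K⁰₄` are collected in `ℓ`.
  row₀ : Row r₀ y (q^ 1 ⊗ x₁) ≈ˢ A ⊗ (T₂₋₂ ⊕ T₂₂) ⊕ B ⊗ (T₄₋₄ ⊕ T₄₄) ⊕ C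
  row₀ = ⊗-cancelˡ Θ₀-unit (Row r₀ y (q^ 1 ⊗ x₁)) (A ⊗ (T₂₋₂ ⊕ T₂₂) ⊕ B ⊗ (T₄₋₄ ⊕ T₄₄) ⊕ C) (modulo
    (𝕊.solve 23 (λ t x y q A B C r₀ r₁ p₄ m₂ m₄ T₀ T₋ T₊ U₀ U₋ U₊ ℓ L M k l →
      t *: (t *: r₀ -: (x *: (p₄ +: A *: (q *: m₂)) +: x *: (p₄ +: A *: (q *: m₂))) +: (y *: (q *: (r₁ -: B *: m₄)) +: y *: (q *: (r₁ -: B *: m₄))))
      =: t *: (A *: (T₋ +: T₊) +: B *: (U₋ +: U₊) +: C)
        +: (1: *: (t *: (t *: r₀ -: (x *: p₄ +: x *: p₄) +: (y *: (q *: r₁) +: y *: (q *: r₁))) -: (A *: k +: B *: l +: t *: ℓ))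
        +: t *: (ℓ -: (A *: L +: B *: M +: C))
        +: (-: ((x +: x) *: A)) *: (t *: (q *: m₂) -: (-: T₀))
        +: (-: ((y +: y) *: B)) *: (t *: (q *: m₄) -: (-: U₀))
        +: (-: A) *: ((t *: T₋ -: x *: T₀) -: k)
        +: (-: A) *: ((t *: T₊ -: x *: T₀) -: t *: L)
        +: (-: B) *: ((t *: U₋ -: y *: U₀) -: l)
        +: (-: B) *: ((t *: U₊ -: y *: U₀) -: t *: M)))
      ≈-refl (Θ 0) (Θ 2) (Θ 4) (q^ 1) A B C r₀ r₁ p₄ m₂ m₄ T₂₀ T₂₋₂ T₂₂ T₄₀ T₄₋₄ T₄₄ ℓ L₂ L₄ ⟦ k₂₋₂ ⟧ₜ ⟦ k₄₋₄ ⟧ₜ)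
    (Zero-⊕ (Zero-⊕ (Zero-⊕ (Zero-⊕ (Zero-⊕ (Zero-⊕ (Zero-⊕ (multiple (𝕊.int (+ 1)) h₀) (multiple (Θ 0) hℓ)) (multiple (⊝ ((Θ 2 ⊕ Θ 2) ⊗ A)) μ₂)) (multiple (⊝ ((Θ 4 ⊕ Θ 4) ⊗ B)) μ₄))
      (multiple (⊝ A) (K-Θ (+ 2) T₂₋₂ T₂₀ K₂₋₂))) (multiple (⊝ A) (K-Θ (+ 2) T₂₂ T₂₀ (≈-trans K⁰₂ (⊗-congʳ {L₂} (θ-term (+ 0))))))) (multiple (⊝ B) (K-Θ (+ 4) T₄₋₄ T₄₀ K₄₋₄))) (multiple (⊝ B) (K-Θ (+ 4) T₄₄ T₄₀ (≈-trans K⁰₄ (⊗-congʳ {L₄} (θ-term (+ 0))))))))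

  row₁ : q^ 1 ⊗ Row x₁ r₀ (q^ 1 ⊗ r₂) ≈ˢ B ⊗ T₄₀
  row₁ = modulo
    (𝕊.solve 10 (λ t x y q B r₁ r₀ r₂ m U₀ →
      q *: (t *: (r₁ -: B *: m) -: (x *: r₀ +: x *: r₀) +: (y *: (q *: r₂) +: y *: (q *: r₂)))
      =: B *: U₀ +: (q *: ((t *: r₁ -: (x *: r₀ +: x *: r₀) +: (y *: (q *: r₂) +: y *: (q *: r₂))) -: con: (+ 0))
        +: (-: B) *: (t *: (q *: m) -: (-: U₀))))
      ≈-refl (Θ 0) (Θ 2) (Θ 4) (q^ 1) B r₁ r₀ r₂ m₄ T₄₀)
    (Zero-⊕ (multiple (q^ 1) {g = 𝕊.int (+ 0)} h₁) (multiple (⊝ B) μ₄))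

  row₂ : q^ 1 ⊗ Row r₂ x₁ (q^ 1 ⊗ r₃) ≈ˢ ⊝ (B ⊗ (T₄₋₂ ⊕ T₄₂))
  row₂ = ⊗-cancelˡ Θ₀-unit (q^ 1 ⊗ Row r₂ x₁ (q^ 1 ⊗ r₃)) (⊝ (B ⊗ (T₄₋₂ ⊕ T₄₂))) (modulo
    (𝕊.solve 14 (λ t x y q B r₂ r₁ r₃ m U₀ U₋ U₊ k l →
      t *: (q *: (t *: r₂ -: (x *: (r₁ -: B *: m) +: x *: (r₁ -: B *: m)) +: (y *: (q *: r₃) +: y *: (q *: r₃))))
      =: t *: (-: (B *: (U₋ +: U₊)))
        +: (1: *: (q *: (t *: (t *: r₂ -: (x *: r₁ +: x *: r₁) +: (y *: (q *: r₃) +: y *: (q *: r₃)))) -: (-: (B *: (k +: l))))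
        +: ((x +: x) *: B) *: (t *: (q *: m) -: (-: U₀))
        +: B *: ((t *: U₊ -: x *: U₀) -: k)
        +: B *: ((t *: U₋ -: x *: U₀) -: l)))
      ≈-refl (Θ 0) (Θ 2) (Θ 4) (q^ 1) B r₂ r₁ r₃ m₄ T₄₀ T₄₋₂ T₄₂ ⟦ k₄₂ ⟧ₜ ⟦ k₄₋₂ ⟧ₜ)
    (Zero-⊕ (Zero-⊕ (Zero-⊕ (multiple (𝕊.int (+ 1)) h₂) (multiple ((Θ 2 ⊕ Θ 2) ⊗ B) μ₄)) (multiple B (K-Θ (+ 2) T₄₂ T₄₀ K₄₂))) (multiple B (K-Θ (+ 2) T₄₋₂ T₄₀ K₄₋₂))))

  row₃ : Row r₃ r₂ y ≈ˢ ⊝ (A ⊗ (T₂₋₄ ⊕ T₂₄))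
  row₃ = ⊗-cancelˡ Θ₀-unit (Row r₃ r₂ y) (⊝ (A ⊗ (T₂₋₄ ⊕ T₂₄))) (modulo
    (𝕊.solve 14 (λ t x y q A r₃ r₂ p₄ m T₀ T₋ T₊ k l →
      t *: (t *: r₃ -: (x *: r₂ +: x *: r₂) +: (y *: (p₄ +: A *: (q *: m)) +: y *: (p₄ +: A *: (q *: m))))
      =: t *: (-: (A *: (T₋ +: T₊)))
        +: (1: *: (t *: (t *: r₃ -: (x *: r₂ +: x *: r₂) +: (y *: p₄ +: y *: p₄)) -: (-: (A *: (k +: l))))
        +: ((y +: y) *: A) *: (t *: (q *: m) -: (-: T₀))
        +: A *: ((t *: T₊ -: y *: T₀) -: k)
        +: A *: ((t *: T₋ -: y *: T₀) -: l)))
      ≈-refl (Θ 0) (Θ 2) (Θ 4) (q^ 1) A r₃ r₂ p₄ m₂ T₂₀ T₂₋₄ T₂₄ ⟦ k₂₄ ⟧ₜ ⟦ k₂₋₄ ⟧ₜ)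
    (Zero-⊕ (Zero-⊕ (Zero-⊕ (multiple (𝕊.int (+ 1)) h₃) (multiple ((Θ 4 ⊕ Θ 4) ⊗ A) μ₂)) (multiple A (K-Θ (+ 4) T₂₄ T₂₀ K₂₄))) (multiple A (K-Θ (+ 4) T₂₋₄ T₂₀ K₂₋₄))))

  row₄ : Row y (q^ 1 ⊗ r₃) (q^ 1 ⊗ r₀) ≈ˢ ⊝ (A ⊗ T₂₀)
  row₄ = modulo
    (𝕊.solve 10 (λ t x y q A p₄ r₃ r₀ m T₀ →
      t *: (p₄ +: A *: (q *: m)) -: (x *: (q *: r₃) +: x *: (q *: r₃)) +: (y *: (q *: r₀) +: y *: (q *: r₀))
      =: -: (A *: T₀) +: (1: *: ((t *: p₄ -: (x *: (q *: r₃) +: x *: (q *: r₃)) +: (y *: (q *: r₀) +: y *: (q *: r₀))) -: con: (+ 0))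
        +: A *: (t *: (q *: m) -: (-: T₀))))
      ≈-refl (Θ 0) (Θ 2) (Θ 4) (q^ 1) A p₄ r₃ r₀ m₂ T₂₀)
    (Zero-⊕ (multiple (𝕊.int (+ 1)) {g = 𝕊.int (+ 0)} h₄) (multiple A μ₂))

-- Turns scalars into ring elements, so that the coefficients of a rank equation can be variables
-- for the solver.
⋆-int : ∀ c f → c ⋆ f ≈ˢ 𝕊.int c ⊗ f
⋆-int (+ n) f = go n
  where
  go : ∀ n → (+ n) ⋆ f ≈ˢ 𝕊.nat n ⊗ f
  go zero = ≈-sym (⊗-zeroˡ f)
  go (suc n) = ≈-trans (λ m → trans (ℤS.solve 2 (λ n f → (con (+ 1) :+ n) :* f := f :+ n :* f) refl (+ n) (f m)) (cong (λ z → f m + z) (go n m)))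
    (≈-trans (𝕊.solve 2 (λ n f → f +: n *: f =: (1: +: n) *: f) ≈-refl (𝕊.nat n) f) (⊗-congʳ {f} (≈-sym (𝕊.nat-suc n))))
⋆-int -[1+ n ] f = ≈-trans (λ m → trans (sym (ℤP.neg-distribˡ-* (+ suc n) (f m))) (cong -_ (⋆-int (+ suc n) f m)))
  (𝕊.solve 2 (λ n f → -: (n *: f) =: (-: n) *: f) ≈-refl (𝕊.nat (suc n)) f)

int-⋆ : ∀ c → 𝕊.int c ≈ˢ c ⋆ one
int-⋆ c = ≈-trans (≈-sym (⊗-identityʳ (𝕊.int c))) (≈-sym (⋆-int c one))

q^-shift : ∀ s F m → (q^ s ⊗ F) (s ℕ.+ m) ≡ F m
q^-shift zero F m = ⊗-identityˡ F m
q^-shift (suc s) F m = trans (q^-suc-⊗ s F (s ℕ.+ m)) (q^-shift s F m)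

sec-q^⊗ : ∀ s d F → sec (s ℕ.+ d) (q^ s ⊗ F) ≈ˢ sec d F
sec-q^⊗ s d F n = trans (cong (q^ s ⊗ F) (N.solve 3 (λ a s d → a N.:+ (s N.:+ d) N.:= s N.:+ (a N.:+ d)) refl (5 ℕ.* n) s d)) (q^-shift s F (5 ℕ.* n ℕ.+ d))

-- Subtracting `s` from `5 n + d` with `d < s` borrows a 5, which becomes the factor `q`.
sec-q^⊗-carry : ∀ {s d} d′ → d ℕ.< s → 5 ℕ.+ d ≡ s ℕ.+ d′ → ∀ F → sec d (q^ s ⊗ F) ≈ˢ q^ 1 ⊗ sec d′ F
sec-q^⊗-carry {s} {d} d′ d<s eq F zero = trans (Ord-⊗ {+ s} {q^ s} (Ord-mono (+ s)) F d (ℤ.+<+ d<s)) (sym (Ord-⊗ {+ 1} {q^ 1} (Ord-mono (+ 1)) (sec d′ F) 0 (ℤ.+<+ (s≤s z≤n))))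
sec-q^⊗-carry {s} {d} d′ d<s eq F (suc n) = trans (cong (q^ s ⊗ F) index) (trans (q^-shift s F (5 ℕ.* n ℕ.+ d′))
  (sym (trans (q^-suc-⊗ 0 (sec d′ F) n) (⊗-identityˡ (sec d′ F) n))))
  where
  index : 5 ℕ.* suc n ℕ.+ d ≡ s ℕ.+ (5 ℕ.* n ℕ.+ d′)
  index = trans (5*suc n d) (trans (N.solve 2 (λ a d → N.con 5 N.:+ (a N.:+ d) N.:= a N.:+ (N.con 5 N.:+ d)) refl (5 ℕ.* n) d)
    (trans (cong (λ z → 5 ℕ.* n ℕ.+ z) eq) (N.solve 3 (λ a s d → a N.:+ (s N.:+ d) N.:= s N.:+ (a N.:+ d)) refl (5 ℕ.* n) s d′)))

Row-cong : ∀ f {g g′ h h′} → g ≈ˢ g′ → h ≈ˢ h′ → Row f g h ≈ˢ Row f g′ h′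
Row-cong f p q = ⊕-cong (⊖-cong (≈-refl {Θ 0 ⊗ f}) (⊕-cong (⊗-congˡ {Θ 2} p) (⊗-congˡ {Θ 2} p))) (⊕-cong (⊗-congˡ {Θ 4} q) (⊗-congˡ {Θ 4} q))

sec-Row : ∀ {d} → d ℕ.≤ 4 → ∀ F → sec d (φ ⊗ F) ≈ˢ Row (sec d F) (sec d (q^ 1 ⊗ F)) (sec d (q^ 4 ⊗ F))
sec-Row {d} d≤4 F = ≈-trans (sec-φ d≤4 F) (⊕-cong (⊖-cong (⊗-congʳ {sec d F} (θ-term (+ 0)))
  (twice {θ (+ 2) ⊗ sec d (q^ 1 ⊗ F)} (⊗-congʳ {sec d (q^ 1 ⊗ F)} (θ-term (+ 2))))) (twice {θ (+ 4) ⊗ sec d (q^ 4 ⊗ F)} (⊗-congʳ {sec d (q^ 4 ⊗ F)} (θ-term (+ 4)))))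
  where
  twice : ∀ {f g} → f ≈ˢ g → (+ 2) ⋆ f ≈ˢ g ⊕ g
  twice {f} {g} p n = trans (cong (λ z → + 2 * z) (p n)) (ℤS.solve 1 (λ x → con (+ 2) :* x := x :+ x) refl (g n))

module RankSystem (F : Series) (a b c : ℤ) (equation : φ ⊗ F ≈ˢ a ⋆ lambert (+ 1) ⊕ b ⋆ lambert (+ 2) ⊕ c ⋆ one) where

  A B C : Series
  A = 𝕊.int a
  B = 𝕊.int b
  C = 𝕊.int c

  private
    section : ∀ {d} → d ℕ.≤ 4 → q^ 1 ⊗ sec d (φ ⊗ F) ≈ˢ
      A ⊗ (𝕊.int (q^ 3 d * -[1+ 0 ]) ⊗ (q^ 1 ⊗ T₂₋₄) ⊕ 𝕊.int (q^ 0 d * + 1) ⊗ (q^ 1 ⊗ T₂₋₂) ⊕ 𝕊.int (q^ 4 d * -[1+ 0 ]) ⊗ (one ⊗ T₂₀)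
           ⊕ 𝕊.int (q^ 0 d * + 1) ⊗ (q^ 1 ⊗ T₂₂) ⊕ 𝕊.int (q^ 3 d * -[1+ 0 ]) ⊗ (q^ 1 ⊗ T₂₄))
      ⊕ B ⊗ (𝕊.int (q^ 0 d * + 1) ⊗ (q^ 1 ⊗ T₄₋₄) ⊕ 𝕊.int (q^ 2 d * -[1+ 0 ]) ⊗ (one ⊗ T₄₋₂) ⊕ 𝕊.int (q^ 1 d * + 1) ⊗ (one ⊗ T₄₀)
           ⊕ 𝕊.int (q^ 2 d * -[1+ 0 ]) ⊗ (one ⊗ T₄₂) ⊕ 𝕊.int (q^ 0 d * + 1) ⊗ (q^ 1 ⊗ T₄₄))
      ⊕ C ⊗ (q^ 1 ⊗ 𝕊.int (q^ 0 d))
    section {d} d≤4 = ≈-trans (⊗-congˡ {q^ 1} (λ n → equation (5 ℕ.* n ℕ.+ d))) (≈-trans (⊗-congˡ {q^ 1} (⊕-cong (⊕-cong (⋆-int a (sec d (lambert (+ 1)))) (⋆-int b (sec d (lambert (+ 2)))))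
        (≈-trans (⋆-cong {c} refl (≈-trans (sec-q^ z≤n) (≈-sym (int-⋆ (q^ 0 d))))) (⋆-int c (𝕊.int (q^ 0 d))))))
      (≈-trans (𝕊.solve 7 (λ q A B C l m o → q *: (A *: l +: B *: m +: C *: o) =: A *: (q *: l) +: B *: (q *: m) +: C *: (q *: o)) ≈-refl
          (q^ 1) A B C (sec d (lambert (+ 1))) (sec d (lambert (+ 2))) (𝕊.int (q^ 0 d)))
        (⊕-cong (⊕-cong
          (⊗-congˡ {A} (≈-trans (lambert₁-sections d≤4) (⊕-cong (⊕-cong (⊕-cong (⊕-cong (⋆-int (q^ 3 d * -[1+ 0 ]) (q^ 1 ⊗ T₂₋₄)) (⋆-int (q^ 0 d * + 1) (q^ 1 ⊗ T₂₋₂)))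
            (⋆-int (q^ 4 d * -[1+ 0 ]) (one ⊗ T₂₀))) (⋆-int (q^ 0 d * + 1) (q^ 1 ⊗ T₂₂))) (⋆-int (q^ 3 d * -[1+ 0 ]) (q^ 1 ⊗ T₂₄)))))
          (⊗-congˡ {B} (≈-trans (lambert₂-sections d≤4) (⊕-cong (⊕-cong (⊕-cong (⊕-cong (⋆-int (q^ 0 d * + 1) (q^ 1 ⊗ T₄₋₄)) (⋆-int (q^ 2 d * -[1+ 0 ]) (one ⊗ T₄₋₂)))
            (⋆-int (q^ 1 d * + 1) (one ⊗ T₄₀))) (⋆-int (q^ 2 d * -[1+ 0 ]) (one ⊗ T₄₂))) (⋆-int (q^ 0 d * + 1) (q^ 1 ⊗ T₄₄))))))
          (≈-refl {C ⊗ (q^ 1 ⊗ 𝕊.int (q^ 0 d))}))))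

    -- For a concrete `d` the numbers `q^ s d` compute to 0 or 1, whereupon the solver discards the
    -- Appell sums absent from that section.
    form : ∀ {n} → ℕ → (q A B C t₋₄ t₋₂ t₀ t₂ t₄ u₋₄ u₋₂ u₀ u₂ u₄ : 𝕊.Polynomial n) → 𝕊.Polynomial n
    form d q A B C t₋₄ t₋₂ t₀ t₂ t₄ u₋₄ u₋₂ u₀ u₂ u₄ =
      A *: (con: (q^ 3 d * -[1+ 0 ]) *: (q *: t₋₄) +: con: (q^ 0 d * + 1) *: (q *: t₋₂) +: con: (q^ 4 d * -[1+ 0 ]) *: (1: *: t₀) +: con: (q^ 0 d * + 1) *: (q *: t₂) +: con: (q^ 3 d * -[1+ 0 ]) *: (q *: t₄))
      +: B *: (con: (q^ 0 d * + 1) *: (q *: u₋₄) +: con: (q^ 2 d * -[1+ 0 ]) *: (1: *: u₋₂) +: con: (q^ 1 d * + 1) *: (1: *: u₀) +: con: (q^ 2 d * -[1+ 0 ]) *: (1: *: u₂) +: con: (q^ 0 d * + 1) *: (q *: u₄))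
      +: C *: (q *: con: (q^ 0 d))

  section₀ : sec 0 (φ ⊗ F) ≈ˢ A ⊗ (T₂₋₂ ⊕ T₂₂) ⊕ B ⊗ (T₄₋₄ ⊕ T₄₄) ⊕ C
  section₀ = q^-cancelˡ 1 {sec 0 (φ ⊗ F)} (≈-trans (section z≤n) (𝕊.solve 14 (λ q A B C t₋₄ t₋₂ t₀ t₂ t₄ u₋₄ u₋₂ u₀ u₂ u₄ → form 0 q A B C t₋₄ t₋₂ t₀ t₂ t₄ u₋₄ u₋₂ u₀ u₂ u₄ =: q *: (A *: (t₋₂ +: t₂) +: B *: (u₋₄ +: u₄) +: C)) ≈-refl (q^ 1) A B C T₂₋₄ T₂₋₂ T₂₀ T₂₂ T₂₄ T₄₋₄ T₄₋₂ T₄₀ T₄₂ T₄₄))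

  section₁ : q^ 1 ⊗ sec 1 (φ ⊗ F) ≈ˢ B ⊗ T₄₀
  section₁ = ≈-trans (section (s≤s z≤n)) (𝕊.solve 14 (λ q A B C t₋₄ t₋₂ t₀ t₂ t₄ u₋₄ u₋₂ u₀ u₂ u₄ → form 1 q A B C t₋₄ t₋₂ t₀ t₂ t₄ u₋₄ u₋₂ u₀ u₂ u₄ =: B *: u₀) ≈-refl (q^ 1) A B C T₂₋₄ T₂₋₂ T₂₀ T₂₂ T₂₄ T₄₋₄ T₄₋₂ T₄₀ T₄₂ T₄₄)

  section₂ : q^ 1 ⊗ sec 2 (φ ⊗ F) ≈ˢ ⊝ (B ⊗ (T₄₋₂ ⊕ T₄₂))
  section₂ = ≈-trans (section (s≤s (s≤s z≤n))) (𝕊.solve 14 (λ q A B C t₋₄ t₋₂ t₀ t₂ t₄ u₋₄ u₋₂ u₀ u₂ u₄ → form 2 q A B C t₋₄ t₋₂ t₀ t₂ t₄ u₋₄ u₋₂ u₀ u₂ u₄ =: -: (B *: (u₋₂ +: u₂))) ≈-refl (q^ 1) A B C T₂₋₄ T₂₋₂ T₂₀ T₂₂ T₂₄ T₄₋₄ T₄₋₂ T₄₀ T₄₂ T₄₄)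

  section₃ : sec 3 (φ ⊗ F) ≈ˢ ⊝ (A ⊗ (T₂₋₄ ⊕ T₂₄))
  section₃ = q^-cancelˡ 1 {sec 3 (φ ⊗ F)} (≈-trans (section (s≤s (s≤s (s≤s z≤n)))) (𝕊.solve 14 (λ q A B C t₋₄ t₋₂ t₀ t₂ t₄ u₋₄ u₋₂ u₀ u₂ u₄ → form 3 q A B C t₋₄ t₋₂ t₀ t₂ t₄ u₋₄ u₋₂ u₀ u₂ u₄ =: q *: (-: (A *: (t₋₄ +: t₄)))) ≈-refl (q^ 1) A B C T₂₋₄ T₂₋₂ T₂₀ T₂₂ T₂₄ T₄₋₄ T₄₋₂ T₄₀ T₄₂ T₄₄))

  section₄ : q^ 1 ⊗ sec 4 (φ ⊗ F) ≈ˢ ⊝ (A ⊗ T₂₀)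
  section₄ = ≈-trans (section ℕP.≤-refl) (𝕊.solve 14 (λ q A B C t₋₄ t₋₂ t₀ t₂ t₄ u₋₄ u₋₂ u₀ u₂ u₄ → form 4 q A B C t₋₄ t₋₂ t₀ t₂ t₄ u₋₄ u₋₂ u₀ u₂ u₄ =: -: (A *: t₀)) ≈-refl (q^ 1) A B C T₂₋₄ T₂₋₂ T₂₀ T₂₂ T₂₄ T₄₋₄ T₄₋₂ T₄₀ T₄₂ T₄₄)

  y : Series
  y = q^ 1 ⊗ sec 4 F

  -- The section 4 occurs in the rows for `d = 0` and `d = 3` only with a factor `q` from the
  -- borrow. Taking `q` times it as the unknown, and multiplying its own row by `q`, keeps the
  -- system free of negative powers.
  rank-system : System (sec 0 F) (sec 1 F) (sec 2 F) (sec 3 F) y (sec 0 (φ ⊗ F)) (sec 1 (φ ⊗ F)) (sec 2 (φ ⊗ F)) (sec 3 (φ ⊗ F)) (q^ 1 ⊗ sec 4 (φ ⊗ F))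
  rank-system = system
    (≈-sym (≈-trans (sec-Row z≤n F) (Row-cong (sec 0 F) (sec-q^⊗-carry 4 (s≤s z≤n) refl F) (sec-q^⊗-carry 1 (s≤s z≤n) refl F))))
    (≈-sym (≈-trans (sec-Row (s≤s z≤n) F) (Row-cong (sec 1 F) (sec-q^⊗ 1 0 F) (sec-q^⊗-carry 2 (s≤s (s≤s z≤n)) refl F))))
    (≈-sym (≈-trans (sec-Row (s≤s (s≤s z≤n)) F) (Row-cong (sec 2 F) (sec-q^⊗ 1 1 F) (sec-q^⊗-carry 3 (s≤s (s≤s (s≤s z≤n))) refl F))))
    (≈-sym (≈-trans (sec-Row (s≤s (s≤s (s≤s z≤n))) F) (Row-cong (sec 3 F) (sec-q^⊗ 1 2 F) (sec-q^⊗-carry 4 ℕP.≤-refl refl F))))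
    (≈-sym (≈-trans (⊗-congˡ {q^ 1} (≈-trans (sec-Row ℕP.≤-refl F) (Row-cong (sec 4 F) (sec-q^⊗ 1 3 F) (sec-q^⊗ 4 0 F))))
      (𝕊.solve 7 (λ q t x y f g h → q *: (t *: f -: (x *: g +: x *: g) +: (y *: h +: y *: h))
        =: t *: (q *: f) -: (x *: (q *: g) +: x *: (q *: g)) +: (y *: (q *: h) +: y *: (q *: h))) ≈-refl
        (q^ 1) (Θ 0) (Θ 2) (Θ 4) (sec 4 F) (sec 3 F) (sec 0 F))))

open System

module Determined (F : Series) (a b c : ℤ) (equation : φ ⊗ F ≈ˢ a ⋆ lambert (+ 1) ⊕ b ⋆ lambert (+ 2) ⊕ c ⋆ one) (r₀ r₁ r₂ r₃ p₄ ℓ : Series)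
  (h₀ : Zero (Θ 0 ⊗ Row r₀ p₄ (q^ 1 ⊗ r₁) ⊖ (a ⋆ ⟦ k₂₋₂ ⟧ₜ ⊕ b ⋆ ⟦ k₄₋₄ ⟧ₜ ⊕ Θ 0 ⊗ ℓ)))
  (hℓ : ℓ ≈ˢ a ⋆ L₂ ⊕ b ⋆ L₄ ⊕ c ⋆ one)
  (h₁ : Zero (Row r₁ r₀ (q^ 1 ⊗ r₂)))
  (h₂ : Zero (q^ 1 ⊗ (Θ 0 ⊗ Row r₂ r₁ (q^ 1 ⊗ r₃)) ⊖ (- b) ⋆ (⟦ k₄₂ ⟧ₜ ⊕ ⟦ k₄₋₂ ⟧ₜ)))
  (h₃ : Zero (Θ 0 ⊗ Row r₃ r₂ p₄ ⊖ (- a) ⋆ (⟦ k₂₄ ⟧ₜ ⊕ ⟦ k₂₋₄ ⟧ₜ)))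
  (h₄ : Zero (Row p₄ (q^ 1 ⊗ r₃) (q^ 1 ⊗ r₀))) where

  private
    module Rank = RankSystem F a b c equation
    open Rank using (A; B; C)

    negated : ∀ k {f} → (- k) ⋆ f ≈ˢ ⊝ (𝕊.int k ⊗ f)
    negated k {f} n = trans (sym (ℤP.neg-distribˡ-* k (f n))) (cong -_ (⋆-int k f n))

    module Sol = Solution A B C r₀ r₁ r₂ r₃ p₄ ℓ
      (≈-trans (⊖-zero h₀) (⊕-cong (⊕-cong (⋆-int a ⟦ k₂₋₂ ⟧ₜ) (⋆-int b ⟦ k₄₋₄ ⟧ₜ)) (≈-refl {Θ 0 ⊗ ℓ})))
      (≈-trans hℓ (⊕-cong (⊕-cong (⋆-int a L₂) (⋆-int b L₄)) (≈-sym (int-⋆ c))))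
      h₁ (≈-trans (⊖-zero h₂) (negated b)) (≈-trans (⊖-zero h₃) (negated a)) h₄

    candidate : System r₀ Sol.x₁ r₂ r₃ Sol.y (sec 0 (φ ⊗ F)) (sec 1 (φ ⊗ F)) (sec 2 (φ ⊗ F)) (sec 3 (φ ⊗ F)) (q^ 1 ⊗ sec 4 (φ ⊗ F))
    candidate = system
      (≈-trans Sol.row₀ (≈-sym Rank.section₀))
      (q^-cancelˡ 1 {Row Sol.x₁ r₀ (q^ 1 ⊗ r₂)} {sec 1 (φ ⊗ F)} (≈-trans Sol.row₁ (≈-sym Rank.section₁)))
      (q^-cancelˡ 1 {Row r₂ Sol.x₁ (q^ 1 ⊗ r₃)} {sec 2 (φ ⊗ F)} (≈-trans Sol.row₂ (≈-sym Rank.section₂)))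
      (≈-trans Sol.row₃ (≈-sym Rank.section₃))
      (≈-trans Sol.row₄ (≈-sym Rank.section₄))

    module U = Uniqueness {sec 0 F} {sec 1 F} {sec 2 F} {sec 3 F} {Rank.y} Rank.rank-system candidate

  value₀ : sec 0 F ≈ˢ r₀
  value₀ = U.unique₀
  value₁ : sec 1 F ≈ˢ r₁ ⊖ b ⋆ mock 4
  value₁ = ≈-trans U.unique₁ (⊖-cong (≈-refl {r₁}) (≈-sym (⋆-int b (mock 4))))
  value₂ : sec 2 F ≈ˢ r₂
  value₂ = U.unique₂
  value₃ : sec 3 F ≈ˢ r₃
  value₃ = U.unique₃
  value₄ : q^ 1 ⊗ sec 4 F ≈ˢ p₄ ⊕ a ⋆ (q^ 1 ⊗ mock 2)
  value₄ = ≈-trans U.unique-y (⊕-cong (≈-refl {p₄}) (≈-sym (⋆-int a (q^ 1 ⊗ mock 2))))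

rankDifference : ℕ → ℕ → Series
rankDifference s t n = + N̄₂ s 5 n - + N̄₂ t 5 n

mock-scale : ∀ c a → c ⋆ mock a ≈ˢ (c ⋆ q^ (a ℕ.∸ 1) ⊗ Pn 5 5 ⊗ S a) ÷ P 5 5
mock-scale c a = ≈-trans (≈-sym (⋆-⊗ c (q^ (a ℕ.∸ 1) ⊗ Pn 5 5 ⊗ S a) (inv (P 5 5)))) (⊗-congʳ {inv (P 5 5)}
  (≈-trans (≈-sym (⋆-⊗ c (q^ (a ℕ.∸ 1) ⊗ Pn 5 5) (S a))) (⊗-congʳ {S a} (≈-sym (⋆-⊗ c (q^ (a ℕ.∸ 1)) (Pn 5 5))))))

-- Counting overpartitions by rank

ind : Bool → ℤ
ind b = if b then + 1 else + 0

ind-∧ : ∀ a b → ind (a ∧ b) ≡ ind a * ind b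
ind-∧ true b = sym (ℤP.*-identityˡ (ind b))
ind-∧ false b = refl

total-over : {A : Set} → (A → ℤ) → List A → ℤ
total-over f [] = + 0
total-over f (x ∷ xs) = f x + total-over f xs

over-++ : ∀ {A : Set} (f : A → ℤ) xs ys → total-over f (xs ++ ys) ≡ total-over f xs + total-over f ys
over-++ f [] ys = sym (ℤP.+-identityˡ (total-over f ys))
over-++ f (x ∷ xs) ys = trans (cong (λ z → f x + z) (over-++ f xs ys)) (sym (ℤP.+-assoc (f x) (total-over f xs) (total-over f ys)))

module _ {A : Set} where

  over-cong : ∀ {f g : A → ℤ} → (∀ x → f x ≡ g x) → ∀ xs → total-over f xs ≡ total-over g xs
  over-cong p [] = refl
  over-cong p (x ∷ xs) = cong₂ _+_ (p x) (over-cong p xs)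

  over-map : ∀ {B : Set} (f : B → ℤ) (g : A → B) xs → total-over f (List.map g xs) ≡ total-over (λ x → f (g x)) xs
  over-map f g [] = refl
  over-map f g (x ∷ xs) = cong (λ z → f (g x) + z) (over-map f g xs)

  over-concatMap : ∀ {B : Set} (f : B → ℤ) (g : A → List B) xs → total-over f (List.concatMap g xs) ≡ total-over (λ x → total-over f (g x)) xs
  over-concatMap f g [] = refl
  over-concatMap f g (x ∷ xs) = trans (over-++ f (g x) (List.concatMap g xs)) (cong (λ z → total-over f (g x) + z) (over-concatMap f g xs))

  over-*ˡ : ∀ c (f : A → ℤ) xs → total-over (λ x → c * f x) xs ≡ c * total-over f xs
  over-*ˡ c f [] = sym (ℤP.*-zeroʳ c)
  over-*ˡ c f (x ∷ xs) = trans (cong (λ z → c * f x + z) (over-*ˡ c f xs)) (sym (ℤP.*-distribˡ-+ c (f x) (total-over f xs)))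

  over-⊖ : ∀ (f g : A → ℤ) xs → total-over (λ x → f x - g x) xs ≡ total-over f xs - total-over g xs
  over-⊖ f g [] = refl
  over-⊖ f g (x ∷ xs) = trans (cong (λ z → f x - g x + z) (over-⊖ f g xs))
    (ℤS.solve 4 (λ a b c d → a :- b :+ (c :- d) := (a :+ c) :- (b :+ d)) refl (f x) (g x) (total-over f xs) (total-over g xs))

  length-filter : ∀ (p : A → Bool) xs → + List.length (List.filterᵇ p xs) ≡ total-over (λ x → ind (p x)) xs
  length-filter p [] = refl
  length-filter p (x ∷ xs) with p x
  ... | true = cong (λ z → + 1 + z) (length-filter p xs)
  ... | false = trans (length-filter p xs) (sym (ℤP.+-identityˡ (total-over (λ y → ind (p y)) xs)))

Σ< : ℕ → (ℕ → ℤ) → ℤ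
Σ< zero f = + 0
Σ< (suc n) f = f 0 + Σ< n (f ∘ suc)

Σ<-cong : ∀ n {f g} → (∀ i → i ℕ.< n → f i ≡ g i) → Σ< n f ≡ Σ< n g
Σ<-cong zero p = refl
Σ<-cong (suc n) p = cong₂ _+_ (p 0 (s≤s z≤n)) (Σ<-cong n (λ i i<n → p (suc i) (s≤s i<n)))

Σ<-last : ∀ n f → Σ< (suc n) f ≡ Σ< n f + f n
Σ<-last zero f = ℤP.+-comm (f 0) (+ 0)
Σ<-last (suc n) f = trans (cong (λ z → f 0 + z) (Σ<-last n (f ∘ suc))) (sym (ℤP.+-assoc (f 0) (Σ< n (f ∘ suc)) (f (suc n))))

Σ<-+ : ∀ n f g → Σ< n (λ i → f i + g i) ≡ Σ< n f + Σ< n g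
Σ<-+ zero f g = refl
Σ<-+ (suc n) f g = trans (cong (λ z → f 0 + g 0 + z) (Σ<-+ n (f ∘ suc) (g ∘ suc))) (interchange (f 0) (g 0) (Σ< n (f ∘ suc)) (Σ< n (g ∘ suc)))

Σ<-*ˡ : ∀ n c f → Σ< n (λ i → c * f i) ≡ c * Σ< n f
Σ<-*ˡ zero c f = sym (ℤP.*-zeroʳ c)
Σ<-*ˡ (suc n) c f = trans (cong (λ z → c * f 0 + z) (Σ<-*ˡ n c (f ∘ suc))) (sym (ℤP.*-distribˡ-+ c (f 0) (Σ< n (f ∘ suc))))

Σ<-0 : ∀ n → Σ< n (λ _ → + 0) ≡ + 0
Σ<-0 zero = refl
Σ<-0 (suc n) = trans (ℤP.+-identityˡ (Σ< n (λ _ → + 0))) (Σ<-0 n)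

Σ<-swap : ∀ m n (f : ℕ → ℕ → ℤ) → Σ< m (λ i → Σ< n (f i)) ≡ Σ< n (λ j → Σ< m (λ i → f i j))
Σ<-swap zero n f = sym (Σ<-0 n)
Σ<-swap (suc m) n f = trans (cong (λ z → Σ< n (f 0) + z) (Σ<-swap m n (f ∘ suc))) (sym (Σ<-+ n (f 0) (λ j → Σ< m (λ i → f (suc i) j))))

Σ<-extend : ∀ {n} f → (∀ i → n ℕ.≤ i → f i ≡ + 0) → ∀ m → n ℕ.≤ m → Σ< m f ≡ Σ< n f
Σ<-extend {zero} f z m _ = trans (Σ<-cong m (λ i _ → z i z≤n)) (Σ<-0 m)
Σ<-extend {suc n} f z (suc m) (s≤s n≤m) = cong (λ w → f 0 + w) (Σ<-extend (f ∘ suc) (λ i n≤i → z (suc i) (s≤s n≤i)) m n≤m)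

Σ<-below : ∀ {k N} (f : ℕ → ℤ) → k ℕ.≤ N → Σ< N (λ i → ind (i ℕ.<ᵇ k) * f i) ≡ Σ< k f
Σ<-below {zero} {N} f _ = Σ<-0 N
Σ<-below {suc k} {suc N} f (s≤s k≤N) = cong₂ _+_ (ℤP.*-identityˡ (f 0)) (Σ<-below (f ∘ suc) k≤N)

Σ<-at : ∀ {k N} (f : ℕ → ℤ) → k ℕ.< N → Σ< N (λ i → ind (k ℕ.≡ᵇ i) * f i) ≡ f k
Σ<-at {zero} {suc N} f _ = trans (cong (λ z → + 1 * f 0 + z) (Σ<-0 N)) (trans (ℤP.+-identityʳ (+ 1 * f 0)) (ℤP.*-identityˡ (f 0)))
Σ<-at {suc k} {suc N} f (s≤s k<N) = trans (ℤP.+-identityˡ (Σ< N (λ i → ind (k ℕ.≡ᵇ i) * f (suc i)))) (Σ<-at (f ∘ suc) k<N)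

over-applyUpTo : ∀ {A : Set} (f : A → ℤ) (g : ℕ → A) n → total-over f (List.applyUpTo g n) ≡ Σ< n (f ∘ g)
over-applyUpTo f g zero = refl
over-applyUpTo f g (suc n) = cong (λ z → f (g 0) + z) (over-applyUpTo f (g ∘ suc) n)

over-alphabet : ∀ (f : Part → ℤ) N → total-over f (alphabet N) ≡ Σ< N (λ i → f (suc i , true) + f (suc i , false))
over-alphabet f N = trans (over-concatMap f _ (List.upTo N)) (trans (over-applyUpTo _ (λ i → i) N)
  (Σ<-cong N (λ i _ → cong (λ z → f (suc i , true) + z) (ℤP.+-identityʳ (f (suc i , false))))))

over-lists : ∀ N ℓ (f : List Part → ℤ) → total-over f (listsOfLength (alphabet N) (suc ℓ)) ≡
  Σ< N (λ i → total-over (λ r → f ((suc i , true) ∷ r)) (listsOfLength (alphabet N) ℓ) + total-over (λ r → f ((suc i , false) ∷ r)) (listsOfLength (alphabet N) ℓ))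
over-lists N ℓ f = trans (over-concatMap f _ (alphabet N)) (trans (over-cong (λ a → over-map f (a ∷_) (listsOfLength (alphabet N) ℓ)) (alphabet N)) (over-alphabet _ N))

-- The parts that count negatively in the M₂-rank.
charge : Part → ℕ
charge (k , b) = if isOdd k ∧ not b then 0 else 1

charges : List Part → ℕ
charges [] = 0
charges (p ∷ r) = charge p ℕ.+ charges r

-- Indicator of the overpartitions of n whose largest part may follow a part of size k + 1.
after : ℕ → ℕ → List Part → ℤ
after k n [] = ind (n ℕ.≡ᵇ 0)
after k n ((zero , b) ∷ r) = + 0
after k n ((suc i , b) ∷ r) = ind ((i ℕ.<ᵇ k) ∨ ((k ℕ.≡ᵇ i) ∧ not b)) * (ind (i ℕ.<ᵇ n) * after i (n ℕ.∸ suc i) r)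

≡ᵇ-+ : ∀ i w n → (suc i ℕ.+ w ℕ.≡ᵇ n) ≡ (i ℕ.<ᵇ n) ∧ (w ℕ.≡ᵇ n ℕ.∸ suc i)
≡ᵇ-+ i w zero = refl
≡ᵇ-+ zero w (suc n) = refl
≡ᵇ-+ (suc i) w (suc n) = ≡ᵇ-+ i w n

after-correct : ∀ k b n r → ind (positiveParts r ∧ canonical ((suc k , b) ∷ r) ∧ (weight r ℕ.≡ᵇ n)) ≡ after k n r
head-correct : ∀ i b n r → ind (positiveParts r ∧ canonical ((suc i , b) ∷ r) ∧ (suc i ℕ.+ weight r ℕ.≡ᵇ n)) ≡ ind (i ℕ.<ᵇ n) * after i (n ℕ.∸ suc i) r

after-correct k b zero [] = refl
after-correct k b (suc n) [] = refl
after-correct k b n ((zero , b′) ∷ r) = refl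
after-correct k b n ((suc i , b′) ∷ r) = trans (pull (positiveParts r) ((i ℕ.<ᵇ k) ∨ ((k ℕ.≡ᵇ i) ∧ not b′)) (canonical ((suc i , b′) ∷ r)) (suc i ℕ.+ weight r ℕ.≡ᵇ n))
  (cong (λ z → ind ((i ℕ.<ᵇ k) ∨ ((k ℕ.≡ᵇ i) ∧ not b′)) * z) (head-correct i b′ n r))
  where
  pull : ∀ p a c w → ind (p ∧ (a ∧ c) ∧ w) ≡ ind a * ind (p ∧ c ∧ w)
  pull p true c w = sym (ℤP.*-identityˡ (ind (p ∧ c ∧ w)))
  pull true false c w = refl
  pull false false c w = refl

head-correct i b n r = trans (cong (λ z → ind (positiveParts r ∧ canonical ((suc i , b) ∷ r) ∧ z)) (≡ᵇ-+ i (weight r) n))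
  (trans (pull (positiveParts r) (canonical ((suc i , b) ∷ r)) (i ℕ.<ᵇ n) (weight r ℕ.≡ᵇ n ℕ.∸ suc i))
    (cong (λ z → ind (i ℕ.<ᵇ n) * z) (after-correct i b (n ℕ.∸ suc i) r)))
  where
  pull : ∀ p c a w → ind (p ∧ c ∧ a ∧ w) ≡ ind a * ind (p ∧ c ∧ w)
  pull p c true w = sym (ℤP.*-identityˡ (ind (p ∧ c ∧ w)))
  pull true true false w = refl
  pull true false false w = refl
  pull false c false w = refl

-- followers ℓ k n h sums h (charges λ) over the λ of length ℓ counted by 'after k n'.
followers : ℕ → ℕ → ℕ → (ℕ → ℤ) → ℤ
overlinedHead plainHead : ℕ → ℕ → ℕ → (ℕ → ℤ) → ℤ

followers zero k n h = ind (n ℕ.≡ᵇ 0) * h 0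
followers (suc ℓ) k n h = Σ< k (λ i → overlinedHead ℓ i n h + plainHead ℓ i n h) + plainHead ℓ k n h

overlinedHead ℓ i n h = ind (i ℕ.<ᵇ n) * followers ℓ i (n ℕ.∸ suc i) (λ j → h (charge (suc i , true) ℕ.+ j))
plainHead ℓ i n h = ind (i ℕ.<ᵇ n) * followers ℓ i (n ℕ.∸ suc i) (λ j → h (charge (suc i , false) ℕ.+ j))

followers-correct : ∀ {N} ℓ {k} → k ℕ.< N → ∀ n h → total-over (λ r → after k n r * h (charges r)) (listsOfLength (alphabet N) ℓ) ≡ followers ℓ k n h
heads-correct : ∀ {N} ℓ {i} → i ℕ.< N → ∀ b n h → total-over (λ r → (ind (i ℕ.<ᵇ n) * after i (n ℕ.∸ suc i) r) * h (charges ((suc i , b) ∷ r))) (listsOfLength (alphabet N) ℓ)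
                ≡ ind (i ℕ.<ᵇ n) * followers ℓ i (n ℕ.∸ suc i) (λ j → h (charge (suc i , b) ℕ.+ j))

followers-correct zero k<N n h = ℤP.+-identityʳ (ind (n ℕ.≡ᵇ 0) * h 0)
followers-correct {N} (suc ℓ) {k} k<N n h = begin
  total-over (λ r → after k n r * h (charges r)) (listsOfLength (alphabet N) (suc ℓ))
    ≡⟨ over-lists N ℓ (λ r → after k n r * h (charges r)) ⟩
  Σ< N (λ i → part true i + part false i)
    ≡⟨ Σ<-cong N (λ i i<N → trans (cong₂ _+_ (evaluate true i i<N) (evaluate false i i<N))
         (split (i ℕ.<ᵇ k) (k ℕ.≡ᵇ i) (disjoint i k) (overlinedHead ℓ i n h) (plainHead ℓ i n h))) ⟩
  Σ< N (λ i → ind (i ℕ.<ᵇ k) * (overlinedHead ℓ i n h + plainHead ℓ i n h) + ind (k ℕ.≡ᵇ i) * plainHead ℓ i n h)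
    ≡⟨ Σ<-+ N _ _ ⟩
  Σ< N (λ i → ind (i ℕ.<ᵇ k) * (overlinedHead ℓ i n h + plainHead ℓ i n h)) + Σ< N (λ i → ind (k ℕ.≡ᵇ i) * plainHead ℓ i n h)
    ≡⟨ cong₂ _+_ (Σ<-below (λ i → overlinedHead ℓ i n h + plainHead ℓ i n h) (ℕP.<⇒≤ k<N)) (Σ<-at (λ i → plainHead ℓ i n h) k<N) ⟩
  followers (suc ℓ) k n h ∎
  where
  open ≡.≡-Reasoning
  allowed : Bool → ℕ → Bool
  allowed b i = (i ℕ.<ᵇ k) ∨ ((k ℕ.≡ᵇ i) ∧ not b)
  part : Bool → ℕ → ℤ
  part b i = total-over (λ r → after k n ((suc i , b) ∷ r) * h (charges ((suc i , b) ∷ r))) (listsOfLength (alphabet N) ℓ)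
  evaluate : ∀ b i → i ℕ.< N → part b i ≡ ind (allowed b i) * (ind (i ℕ.<ᵇ n) * followers ℓ i (n ℕ.∸ suc i) (λ j → h (charge (suc i , b) ℕ.+ j)))
  evaluate b i i<N = trans (over-cong (λ r → ℤP.*-assoc (ind (allowed b i)) (ind (i ℕ.<ᵇ n) * after i (n ℕ.∸ suc i) r) (h (charges ((suc i , b) ∷ r)))) (listsOfLength (alphabet N) ℓ))
    (trans (over-*ˡ (ind (allowed b i)) _ (listsOfLength (alphabet N) ℓ)) (cong (λ z → ind (allowed b i) * z) (heads-correct ℓ i<N b n h)))
  disjoint : ∀ i k → ind (i ℕ.<ᵇ k) * ind (k ℕ.≡ᵇ i) ≡ + 0
  disjoint zero zero = refl
  disjoint zero (suc k) = refl
  disjoint (suc i) zero = refl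
  disjoint (suc i) (suc k) = disjoint i k
  split : ∀ a e → ind a * ind e ≡ + 0 → ∀ x y → ind (a ∨ (e ∧ false)) * x + ind (a ∨ (e ∧ true)) * y ≡ ind a * (x + y) + ind e * y
  split true false _ x y = ℤS.solve 2 (λ x y → con (+ 1) :* x :+ con (+ 1) :* y := con (+ 1) :* (x :+ y) :+ con (+ 0) :* y) refl x y
  split false true _ x y = ℤS.solve 2 (λ x y → con (+ 0) :* x :+ con (+ 1) :* y := con (+ 0) :* (x :+ y) :+ con (+ 1) :* y) refl x y
  split false false _ x y = ℤS.solve 2 (λ x y → con (+ 0) :* x :+ con (+ 0) :* y := con (+ 0) :* (x :+ y) :+ con (+ 0) :* y) refl x y
  split true true ()

heads-correct {N} ℓ {i} i<N b n h = trans
  (over-cong (λ r → ℤP.*-assoc (ind (i ℕ.<ᵇ n)) (after i (n ℕ.∸ suc i) r) (h (charges ((suc i , b) ∷ r)))) (listsOfLength (alphabet N) ℓ))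
  (trans (over-*ˡ (ind (i ℕ.<ᵇ n)) (λ r → after i (n ℕ.∸ suc i) r * h (charge (suc i , b) ℕ.+ charges r)) (listsOfLength (alphabet N) ℓ))
    (cong (λ z → ind (i ℕ.<ᵇ n) * z) (followers-correct ℓ i<N (n ℕ.∸ suc i) (λ j → h (charge (suc i , b) ℕ.+ j)))))

charge≤1 : ∀ p → charge p ℕ.≤ 1
charge≤1 (k , b) with isOdd k ∧ not b
... | true = z≤n
... | false = s≤s z≤n

<ᵇ-elim : ∀ i n (x y : ℤ) → (i ℕ.< n → x ≡ y) → ind (i ℕ.<ᵇ n) * x ≡ ind (i ℕ.<ᵇ n) * y
<ᵇ-elim i n x y p with i ℕ.<ᵇ n in eq
... | true = cong (λ z → + 1 * z) (p (ℕP.<ᵇ⇒< i n (≡.subst IsTrue (sym eq) _)))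
... | false = refl

∸-suc-< : ∀ {i n} → i ℕ.< n → n ℕ.∸ suc i ℕ.< n
∸-suc-< {i} {suc n} _ = s≤s (ℕP.m∸n≤m n i)

module Heads (ℓ i n : ℕ) (b : Bool) where

  head : (ℕ → ℤ) → ℤ
  head h = ind (i ℕ.<ᵇ n) * followers ℓ i (n ℕ.∸ suc i) (λ j → h (charge (suc i , b) ℕ.+ j))

-- A list of length `ℓ` has at most `ℓ` charged parts, so `h` matters only up to `ℓ`.
followers-cong : ∀ ℓ k n {h h′} → (∀ j → j ℕ.≤ ℓ → h j ≡ h′ j) → followers ℓ k n h ≡ followers ℓ k n h′
head-cong : ∀ ℓ i n b {h h′} → (∀ j → j ℕ.≤ suc ℓ → h j ≡ h′ j) → Heads.head ℓ i n b h ≡ Heads.head ℓ i n b h′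
followers-cong zero k n p = cong (λ z → ind (n ℕ.≡ᵇ 0) * z) (p 0 z≤n)
followers-cong (suc ℓ) k n p = cong₂ _+_ (Σ<-cong k (λ i _ → cong₂ _+_ (head-cong ℓ i n true p) (head-cong ℓ i n false p))) (head-cong ℓ k n false p)
head-cong ℓ i n b p = cong (λ z → ind (i ℕ.<ᵇ n) * z) (followers-cong ℓ i (n ℕ.∸ suc i) (λ j j≤ℓ → p (charge (suc i , b) ℕ.+ j) (ℕP.+-mono-≤ (charge≤1 (suc i , b)) j≤ℓ)))

followers-linear : ∀ ℓ k n M (c : ℕ → ℤ) (d : ℕ → ℕ → ℤ) → followers ℓ k n (λ j → Σ< M (λ t → c t * d t j)) ≡ Σ< M (λ t → c t * followers ℓ k n (d t))
head-linear : ∀ ℓ i n b M (c : ℕ → ℤ) (d : ℕ → ℕ → ℤ) → Heads.head ℓ i n b (λ j → Σ< M (λ t → c t * d t j)) ≡ Σ< M (λ t → c t * Heads.head ℓ i n b (d t))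
swap-* : ∀ a c x → a * (c * x) ≡ c * (a * x)
swap-* = ℤS.solve 3 (λ a c x → a :* (c :* x) := c :* (a :* x)) refl

Σ<-push : ∀ M a (c x : ℕ → ℤ) → a * Σ< M (λ t → c t * x t) ≡ Σ< M (λ t → c t * (a * x t))
Σ<-push M a c x = trans (sym (Σ<-*ˡ M a (λ t → c t * x t))) (Σ<-cong M (λ t _ → swap-* a (c t) (x t)))

Σ<-join : ∀ M (c x y : ℕ → ℤ) → Σ< M (λ t → c t * x t) + Σ< M (λ t → c t * y t) ≡ Σ< M (λ t → c t * (x t + y t))
Σ<-join M c x y = trans (sym (Σ<-+ M (λ t → c t * x t) (λ t → c t * y t))) (Σ<-cong M (λ t _ → sym (ℤP.*-distribˡ-+ (c t) (x t) (y t))))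

followers-linear zero k n M c d = Σ<-push M (ind (n ℕ.≡ᵇ 0)) c (λ t → d t 0)
followers-linear (suc ℓ) k n M c d = trans (cong₂ _+_
    (trans (Σ<-cong k (λ i _ → trans (cong₂ _+_ (head-linear ℓ i n true M c d) (head-linear ℓ i n false M c d)) (Σ<-join M c _ _)))
      (trans (Σ<-swap k M (λ i t → c t * (overlinedHead ℓ i n (d t) + plainHead ℓ i n (d t))))
        (Σ<-cong M (λ t _ → Σ<-*ˡ k (c t) (λ i → overlinedHead ℓ i n (d t) + plainHead ℓ i n (d t))))))
    (head-linear ℓ k n false M c d)) (Σ<-join M c _ _)
head-linear ℓ i n b M c d = trans (cong (λ z → ind (i ℕ.<ᵇ n) * z) (followers-linear ℓ i (n ℕ.∸ suc i) M c (λ t j → d t (charge (suc i , b) ℕ.+ j))))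
  (Σ<-push M (ind (i ℕ.<ᵇ n)) c (λ t → followers ℓ i (n ℕ.∸ suc i) (λ j → d t (charge (suc i , b) ℕ.+ j))))

followers-0 : ∀ ℓ k n → followers ℓ k n (λ _ → + 0) ≡ + 0
followers-0 ℓ k n = followers-linear ℓ k n 0 (λ _ → + 0) (λ _ _ → + 0)

followers-long : ∀ ℓ k n h → n ℕ.< ℓ → followers ℓ k n h ≡ + 0
head-long : ∀ ℓ i n b h → n ℕ.≤ ℓ → Heads.head ℓ i n b h ≡ + 0
followers-long (suc ℓ) k n h (s≤s n≤ℓ) = cong₂ _+_ (trans (Σ<-cong k (λ i _ → cong₂ _+_ (head-long ℓ i n true h n≤ℓ) (head-long ℓ i n false h n≤ℓ))) (Σ<-0 k)) (head-long ℓ k n false h n≤ℓ)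
head-long ℓ i n b h n≤ℓ = trans (<ᵇ-elim i n (followers ℓ i (n ℕ.∸ suc i) (λ j → h (charge (suc i , b) ℕ.+ j))) (+ 0)
  (λ i<n → followers-long ℓ i (n ℕ.∸ suc i) _ (ℕP.<-≤-trans (∸-suc-< i<n) n≤ℓ))) (ℤP.*-zeroʳ (ind (i ℕ.<ᵇ n)))

-- upToSize k counts the overpartitions with parts of size at most k, upToPlain k admits in addition
-- non-overlined parts of size k + 1, and startingWith b i requires the largest part to be (i + 1 , b).
upToPlain upToSize : ℕ → ℕ → (ℕ → ℤ) → ℤ
startingWith : Bool → ℕ → ℕ → (ℕ → ℤ) → ℤ
upToPlain k n h = Σ< (suc n) (λ ℓ → followers ℓ k n h)
startingWith b i n h = ind (i ℕ.<ᵇ n) * upToPlain i (n ℕ.∸ suc i) (λ j → h (charge (suc i , b) ℕ.+ j))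
upToSize k n h = ind (n ℕ.≡ᵇ 0) * h 0 + Σ< k (λ i → startingWith true i n h + startingWith false i n h)

Σ<-head : ∀ i n b h → Σ< n (λ ℓ → Heads.head ℓ i n b h) ≡ startingWith b i n h
Σ<-head i n b h = trans (Σ<-*ˡ n (ind (i ℕ.<ᵇ n)) _) (<ᵇ-elim i n _ _ (λ i<n →
  Σ<-extend (λ ℓ → followers ℓ i (n ℕ.∸ suc i) (λ j → h (charge (suc i , b) ℕ.+ j))) (λ ℓ lt → followers-long ℓ i (n ℕ.∸ suc i) _ lt) n (∸-suc-< i<n)))

upToPlain-step : ∀ k n h → upToPlain k n h ≡ upToSize k n h + startingWith false k n h
upToPlain-step k n h = trans (cong (λ z → ind (n ℕ.≡ᵇ 0) * h 0 + z) (trans (Σ<-+ n (λ ℓ → Σ< k (λ i → overlinedHead ℓ i n h + plainHead ℓ i n h)) (λ ℓ → plainHead ℓ k n h))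
    (cong₂ _+_ (trans (Σ<-swap n k (λ ℓ i → overlinedHead ℓ i n h + plainHead ℓ i n h))
      (Σ<-cong k (λ i _ → trans (Σ<-+ n (λ ℓ → overlinedHead ℓ i n h) (λ ℓ → plainHead ℓ i n h)) (cong₂ _+_ (Σ<-head i n true h) (Σ<-head i n false h)))))
      (Σ<-head k n false h))))
  (sym (ℤP.+-assoc (ind (n ℕ.≡ᵇ 0) * h 0) (Σ< k (λ i → startingWith true i n h + startingWith false i n h)) (startingWith false k n h)))

upToSize-step : ∀ k n h → upToSize (suc k) n h ≡ upToPlain k n h + startingWith true k n h
upToSize-step k n h = trans (cong (λ z → ind (n ℕ.≡ᵇ 0) * h 0 + z) (Σ<-last k (λ i → startingWith true i n h + startingWith false i n h)))
  (trans (ℤS.solve 4 (λ a s o p → a :+ (s :+ (o :+ p)) := (a :+ s :+ p) :+ o) refl (ind (n ℕ.≡ᵇ 0) * h 0) (Σ< k (λ i → startingWith true i n h + startingWith false i n h)) (startingWith true k n h) (startingWith false k n h))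
    (cong (_+ startingWith true k n h) (sym (upToPlain-step k n h))))

unitAt : ℕ → ℕ → ℤ
unitAt t j = ind (j ℕ.≡ᵇ t)

-- Any statistic of the number of charged parts is a combination of the counts with exactly `t` of
-- them, and `t ≤ n` because parts are positive. This is the passage to generating functions in two
-- variables.
upToPlain-expand : ∀ k n h → upToPlain k n h ≡ Σ< (suc n) (λ t → h t * upToPlain k n (unitAt t))
upToPlain-expand k n h = begin
  Σ< (suc n) (λ ℓ → followers ℓ k n h)
    ≡⟨ Σ<-cong (suc n) (λ ℓ ℓ<sn → trans (followers-cong ℓ k n (λ j j≤ℓ → sym (select j (ℕP.≤-<-trans j≤ℓ ℓ<sn)))) (followers-linear ℓ k n (suc n) h unitAt)) ⟩
  Σ< (suc n) (λ ℓ → Σ< (suc n) (λ t → h t * followers ℓ k n (unitAt t)))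
    ≡⟨ Σ<-swap (suc n) (suc n) (λ ℓ t → h t * followers ℓ k n (unitAt t)) ⟩
  Σ< (suc n) (λ t → Σ< (suc n) (λ ℓ → h t * followers ℓ k n (unitAt t)))
    ≡⟨ Σ<-cong (suc n) (λ t _ → Σ<-*ˡ (suc n) (h t) (λ ℓ → followers ℓ k n (unitAt t))) ⟩
  Σ< (suc n) (λ t → h t * upToPlain k n (unitAt t)) ∎
  where
  open ≡.≡-Reasoning
  select : ∀ j → j ℕ.< suc n → Σ< (suc n) (λ t → h t * unitAt t j) ≡ h j
  select j j<sn = trans (Σ<-cong (suc n) (λ t _ → ℤP.*-comm (h t) (unitAt t j))) (Σ<-at h j<sn)

upToPlain-cong : ∀ k n {h h′} → (∀ j → h j ≡ h′ j) → upToPlain k n h ≡ upToPlain k n h′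
upToPlain-cong k n p = Σ<-cong (suc n) (λ ℓ _ → followers-cong ℓ k n (λ j _ → p j))

upToPlain-0 : ∀ k n → upToPlain k n (λ _ → + 0) ≡ + 0
upToPlain-0 k n = trans (Σ<-cong (suc n) (λ ℓ _ → followers-0 ℓ k n)) (Σ<-0 (suc n))

≡ᵇ-≢ : ∀ {i j} → i ℕ.< j → ind (i ℕ.≡ᵇ j) ≡ + 0
≡ᵇ-≢ {zero} {suc j} _ = refl
≡ᵇ-≢ {suc i} {suc j} (s≤s i<j) = ≡ᵇ-≢ i<j

upToPlain-high : ∀ k n t → n ℕ.< t → upToPlain k n (unitAt t) ≡ + 0
upToPlain-high k n t n<t = trans (Σ<-cong (suc n) (λ ℓ ℓ<sn → trans (followers-cong ℓ k n (λ j j≤ℓ → ≡ᵇ-≢ (ℕP.≤-<-trans j≤ℓ (ℕP.≤-<-trans (ℕP.≤-pred ℓ<sn) n<t)))) (followers-0 ℓ k n))) (Σ<-0 (suc n))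

-- The rank in terms of largest part and charges

lengths : ∀ r → List.length r ≡ charges r ℕ.+ numOddNonOverlined r
lengths [] = refl
lengths ((k , b) ∷ r) with isOdd k ∧ not b
... | true = trans (cong suc (lengths r)) (sym (ℕP.+-suc (charges r) (numOddNonOverlined r)))
... | false = cong suc (lengths r)

headRank : ℕ → Bool → ℤ
headRank i b = + ((suc i ℕ.+ 1) / 2) - + chi ((suc i , b) ∷ [])

-- The number of parts minus that of odd non-overlined parts is the number of charged parts; what is
-- left of the rank depends on the largest part alone.
m2rank-head : ∀ i b r → m2rank ((suc i , b) ∷ r) ≡ headRank i b - + charges ((suc i , b) ∷ r)
m2rank-head i b r = trans (cong (λ z → ((x - + z) + + o) - + chi ((suc i , b) ∷ r)) (lengths ((suc i , b) ∷ r)))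
  (ℤS.solve 4 (λ x c o h → ((x :- (c :+ o)) :+ o) :- h := (x :- h) :- c) refl x (+ charges ((suc i , b) ∷ r)) (+ o) (+ chi ((suc i , b) ∷ r)))
  where
  x = + ((suc i ℕ.+ 1) / 2)
  o = numOddNonOverlined ((suc i , b) ∷ r)

rankTotal : (ℤ → ℤ) → ℕ → ℤ
rankTotal f n = total-over (λ λs → ind (isOverpartitionOf n λs) * f (m2rank λs)) (candidates n)

rankTotal-heads : ∀ f n → let N = suc n in
  rankTotal f N ≡ Σ< N (λ i → startingWith true i N (λ j → f (headRank i true - + j)) + startingWith false i N (λ j → f (headRank i false - + j)))
rankTotal-heads f n = begin
  rankTotal f N
    ≡⟨ trans (over-concatMap value (listsOfLength (alphabet N)) (List.upTo (suc N))) (over-applyUpTo (λ ℓ → total-over value (listsOfLength (alphabet N) ℓ)) (λ i → i) (suc N)) ⟩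
  Σ< (suc N) (λ ℓ → total-over value (listsOfLength (alphabet N) ℓ))
    -- The empty list has weight 0 and is not an overpartition of `N`, which is positive.
    ≡⟨ ℤP.+-identityˡ (Σ< N (λ ℓ → total-over value (listsOfLength (alphabet N) (suc ℓ)))) ⟩
  Σ< N (λ ℓ → total-over value (listsOfLength (alphabet N) (suc ℓ)))
    ≡⟨ Σ<-cong N (λ ℓ _ → trans (over-lists N ℓ value) (Σ<-cong N (λ i i<N → cong₂ _+_ (evaluate ℓ i i<N true) (evaluate ℓ i i<N false)))) ⟩
  Σ< N (λ ℓ → Σ< N (λ i → Heads.head ℓ i N true (h i true) + Heads.head ℓ i N false (h i false)))
    ≡⟨ Σ<-swap N N (λ ℓ i → Heads.head ℓ i N true (h i true) + Heads.head ℓ i N false (h i false)) ⟩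
  Σ< N (λ i → Σ< N (λ ℓ → Heads.head ℓ i N true (h i true) + Heads.head ℓ i N false (h i false)))
    ≡⟨ Σ<-cong N (λ i _ → trans (Σ<-+ N (λ ℓ → Heads.head ℓ i N true (h i true)) (λ ℓ → Heads.head ℓ i N false (h i false))) (cong₂ _+_ (Σ<-head i N true (h i true)) (Σ<-head i N false (h i false)))) ⟩
  Σ< N (λ i → startingWith true i N (h i true) + startingWith false i N (h i false)) ∎
  where
  open ≡.≡-Reasoning
  N = suc n
  value : List Part → ℤ
  value λs = ind (isOverpartitionOf N λs) * f (m2rank λs)
  h : ℕ → Bool → ℕ → ℤ
  h i b j = f (headRank i b - + j)
  evaluate : ∀ ℓ i → i ℕ.< N → ∀ b → total-over (λ r → value ((suc i , b) ∷ r)) (listsOfLength (alphabet N) ℓ) ≡ Heads.head ℓ i N b (h i b)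
  evaluate ℓ i i<N b = trans (over-cong (λ r → cong₂ _*_ (head-correct i b N r) (cong f (m2rank-head i b r))) (listsOfLength (alphabet N) ℓ)) (heads-correct ℓ i<N b N (h i b))

half-even : ∀ t → (suc (t ℕ.* 2) ℕ.+ 1) / 2 ≡ suc t
half-even t = trans (cong (λ z → z / 2) (ℕP.+-comm (suc (t ℕ.* 2)) 1)) (m*n/n≡m (suc t) 2)

half-odd : ∀ t → (suc (suc (t ℕ.* 2)) ℕ.+ 1) / 2 ≡ suc t
half-odd t = trans (cong (λ z → z / 2) (ℕP.+-comm (suc t ℕ.* 2) 1)) (trans (+-distrib-/-∣ʳ 1 {n = suc t ℕ.* 2} {d = 2} (divides (suc t) refl)) (m*n/n≡m (suc t) 2))

isOdd-odd : ∀ t → isOdd (suc (t ℕ.* 2)) ≡ true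
isOdd-odd t = cong (ℕ._≡ᵇ 1) ([m+kn]%n≡m%n 1 t 2)

isOdd-even : ∀ t → isOdd (suc (suc (t ℕ.* 2))) ≡ false
isOdd-even t = cong (ℕ._≡ᵇ 1) (m*n%n≡0 (suc t) 2)

∧-false : ∀ b → b ∧ false ≡ false
∧-false true = refl
∧-false false = refl

-- A non-overlined largest part `2 t + 1` contributes `t`; an overlined `2 t + 1` and either kind of
-- `2 t + 2` contribute `t + 1`. The cut between successive contributions thus falls just after the
-- non-overlined parts of odd size, which is where `γ` cuts.
headRank-odd : ∀ t → headRank (t ℕ.* 2) true ≡ + suc t
headRank-odd t = trans (cong₂ (λ a b → + a - + (if b then 1 else 0)) (half-even t) (∧-false (isOdd (suc (t ℕ.* 2))))) (ℤP.+-identityʳ (+ suc t))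

headRank-odd-plain : ∀ t → headRank (t ℕ.* 2) false ≡ + t
headRank-odd-plain t = cong₂ (λ a b → + a - + (if b ∧ true then 1 else 0)) (half-even t) (isOdd-odd t)

headRank-even : ∀ t b → headRank (suc (t ℕ.* 2)) b ≡ + suc t
headRank-even t b = trans (cong₂ (λ x y → + x - + (if y ∧ not b then 1 else 0)) (half-odd t) (isOdd-even t)) (ℤP.+-identityʳ (+ suc t))

charge-overlined : ∀ k → charge (k , true) ≡ 1
charge-overlined k = cong (λ z → if z then 0 else 1) (∧-false (isOdd k))

charge-odd : ∀ t → charge (suc (t ℕ.* 2) , false) ≡ 0
charge-odd t = cong (λ z → if z ∧ true then 0 else 1) (isOdd-odd t)

charge-even : ∀ t → charge (suc (suc (t ℕ.* 2)) , false) ≡ 1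
charge-even t = cong (λ z → if z ∧ true then 0 else 1) (isOdd-even t)

startingWith-cong : ∀ b i n {h h′} → (∀ j → h j ≡ h′ j) → startingWith b i n h ≡ startingWith b i n h′
startingWith-cong b i n p = cong (λ z → ind (i ℕ.<ᵇ n) * z) (upToPlain-cong i (n ℕ.∸ suc i) (λ j → p (charge (suc i , b) ℕ.+ j)))

startingWith-large : ∀ b i n h → n ℕ.≤ i → startingWith b i n h ≡ + 0
startingWith-large b i n h n≤i = trans (<ᵇ-elim i n (upToPlain i (n ℕ.∸ suc i) (λ j → h (charge (suc i , b) ℕ.+ j))) (+ 0) (λ i<n → ⊥-elim (ℕP.≤⇒≯ n≤i i<n))) (ℤP.*-zeroʳ (ind (i ℕ.<ᵇ n)))

-- γ k is the generating function of the overpartitions whose largest part contributes at most k to the rank.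
γ : ℕ → ℕ → Series
γ k j n = upToPlain (k ℕ.* 2) n (unitAt j)

module _ (f : ℤ → ℤ) where

  shifted : ℕ → ℕ → ℤ
  shifted k j = f (+ k - + j)

  increments : ℕ → ℕ → ℤ
  increments n K = upToPlain 0 n (shifted 0) + Σ< K (λ k → upToPlain (suc k ℕ.* 2) n (shifted (suc k)) - upToPlain (k ℕ.* 2) n (shifted (suc k)))

  heads : ℕ → ℕ → ℤ
  heads n i = startingWith true i n (λ j → f (headRank i true - + j)) + startingWith false i n (λ j → f (headRank i false - + j))

  -- The contribution `K + 1` belongs to four kinds of largest part, from overlined `2 K + 1` to
  -- non-overlined `2 K + 3`. A sum over sizes stops before the last of these, whence the extra
  -- `startingWith` term on the left.
  heads-increments : ∀ n K → Σ< (K ℕ.* 2) (heads (suc n)) + startingWith false (K ℕ.* 2) (suc n) (shifted K) ≡ increments (suc n) K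
  heads-increments n zero = trans (ℤP.+-identityˡ (startingWith false 0 (suc n) (shifted 0))) (sym (trans (ℤP.+-identityʳ (upToPlain 0 (suc n) (shifted 0)))
    (trans (upToPlain-step 0 (suc n) (shifted 0)) (ℤP.+-identityˡ (startingWith false 0 (suc n) (shifted 0))))))
  heads-increments n (suc K) = begin
    Σ< (2 ℕ.+ i) (heads N) + plain (2 ℕ.+ i)
      ≡⟨ cong (_+ plain (2 ℕ.+ i)) (trans (Σ<-last (suc i) (heads N)) (cong₂ _+_ (Σ<-last i (heads N)) refl)) ⟩
    Σ< i (heads N) + heads N i + heads N (suc i) + plain (2 ℕ.+ i)
      ≡⟨ cong₂ (λ a b → Σ< i (heads N) + a + b + plain (2 ℕ.+ i))
           (cong₂ _+_ (startingWith-cong true i N (λ j → cong (λ z → f (z - + j)) (headRank-odd K))) (startingWith-cong false i N (λ j → cong (λ z → f (z - + j)) (headRank-odd-plain K))))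
           (cong₂ _+_ (startingWith-cong true (suc i) N (λ j → cong (λ z → f (z - + j)) (headRank-even K true))) (startingWith-cong false (suc i) N (λ j → cong (λ z → f (z - + j)) (headRank-even K false)))) ⟩
    Σ< i (heads N) + (o₀ + p₀) + (o₁ + p₁) + p₂
      ≡⟨ ℤS.solve 7 (λ s o₀ p₀ o₁ p₁ p₂ b → s :+ (o₀ :+ p₀) :+ (o₁ :+ p₁) :+ p₂ := (s :+ p₀) :+ ((b :+ o₀ :+ p₁ :+ o₁ :+ p₂) :- b)) refl (Σ< i (heads N)) o₀ p₀ o₁ p₁ p₂ (upToPlain i N g) ⟩
    (Σ< i (heads N) + p₀) + ((upToPlain i N g + o₀ + p₁ + o₁ + p₂) - upToPlain i N g)
      ≡⟨ cong₂ (λ a b → a + (b - upToPlain i N g)) (heads-increments n K) (sym up) ⟩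
    increments N K + (upToPlain (2 ℕ.+ i) N g - upToPlain i N g)
      ≡⟨ trans (ℤP.+-assoc (upToPlain 0 N (shifted 0)) _ _) (cong (λ z → upToPlain 0 N (shifted 0) + z) (sym (Σ<-last K _))) ⟩
    increments N (suc K) ∎
    where
    open ≡.≡-Reasoning
    N = suc n
    i = K ℕ.* 2
    g = shifted (suc K)
    plain : ℕ → ℤ
    plain i = startingWith false i N g
    o₀ = startingWith true i N g
    p₀ = startingWith false i N (shifted K)
    o₁ = startingWith true (suc i) N g
    p₁ = startingWith false (suc i) N g
    p₂ = startingWith false (2 ℕ.+ i) N g
    up : upToPlain (2 ℕ.+ i) N g ≡ upToPlain i N g + o₀ + p₁ + o₁ + p₂
    up = trans (upToPlain-step (2 ℕ.+ i) N g) (cong (_+ p₂) (trans (upToSize-step (suc i) N g) (cong (_+ o₁)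
      (trans (upToPlain-step (suc i) N g) (cong (_+ p₁) (upToSize-step i N g))))))

  rankTotal-γ : ∀ n → let N = suc n in rankTotal f N ≡ Σ< (suc N) (λ t → shifted 0 t * γ 0 t N)
    + Σ< N (λ k → Σ< (suc N) (λ t → shifted (suc k) t * (γ (suc k) t N - γ k t N)))
  -- Sizes above `N` contribute nothing. The range of sizes is extended to `2 N`, so that they can
  -- be grouped in pairs.
  rankTotal-γ n = trans (rankTotal-heads f n) (trans (sym (Σ<-extend (heads N) (λ i N≤i → cong₂ _+_ (startingWith-large true i N (λ j → f (headRank i true - + j)) N≤i) (startingWith-large false i N (λ j → f (headRank i false - + j)) N≤i)) (N ℕ.* 2) (ℕP.m≤m*n N 2)))
    (trans (sym (ℤP.+-identityʳ (Σ< (N ℕ.* 2) (heads N)))) (trans (cong (λ z → Σ< (N ℕ.* 2) (heads N) + z) (sym (startingWith-large false (N ℕ.* 2) N (shifted N) (ℕP.m≤m*n N 2))))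
    (trans (heads-increments n N) (cong₂ _+_ (upToPlain-expand 0 N (shifted 0)) (Σ<-cong N (λ k _ → difference k)))))))
    where
    N = suc n
    difference : ∀ k → upToPlain (suc k ℕ.* 2) N (shifted (suc k)) - upToPlain (k ℕ.* 2) N (shifted (suc k)) ≡ Σ< (suc N) (λ t → shifted (suc k) t * (γ (suc k) t N - γ k t N))
    difference k = trans (cong₂ _-_ (upToPlain-expand (suc k ℕ.* 2) N (shifted (suc k))) (upToPlain-expand (k ℕ.* 2) N (shifted (suc k))))
      (trans (ℤS.solve 2 (λ a b → a :- b := a :+ con -[1+ 0 ] :* b) refl (Σ< (suc N) (λ t → shifted (suc k) t * γ (suc k) t N)) (Σ< (suc N) (λ t → shifted (suc k) t * γ k t N)))
      (trans (cong (λ z → Σ< (suc N) (λ t → shifted (suc k) t * γ (suc k) t N) + z) (Σ<-push (suc N) -[1+ 0 ] (shifted (suc k)) (λ t → γ k t N)))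
      (trans (Σ<-join (suc N) (shifted (suc k)) (λ t → γ (suc k) t N) (λ t → -[1+ 0 ] * γ k t N))
        (Σ<-cong (suc N) (λ t _ → cong (λ z → shifted (suc k) t * z) (ℤS.solve 2 (λ a b → a :+ con -[1+ 0 ] :* b := a :- b) refl (γ (suc k) t N) (γ k t N)))))))

-- The recurrences of γ as identities between power series in a second variable w.
shiftW : (ℕ → Series) → ℕ → Series
shiftW X zero = λ _ → + 0
shiftW X (suc j) = X j

q^-coefficients : ∀ i X n → (q^ (suc i) ⊗ X) n ≡ ind (i ℕ.<ᵇ n) * X (n ℕ.∸ suc i)
q^-coefficients i X zero = Ord-⊗ {+ suc i} {q^ (suc i)} (Ord-mono (+ suc i)) X 0 (ℤ.+<+ (s≤s z≤n))
q^-coefficients zero X (suc n) = trans (q^-suc-⊗ 0 X n) (trans (⊗-identityˡ X n) (sym (ℤP.*-identityˡ (X n))))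
q^-coefficients (suc i) X (suc n) = trans (q^-suc-⊗ (suc i) X n) (q^-coefficients i X n)

plainW sizeW : ℕ → ℕ → Series
plainW i j n = upToPlain i n (unitAt j)
sizeW i j n = upToSize i n (unitAt j)

startingWith-charged : ∀ b i j → charge (suc i , b) ≡ 1 → (λ n → startingWith b i n (unitAt j)) ≈ˢ q^ (suc i) ⊗ shiftW (plainW i) j
startingWith-charged b i zero c n = trans (cong (λ z → ind (i ℕ.<ᵇ n) * z) (trans (upToPlain-cong i (n ℕ.∸ suc i) (λ j → cong (λ z → unitAt 0 (z ℕ.+ j)) c)) (upToPlain-0 i (n ℕ.∸ suc i))))
  (trans (ℤP.*-zeroʳ (ind (i ℕ.<ᵇ n))) (sym (⊗-zeroʳ (q^ (suc i)) n)))
startingWith-charged b i (suc j) c n = trans (cong (λ z → ind (i ℕ.<ᵇ n) * z) (upToPlain-cong i (n ℕ.∸ suc i) (λ t → cong (λ z → unitAt (suc j) (z ℕ.+ t)) c)))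
  (sym (q^-coefficients i (plainW i j) n))

startingWith-free : ∀ b i j → charge (suc i , b) ≡ 0 → (λ n → startingWith b i n (unitAt j)) ≈ˢ q^ (suc i) ⊗ plainW i j
startingWith-free b i j c n = trans (cong (λ z → ind (i ℕ.<ᵇ n) * z) (upToPlain-cong i (n ℕ.∸ suc i) (λ t → cong (λ z → unitAt j (z ℕ.+ t)) c)))
  (sym (q^-coefficients i (plainW i j) n))

sizeW-step : ∀ i j → sizeW (suc i) j ≈ˢ plainW i j ⊕ q^ (suc i) ⊗ shiftW (plainW i) j
sizeW-step i j n = trans (upToSize-step i n (unitAt j)) (cong (λ z → plainW i j n + z) (startingWith-charged true i j (charge-overlined (suc i)) n))

plainW-odd : ∀ t j → plainW (t ℕ.* 2) j ≈ˢ sizeW (t ℕ.* 2) j ⊕ q^ (suc (t ℕ.* 2)) ⊗ plainW (t ℕ.* 2) j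
plainW-odd t j n = trans (upToPlain-step (t ℕ.* 2) n (unitAt j)) (cong (λ z → sizeW (t ℕ.* 2) j n + z) (startingWith-free false (t ℕ.* 2) j (charge-odd t) n))

plainW-even : ∀ t j → plainW (suc (t ℕ.* 2)) j ≈ˢ sizeW (suc (t ℕ.* 2)) j ⊕ q^ (suc (suc (t ℕ.* 2))) ⊗ shiftW (plainW (suc (t ℕ.* 2))) j
plainW-even t j n = trans (upToPlain-step (suc (t ℕ.* 2)) n (unitAt j)) (cong (λ z → sizeW (suc (t ℕ.* 2)) j n + z) (startingWith-charged false (suc (t ℕ.* 2)) j (charge-even t) n))

sizeW-0 : ∀ j → sizeW 0 (suc j) ≈ˢ λ _ → + 0
sizeW-0 j n = trans (ℤP.+-identityʳ (ind (n ℕ.≡ᵇ 0) * + 0)) (ℤP.*-zeroʳ (ind (n ℕ.≡ᵇ 0)))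

sizeW-00 : sizeW 0 0 ≈ˢ one
sizeW-00 zero = refl
sizeW-00 (suc n) = refl

-- The contiguous relation

module PS = PowerSeries seriesRing
module 𝕎 = IntegerCoefficients PS.powerSeriesRing
open 𝕎 using () renaming (_:+_ to _:+:_; _:*_ to _:*:_; :-_ to :-:_; _:-_ to _:-:_; _:=_ to _:=:_; con to :con)

:1 : ∀ {n} → 𝕎.Polynomial n
:1 = :con (+ 1)

module WM = Modulo PS.powerSeriesRing

open CommutativeRing PS.powerSeriesRing using () renaming (_+_ to _+ᵂ_; _*_ to _*ᵂ_; -_ to -ᵂ_; _≈_ to _≈ᵂ_; 1# to 1ᵂ; 0# to 0ᵂ; trans to transᵂ; sym to symᵂ; refl to reflᵂ; +-cong to +ᵂ-cong; *-cong to *ᵂ-cong; *-congˡ to *ᵂ-congˡ; *-congʳ to *ᵂ-congʳ; -‿cong to -ᵂ-cong; +-congˡ to +ᵂ-congˡ; +-congʳ to +ᵂ-congʳ)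

W : Set
W = ℕ → Series

w : W
w zero = λ _ → + 0
w (suc zero) = one
w (suc (suc _)) = λ _ → + 0

Q : ℕ → W
Q k = PS.constant (q^ k)

constant-*ᵂ : ∀ a X → PS.constant a *ᵂ X ≈ᵂ λ j → a ⊗ X j
constant-*ᵂ a X j = PS.constant-· a X j

w-shift : ∀ X → w *ᵂ X ≈ᵂ shiftW X
w-shift X zero = ⊗-zeroˡ (X 0)
w-shift X (suc j) = ≈-trans (⊕-cong (⊗-zeroˡ (X (suc j))) (≈-trans (PS.·-cong {f = PS.tail w} {f′ = PS.constant one} {g = X} tail-w (λ _ → ≈-refl) j) (PS.·-identityˡ X j))) (λ n → ℤP.+-identityˡ (X j n))
  where
  tail-w : ∀ n → PS.tail w n ≈ˢ PS.constant one n
  tail-w zero = ≈-refl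
  tail-w (suc n) = ≈-refl

Q-+ : ∀ a b → Q a *ᵂ Q b ≈ᵂ Q (a ℕ.+ b)
Q-+ a b j = ≈-trans (constant-*ᵂ (q^ a) (Q b) j) (go j)
  where
  go : ∀ j → q^ a ⊗ Q b j ≈ˢ Q (a ℕ.+ b) j
  go zero = q^-+ a b
  go (suc j) = ⊗-zeroʳ (q^ a)

-- Substitution w ↦ w q².
dil : W → W
dil X j = q^ (j ℕ.* 2) ⊗ X j

dil-cong : ∀ {X Y} → X ≈ᵂ Y → dil X ≈ᵂ dil Y
dil-cong p j = ⊗-congˡ {q^ (j ℕ.* 2)} (p j)

dil-+ : ∀ X Y → dil (X +ᵂ Y) ≈ᵂ dil X +ᵂ dil Y
dil-+ X Y j = ⊗-distribˡ-⊕ (q^ (j ℕ.* 2)) (X j) (Y j)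

dil-neg : ∀ X → dil (-ᵂ X) ≈ᵂ -ᵂ dil X
dil-neg X j = 𝕊.solve 2 (λ q x → q *: (-: x) =: -: (q *: x)) ≈-refl (q^ (j ℕ.* 2)) (X j)

dil-constant : ∀ a → dil (PS.constant a) ≈ᵂ PS.constant a
dil-constant a zero = ⊗-identityˡ a
dil-constant a (suc j) = ⊗-zeroʳ (q^ (suc j ℕ.* 2))

dil-* : ∀ X Y → dil (X *ᵂ Y) ≈ᵂ dil X *ᵂ dil Y
dil-* X Y zero = 𝕊.solve 2 (λ x y → 1: *: (x *: y) =: (1: *: x) *: (1: *: y)) ≈-refl (X 0) (Y 0)
dil-* X Y (suc j) = begin
  q^ (2 ℕ.+ j ℕ.* 2) ⊗ (X 0 ⊗ Y (suc j) ⊕ (PS.tail X PS.· Y) j)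
    ≈⟨ 𝕊.solve 4 (λ r x y t → r *: (x *: y +: t) =: (1: *: x) *: (r *: y) +: r *: t) ≈-refl (q^ (2 ℕ.+ j ℕ.* 2)) (X 0) (Y (suc j)) ((PS.tail X PS.· Y) j) ⟩
  dil X 0 ⊗ dil Y (suc j) ⊕ q^ (2 ℕ.+ j ℕ.* 2) ⊗ (PS.tail X PS.· Y) j
    ≈⟨ ⊕-cong (≈-refl {dil X 0 ⊗ dil Y (suc j)}) (≈-trans (⊗-congʳ {(PS.tail X PS.· Y) j} (≈-sym (q^-+ 2 (j ℕ.* 2)))) (≈-trans (⊗-assoc (q^ 2) (q^ (j ℕ.* 2)) ((PS.tail X PS.· Y) j)) (⊗-congˡ {q^ 2} (dil-* (PS.tail X) Y j)))) ⟩
  dil X 0 ⊗ dil Y (suc j) ⊕ q^ 2 ⊗ (dil (PS.tail X) PS.· dil Y) j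
    ≈⟨ ⊕-cong (≈-refl {dil X 0 ⊗ dil Y (suc j)}) (≈-sym (≈-trans (PS.·-cong {f = PS.tail (dil X)} {f′ = λ i → q^ 2 ⊗ dil (PS.tail X) i} {g = dil Y} tail-dil (λ _ → ≈-refl) j) (PS.·-scaleˡ (q^ 2) (dil (PS.tail X)) (dil Y) j))) ⟩
  (dil X *ᵂ dil Y) (suc j) ∎
  where
  open SetoidReasoning seriesSetoid
  tail-dil : ∀ i → PS.tail (dil X) i ≈ˢ q^ 2 ⊗ dil (PS.tail X) i
  tail-dil i = ≈-trans (⊗-congʳ {X (suc i)} (≈-sym (q^-+ 2 (i ℕ.* 2)))) (⊗-assoc (q^ 2) (q^ (i ℕ.* 2)) (X (suc i)))

dil-w : dil w ≈ᵂ Q 2 *ᵂ w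
dil-w j = ≈-trans (go j) (≈-sym (constant-*ᵂ (q^ 2) w j))
  where
  go : ∀ j → dil w j ≈ˢ q^ 2 ⊗ w j
  go zero = ≈-trans (⊗-zeroʳ (q^ 0)) (≈-sym (⊗-zeroʳ (q^ 2)))
  go (suc zero) = ≈-refl
  go (suc (suc j)) = ≈-trans (⊗-zeroʳ (q^ (suc (suc j) ℕ.* 2))) (≈-sym (⊗-zeroʳ (q^ 2)))

·-vanish : ∀ V D n → (∀ i → i ℕ.≤ n → Zero (D i)) → Zero ((V PS.· D) n)
·-vanish V D zero z = ≈-trans (⊗-congˡ {V 0} (z 0 z≤n)) (⊗-zeroʳ (V 0))
·-vanish V D (suc n) z = Zero-⊕ (≈-trans (⊗-congˡ {V 0} (z (suc n) ℕP.≤-refl)) (⊗-zeroʳ (V 0))) (·-vanish (PS.tail V) D n (λ i i≤n → z i (ℕP.m≤n⇒m≤1+n i≤n)))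

·-cancel-0 : ∀ U D → Unit (U 0) → (∀ n → Zero ((U PS.· D) n)) → ∀ n i → i ℕ.≤ n → Zero (D i)
·-cancel-0 U D u z n i i≤n with ℕP.m≤n⇒m<n∨m≡n i≤n
·-cancel-0 U D u z (suc n) i i≤n | inj₁ (s≤s i≤n′) = ·-cancel-0 U D u z n i i≤n′
·-cancel-0 U D u z zero .0 i≤n | inj₂ refl = ⊗-cancelˡ {U 0} u (D 0) (λ _ → + 0) (≈-trans (z 0) (≈-sym (⊗-zeroʳ (U 0))))
·-cancel-0 U D u z (suc n) .(suc n) i≤n | inj₂ refl = ⊗-cancelˡ {U 0} u (D (suc n)) (λ _ → + 0) (≈-trans
  (λ m → trans (sym (trans (cong (λ r → (U 0 ⊗ D (suc n)) m + r) (·-vanish (PS.tail U) D n (·-cancel-0 U D u z n) m)) (ℤP.+-identityʳ ((U 0 ⊗ D (suc n)) m)))) (z (suc n) m))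
  (≈-sym (⊗-zeroʳ (U 0))))

-- Invertibility of the lowest coefficient in `w` is enough, by induction on the degree in `w`.
cancelᵂ : ∀ U {X Y} → Unit (U 0) → U *ᵂ X ≈ᵂ U *ᵂ Y → X ≈ᵂ Y
cancelᵂ U {X} {Y} u p j = ⊖-zero (·-cancel-0 U (X +ᵂ -ᵂ Y) u zero′ j j ℕP.≤-refl)
  where
  zero′ : U *ᵂ (X +ᵂ -ᵂ Y) ≈ᵂ 0ᵂ
  zero′ = transᵂ (𝕎.solve 3 (λ u x y → u :*: (x :-: y) :=: :1 :*: (u :*: x :-: u :*: y)) (λ _ _ → refl) U X Y) (WM.vanish-* 1ᵂ {U *ᵂ X} {U *ᵂ Y} p)

infixl 6 _-ᵂ_
_-ᵂ_ : W → W → W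
X -ᵂ Y = X +ᵂ -ᵂ Y

1-w 1+w : W → W
1-w X = 1ᵂ -ᵂ X *ᵂ w
1+w X = 1ᵂ +ᵂ X *ᵂ w

γ-step : ∀ k → (1ᵂ -ᵂ Q (3 ℕ.+ k ℕ.* 2)) *ᵂ (1-w (Q (2 ℕ.+ k ℕ.* 2)) *ᵂ γ (suc k)) ≈ᵂ 1+w (Q (1 ℕ.+ k ℕ.* 2)) *ᵂ (1+w (Q (2 ℕ.+ k ℕ.* 2)) *ᵂ γ k)
γ-step k = WM.remove
  (𝕎.solve 9 (λ w a b c g σ₁ p σ₂ g′ → (:1 :-: c) :*: ((:1 :-: b :*: w) :*: g′)
     :=: (:1 :+: a :*: w) :*: ((:1 :+: b :*: w) :*: g)
       :+: ((:1 :-: b :*: w) :*: (g′ :-: (σ₂ :+: c :*: g′)) :+: (:1 :-: b :*: w) :*: (σ₂ :-: (p :+: b :*: (w :*: p)))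
         :+: (:1 :+: b :*: w) :*: (p :-: (σ₁ :+: b :*: (w :*: p))) :+: (:1 :+: b :*: w) :*: (σ₁ :-: (g :+: a :*: (w :*: g)))))
     (λ _ _ → refl) w a b c (γ k) σ₁ p σ₂ (γ (suc k)))
  (WM.vanish-+ (WM.vanish-+ (WM.vanish-+ (WM.vanish-* (1-w b) e₄) (WM.vanish-* (1-w b) e₃)) (WM.vanish-* (1+w b) e₂)) (WM.vanish-* (1+w b) e₁))
  where
  a b c σ₁ p σ₂ : W
  a = Q (1 ℕ.+ k ℕ.* 2)
  b = Q (2 ℕ.+ k ℕ.* 2)
  c = Q (3 ℕ.+ k ℕ.* 2)
  σ₁ = sizeW (1 ℕ.+ k ℕ.* 2)
  p = plainW (1 ℕ.+ k ℕ.* 2)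
  σ₂ = sizeW (2 ℕ.+ k ℕ.* 2)
  times-w : ∀ m X j → q^ m ⊗ shiftW X j ≈ˢ (Q m *ᵂ (w *ᵂ X)) j
  times-w m X j = ≈-sym (≈-trans (constant-*ᵂ (q^ m) (w *ᵂ X) j) (⊗-congˡ {q^ m} (w-shift X j)))
  e₁ : σ₁ ≈ᵂ γ k +ᵂ a *ᵂ (w *ᵂ γ k)
  e₁ j = ≈-trans (sizeW-step (k ℕ.* 2) j) (⊕-cong (≈-refl {γ k j}) (times-w (1 ℕ.+ k ℕ.* 2) (γ k) j))
  e₂ : p ≈ᵂ σ₁ +ᵂ b *ᵂ (w *ᵂ p)
  e₂ j = ≈-trans (plainW-even k j) (⊕-cong (≈-refl {σ₁ j}) (times-w (2 ℕ.+ k ℕ.* 2) p j))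
  e₃ : σ₂ ≈ᵂ p +ᵂ b *ᵂ (w *ᵂ p)
  e₃ j = ≈-trans (sizeW-step (1 ℕ.+ k ℕ.* 2) j) (⊕-cong (≈-refl {p j}) (times-w (2 ℕ.+ k ℕ.* 2) p j))
  e₄ : γ (suc k) ≈ᵂ σ₂ +ᵂ c *ᵂ γ (suc k)
  e₄ j = ≈-trans (plainW-odd (suc k) j) (⊕-cong (≈-refl {σ₂ j}) (≈-sym (constant-*ᵂ (q^ (3 ℕ.+ k ℕ.* 2)) (γ (suc k)) j)))

dil-sub : ∀ X Y → dil (X -ᵂ Y) ≈ᵂ dil X -ᵂ dil Y
dil-sub X Y = transᵂ (dil-+ X (-ᵂ Y)) (+ᵂ-congˡ {dil X} (dil-neg Y))

dil-Qw : ∀ m → dil (Q m *ᵂ w) ≈ᵂ Q (2 ℕ.+ m) *ᵂ w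
dil-Qw m = transᵂ (dil-* (Q m) w) (transᵂ (*ᵂ-cong (dil-constant (q^ m)) dil-w)
  (transᵂ (𝕎.solve 3 (λ a b w → a :*: (b :*: w) :=: (b :*: a) :*: w) (λ _ _ → refl) (Q m) (Q 2) w) (*ᵂ-congʳ {w} (Q-+ 2 m))))

dil-1-w : ∀ m → dil (1-w (Q m)) ≈ᵂ 1-w (Q (2 ℕ.+ m))
dil-1-w m = transᵂ (dil-sub 1ᵂ (Q m *ᵂ w)) (+ᵂ-cong (dil-constant one) (-ᵂ-cong (dil-Qw m)))

dil-1+w : ∀ m → dil (1+w (Q m)) ≈ᵂ 1+w (Q (2 ℕ.+ m))
dil-1+w m = transᵂ (dil-+ 1ᵂ (Q m *ᵂ w)) (+ᵂ-cong (dil-constant one) (dil-Qw m))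

dil-step : ∀ k → (1ᵂ -ᵂ Q (3 ℕ.+ k ℕ.* 2)) *ᵂ (1-w (Q (4 ℕ.+ k ℕ.* 2)) *ᵂ dil (γ (suc k))) ≈ᵂ 1+w (Q (3 ℕ.+ k ℕ.* 2)) *ᵂ (1+w (Q (4 ℕ.+ k ℕ.* 2)) *ᵂ dil (γ k))
dil-step k = transᵂ (symᵂ (transᵂ (dil-* (1ᵂ -ᵂ Q (3 ℕ.+ k ℕ.* 2)) (1-w (Q (2 ℕ.+ k ℕ.* 2)) *ᵂ γ (suc k)))
    (*ᵂ-cong (transᵂ (dil-sub 1ᵂ (Q (3 ℕ.+ k ℕ.* 2))) (+ᵂ-cong (dil-constant one) (-ᵂ-cong (dil-constant (q^ (3 ℕ.+ k ℕ.* 2))))))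
      (transᵂ (dil-* (1-w (Q (2 ℕ.+ k ℕ.* 2))) (γ (suc k))) (*ᵂ-congʳ {dil (γ (suc k))} (dil-1-w (2 ℕ.+ k ℕ.* 2)))))))
  (transᵂ (dil-cong (γ-step k)) (transᵂ (dil-* (1+w (Q (1 ℕ.+ k ℕ.* 2))) (1+w (Q (2 ℕ.+ k ℕ.* 2)) *ᵂ γ k))
    (*ᵂ-cong (dil-1+w (1 ℕ.+ k ℕ.* 2)) (transᵂ (dil-* (1+w (Q (2 ℕ.+ k ℕ.* 2))) (γ k)) (*ᵂ-congʳ {dil (γ k)} (dil-1+w (2 ℕ.+ k ℕ.* 2)))))))

γ₀-high : ∀ j → Zero (γ 0 (suc j))
γ₀-high j = ⊗-cancelˡ {one ⊖ q^ 1} (is-unit refl) (γ 0 (suc j)) (λ _ → + 0) (≈-trans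
  (𝕊.solve 2 (λ q g → (1: -: q) *: g =: g -: q *: g) ≈-refl (q^ 1) (γ 0 (suc j)))
  (≈-trans (λ n → trans (cong (λ z → z - (q^ 1 ⊗ γ 0 (suc j)) n) (plainW-odd 0 (suc j) n))
      (trans (ℤS.solve 2 (λ s x → s :+ x :- x := s) refl (sizeW 0 (suc j) n) ((q^ 1 ⊗ γ 0 (suc j)) n)) (sizeW-0 j n)))
    (≈-sym (⊗-zeroʳ (one ⊖ q^ 1)))))

γ₀-0 : (one ⊖ q^ 1) ⊗ γ 0 0 ≈ˢ one
γ₀-0 = ≈-trans (𝕊.solve 2 (λ q g → (1: -: q) *: g =: g -: q *: g) ≈-refl (q^ 1) (γ 0 0))
  (λ n → trans (cong (λ z → z - (q^ 1 ⊗ γ 0 0) n) (plainW-odd 0 0 n)) (trans (ℤS.solve 2 (λ s x → s :+ x :- x := s) refl (sizeW 0 0 n) ((q^ 1 ⊗ γ 0 0) n)) (sizeW-00 n)))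

dil-γ₀ : dil (γ 0) ≈ᵂ γ 0
dil-γ₀ zero = ⊗-identityˡ (γ 0 0)
dil-γ₀ (suc j) = ≈-trans (⊗-congˡ {q^ (suc j ℕ.* 2)} (γ₀-high j)) (≈-trans (⊗-zeroʳ (q^ (suc j ℕ.* 2))) (≈-sym (γ₀-high j)))

-- In product form, `γ (suc k)` and the dilated `γ k` differ by the lowest factors in `w` and one
-- factor free of `w`. The induction compares both sides through `γ-step` and `dil-step`, without
-- writing the products.
γ-dil : ∀ k → (1ᵂ -ᵂ Q (3 ℕ.+ k ℕ.* 2)) *ᵂ (1-w (Q 2) *ᵂ γ (suc k)) ≈ᵂ 1+w (Q 1) *ᵂ (1+w (Q 2) *ᵂ dil (γ k))
γ-dil zero = transᵂ (γ-step 0) (*ᵂ-congˡ {1+w (Q 1)} (*ᵂ-congˡ {1+w (Q 2)} (symᵂ dil-γ₀)))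
γ-dil (suc k) = cancelᵂ U (is-unit refl) (WM.remove
  (𝕎.solve 10 (λ w q s a b c x y z g → ((:1 :-: a) :*: (:1 :-: b :*: w)) :*: ((:1 :-: c) :*: ((:1 :-: s :*: w) :*: x))
    :=: ((:1 :-: a) :*: (:1 :-: b :*: w)) :*: ((:1 :+: q :*: w) :*: ((:1 :+: s :*: w) :*: y))
      :+: (((:1 :-: a) :*: (:1 :-: s :*: w)) :*: ((:1 :-: c) :*: ((:1 :-: b :*: w) :*: x) :-: (:1 :+: a :*: w) :*: ((:1 :+: b :*: w) :*: z))
        :+: ((:1 :+: a :*: w) :*: (:1 :+: b :*: w)) :*: ((:1 :-: a) :*: ((:1 :-: s :*: w) :*: z) :-: (:1 :+: q :*: w) :*: ((:1 :+: s :*: w) :*: g))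
        :+: (:-: ((:1 :+: q :*: w) :*: (:1 :+: s :*: w))) :*: ((:1 :-: a) :*: ((:1 :-: b :*: w) :*: y) :-: (:1 :+: a :*: w) :*: ((:1 :+: b :*: w) :*: g))))
    (λ _ _ → refl) w (Q 1) (Q 2) a b c (γ (suc (suc k))) (dil (γ (suc k))) (γ (suc k)) (dil (γ k)))
  (WM.vanish-+ (WM.vanish-+ (WM.vanish-* ((1ᵂ -ᵂ a) *ᵂ 1-w (Q 2)) (γ-step (suc k))) (WM.vanish-* (1+w a *ᵂ 1+w b) (γ-dil k))) (WM.vanish-* (-ᵂ (1+w (Q 1) *ᵂ 1+w (Q 2))) (dil-step k))))
  where
  a b c U : W
  a = Q (3 ℕ.+ k ℕ.* 2)
  b = Q (4 ℕ.+ k ℕ.* 2)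
  c = Q (5 ℕ.+ k ℕ.* 2)
  U = (1ᵂ -ᵂ a) *ᵂ 1-w b

-- As series in `w`, `Γ k` is `γ k / (1 - w)` and `F k` is `(1 + w) / (1 - w)` times `γ k`.
Γ F : ℕ → W
Γ k zero = γ k 0
Γ k (suc j) = Γ k j ⊕ γ k (suc j)
F k = Γ k +ᵂ shiftW (Γ k)

Γ-γ : ∀ k j → Γ k j ≈ˢ γ k j ⊕ shiftW (Γ k) j
Γ-γ k zero n = sym (ℤP.+-identityʳ (γ k 0 n))
Γ-γ k (suc j) n = ℤP.+-comm (Γ k j n) (γ k (suc j) n)

F-γ : ∀ k → (1ᵂ -ᵂ w) *ᵂ F k ≈ᵂ (1ᵂ +ᵂ w) *ᵂ γ k
F-γ k = WM.remove
  (𝕎.solve 4 (λ w f s g → (:1 :-: w) :*: (f :+: s) :=: (:1 :+: w) :*: g :+: ((:1 :+: w) :*: (f :-: (g :+: s)) :+: :con (+ 2) :*: (s :-: w :*: f))) (λ _ _ → refl) w (Γ k) (shiftW (Γ k)) (γ k))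
  (WM.vanish-+ (WM.vanish-* (1ᵂ +ᵂ w) (Γ-γ k)) (WM.vanish-* (𝕎.int (+ 2)) (symᵂ (w-shift (Γ k)))))

dil-F-γ : ∀ k → 1-w (Q 2) *ᵂ dil (F k) ≈ᵂ 1+w (Q 2) *ᵂ dil (γ k)
dil-F-γ k = transᵂ (symᵂ (transᵂ (dil-* (1ᵂ -ᵂ w) (F k)) (*ᵂ-congʳ {dil (F k)} (transᵂ (dil-sub 1ᵂ w) (+ᵂ-cong (dil-constant one) (-ᵂ-cong dil-w))))))
  (transᵂ (dil-cong (F-γ k)) (transᵂ (dil-* (1ᵂ +ᵂ w) (γ k)) (*ᵂ-congʳ {dil (γ k)} (transᵂ (dil-+ 1ᵂ w) (+ᵂ-cong (dil-constant one) dil-w)))))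

-- All series are expressed through the dilated `γ k`. After clearing the denominator
-- `(1 - q^(2k+3)) (1 - q² w)`, an identity of polynomials in `w` remains; the last multiplier
-- identifies `q · q^(2k+3)` with `q^(2k+4)`.
contiguity : ∀ k → Q (3 ℕ.+ k ℕ.* 2) *ᵂ (F (suc k) -ᵂ w *ᵂ F (suc k)) +ᵂ (dil (F k) -ᵂ Q (4 ℕ.+ k ℕ.* 2) *ᵂ (w *ᵂ (w *ᵂ dil (F k)))) ≈ᵂ dil (F (suc k)) -ᵂ Q (4 ℕ.+ k ℕ.* 2) *ᵂ (w *ᵂ dil (F (suc k)))
contiguity k = cancelᵂ ((1ᵂ -ᵂ a) *ᵂ 1-w (Q 2)) (is-unit refl) (WM.remove
  (𝕎.solve 11 (λ w q s a b F′ f′ f G′ d′ d →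
    ((:1 :-: a) :*: (:1 :-: s :*: w)) :*: (a :*: (F′ :-: w :*: F′) :+: (f :-: b :*: (w :*: (w :*: f))))
    :=: ((:1 :-: a) :*: (:1 :-: s :*: w)) :*: (f′ :-: b :*: (w :*: f′))
      :+: ((((:1 :-: a) :*: (:1 :-: s :*: w)) :*: a) :*: ((:1 :-: w) :*: F′ :-: (:1 :+: w) :*: G′)
        :+: (:-: ((:1 :-: a) :*: (:1 :-: b :*: w))) :*: ((:1 :-: s :*: w) :*: f′ :-: (:1 :+: s :*: w) :*: d′)
        :+: ((:1 :-: a) :*: (:1 :-: b :*: (w :*: w))) :*: ((:1 :-: s :*: w) :*: f :-: (:1 :+: s :*: w) :*: d)
        :+: (a :*: (:1 :+: w)) :*: ((:1 :-: a) :*: ((:1 :-: s :*: w) :*: G′) :-: (:1 :+: q :*: w) :*: ((:1 :+: s :*: w) :*: d))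
        :+: (:-: (:1 :+: s :*: w)) :*: ((:1 :-: a) :*: ((:1 :-: b :*: w) :*: d′) :-: (:1 :+: a :*: w) :*: ((:1 :+: b :*: w) :*: d))
        :+: ((w :+: w :*: w) :*: ((:1 :+: s :*: w) :*: d)) :*: (q :*: a :-: b)))
    (λ _ _ → refl) w (Q 1) (Q 2) a b (F (suc k)) (dil (F (suc k))) (dil (F k)) (γ (suc k)) (dil (γ (suc k))) (dil (γ k)))
  (WM.vanish-+ (WM.vanish-+ (WM.vanish-+ (WM.vanish-+ (WM.vanish-+
    (WM.vanish-* (((1ᵂ -ᵂ a) *ᵂ 1-w (Q 2)) *ᵂ a) (F-γ (suc k))) (WM.vanish-* (-ᵂ ((1ᵂ -ᵂ a) *ᵂ 1-w b)) (dil-F-γ (suc k))))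
    (WM.vanish-* ((1ᵂ -ᵂ a) *ᵂ (1ᵂ -ᵂ b *ᵂ (w *ᵂ w))) (dil-F-γ k))) (WM.vanish-* (a *ᵂ (1ᵂ +ᵂ w)) (γ-dil k)))
    (WM.vanish-* (-ᵂ (1+w (Q 2))) (dil-step k))) (WM.vanish-* ((w +ᵂ w *ᵂ w) *ᵂ (1+w (Q 2) *ᵂ dil (γ k))) (Q-+ 1 (3 ℕ.+ k ℕ.* 2)))))
  where
  a b : W
  a = Q (3 ℕ.+ k ℕ.* 2)
  b = Q (4 ℕ.+ k ℕ.* 2)

w²-shift : ∀ X → w *ᵂ (w *ᵂ X) ≈ᵂ shiftW (shiftW X)
w²-shift X = transᵂ (*ᵂ-congˡ {w} (w-shift X)) (w-shift (shiftW X))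

contiguity-coefficients : ∀ k j → q^ (3 ℕ.+ k ℕ.* 2) ⊗ (F (suc k) j ⊖ shiftW (F (suc k)) j) ⊕ q^ (j ℕ.* 2) ⊗ (F k j ⊖ q^ (k ℕ.* 2) ⊗ shiftW (shiftW (F k)) j)
  ≈ˢ q^ (j ℕ.* 2) ⊗ (F (suc k) j ⊖ q^ (2 ℕ.+ k ℕ.* 2) ⊗ shiftW (F (suc k)) j)
contiguity-coefficients k j = ≈-trans (⊕-cong (≈-sym (≈-trans (constant-*ᵂ (q^ (3 ℕ.+ k ℕ.* 2)) (F (suc k) -ᵂ w *ᵂ F (suc k)) j) (⊗-congˡ {q^ (3 ℕ.+ k ℕ.* 2)} (⊖-cong (≈-refl {F (suc k) j}) (w-shift (F (suc k)) j)))))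
    (≈-sym (≈-trans (⊖-cong (≈-refl {dil (F k) j}) (≈-trans (constant-*ᵂ (q^ (4 ℕ.+ k ℕ.* 2)) (w *ᵂ (w *ᵂ dil (F k))) j) (≈-trans (⊗-congˡ {q^ (4 ℕ.+ k ℕ.* 2)} (w²-shift (dil (F k)) j)) (shift₂ j)))) (factor-out (q^ (j ℕ.* 2)) (F k j) (q^ (k ℕ.* 2) ⊗ shiftW (shiftW (F k)) j)))))
  (≈-trans (contiguity k j) (≈-trans (⊖-cong (≈-refl {dil (F (suc k)) j}) (≈-trans (constant-*ᵂ (q^ (4 ℕ.+ k ℕ.* 2)) (w *ᵂ dil (F (suc k))) j) (≈-trans (⊗-congˡ {q^ (4 ℕ.+ k ℕ.* 2)} (w-shift (dil (F (suc k))) j)) (shift₁ j))))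
    (factor-out (q^ (j ℕ.* 2)) (F (suc k) j) (q^ (2 ℕ.+ k ℕ.* 2) ⊗ shiftW (F (suc k)) j))))
  where
  factor-out : ∀ p x y → p ⊗ x ⊖ p ⊗ y ≈ˢ p ⊗ (x ⊖ y)
  factor-out p x y = 𝕊.solve 3 (λ p x y → p *: x -: p *: y =: p *: (x -: y)) ≈-refl p x y
  regroup : ∀ a b c d X → a ℕ.+ b ≡ c ℕ.+ d → q^ a ⊗ (q^ b ⊗ X) ≈ˢ q^ c ⊗ (q^ d ⊗ X)
  regroup a b c d X e = ≈-trans (≈-sym (⊗-assoc (q^ a) (q^ b) X)) (≈-trans (⊗-congʳ {X} (λ n → trans (q^-+ a b n) (trans (cong (λ z → q^ z n) e) (sym (q^-+ c d n))))) (⊗-assoc (q^ c) (q^ d) X))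
  zeros : ∀ a c d → q^ a ⊗ (λ _ → + 0) ≈ˢ q^ c ⊗ (q^ d ⊗ (λ _ → + 0))
  zeros a c d = ≈-trans (⊗-zeroʳ (q^ a)) (≈-sym (≈-trans (⊗-congˡ {q^ c} (⊗-zeroʳ (q^ d))) (⊗-zeroʳ (q^ c))))
  shift₁ : ∀ j → q^ (4 ℕ.+ k ℕ.* 2) ⊗ shiftW (dil (F (suc k))) j ≈ˢ q^ (j ℕ.* 2) ⊗ (q^ (2 ℕ.+ k ℕ.* 2) ⊗ shiftW (F (suc k)) j)
  shift₁ zero = zeros (4 ℕ.+ k ℕ.* 2) 0 (2 ℕ.+ k ℕ.* 2)
  shift₁ (suc j) = regroup (4 ℕ.+ k ℕ.* 2) (j ℕ.* 2) (2 ℕ.+ j ℕ.* 2) (2 ℕ.+ k ℕ.* 2) (F (suc k) j)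
    (N.solve 2 (λ k j → N.con 4 N.:+ k N.:+ j N.:= N.con 2 N.:+ j N.:+ (N.con 2 N.:+ k)) refl (k ℕ.* 2) (j ℕ.* 2))
  shift₂ : ∀ j → q^ (4 ℕ.+ k ℕ.* 2) ⊗ shiftW (shiftW (dil (F k))) j ≈ˢ q^ (j ℕ.* 2) ⊗ (q^ (k ℕ.* 2) ⊗ shiftW (shiftW (F k)) j)
  shift₂ zero = zeros (4 ℕ.+ k ℕ.* 2) 0 (k ℕ.* 2)
  shift₂ (suc zero) = zeros (4 ℕ.+ k ℕ.* 2) 2 (k ℕ.* 2)
  shift₂ (suc (suc j)) = regroup (4 ℕ.+ k ℕ.* 2) (j ℕ.* 2) (4 ℕ.+ j ℕ.* 2) (k ℕ.* 2) (F k j)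
    (N.solve 2 (λ k j → N.con 4 N.:+ k N.:+ j N.:= N.con 4 N.:+ j N.:+ k) refl (k ℕ.* 2) (j ℕ.* 2))

-- The coefficients of `(1 + w) γ k`, equivalently by `F-E` of `(1 - w) F k`. The factor `1 + w` is
-- what merges neighbouring ranks.
E : ℕ → ℕ → Series
E k j = γ k j ⊕ shiftW (γ k) j

F-E : ∀ k j → F k j ⊖ shiftW (F k) j ≈ˢ E k j
F-E k zero n = ℤS.solve 1 (λ g → g :+ con (+ 0) :- con (+ 0) := g :+ con (+ 0)) refl (γ k 0 n)
F-E k (suc j) n = trans (cong (λ z → Γ k j n + γ k (suc j) n + Γ k j n - (z + shiftW (Γ k) j n)) (Γ-γ k j n))
  (trans (cong (λ z → z + γ k (suc j) n + z - (γ k j n + shiftW (Γ k) j n + shiftW (Γ k) j n)) (Γ-γ k j n))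
    (ℤS.solve 3 (λ g s h → g :+ s :+ h :+ (g :+ s) :- (g :+ s :+ s) := h :+ g) refl (γ k j n) (shiftW (Γ k) j n) (γ k (suc j) n)))

-- Summation along the ranks

-- The quantity that telescopes: in `E-step` it occurs at `(k + 1 , j)` and at `(k , j - 1)`, two
-- neighbours on the same diagonal.
τ : ℕ → ℕ → Series
τ k a = F k a ⊖ q^ (k ℕ.* 2) ⊗ shiftW (F k) a

τ-split : ∀ k j → F k j ⊖ q^ (k ℕ.* 2) ⊗ shiftW (shiftW (F k)) j ≈ˢ E k j ⊕ shiftW (τ k) j
τ-split k zero n = trans (cong (λ z → F k 0 n - z) (⊗-zeroʳ (q^ (k ℕ.* 2)) n)) (trans (F-E k 0 n) (sym (ℤP.+-identityʳ (E k 0 n))))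
τ-split k (suc j) n = trans (ℤS.solve 3 (λ f g h → f :- h := (f :- g) :+ (g :- h)) refl (F k (suc j) n) (F k j n) ((q^ (k ℕ.* 2) ⊗ shiftW (F k) j) n))
  (cong (_+ τ k j n) (F-E k (suc j) n))

E-step : ∀ k j → q^ (3 ℕ.+ k ℕ.* 2) ⊗ E (suc k) j ⊕ q^ (j ℕ.* 2) ⊗ (E k j ⊕ shiftW (τ k) j) ≈ˢ q^ (j ℕ.* 2) ⊗ τ (suc k) j
E-step k j = ≈-trans (⊕-cong (⊗-congˡ {q^ (3 ℕ.+ k ℕ.* 2)} (≈-sym (F-E (suc k) j))) (⊗-congˡ {q^ (j ℕ.* 2)} (≈-sym (τ-split k j)))) (contiguity-coefficients k j)

q^-split : ∀ a b X → q^ (a ℕ.+ b) ⊗ X ≈ˢ q^ a ⊗ (q^ b ⊗ X)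
q^-split a b X = ≈-trans (⊗-congʳ {X} (≈-sym (q^-+ a b))) (⊗-assoc (q^ a) (q^ b) X)

q^-≡ : ∀ {a b} X → a ≡ b → q^ a ⊗ X ≈ˢ q^ b ⊗ X
q^-≡ X refl = ≈-refl

E-≡ : ∀ {k k′ j j′} → k ≡ k′ → j ≡ j′ → E k j ≈ˢ E k′ j′
E-≡ refl refl = ≈-refl

-- With `j = k + m + 2` the two powers of `q` in `E-step` differ by the exponent `2 m + 1`, which
-- does not depend on `k`. This makes summation along the diagonal possible; above the diagonal the
-- roles of the two powers are exchanged.
below-diagonal : ∀ m k → E (suc k) (suc (suc (k ℕ.+ m))) ⊕ q^ (suc (m ℕ.* 2)) ⊗ (E k (suc (suc (k ℕ.+ m))) ⊕ τ k (suc (k ℕ.+ m))) ≈ˢ q^ (suc (m ℕ.* 2)) ⊗ τ (suc k) (suc (suc (k ℕ.+ m)))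
below-diagonal m k = q^-cancelˡ (3 ℕ.+ k ℕ.* 2) (≈-trans (𝕊.solve 4 (λ q e r x → q *: (e +: r *: x) =: q *: e +: q *: (r *: x)) ≈-refl (q^ (3 ℕ.+ k ℕ.* 2)) (E (suc k) j) (q^ (suc (m ℕ.* 2))) X)
  (≈-trans (⊕-cong (≈-refl {q^ (3 ℕ.+ k ℕ.* 2) ⊗ E (suc k) j}) (split X)) (≈-trans (E-step k j) (≈-sym (split (τ (suc k) j))))))
  where
  j = suc (suc (k ℕ.+ m))
  X = E k j ⊕ τ k (suc (k ℕ.+ m))
  split : ∀ X → q^ (3 ℕ.+ k ℕ.* 2) ⊗ (q^ (suc (m ℕ.* 2)) ⊗ X) ≈ˢ q^ (j ℕ.* 2) ⊗ X
  split X = ≈-trans (≈-sym (q^-split (3 ℕ.+ k ℕ.* 2) (suc (m ℕ.* 2)) X)) (q^-≡ X (N.solve 2 (λ k m → N.con 3 N.:+ k N.:* N.con 2 N.:+ (N.con 1 N.:+ m N.:* N.con 2) N.:= (N.con 2 N.:+ (k N.:+ m)) N.:* N.con 2) refl k m))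

above-diagonal : ∀ t a → q^ (3 ℕ.+ t ℕ.* 2) ⊗ E (suc (a ℕ.+ t)) a ⊕ (E (a ℕ.+ t) a ⊕ shiftW (τ (a ℕ.+ t)) a) ≈ˢ τ (suc (a ℕ.+ t)) a
above-diagonal t a = q^-cancelˡ (a ℕ.* 2) (≈-trans (𝕊.solve 4 (λ q e r x → q *: (r *: e +: x) =: q *: (r *: e) +: q *: x) ≈-refl (q^ (a ℕ.* 2)) (E (suc (a ℕ.+ t)) a) (q^ (3 ℕ.+ t ℕ.* 2)) X)
  (≈-trans (⊕-cong (≈-trans (≈-sym (q^-split (a ℕ.* 2) (3 ℕ.+ t ℕ.* 2) (E (suc (a ℕ.+ t)) a))) (q^-≡ (E (suc (a ℕ.+ t)) a)
      (N.solve 2 (λ a t → a N.:* N.con 2 N.:+ (N.con 3 N.:+ t N.:* N.con 2) N.:= N.con 3 N.:+ (a N.:+ t) N.:* N.con 2) refl a t))) (≈-refl {q^ (a ℕ.* 2) ⊗ X})) (E-step (a ℕ.+ t) a)))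
  where
  X = E (a ℕ.+ t) a ⊕ shiftW (τ (a ℕ.+ t)) a

on-diagonal : ∀ a → q^ 1 ⊗ E (suc a) (suc a) ⊕ (E a (suc a) ⊕ τ a a) ≈ˢ τ (suc a) (suc a)
on-diagonal a = q^-cancelˡ (2 ℕ.+ a ℕ.* 2) (≈-trans (𝕊.solve 4 (λ q e r x → q *: (r *: e +: x) =: q *: (r *: e) +: q *: x) ≈-refl (q^ (2 ℕ.+ a ℕ.* 2)) (E (suc a) (suc a)) (q^ 1) (E a (suc a) ⊕ τ a a))
  (≈-trans (⊕-cong (≈-trans (≈-sym (q^-split (2 ℕ.+ a ℕ.* 2) 1 (E (suc a) (suc a)))) (q^-≡ (E (suc a) (suc a)) (ℕP.+-comm (2 ℕ.+ a ℕ.* 2) 1))) (≈-refl {q^ (2 ℕ.+ a ℕ.* 2) ⊗ (E a (suc a) ⊕ τ a a)})) (E-step a (suc a))))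

ΣS : ℕ → (ℕ → Series) → Series
ΣS K F n = Σ< K (λ k → F k n)

ΣS-last : ∀ K F → ΣS (suc K) F ≈ˢ ΣS K F ⊕ F K
ΣS-last K F n = Σ<-last K (λ k → F k n)

⊗-ΣS : ∀ g K F → g ⊗ ΣS K F ≈ˢ ΣS K (λ k → g ⊗ F k)
⊗-ΣS g zero F = ⊗-zeroʳ g
⊗-ΣS g (suc K) F = ≈-trans (⊗-distribˡ-⊕ g (F 0) (ΣS K (F ∘ suc))) (⊕-cong (≈-refl {g ⊗ F 0}) (⊗-ΣS g K (F ∘ suc)))

belowSum aboveSum : ℕ → ℕ → Series
belowSum m K = ΣS K (λ k → E k (suc (k ℕ.+ m)))
aboveSum t A = ΣS A (λ a → E (a ℕ.+ t) a)

[0] : ℕ → Series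
[0] zero = one
[0] (suc m) _ = + 0

γ₀-step : γ 0 0 ≈ˢ q^ 1 ⊗ γ 0 0 ⊕ one
γ₀-step = ≈-trans (𝕊.solve 2 (λ q g → g =: q *: g +: (1: -: q) *: g) ≈-refl (q^ 1) (γ 0 0)) (⊕-cong (≈-refl {q^ 1 ⊗ γ 0 0}) γ₀-0)

E₀ : ∀ m → E 0 (suc m) ≈ˢ q^ (suc (m ℕ.* 2)) ⊗ E 0 (suc m) ⊕ [0] m
E₀ zero = ≈-trans E≈γ (≈-trans γ₀-step (⊕-cong (⊗-congˡ {q^ 1} (≈-sym E≈γ)) (≈-refl {one})))
  where
  E≈γ : E 0 1 ≈ˢ γ 0 0
  E≈γ n = trans (cong (λ z → z + γ 0 0 n) (γ₀-high 0 n)) (ℤP.+-identityˡ (γ 0 0 n))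
E₀ (suc m) = ≈-trans z (≈-sym (Zero-⊕ {g = λ _ → + 0} (≈-trans (⊗-congˡ {q^ (suc (suc m ℕ.* 2))} z) (⊗-zeroʳ (q^ (suc (suc m ℕ.* 2))))) (λ _ → refl)))
  where
  z : Zero (E 0 (suc (suc m)))
  z = Zero-⊕ {γ 0 (suc (suc m))} {γ 0 (suc m)} (γ₀-high (suc m)) (γ₀-high m)

τ₀ : ∀ m → τ 0 (suc m) ≈ˢ E 0 (suc m)
τ₀ m = ≈-trans (⊖-cong (≈-refl {F 0 (suc m)}) (⊗-identityˡ (F 0 m))) (F-E 0 (suc m))

-- Summing `below-diagonal` leaves only the last `τ`, apart from the boundary term at `k = 0`, which
-- is nonzero for `m = 0` alone.
below-partial : ∀ m K → belowSum m (suc K) ⊕ q^ (suc (m ℕ.* 2)) ⊗ belowSum (suc m) K ≈ˢ q^ (suc (m ℕ.* 2)) ⊗ τ K (suc (K ℕ.+ m)) ⊕ [0] m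
below-partial m zero = ≈-trans (⊕-cong (λ n → ℤP.+-identityʳ (E 0 (suc m) n)) (⊗-zeroʳ (q^ (suc (m ℕ.* 2))))) (≈-trans (λ n → ℤP.+-identityʳ (E 0 (suc m) n))
  (≈-trans (E₀ m) (⊕-cong (⊗-congˡ {q^ (suc (m ℕ.* 2))} (≈-sym (τ₀ m))) (≈-refl {[0] m}))))
below-partial m (suc K) = begin
  belowSum m (suc (suc K)) ⊕ r ⊗ belowSum (suc m) (suc K)
    ≈⟨ ⊕-cong (ΣS-last (suc K) (λ k → E k (suc (k ℕ.+ m)))) (⊗-congˡ {r} (≈-trans (ΣS-last K (λ k → E k (suc (k ℕ.+ suc m)))) (⊕-cong (≈-refl {belowSum (suc m) K}) (E-≡ {K} refl (cong suc (ℕP.+-suc K m)))))) ⟩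
  (belowSum m (suc K) ⊕ E (suc K) j) ⊕ r ⊗ (belowSum (suc m) K ⊕ E K j)
    ≈⟨ 𝕊.solve 6 (λ r s t e f x → (s +: e) +: r *: (t +: f) =: (s +: r *: t) +: (e +: r *: (f +: x)) -: r *: x) ≈-refl r (belowSum m (suc K)) (belowSum (suc m) K) (E (suc K) j) (E K j) (τ K (suc (K ℕ.+ m))) ⟩
  (belowSum m (suc K) ⊕ r ⊗ belowSum (suc m) K) ⊕ (E (suc K) j ⊕ r ⊗ (E K j ⊕ τ K (suc (K ℕ.+ m)))) ⊖ r ⊗ τ K (suc (K ℕ.+ m))
    ≈⟨ ⊖-cong (⊕-cong (below-partial m K) (below-diagonal m K)) (≈-refl {r ⊗ τ K (suc (K ℕ.+ m))}) ⟩
  (r ⊗ τ K (suc (K ℕ.+ m)) ⊕ [0] m) ⊕ r ⊗ τ (suc K) j ⊖ r ⊗ τ K (suc (K ℕ.+ m))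
    ≈⟨ 𝕊.solve 3 (λ x c y → (x +: c) +: y -: x =: y +: c) ≈-refl (r ⊗ τ K (suc (K ℕ.+ m))) ([0] m) (r ⊗ τ (suc K) j) ⟩
  r ⊗ τ (suc K) j ⊕ [0] m ∎
  where
  open SetoidReasoning seriesSetoid
  r = q^ (suc (m ℕ.* 2))
  j = suc (suc (K ℕ.+ m))

above-partial : ∀ t A → q^ (3 ℕ.+ t ℕ.* 2) ⊗ aboveSum (suc t) A ⊕ aboveSum t A ≈ˢ shiftW (λ a → τ (suc (a ℕ.+ t)) a) A
above-partial t zero n = trans (ℤP.+-identityʳ _) (⊗-zeroʳ (q^ (3 ℕ.+ t ℕ.* 2)) n)
above-partial t (suc A) = begin
  r ⊗ aboveSum (suc t) (suc A) ⊕ aboveSum t (suc A)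
    ≈⟨ ⊕-cong (⊗-congˡ {r} (≈-trans (ΣS-last A (λ a → E (a ℕ.+ suc t) a)) (⊕-cong (≈-refl {aboveSum (suc t) A}) (E-≡ {j = A} (ℕP.+-suc A t) refl)))) (ΣS-last A (λ a → E (a ℕ.+ t) a)) ⟩
  r ⊗ (aboveSum (suc t) A ⊕ E (suc (A ℕ.+ t)) A) ⊕ (aboveSum t A ⊕ E (A ℕ.+ t) A)
    ≈⟨ 𝕊.solve 6 (λ r s t e f x → r *: (s +: e) +: (t +: f) =: (r *: s +: t) +: (r *: e +: (f +: x)) -: x) ≈-refl r (aboveSum (suc t) A) (aboveSum t A) (E (suc (A ℕ.+ t)) A) (E (A ℕ.+ t) A) (shiftW (τ (A ℕ.+ t)) A) ⟩
  (r ⊗ aboveSum (suc t) A ⊕ aboveSum t A) ⊕ (r ⊗ E (suc (A ℕ.+ t)) A ⊕ (E (A ℕ.+ t) A ⊕ shiftW (τ (A ℕ.+ t)) A)) ⊖ shiftW (τ (A ℕ.+ t)) A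
    ≈⟨ ⊖-cong (⊕-cong (≈-trans (above-partial t A) (previous A)) (above-diagonal t A)) (≈-refl {shiftW (τ (A ℕ.+ t)) A}) ⟩
  shiftW (τ (A ℕ.+ t)) A ⊕ τ (suc (A ℕ.+ t)) A ⊖ shiftW (τ (A ℕ.+ t)) A
    ≈⟨ 𝕊.solve 2 (λ x y → x +: y -: x =: y) ≈-refl (shiftW (τ (A ℕ.+ t)) A) (τ (suc (A ℕ.+ t)) A) ⟩
  τ (suc (A ℕ.+ t)) A ∎
  where
  open SetoidReasoning seriesSetoid
  r = q^ (3 ℕ.+ t ℕ.* 2)
  previous : ∀ A → shiftW (λ a → τ (suc (a ℕ.+ t)) a) A ≈ˢ shiftW (τ (A ℕ.+ t)) A
  previous zero = ≈-refl
  previous (suc A) = ≈-refl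

-- The relation on the diagonal itself joins the two families, and it is the one that determines
-- `Y`.
diagonal-partial : ∀ A → q^ 1 ⊗ aboveSum 0 (suc A) ⊕ belowSum 0 A ⊕ one ≈ˢ τ A A
diagonal-partial zero = ≈-trans (⊕-cong {q^ 1 ⊗ aboveSum 0 1 ⊕ (λ _ → + 0)} {q^ 1 ⊗ γ 0 0} (λ n → trans (ℤP.+-identityʳ ((q^ 1 ⊗ aboveSum 0 1) n)) (⊗-congˡ {q^ 1} (λ m → trans (ℤP.+-identityʳ (γ 0 0 m + + 0)) (ℤP.+-identityʳ (γ 0 0 m))) n)) (≈-refl {one}))
  (≈-trans (≈-sym γ₀-step) (λ n → sym (trans (cong (λ z → F 0 0 n - z) (⊗-zeroʳ one n)) (ℤS.solve 1 (λ g → g :+ con (+ 0) :- con (+ 0) := g) refl (γ 0 0 n)))))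
diagonal-partial (suc A) = begin
  q^ 1 ⊗ aboveSum 0 (suc (suc A)) ⊕ belowSum 0 (suc A) ⊕ one
    ≈⟨ ⊕-cong (⊕-cong (⊗-congˡ {q^ 1} (≈-trans (ΣS-last (suc A) (λ a → E (a ℕ.+ 0) a)) (⊕-cong (≈-refl {aboveSum 0 (suc A)}) (E-≡ {j = suc A} (ℕP.+-identityʳ (suc A)) refl))))
         (≈-trans (ΣS-last A (λ k → E k (suc (k ℕ.+ 0)))) (⊕-cong (≈-refl {belowSum 0 A}) (E-≡ {A} refl (cong suc (ℕP.+-identityʳ A)))))) (≈-refl {one}) ⟩
  q^ 1 ⊗ (aboveSum 0 (suc A) ⊕ E (suc A) (suc A)) ⊕ (belowSum 0 A ⊕ E A (suc A)) ⊕ one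
    ≈⟨ 𝕊.solve 7 (λ r s t e f x o → r *: (s +: e) +: (t +: f) +: o =: (r *: s +: t +: o) +: (r *: e +: (f +: x)) -: x) ≈-refl (q^ 1) (aboveSum 0 (suc A)) (belowSum 0 A) (E (suc A) (suc A)) (E A (suc A)) (τ A A) one ⟩
  (q^ 1 ⊗ aboveSum 0 (suc A) ⊕ belowSum 0 A ⊕ one) ⊕ (q^ 1 ⊗ E (suc A) (suc A) ⊕ (E A (suc A) ⊕ τ A A)) ⊖ τ A A
    ≈⟨ ⊖-cong (⊕-cong (diagonal-partial A) (on-diagonal A)) (≈-refl {τ A A}) ⟩
  τ A A ⊕ τ (suc A) (suc A) ⊖ τ A A
    ≈⟨ 𝕊.solve 2 (λ x y → x +: y -: x =: y) ≈-refl (τ A A) (τ (suc A) (suc A)) ⟩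
  τ (suc A) (suc A) ∎
  where open SetoidReasoning seriesSetoid

-- Limits along the diagonals

upToPlain-stable : ∀ i n h → n ℕ.≤ i → upToPlain (suc i) n h ≡ upToPlain i n h
upToPlain-stable i n h n≤i = trans (upToPlain-step (suc i) n h) (trans (cong₂ _+_ (trans (upToSize-step i n h) (cong (λ z → upToPlain i n h + z) (startingWith-large true i n h n≤i)))
  (startingWith-large false (suc i) n h (ℕP.m≤n⇒m≤1+n n≤i))) (ℤS.solve 1 (λ x → x :+ con (+ 0) :+ con (+ 0) := x) refl (upToPlain i n h)))

γ-stable : ∀ d j n → γ (d ℕ.+ n) j n ≡ γ n j n
γ-stable zero j n = refl
γ-stable (suc d) j n = trans (upToPlain-stable (suc ((d ℕ.+ n) ℕ.* 2)) n (unitAt j) (ℕP.m≤n⇒m≤1+n n≤)) (trans (upToPlain-stable ((d ℕ.+ n) ℕ.* 2) n (unitAt j) n≤) (γ-stable d j n))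
  where
  n≤ : n ℕ.≤ (d ℕ.+ n) ℕ.* 2
  n≤ = ℕP.≤-trans (ℕP.m≤n+m n d) (ℕP.m≤m*n (d ℕ.+ n) 2)

Γ-stable : ∀ d j n → Γ (d ℕ.+ n) j n ≡ Γ n j n
Γ-stable d zero n = γ-stable d 0 n
Γ-stable d (suc j) n = cong₂ _+_ (Γ-stable d j n) (γ-stable d (suc j) n)

F-stable : ∀ d j n → F (d ℕ.+ n) j n ≡ F n j n
F-stable d zero n = cong (_+ + 0) (Γ-stable d 0 n)
F-stable d (suc j) n = cong₂ _+_ (Γ-stable d (suc j) n) (Γ-stable d j n)

E-high : ∀ k j n → suc n ℕ.< j → E k j n ≡ + 0
E-high k (suc j) n (s≤s n<j) = cong₂ _+_ (upToPlain-high (k ℕ.* 2) n (suc j) (ℕP.m≤n⇒m≤1+n n<j)) (upToPlain-high (k ℕ.* 2) n j n<j)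

F-flat : ∀ k d n → F k (d ℕ.+ suc n) n ≡ F k (suc n) n
F-flat k zero n = refl
F-flat k (suc d) n = trans (trans (ℤS.solve 2 (λ f g → f := f :- g :+ g) refl (F k (suc d ℕ.+ suc n) n) (F k (d ℕ.+ suc n) n))
  (trans (cong (_+ F k (d ℕ.+ suc n) n) (trans (F-E k (suc d ℕ.+ suc n) n) (E-high k (suc d ℕ.+ suc n) n (s≤s (ℕP.m≤n+m (suc n) d))))) (ℤP.+-identityˡ (F k (d ℕ.+ suc n) n)))) (F-flat k d n)

-- Twice the generating function of all overpartitions.
Y : Series
Y n = F n (suc n) n

F-Y : ∀ {K j n} → n ℕ.≤ K → n ℕ.< j → F K j n ≡ Y n
F-Y {K} {j} {n} n≤K n<j = trans (cong₂ (λ a b → F a b n) (sym (ℕP.m∸n+n≡m n≤K)) (sym (ℕP.m∸n+n≡m n<j)))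
  (trans (F-flat (K ℕ.∸ n ℕ.+ n) (j ℕ.∸ suc n) n) (F-stable (K ℕ.∸ n) (suc n) n))

-- At a fixed coefficient neither larger parts nor a larger bound on the number of charged parts
-- matter any more, and the subtracted term has high order.
τ-Y : ∀ {K j M} → M ℕ.≤ K → M ℕ.≤ j → τ K j ≈[ M ] Y
τ-Y {K} {j} M≤K M≤j n n<M = trans (cong₂ _-_ (F-Y (ℕP.<⇒≤ n<K) (ℕP.<-≤-trans n<M M≤j)) (Ord-⊗ {+ (K ℕ.* 2)} {q^ (K ℕ.* 2)} (Ord-mono (+ (K ℕ.* 2))) (shiftW (F K) j) n (ℤ.+<+ (ℕP.<-≤-trans n<K (ℕP.m≤m*n K 2)))))
  (ℤP.+-identityʳ (Y n))
  where
  n<K : n ℕ.< K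
  n<K = ℕP.<-≤-trans n<M M≤K

below above : ℕ → Series
below m n = belowSum m (suc n) n
above t n = aboveSum t (2 ℕ.+ n) n

below-agree : ∀ m K → belowSum m K ≈[ K ] below m
below-agree m K n n<K = Σ<-extend (λ k → E k (suc (k ℕ.+ m)) n) (λ k n<k → E-high k (suc (k ℕ.+ m)) n (s≤s (ℕP.≤-trans n<k (ℕP.m≤m+n k m)))) K n<K

above-agree : ∀ t A → aboveSum t (suc A) ≈[ A ] above t
above-agree t A n n<A = Σ<-extend (λ a → E (a ℕ.+ t) a n) (λ a n<a → E-high (a ℕ.+ t) a n n<a) (suc A) (s≤s n<A)

agree-⊕ : ∀ {k f f′ g g′} → f ≈[ k ] f′ → g ≈[ k ] g′ → f ⊕ g ≈[ k ] f′ ⊕ g′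
agree-⊕ p r n n<k = cong₂ _+_ (p n n<k) (r n n<k)

agree-refl : ∀ {k f} → f ≈[ k ] f
agree-refl n _ = refl

below-recurrence : ∀ m → below m ⊕ q^ (suc (m ℕ.* 2)) ⊗ below (suc m) ≈ˢ q^ (suc (m ℕ.* 2)) ⊗ Y ⊕ [0] m
below-recurrence m n = agree-trans (agree-⊕ (agree-sym (agree-≤ (ℕP.n≤1+n (suc n)) (below-agree m (2 ℕ.+ n)))) (agree-⊗ {f = q^ (suc (m ℕ.* 2))} agree-refl (agree-sym (below-agree (suc m) (suc n)))))
  (agree-trans (agree-≈ (below-partial m (suc n))) (agree-⊕ {g = [0] m} (agree-⊗ {f = q^ (suc (m ℕ.* 2))} agree-refl (τ-Y {suc n} ℕP.≤-refl (ℕP.m≤n⇒m≤1+n (ℕP.m≤m+n (suc n) m)))) agree-refl)) n ℕP.≤-refl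

above-recurrence : ∀ t → q^ (3 ℕ.+ t ℕ.* 2) ⊗ above (suc t) ⊕ above t ≈ˢ Y
above-recurrence t n = agree-trans (agree-⊕ (agree-⊗ {f = q^ (3 ℕ.+ t ℕ.* 2)} agree-refl (agree-sym (above-agree (suc t) (suc n)))) (agree-sym (above-agree t (suc n))))
  (agree-trans (agree-≈ (above-partial t (2 ℕ.+ n))) (τ-Y {suc (suc n ℕ.+ t)} {suc n} (s≤s (ℕP.≤-trans (ℕP.n≤1+n n) (ℕP.m≤m+n (suc n) t))) ℕP.≤-refl)) n ℕP.≤-refl

diagonal-recurrence : q^ 1 ⊗ above 0 ⊕ below 0 ⊕ one ≈ˢ Y
diagonal-recurrence n = agree-trans (agree-⊕ {g = one} (agree-⊕ (agree-⊗ {f = q^ 1} agree-refl (agree-sym (above-agree 0 (suc n)))) (agree-sym (below-agree 0 (suc n)))) agree-refl)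
  (agree-trans (agree-≈ (diagonal-partial (suc n))) (τ-Y {suc n} ℕP.≤-refl ℕP.≤-refl)) n ℕP.≤-refl

q^-Below : ∀ a {n f} → Below n f → Below n (q^ a ⊗ f)
q^-Below a {n} {f} b k k<n = trans (⊗-lowest (q^ a) {k} {f} (λ j j<k → b j (ℕP.<-trans j<k k<n))) (trans (cong (λ z → q^ a 0 * z) (b k k<n)) (ℤP.*-zeroʳ (q^ a 0)))

-- Iterating the relation makes `δ m` divisible by arbitrarily high powers of `q`. No starting value
-- is needed: a recurrence of this shape has at most one solution.
descent : ∀ (e : ℕ → ℕ) (δ : ℕ → Series) → (∀ m → δ m ≈ˢ ⊝ (q^ (suc (e m)) ⊗ δ (suc m))) → ∀ N m → Below N (δ m)
descent e δ p zero m k ()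
descent e δ p (suc N) m zero _ = trans (p m 0) (cong -_ (Ord-⊗ {+ suc (e m)} {q^ (suc (e m))} (Ord-mono (+ suc (e m))) (δ (suc m)) 0 (ℤ.+<+ (s≤s z≤n))))
descent e δ p (suc N) m (suc k) (s≤s k<N) = trans (p m (suc k)) (cong -_ (trans (q^-suc-⊗ (e m) (δ (suc m)) k) (q^-Below (e m) {N} {δ (suc m)} (descent e δ p N (suc m)) k k<N)))

descent-unique : ∀ (e : ℕ → ℕ) (x y : ℕ → Series) → (∀ m → x m ⊕ q^ (suc (e m)) ⊗ x (suc m) ≈ˢ y m ⊕ q^ (suc (e m)) ⊗ y (suc m)) → ∀ m → x m ≈ˢ y m
descent-unique e x y p m = ⊖-zero (λ n → descent e (λ m → x m ⊖ y m) step′ (suc n) m n ℕP.≤-refl)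
  where
  step′ : ∀ m → x m ⊖ y m ≈ˢ ⊝ (q^ (suc (e m)) ⊗ (x (suc m) ⊖ y (suc m)))
  step′ m = ≈-trans (𝕊.solve 5 (λ x y q x′ y′ → x -: y =: ((x +: q *: x′) -: (y +: q *: y′)) -: q *: (x′ -: y′)) ≈-refl (x m) (y m) (q^ (suc (e m))) (x (suc m)) (y (suc m)))
    (λ n → trans (cong (λ z → z - (q^ (suc (e m)) ⊗ (x (suc m) ⊖ y (suc m))) n) (trans (cong (_- (y m ⊕ q^ (suc (e m)) ⊗ y (suc m)) n) (p m n)) (ℤP.+-inverseʳ ((y m ⊕ q^ (suc (e m)) ⊗ y (suc m)) n)))) (ℤP.+-identityˡ _))

ψ-exponent : ℕ → ℕ → ℕ
ψ-exponent m i = suc i ℕ.* suc i ℕ.+ suc i ℕ.* (m ℕ.* 2)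

ψ-term : ℕ → ℕ → Series
ψ-term m i = sgℕ i ⋆ q^ (ψ-exponent m i)

-- The partial theta series with terms `(-1)^(i-1) q^(i² + 2 m i)` for `i ≥ 1`.
Ψ : ℕ → Series
Ψ m n = ΣS (suc n) (ψ-term m) n

ψ-order : ∀ m i n → n ℕ.≤ i → ψ-term m i n ≡ + 0
ψ-order m i n n≤i = Ord-⋆ {+ (ψ-exponent m i)} (sgℕ i) (Ord-mono (+ (ψ-exponent m i))) n (ℤ.+<+ (ℕP.≤-trans (s≤s n≤i) (ℕP.≤-trans (ℕP.m≤m*n (suc i) (suc i)) (ℕP.m≤m+n (suc i ℕ.* suc i) (suc i ℕ.* (m ℕ.* 2))))))

Ψ-agree : ∀ m K → ΣS K (ψ-term m) ≈[ K ] Ψ m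
Ψ-agree m K n n<K = Σ<-extend (λ i → ψ-term m i n) (λ i n<i → ψ-order m i n (ℕP.<⇒≤ n<i)) K n<K

-- Multiplication by `q^(2m+1)` carries term `i` of `Ψ (suc m)` to minus term `i + 1` of `Ψ m`,
-- because `(i + 2)² = (i + 1)² + 2 (i + 1) + 1`.
Ψ-partial : ∀ m K → ΣS (suc K) (ψ-term m) ⊕ q^ (suc (m ℕ.* 2)) ⊗ ΣS K (ψ-term (suc m)) ≈ˢ q^ (suc (m ℕ.* 2))
Ψ-partial m K n = trans (cong (λ z → ΣS (suc K) (ψ-term m) n + z) (trans (⊗-ΣS (q^ (suc (m ℕ.* 2))) K (ψ-term (suc m)) n) (Σ<-cong K (λ i _ → next i n))))
  (trans (ℤP.+-assoc (ψ-term m 0 n) (Σ< K (λ i → ψ-term m (suc i) n)) (Σ< K (λ i → - ψ-term m (suc i) n)))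
  (trans (cong (λ z → ψ-term m 0 n + z) (trans (sym (Σ<-+ K _ _)) (trans (Σ<-cong K (λ i _ → ℤP.+-inverseʳ (ψ-term m (suc i) n))) (Σ<-0 K))))
  (trans (ℤP.+-identityʳ (ψ-term m 0 n)) (trans (ℤP.*-identityˡ (q^ (ψ-exponent m 0) n)) (cong (λ z → q^ (suc z) n) (ℕP.+-identityʳ (m ℕ.* 2)))))))
  where
  next : ∀ i → q^ (suc (m ℕ.* 2)) ⊗ ψ-term (suc m) i ≈ˢ ⊝ ψ-term m (suc i)
  next i = ≈-trans (⊗-⋆ (sgℕ i) (q^ (suc (m ℕ.* 2))) (q^ (ψ-exponent (suc m) i))) (λ n → trans (cong (λ z → sgℕ i * z) (trans (q^-+ (suc (m ℕ.* 2)) (ψ-exponent (suc m) i) n)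
    (cong (λ z → q^ z n) (N.solve 2 (λ m i → (N.con 1 N.:+ m N.:* N.con 2) N.:+ ((N.con 1 N.:+ i) N.:* (N.con 1 N.:+ i) N.:+ (N.con 1 N.:+ i) N.:* ((N.con 1 N.:+ m) N.:* N.con 2))
      N.:= (N.con 2 N.:+ i) N.:* (N.con 2 N.:+ i) N.:+ (N.con 2 N.:+ i) N.:* (m N.:* N.con 2)) refl m i))))
    (ℤS.solve 2 (λ s x → s :* x := :- ((:- s) :* x)) refl (sgℕ i) (q^ (ψ-exponent m (suc i)) n)))

Ψ-recurrence : ∀ m → Ψ m ⊕ q^ (suc (m ℕ.* 2)) ⊗ Ψ (suc m) ≈ˢ q^ (suc (m ℕ.* 2))
Ψ-recurrence m n = agree-trans (agree-⊕ (agree-sym (agree-≤ (ℕP.n≤1+n (suc n)) (Ψ-agree m (2 ℕ.+ n)))) (agree-⊗ {f = q^ (suc (m ℕ.* 2))} agree-refl (agree-sym (Ψ-agree (suc m) (suc n)))))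
  (agree-≈ (Ψ-partial m (suc n))) n ℕP.≤-refl

sumZ-Σ< : ∀ B (f : ℤ → ℤ) → sumZ B f ≡ f (+ 0) + Σ< B (λ i → f (+ suc i) + f -[1+ i ])
sumZ-Σ< zero f = sym (ℤP.+-identityʳ (f (+ 0)))
sumZ-Σ< (suc B) f = trans (cong (_+ (f (+ suc B) + f -[1+ B ])) (sumZ-Σ< B f)) (trans (ℤP.+-assoc (f (+ 0)) (Σ< B (λ i → f (+ suc i) + f -[1+ i ])) (f (+ suc B) + f -[1+ B ]))
  (cong (λ z → f (+ 0) + z) (sym (Σ<-last B (λ i → f (+ suc i) + f -[1+ i ])))))

φ-Ψ : φ ≈ˢ one ⊖ (Ψ 0 ⊕ Ψ 0)
φ-Ψ n = trans (sumZ-Σ< (n ℕ.+ 10) (λ i → sg i * mono (i * i) n)) (trans (cong₂ _+_ (ℤP.*-identityˡ (one n))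
    (trans (Σ<-cong (n ℕ.+ 10) (λ i _ → trans (cong (λ z → (- sgℕ i) * q^ z n + (- sgℕ i) * q^ z n) (exponent i)) (ℤS.solve 2 (λ s x → (:- s) :* x :+ (:- s) :* x := con -[1+ 1 ] :* (s :* x)) refl (sgℕ i) (q^ (ψ-exponent 0 i) n))))
      (trans (Σ<-*ˡ (n ℕ.+ 10) -[1+ 1 ] (λ i → ψ-term 0 i n)) (cong (λ z → -[1+ 1 ] * z) (Ψ-agree 0 (n ℕ.+ 10) n (ℕP.m<m+n n (s≤s z≤n)))))))
  (ℤS.solve 2 (λ o p → o :+ con -[1+ 1 ] :* p := o :- (p :+ p)) refl (one n) (Ψ 0 n)))
  where
  exponent : ∀ i → suc i ℕ.* suc i ≡ ψ-exponent 0 i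
  exponent i = sym (trans (cong (λ z → suc i ℕ.* suc i ℕ.+ z) (ℕP.*-zeroʳ i)) (ℕP.+-identityʳ (suc i ℕ.* suc i)))

below-formula : ∀ m → below m ≈ˢ Y ⊗ Ψ m ⊕ [0] m
below-formula = descent-unique (ℕ._* 2) below (λ m → Y ⊗ Ψ m ⊕ [0] m) (λ m → ≈-trans (below-recurrence m) (≈-sym (≈-trans
  (𝕊.solve 6 (λ y p c q p′ z → (y *: p +: c) +: q *: (y *: p′ +: z) =: (y *: (p +: q *: p′) +: c) +: q *: z) ≈-refl Y (Ψ m) ([0] m) (q^ (suc (m ℕ.* 2))) (Ψ (suc m)) (λ _ → + 0))
  (≈-trans (⊕-cong (⊕-cong (≈-trans (⊗-congˡ {Y} (Ψ-recurrence m)) (⊗-comm Y (q^ (suc (m ℕ.* 2))))) (≈-refl {[0] m})) (⊗-zeroʳ (q^ (suc (m ℕ.* 2)))))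
    (λ n → ℤP.+-identityʳ _)))))

above-formula : ∀ t → above t ≈ˢ Y ⊗ (one ⊖ Ψ (suc t))
above-formula = descent-unique (λ t → 2 ℕ.+ t ℕ.* 2) above (λ t → Y ⊗ (one ⊖ Ψ (suc t))) (λ t → ≈-trans (λ n → ℤP.+-comm (above t n) _) (≈-trans (above-recurrence t) (≈-sym (≈-trans
  (𝕊.solve 4 (λ y p q p′ → y *: (1: -: p) +: q *: (y *: (1: -: p′)) =: y *: (1: +: q -: (p +: q *: p′))) ≈-refl Y (Ψ (suc t)) (q^ (3 ℕ.+ t ℕ.* 2)) (Ψ (suc (suc t))))
  (≈-trans (⊗-congˡ {Y} (≈-trans (⊖-cong (≈-refl {one ⊕ q^ (3 ℕ.+ t ℕ.* 2)}) (Ψ-recurrence (suc t))) (λ n → ℤS.solve 2 (λ o q → o :+ q :- q := o) refl (one n) (q^ (3 ℕ.+ t ℕ.* 2) n)))) (⊗-identityʳ Y))))))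

-- Substituting both formulas into `diagonal-recurrence` gives `Y (1 - Ψ 0 - q + q Ψ 1) = 2`, and
-- `Ψ-recurrence` turns the bracket into `1 - 2 Ψ 0`. The infinite product for overpartitions is not
-- involved.
φ-Y : φ ⊗ Y ≈ˢ one ⊕ one
φ-Y = ≈-trans (⊗-congʳ {Y} φ-Ψ) (Mod.remove
  (𝕊.solve 7 (λ y p p′ q a b o → (1: -: (p +: p)) *: y =: (1: +: 1:) +: (con: -[1+ 0 ] *: (q *: a +: b +: 1: -: y)
      +: q *: (a -: y *: (1: -: p′)) +: 1: *: (b -: (y *: p +: 1:)) +: (-: y) *: (p +: q *: p′ -: q)))
    ≈-refl Y (Ψ 0) (Ψ 1) (q^ 1) (above 0) (below 0) one)
  (Mod.vanish-+ (Mod.vanish-+ (Mod.vanish-+ (Mod.vanish-* (𝕊.int -[1+ 0 ]) diagonal-recurrence) (Mod.vanish-* (q^ 1) (above-formula 0))) (Mod.vanish-* (𝕊.int (+ 1)) (below-formula 0))) (Mod.vanish-* (⊝ Y) (Ψ-recurrence 0))))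
  where module Mod = Modulo seriesRing

-- Peeling off the first row and the first column leaves a smaller square whose diagonals are the
-- old ones without their first entries.
diagonals : ∀ T M (g : ℕ → ℕ → ℤ) → M ℕ.≤ T → (∀ k a → M ℕ.≤ k → g k a ≡ + 0) → (∀ k a → M ℕ.≤ a → g k a ≡ + 0) →
  Σ< M (λ k → Σ< M (g k)) ≡ Σ< T (λ t → Σ< M (λ a → g (a ℕ.+ t) a)) + Σ< T (λ m → Σ< M (λ k → g k (suc (k ℕ.+ m))))
diagonals T zero g _ _ _ = sym (cong₂ _+_ (Σ<-0 T) (Σ<-0 T))
diagonals T (suc M) g M<T v₁ v₂ = begin
  (g 0 0 + Σ< M (λ a → g 0 (suc a))) + Σ< M (λ k → g (suc k) 0 + Σ< M (λ a → g (suc k) (suc a)))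
    ≡⟨ cong (λ z → (g 0 0 + Σ< M (λ a → g 0 (suc a))) + z) (trans (Σ<-+ M (λ k → g (suc k) 0) (λ k → Σ< M (λ a → g (suc k) (suc a))))
         (cong (λ z → Σ< M (λ k → g (suc k) 0) + z) (diagonals T M (λ k a → g (suc k) (suc a)) (ℕP.<⇒≤ M<T) (λ k a h → v₁ (suc k) (suc a) (s≤s h)) (λ k a h → v₂ (suc k) (suc a) (s≤s h))))) ⟩
  (g 0 0 + Σ< M (λ a → g 0 (suc a))) + (Σ< M (λ k → g (suc k) 0) + (inner₁ + inner₂))
    ≡⟨ ℤS.solve 5 (λ o r c x y → (o :+ r) :+ (c :+ (x :+ y)) := (o :+ c :+ x) :+ (r :+ y)) refl (g 0 0) (Σ< M (λ a → g 0 (suc a))) (Σ< M (λ k → g (suc k) 0)) inner₁ inner₂ ⟩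
  (Σ< (suc M) (λ t → g t 0) + inner₁) + (Σ< M (λ m → g 0 (suc m)) + inner₂)
    ≡⟨ cong₂ _+_
         (trans (cong (_+ inner₁) (sym (Σ<-extend (λ t → g t 0) (λ t h → v₁ t 0 h) T M<T))) (sym (Σ<-+ T (λ t → g t 0) (λ t → Σ< M (λ a → g (suc (a ℕ.+ t)) (suc a))))))
         (trans (cong (_+ inner₂) (sym (Σ<-extend (λ m → g 0 (suc m)) (λ m h → v₂ 0 (suc m) (s≤s h)) T (ℕP.<⇒≤ M<T)))) (sym (Σ<-+ T (λ m → g 0 (suc m)) (λ m → Σ< M (λ k → g (suc k) (suc (suc (k ℕ.+ m)))))))) ⟩
  Σ< T (λ t → Σ< (suc M) (λ a → g (a ℕ.+ t) a)) + Σ< T (λ m → Σ< (suc M) (λ k → g k (suc (k ℕ.+ m)))) ∎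
  where
  open ≡.≡-Reasoning
  inner₁ = Σ< T (λ t → Σ< M (λ a → g (suc (a ℕ.+ t)) (suc a)))
  inner₂ = Σ< T (λ m → Σ< M (λ k → g (suc k) (suc (suc (k ℕ.+ m)))))

-- `Δγ k` restricts to the overpartitions whose largest part contributes exactly `k`, together with
-- the empty one for `k = 0`; `H k` is its multiple by `1 + w`.
Δγ H : ℕ → ℕ → Series
Δγ zero t = γ 0 t
Δγ (suc k) t = γ (suc k) t ⊖ γ k t
H zero a = E 0 a
H (suc k) a = E (suc k) a ⊖ E k a

H-Δγ : ∀ k a → H k a ≈ˢ Δγ k a ⊕ shiftW (Δγ k) a
H-Δγ zero zero n = refl
H-Δγ zero (suc a) n = refl
H-Δγ (suc k) zero n = ℤS.solve 2 (λ x y → x :+ con (+ 0) :- (y :+ con (+ 0)) := x :- y :+ con (+ 0)) refl (γ (suc k) 0 n) (γ k 0 n)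
H-Δγ (suc k) (suc a) n = ℤS.solve 4 (λ x x′ y y′ → x :+ x′ :- (y :+ y′) := (x :- y) :+ (x′ :- y′)) refl (γ (suc k) (suc a) n) (γ (suc k) a n) (γ k (suc a) n) (γ k a n)

Δγ-high : ∀ k t n → n ℕ.< t → Δγ k t n ≡ + 0
Δγ-high zero t n h = upToPlain-high 0 n t h
Δγ-high (suc k) t n h = cong₂ _-_ (upToPlain-high (suc k ℕ.* 2) n t h) (upToPlain-high (k ℕ.* 2) n t h)

H-high : ∀ k a n → suc n ℕ.< a → H k a n ≡ + 0
H-high zero a n h = E-high 0 a n h
H-high (suc k) a n h = cong₂ _-_ (E-high (suc k) a n h) (E-high k a n h)

Δγ-stable : ∀ k t n → n ℕ.≤ k → Δγ (suc k) t n ≡ + 0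
Δγ-stable k t n h = trans (cong₂ _-_ (trans (cong (λ z → γ (suc z) t n) (sym (ℕP.m∸n+n≡m h))) (γ-stable (suc (k ℕ.∸ n)) t n)) (trans (cong (λ z → γ z t n) (sym (ℕP.m∸n+n≡m h))) (γ-stable (k ℕ.∸ n) t n)))
  (ℤP.+-inverseʳ (γ n t n))

H-stable : ∀ k a n → suc n ℕ.≤ k → H k a n ≡ + 0
H-stable (suc k) a n (s≤s h) = trans (H-Δγ (suc k) a n) (cong₂ _+_ (Δγ-stable k a n h) (shifted-zero a))
  where
  shifted-zero : ∀ a → shiftW (Δγ (suc k)) a n ≡ + 0
  shifted-zero zero = refl
  shifted-zero (suc a) = Δγ-stable k a n h

-- D⁺ t counts the overpartitions of rank t or t + 1, and D⁻ m those of rank - m - 1 or - m.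
D⁺ D⁻ : ℕ → Series
D⁺ zero = above 0 ⊖ below 0
D⁺ (suc t) = above (suc t) ⊖ above t
D⁻ m = below m ⊖ below (suc m)

Σ<-⊖ : ∀ n f g → Σ< n (λ i → f i - g i) ≡ Σ< n f - Σ< n g
Σ<-⊖ zero f g = refl
Σ<-⊖ (suc n) f g = trans (cong (λ z → f 0 - g 0 + z) (Σ<-⊖ n (f ∘ suc) (g ∘ suc))) (ℤS.solve 4 (λ a b c d → a :- b :+ (c :- d) := (a :+ c) :- (b :+ d)) refl (f 0) (g 0) (Σ< n (f ∘ suc)) (Σ< n (g ∘ suc)))

D⁺-sum : ∀ t n → Σ< (2 ℕ.+ n) (λ a → H (a ℕ.+ t) a n) ≡ D⁺ t n
D⁺-sum zero n = trans (cong (λ z → E 0 0 n + z) (trans (Σ<-cong (suc n) (λ a _ → cong (λ z → E (suc (a ℕ.+ 0)) (suc a) n - E z (suc a) n) (ℕP.+-identityʳ a))) (Σ<-⊖ (suc n) (λ a → E (suc (a ℕ.+ 0)) (suc a) n) (λ a → E a (suc a) n))))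
  (trans (sym (ℤP.+-assoc (E 0 0 n) (Σ< (suc n) (λ a → E (suc (a ℕ.+ 0)) (suc a) n)) (- Σ< (suc n) (λ a → E a (suc a) n))))
    (cong (λ z → above 0 n - z) (Σ<-cong (suc n) (λ a _ → cong (λ z → E a (suc z) n) (sym (ℕP.+-identityʳ a))))))
D⁺-sum (suc t) n = trans (Σ<-cong (2 ℕ.+ n) (λ a _ → trans (cong (λ z → H z a n) (ℕP.+-suc a t)) (cong (λ z → E z a n - E (a ℕ.+ t) a n) (sym (ℕP.+-suc a t)))))
  (Σ<-⊖ (2 ℕ.+ n) (λ a → E (a ℕ.+ suc t) a n) (λ a → E (a ℕ.+ t) a n))

D⁻-sum : ∀ m n → Σ< (2 ℕ.+ n) (λ k → H k (suc (k ℕ.+ m)) n) ≡ D⁻ m n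
D⁻-sum m n = trans (cong (λ z → E 0 (suc m) n + z) (Σ<-⊖ (suc n) (λ k → E (suc k) (suc (suc k ℕ.+ m)) n) (λ k → E k (suc (suc k ℕ.+ m)) n)))
  (trans (sym (ℤP.+-assoc (E 0 (suc m) n) (Σ< (suc n) (λ k → E (suc k) (suc (suc k ℕ.+ m)) n)) (- Σ< (suc n) (λ k → E k (suc (suc k ℕ.+ m)) n))))
    (cong₂ _-_ (below-agree m (2 ℕ.+ n) n (s≤s (ℕP.n≤1+n n))) (Σ<-cong (suc n) (λ k _ → cong (λ z → E k (suc z) n) (sym (ℕP.+-suc k m))))))

module RankSum (d : ℤ → ℤ) where

  f : ℤ → ℤ
  f r = d r + d (r + + 1)

  -- A weight of the form `d r + d (r + 1)` is exchanged for the weight `d` on the series multiplied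
  -- by `1 + w`: the term `d r` is moved one step up in the number of charged parts.
  rankTotal-H : ∀ n → let N = suc n in rankTotal f N ≡ Σ< (2 ℕ.+ N) (λ k → Σ< (2 ℕ.+ N) (λ a → d (+ k + + 1 - + a) * H k a N))
  rankTotal-H n = trans (rankTotal-γ f n) (trans (sym (Σ<-extend {suc N} (λ k → Σ< (suc N) (λ t → f (+ k - + t) * Δγ k t N)) stable (2 ℕ.+ N) (ℕP.n≤1+n (suc N))))
    (Σ<-cong (2 ℕ.+ N) (λ k _ → row k)))
    where
    N = suc n
    stable : ∀ k → suc N ℕ.≤ k → Σ< (suc N) (λ t → f (+ k - + t) * Δγ k t N) ≡ + 0
    stable (suc k) (s≤s h) = trans (Σ<-cong (suc N) (λ t _ → trans (cong (λ z → f (+ suc k - + t) * z) (Δγ-stable k t N h)) (ℤP.*-zeroʳ (f (+ suc k - + t))))) (Σ<-0 (suc N))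
    row : ∀ k → Σ< (suc N) (λ t → f (+ k - + t) * Δγ k t N) ≡ Σ< (2 ℕ.+ N) (λ a → d (+ k + + 1 - + a) * H k a N)
    row k = begin
      Σ< (suc N) (λ t → f (+ k - + t) * Δγ k t N)
        ≡⟨ Σ<-cong (suc N) (λ t _ → split t) ⟩
      Σ< (suc N) (λ t → upper t + lower (suc t))
        ≡⟨ Σ<-+ (suc N) upper (λ t → lower (suc t)) ⟩
      Σ< (suc N) upper + Σ< (suc N) (λ t → lower (suc t))
        ≡⟨ cong₂ _+_ (sym (Σ<-extend upper (λ t h → trans (cong (λ z → d (+ k + + 1 - + t) * z) (Δγ-high k t N h)) (ℤP.*-zeroʳ (d (+ k + + 1 - + t)))) (2 ℕ.+ N) (ℕP.n≤1+n (suc N))))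
             (sym (trans (cong (_+ Σ< (suc N) (λ t → lower (suc t))) (ℤP.*-zeroʳ (d (+ k + + 1 - + 0)))) (ℤP.+-identityˡ (Σ< (suc N) (λ t → lower (suc t)))))) ⟩
      Σ< (2 ℕ.+ N) upper + Σ< (2 ℕ.+ N) lower
        ≡⟨ sym (Σ<-+ (2 ℕ.+ N) upper lower) ⟩
      Σ< (2 ℕ.+ N) (λ a → upper a + lower a)
        ≡⟨ Σ<-cong (2 ℕ.+ N) (λ a _ → trans (sym (ℤP.*-distribˡ-+ (d (+ k + + 1 - + a)) (Δγ k a N) (shiftW (Δγ k) a N))) (cong (λ z → d (+ k + + 1 - + a) * z) (sym (H-Δγ k a N)))) ⟩
      Σ< (2 ℕ.+ N) (λ a → d (+ k + + 1 - + a) * H k a N) ∎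
      where
      open ≡.≡-Reasoning
      upper lower : ℕ → ℤ
      upper a = d (+ k + + 1 - + a) * Δγ k a N
      lower a = d (+ k + + 1 - + a) * shiftW (Δγ k) a N
      split : ∀ t → f (+ k - + t) * Δγ k t N ≡ upper t + lower (suc t)
      split t = trans (cong₂ (λ x y → (d x + d y) * Δγ k t N) (ℤS.solve 2 (λ k t → k :- t := k :+ con (+ 1) :- (con (+ 1) :+ t)) refl (+ k) (+ t)) (ℤS.solve 2 (λ k t → k :- t :+ con (+ 1) := k :+ con (+ 1) :- t) refl (+ k) (+ t)))
        (ℤS.solve 3 (λ x y z → (x :+ y) :* z := y :* z :+ x :* z) refl (d (+ k + + 1 - + suc t)) (d (+ k + + 1 - + t)) (Δγ k t N))

  diagonalSum : ℕ → Series
  diagonalSum T = ΣS T (λ t → d (+ suc t) ⋆ D⁺ t) ⊕ ΣS T (λ m → d (- + m) ⋆ D⁻ m)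

  rankTotal-diagonals : ∀ T n → 3 ℕ.+ n ℕ.≤ T → rankTotal f (suc n) ≡ diagonalSum T (suc n)
  rankTotal-diagonals T n M≤T = trans (rankTotal-H n) (trans (diagonals T M g M≤T
      (λ k a h → trans (cong (λ z → d (+ k + + 1 - + a) * z) (H-stable k a N (ℕP.≤-trans (ℕP.n≤1+n (suc N)) h))) (ℤP.*-zeroʳ (d (+ k + + 1 - + a))))
      (λ k a h → trans (cong (λ z → d (+ k + + 1 - + a) * z) (H-high k a N h)) (ℤP.*-zeroʳ (d (+ k + + 1 - + a)))))
    (cong₂ _+_
      (Σ<-cong T (λ t _ → trans (Σ<-cong M (λ a _ → cong (λ z → d z * H (a ℕ.+ t) a N) (ℤS.solve 2 (λ a t → a :+ t :+ con (+ 1) :- a := con (+ 1) :+ t) refl (+ a) (+ t)))) (trans (Σ<-*ˡ M (d (+ suc t)) (λ a → H (a ℕ.+ t) a N)) (cong (λ z → d (+ suc t) * z) (D⁺-sum t N)))))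
      (Σ<-cong T (λ m _ → trans (Σ<-cong M (λ k _ → cong (λ z → d z * H k (suc (k ℕ.+ m)) N) (ℤS.solve 2 (λ k m → k :+ con (+ 1) :- (con (+ 1) :+ (k :+ m)) := :- m) refl (+ k) (+ m)))) (trans (Σ<-*ˡ M (d (- + m)) (λ k → H k (suc (k ℕ.+ m)) N)) (cong (λ z → d (- + m) * z) (D⁻-sum m N)))))))
    where
    N = suc n
    M = 2 ℕ.+ N
    g : ℕ → ℕ → ℤ
    g k a = d (+ k + + 1 - + a) * H k a N

  -- In the diagonal sums the empty overpartition counts with rank 0, contrary to the convention for
  -- the rank counts; this value has to be added on the other side.
  diagonalSum-0 : ∀ T → diagonalSum (suc T) 0 ≡ f (+ 0)
  diagonalSum-0 T = trans (cong₂ _+_ (cong (λ z → d (+ 1) * + 1 + z) (trans (Σ<-cong T (λ t _ → ℤP.*-zeroʳ (d (+ suc (suc t))))) (Σ<-0 T)))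
      (cong (λ z → d (+ 0) * + 1 + z) (trans (Σ<-cong T (λ m _ → ℤP.*-zeroʳ (d (- + suc m)))) (Σ<-0 T))))
    (ℤS.solve 2 (λ x y → x :* con (+ 1) :+ con (+ 0) :+ (y :* con (+ 1) :+ con (+ 0)) := y :+ x) refl (d (+ 1)) (d (+ 0)))

-- The rank differences

private module Mod = Modulo seriesRing

-- Because `φ Y = 2`, multiplication by `φ` frees the differences of `above` and `below` from `Y`.
-- Between `above 0` and `below 0` the formulas change, which leaves one further `φ`.
consecutive : ∀ t → (Ψ t ⊖ Ψ (suc t)) ⊕ (Ψ t ⊖ Ψ (suc t)) ⊕ [0] t ⊗ φ ≈ˢ φ ⊗ D⁺ t
consecutive zero = Mod.remove
  (𝕊.solve 6 (λ p p′ f y a b → (p -: p′) +: (p -: p′) +: 1: *: f =: f *: (a -: b) +: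
    ((-: f) *: (a -: y *: (1: -: p′)) +: f *: (b -: (y *: p +: 1:))
      +: (-: (1: -: p′ -: p)) *: (f *: y -: (1: +: 1:)) +: con: (+ 2) *: (f -: (1: -: (p +: p)))))
    ≈-refl (Ψ 0) (Ψ 1) φ Y (above 0) (below 0))
  (Mod.vanish-+ (Mod.vanish-+ (Mod.vanish-+ (Mod.vanish-* (⊝ φ) (above-formula 0)) (Mod.vanish-* φ (below-formula 0))) (Mod.vanish-* (⊝ (one ⊖ Ψ 1 ⊖ Ψ 0)) φ-Y)) (Mod.vanish-* (𝕊.int (+ 2)) φ-Ψ))
consecutive (suc t) = Mod.remove
  (𝕊.solve 6 (λ p p′ f y a b → (p -: p′) +: (p -: p′) +: con: (+ 0) *: f =: f *: (a -: b) +: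
    ((-: f) *: (a -: y *: (1: -: p′)) +: f *: (b -: y *: (1: -: p))
      +: (-: (p -: p′)) *: (f *: y -: (1: +: 1:))))
    ≈-refl (Ψ (suc t)) (Ψ (suc (suc t))) φ Y (above (suc t)) (above t))
  (Mod.vanish-+ (Mod.vanish-+ (Mod.vanish-* (⊝ φ) (above-formula (suc t))) (Mod.vanish-* φ (above-formula t))) (Mod.vanish-* (⊝ (Ψ (suc t) ⊖ Ψ (suc (suc t)))) φ-Y))

consecutive⁻ : ∀ m → (Ψ m ⊖ Ψ (suc m)) ⊕ (Ψ m ⊖ Ψ (suc m)) ⊕ [0] m ⊗ φ ≈ˢ φ ⊗ D⁻ m
consecutive⁻ m = Mod.remove
  (𝕊.solve 7 (λ p p′ f y a b z → (p -: p′) +: (p -: p′) +: z *: f =: f *: (a -: b) +: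
    ((-: f) *: (a -: (y *: p +: z)) +: f *: (b -: (y *: p′ +: con: (+ 0)))
      +: (-: (p -: p′)) *: (f *: y -: (1: +: 1:))))
    ≈-refl (Ψ m) (Ψ (suc m)) φ Y (below m) (below (suc m)) ([0] m))
  (Mod.vanish-+ (Mod.vanish-+ (Mod.vanish-* (⊝ φ) (below-formula m)) (Mod.vanish-* φ (below-formula (suc m)))) (Mod.vanish-* (⊝ (Ψ m ⊖ Ψ (suc m))) φ-Y))

lambertPart : ℕ → ℕ → Series
lambertPart b i = sgℕ i ⋆ (q^ (ψ-exponent b i) ⊗ geo (9 ℕ.+ i ℕ.* 10))

-- The terms with `t` congruent to `b` modulo 5 form a geometric progression of ratio `q^(10(i+1))`.
-- Writing each as a difference of two tails prepares it for telescoping.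
ψ-lambert : ∀ b i → ψ-term b i ≈ˢ lambertPart b i ⊖ lambertPart (5 ℕ.+ b) i
ψ-lambert b i n = trans (cong (λ z → sgℕ i * z) (core n)) (ℤS.solve 3 (λ s x y → s :* (x :- y) := s :* x :- s :* y) refl (sgℕ i) ((q^ (ψ-exponent b i) ⊗ g) n) ((q^ (ψ-exponent (5 ℕ.+ b) i) ⊗ g) n))
  where
  g = geo (9 ℕ.+ i ℕ.* 10)
  core : q^ (ψ-exponent b i) ≈ˢ q^ (ψ-exponent b i) ⊗ g ⊖ q^ (ψ-exponent (5 ℕ.+ b) i) ⊗ g
  core = ≈-trans (≈-sym (⊗-identityʳ (q^ (ψ-exponent b i)))) (≈-trans (⊗-congˡ {q^ (ψ-exponent b i)} (≈-sym (inv-correct (one ⊖ q^ (10 ℕ.+ i ℕ.* 10)) refl)))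
    (≈-trans (𝕊.solve 3 (λ x r g → x *: ((1: -: r) *: g) =: x *: g -: (x *: r) *: g) ≈-refl (q^ (ψ-exponent b i)) (q^ (10 ℕ.+ i ℕ.* 10)) g)
      (⊖-cong (≈-refl {q^ (ψ-exponent b i) ⊗ g}) (⊗-congʳ {g} (λ n → trans (q^-+ (ψ-exponent b i) (10 ℕ.+ i ℕ.* 10) n) (cong (λ z → q^ z n)
        (N.solve 2 (λ b i → ((N.con 1 N.:+ i) N.:* (N.con 1 N.:+ i) N.:+ (N.con 1 N.:+ i) N.:* (b N.:* N.con 2)) N.:+ (N.con 10 N.:+ i N.:* N.con 10)
          N.:= (N.con 1 N.:+ i) N.:* (N.con 1 N.:+ i) N.:+ (N.con 1 N.:+ i) N.:* ((N.con 5 N.:+ b) N.:* N.con 2)) refl b i)))))))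

lambertPart-order : ∀ b i n → n ℕ.< b → lambertPart b i n ≡ + 0
lambertPart-order b i n n<b = Ord-⋆ {+ ψ-exponent b i} (sgℕ i) (Ord-⊗ {+ ψ-exponent b i} {q^ (ψ-exponent b i)} (Ord-mono (+ ψ-exponent b i)) (geo (9 ℕ.+ i ℕ.* 10))) n
  (ℤ.+<+ (ℕP.<-≤-trans n<b (ℕP.≤-trans (ℕP.m≤m*n b 2) (ℕP.≤-trans (ℕP.m≤n*m (b ℕ.* 2) (suc i)) (ℕP.m≤n+m (suc i ℕ.* (b ℕ.* 2)) (suc i ℕ.* suc i))))))

-- Each residue class telescopes on its own since the coefficients are constant on it; only the
-- first and the last block survive.
periodic-telescope : ∀ I (c Z : ℕ → ℤ) → (∀ t → c (5 ℕ.+ t) ≡ c t) →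
  Σ< (I ℕ.* 5) (λ t → c t * (Z t - Z (5 ℕ.+ t))) ≡ Σ< 5 (λ b → c b * Z b) - Σ< 5 (λ b → c b * Z (I ℕ.* 5 ℕ.+ b))
periodic-telescope zero c Z p = sym (ℤP.+-inverseʳ (Σ< 5 (λ b → c b * Z b)))
periodic-telescope (suc I) c Z p = trans (cong (λ z → c 0 * (Z 0 - Z 5) + (c 1 * (Z 1 - Z 6) + (c 2 * (Z 2 - Z 7) + (c 3 * (Z 3 - Z 8) + (c 4 * (Z 4 - Z 9) + z)))))
    (trans (Σ<-cong (I ℕ.* 5) (λ t _ → cong (λ z → z * (Z (5 ℕ.+ t) - Z (10 ℕ.+ t))) (p t))) (periodic-telescope I c (λ t → Z (5 ℕ.+ t)) p)))
  (combine (c 0) (c 1) (c 2) (c 3) (c 4) (Z 0) (Z 1) (Z 2) (Z 3) (Z 4) (Z 5) (Z 6) (Z 7) (Z 8) (Z 9) (Σ< 5 (λ b → c b * Z (5 ℕ.+ (I ℕ.* 5 ℕ.+ b)))))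
  where
  combine : ∀ c₀ c₁ c₂ c₃ c₄ z₀ z₁ z₂ z₃ z₄ z₅ z₆ z₇ z₈ z₉ s → _
  combine = ℤS.solve 16 (λ c₀ c₁ c₂ c₃ c₄ z₀ z₁ z₂ z₃ z₄ z₅ z₆ z₇ z₈ z₉ s →
    c₀ :* (z₀ :- z₅) :+ (c₁ :* (z₁ :- z₆) :+ (c₂ :* (z₂ :- z₇) :+ (c₃ :* (z₃ :- z₈) :+ (c₄ :* (z₄ :- z₉) :+ ((c₀ :* z₅ :+ (c₁ :* z₆ :+ (c₂ :* z₇ :+ (c₃ :* z₈ :+ (c₄ :* z₉ :+ con (+ 0)))))) :- s)))))
      := (c₀ :* z₀ :+ (c₁ :* z₁ :+ (c₂ :* z₂ :+ (c₃ :* z₃ :+ (c₄ :* z₄ :+ con (+ 0)))))) :- s) refl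

module Equation (d : ℤ → ℤ) (d-periodic : ∀ r → d (r + + 5) ≡ d r) (rd : Series) (rd-0 : rd 0 ≡ + 0) (rd-total : ∀ n → rd (suc n) ≡ rankTotal (RankSum.f d) (suc n)) where
  open RankSum d

  -- The diagonals `t` above and `t` below carry the same difference of partial theta series by
  -- `consecutive` and `consecutive⁻`, so their weights add up.
  c : ℕ → ℤ
  c t = d (+ suc t) + d (- + t)

  c-periodic : ∀ t → c (5 ℕ.+ t) ≡ c t
  c-periodic t = cong₂ _+_ (trans (cong d (ℤP.+-comm (+ 5) (+ suc t))) (d-periodic (+ suc t)))
    (trans (sym (d-periodic (- + (5 ℕ.+ t)))) (cong d (ℤS.solve 1 (λ t → :- (con (+ 5) :+ t) :+ con (+ 5) := :- t) refl (+ t))))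

  rd-diagonals : ∀ T → rd ⊕ f (+ 0) ⋆ one ≈[ T ] diagonalSum (suc T)
  rd-diagonals T zero _ = trans (cong₂ _+_ rd-0 (ℤP.*-identityʳ (f (+ 0)))) (trans (ℤP.+-identityˡ (f (+ 0))) (sym (diagonalSum-0 T)))
  rd-diagonals (suc T) (suc n) (s≤s n<T) = trans (trans (cong (λ z → rd (suc n) + z) (ℤP.*-zeroʳ (f (+ 0)))) (ℤP.+-identityʳ (rd (suc n))))
    (trans (rd-total n) (rankTotal-diagonals (2 ℕ.+ T) n (s≤s (s≤s n<T))))

  φ-diagonals : ∀ T n → (φ ⊗ diagonalSum (suc T)) n ≡ Σ< (suc T) (λ t → c t * (+ 2 * (Ψ t n - Ψ (suc t) n))) + f (+ 0) * φ n
  φ-diagonals T n = begin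
    (φ ⊗ diagonalSum (suc T)) n
      ≡⟨ ≈-trans (⊗-distribˡ-⊕ φ (ΣS (suc T) up) (ΣS (suc T) down)) (⊕-cong (≈-trans (⊗-ΣS φ (suc T) up) (λ n → Σ<-cong (suc T) (λ t _ → trans (⊗-⋆ (d (+ suc t)) φ (D⁺ t) n) (cong (λ z → d (+ suc t) * z) (sym (consecutive t n))))))
           (≈-trans (⊗-ΣS φ (suc T) down) (λ n → Σ<-cong (suc T) (λ m _ → trans (⊗-⋆ (d (- + m)) φ (D⁻ m) n) (cong (λ z → d (- + m) * z) (sym (consecutive⁻ m n))))))) n ⟩
    Σ< (suc T) (λ t → d (+ suc t) * v t) + Σ< (suc T) (λ t → d (- + t) * v t)
      ≡⟨ trans (sym (Σ<-+ (suc T) (λ t → d (+ suc t) * v t) (λ t → d (- + t) * v t))) (Σ<-cong (suc T) (λ t _ → ℤS.solve 5 (λ a b p p′ z → a :* (p :- p′ :+ (p :- p′) :+ z) :+ b :* (p :- p′ :+ (p :- p′) :+ z)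
           := (a :+ b) :* (con (+ 2) :* (p :- p′)) :+ (a :+ b) :* z) refl (d (+ suc t)) (d (- + t)) (Ψ t n) (Ψ (suc t) n) (([0] t ⊗ φ) n))) ⟩
    Σ< (suc T) (λ t → c t * (+ 2 * (Ψ t n - Ψ (suc t) n)) + c t * ([0] t ⊗ φ) n)
      ≡⟨ Σ<-+ (suc T) (λ t → c t * (+ 2 * (Ψ t n - Ψ (suc t) n))) (λ t → c t * ([0] t ⊗ φ) n) ⟩
    Σ< (suc T) (λ t → c t * (+ 2 * (Ψ t n - Ψ (suc t) n))) + Σ< (suc T) (λ t → c t * ([0] t ⊗ φ) n)
      ≡⟨ cong (λ z → Σ< (suc T) (λ t → c t * (+ 2 * (Ψ t n - Ψ (suc t) n))) + z) (trans (cong₂ _+_ (cong₂ _*_ (ℤP.+-comm (d (+ 1)) (d (+ 0))) (⊗-identityˡ φ n))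
           (trans (Σ<-cong T (λ t _ → trans (cong (λ z → c (suc t) * z) (⊗-zeroˡ φ n)) (ℤP.*-zeroʳ (c (suc t))))) (Σ<-0 T))) (ℤP.+-identityʳ (f (+ 0) * φ n))) ⟩
    Σ< (suc T) (λ t → c t * (+ 2 * (Ψ t n - Ψ (suc t) n))) + f (+ 0) * φ n ∎
    where
    open ≡.≡-Reasoning
    up down : ℕ → Series
    up t = d (+ suc t) ⋆ D⁺ t
    down m = d (- + m) ⋆ D⁻ m
    v : ℕ → ℤ
    v t = Ψ t n - Ψ (suc t) n + (Ψ t n - Ψ (suc t) n) + ([0] t ⊗ φ) n

  Ψ-lambert : ∀ n → Σ< ((2 ℕ.+ n) ℕ.* 5) (λ t → c t * (+ 2 * (Ψ t n - Ψ (suc t) n))) ≡ Σ< (n ℕ.+ 10) (λ i → + 2 * Σ< 5 (λ b → c b * (lambertPart b i n - lambertPart (suc b) i n)))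
  Ψ-lambert n = begin
    Σ< len (λ t → c t * (+ 2 * (Ψ t n - Ψ (suc t) n)))
      ≡⟨ Σ<-cong len (λ t _ → trans (cong (λ z → c t * (+ 2 * z)) (trans (cong₂ _-_ (expandΨ t) (expandΨ (suc t))) (sym (Σ<-⊖ win (λ i → ψ-term t i n) (λ i → ψ-term (suc t) i n)))))
           (trans (ℤS.solve 2 (λ c s → c :* (con (+ 2) :* s) := (con (+ 2) :* c) :* s) refl (c t) (Σ< win (λ i → ψ-term t i n - ψ-term (suc t) i n)))
             (trans (sym (Σ<-*ˡ win (+ 2 * c t) (λ i → ψ-term t i n - ψ-term (suc t) i n))) (Σ<-cong win (λ i _ → trans (ℤP.*-assoc (+ 2) (c t) (ψ-term t i n - ψ-term (suc t) i n)) (cong (λ z → + 2 * (c t * z)) (difference t i))))))) ⟩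
    Σ< len (λ t → Σ< win (λ i → + 2 * (c t * (Z i t - Z i (5 ℕ.+ t)))))
      ≡⟨ Σ<-swap len win (λ t i → + 2 * (c t * (Z i t - Z i (5 ℕ.+ t)))) ⟩
    Σ< win (λ i → Σ< len (λ t → + 2 * (c t * (Z i t - Z i (5 ℕ.+ t)))))
      ≡⟨ Σ<-cong win (λ i _ → trans (Σ<-*ˡ len (+ 2) (λ t → c t * (Z i t - Z i (5 ℕ.+ t)))) (cong (λ z → + 2 * z) (trans (periodic-telescope (2 ℕ.+ n) c (Z i) c-periodic)
           (trans (cong (λ z → Σ< 5 (λ b → c b * Z i b) - z) (trans (Σ<-cong 5 (λ b _ → trans (cong (λ z → c b * z) (far i b)) (ℤP.*-zeroʳ (c b)))) (Σ<-0 5))) (ℤP.+-identityʳ (Σ< 5 (λ b → c b * Z i b))))))) ⟩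
    Σ< win (λ i → + 2 * Σ< 5 (λ b → c b * Z i b)) ∎
    where
    open ≡.≡-Reasoning
    len win : ℕ
    len = (2 ℕ.+ n) ℕ.* 5
    win = n ℕ.+ 10
    Z : ℕ → ℕ → ℤ
    Z i b = lambertPart b i n - lambertPart (suc b) i n
    expandΨ : ∀ t → Ψ t n ≡ Σ< win (λ i → ψ-term t i n)
    expandΨ t = sym (Ψ-agree t win n (ℕP.m<m+n n (s≤s z≤n)))
    difference : ∀ t i → ψ-term t i n - ψ-term (suc t) i n ≡ Z i t - Z i (5 ℕ.+ t)
    difference t i = trans (cong₂ _-_ (ψ-lambert t i n) (ψ-lambert (suc t) i n))
      (ℤS.solve 4 (λ a b c d → a :- b :- (c :- d) := a :- c :- (b :- d)) refl (lambertPart t i n) (lambertPart (5 ℕ.+ t) i n) (lambertPart (suc t) i n) (lambertPart (6 ℕ.+ t) i n))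
    far : ∀ i b → Z i (len ℕ.+ b) ≡ + 0
    far i b = cong₂ _-_ (lambertPart-order (len ℕ.+ b) i n n<) (lambertPart-order (suc (len ℕ.+ b)) i n (ℕP.m≤n⇒m≤1+n n<))
      where
      n< : n ℕ.< len ℕ.+ b
      n< = ℕP.≤-trans (ℕP.n≤1+n (suc n)) (ℕP.≤-trans (ℕP.m≤m*n (2 ℕ.+ n) 5) (ℕP.m≤m+n len b))

  rank-equation : ∀ n → (φ ⊗ (rd ⊕ f (+ 0) ⋆ one)) n ≡ Σ< (n ℕ.+ 10) (λ i → + 2 * Σ< 5 (λ b → c b * (lambertPart b i n - lambertPart (suc b) i n))) + f (+ 0) * φ n
  -- With this bound the diagonal sum has `(2 + n) * 5` terms, a multiple of the period, and its
  -- last block has order above `n`.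
  rank-equation n = trans (agree-⊗ {f = φ} agree-refl (rd-diagonals (9 ℕ.+ n ℕ.* 5)) n (s≤s (ℕP.≤-trans (ℕP.m≤m*n n 5) (ℕP.m≤n+m (n ℕ.* 5) 8))))
    (trans (φ-diagonals (9 ℕ.+ n ℕ.* 5) n) (cong (_+ f (+ 0) * φ n) (Ψ-lambert n)))

-- Residues of the rank modulo 5 and the two equations

mod5-periodic : ∀ x → (x + + 5) %ℕ 5 ≡ x %ℕ 5
mod5-periodic (+ n) = cong (λ z → + z %ℕ 5) (ℕP.+-comm n 5)
mod5-periodic -[1+ 0 ] = refl
mod5-periodic -[1+ 1 ] = refl
mod5-periodic -[1+ 2 ] = refl
mod5-periodic -[1+ 3 ] = refl
mod5-periodic -[1+ 4 ] = refl
mod5-periodic -[1+ suc (suc (suc (suc (suc n)))) ] = refl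

by-residues : ∀ (g h : ℤ → ℤ) → (∀ x → g (x + + 5) ≡ g x) → (∀ x → h (x + + 5) ≡ h x) →
              g (+ 0) ≡ h (+ 0) → g (+ 1) ≡ h (+ 1) → g (+ 2) ≡ h (+ 2) → g (+ 3) ≡ h (+ 3) → g (+ 4) ≡ h (+ 4) → ∀ x → g x ≡ h x
by-residues g h pg ph e₀ e₁ e₂ e₃ e₄ = go
  where
  back : ∀ x → g (x + + 5) ≡ h (x + + 5) → g x ≡ h x
  back x e = trans (sym (pg x)) (trans e (ph x))
  go : ∀ x → g x ≡ h x
  go (+ 0) = e₀
  go (+ 1) = e₁
  go (+ 2) = e₂
  go (+ 3) = e₃
  go (+ 4) = e₄
  go (+ suc (suc (suc (suc (suc n))))) = ≡.subst (λ z → g z ≡ h z) (ℤP.+-comm (+ n) (+ 5)) (trans (pg (+ n)) (trans (go (+ n)) (sym (ph (+ n)))))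
  go -[1+ 0 ] = back -[1+ 0 ] e₄
  go -[1+ 1 ] = back -[1+ 1 ] e₃
  go -[1+ 2 ] = back -[1+ 2 ] e₂
  go -[1+ 3 ] = back -[1+ 3 ] e₁
  go -[1+ 4 ] = back -[1+ 4 ] e₀
  go -[1+ suc (suc (suc (suc (suc n)))) ] = back -[1+ suc (suc (suc (suc (suc n)))) ] (go -[1+ n ])

indicator : ℕ → ℕ → ℤ → ℤ
indicator s t r = ind (congruent 5 r s) - ind (congruent 5 r t)

congruent-periodic : ∀ s r → congruent 5 (r + + 5) s ≡ congruent 5 r s
congruent-periodic s r = cong (ℕ._≡ᵇ 0) (trans (cong (_%ℕ 5) (ℤS.solve 2 (λ r s → r :+ con (+ 5) :- s := r :- s :+ con (+ 5)) refl r (+ s))) (mod5-periodic (r - + s)))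

rankTotal-cong : ∀ {f g} → (∀ r → f r ≡ g r) → ∀ n → rankTotal f n ≡ rankTotal g n
rankTotal-cong p n = over-cong (λ λs → cong (λ z → ind (isOverpartitionOf n λs) * z) (p (m2rank λs))) (candidates n)

rankDifference-total : ∀ s t n → rankDifference s t (suc n) ≡ rankTotal (indicator s t) (suc n)
rankDifference-total s t n = trans (cong₂ _-_ (count s) (count t)) (trans (sym (over-⊖ (term′ s) (term′ t) (candidates (suc n))))
  (over-cong (λ λs → ℤS.solve 3 (λ v a b → v :* a :- v :* b := v :* (a :- b)) refl (ind (isOverpartitionOf (suc n) λs)) (ind (congruent 5 (m2rank λs) s)) (ind (congruent 5 (m2rank λs) t))) (candidates (suc n))))
  where
  term′ : ℕ → List Part → ℤ
  term′ s λs = ind (isOverpartitionOf (suc n) λs) * ind (congruent 5 (m2rank λs) s)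
  count : ∀ s → + N̄₂ s 5 (suc n) ≡ total-over (term′ s) (candidates (suc n))
  count s = trans (length-filter (λ λs → isOverpartitionOf (suc n) λs ∧ congruent 5 (m2rank λs) s) (candidates (suc n)))
    (over-cong (λ λs → ind-∧ (isOverpartitionOf (suc n) λs) (congruent 5 (m2rank λs) s)) (candidates (suc n)))

residue : ℤ → ℤ → ℤ → ℤ → ℤ → ℕ → ℤ
residue a b c d e 0 = a
residue a b c d e 1 = b
residue a b c d e 2 = c
residue a b c d e 3 = d
residue a b c d e _ = e

-- d₁₂ and d₀₂ solve d r + d (r + 1) = indicator s t r; such d exist because 5 is odd.
d₁₂ d₀₂ : ℤ → ℤ
d₁₂ r = residue -[1+ 0 ] (+ 1) (+ 0) -[1+ 0 ] (+ 1) (r %ℕ 5)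
d₀₂ r = residue (+ 0) (+ 1) -[1+ 0 ] (+ 0) (+ 0) (r %ℕ 5)

d₁₂-periodic : ∀ r → d₁₂ (r + + 5) ≡ d₁₂ r
d₁₂-periodic r = cong (residue -[1+ 0 ] (+ 1) (+ 0) -[1+ 0 ] (+ 1)) (mod5-periodic r)

d₀₂-periodic : ∀ r → d₀₂ (r + + 5) ≡ d₀₂ r
d₀₂-periodic r = cong (residue (+ 0) (+ 1) -[1+ 0 ] (+ 0) (+ 0)) (mod5-periodic r)

indicator-periodic : ∀ s t r → indicator s t (r + + 5) ≡ indicator s t r
indicator-periodic s t r = cong₂ (λ x y → ind x - ind y) (congruent-periodic s r) (congruent-periodic t r)

f-periodic : ∀ d → (∀ r → d (r + + 5) ≡ d r) → ∀ r → RankSum.f d (r + + 5) ≡ RankSum.f d r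
f-periodic d p r = cong₂ _+_ (p r) (trans (cong d (ℤS.solve 1 (λ r → r :+ con (+ 5) :+ con (+ 1) := r :+ con (+ 1) :+ con (+ 5)) refl r)) (p (r + + 1)))

module Eq₁₂ = Equation d₁₂ d₁₂-periodic (rankDifference 1 2) refl
  (λ n → trans (rankDifference-total 1 2 n) (rankTotal-cong (by-residues (indicator 1 2) (RankSum.f d₁₂) (indicator-periodic 1 2) (f-periodic d₁₂ d₁₂-periodic) refl refl refl refl refl) (suc n)))

module Eq₀₂ = Equation d₀₂ d₀₂-periodic (rankDifference 0 2) refl
  (λ n → trans (rankDifference-total 0 2 n) (rankTotal-cong (by-residues (indicator 0 2) (RankSum.f d₀₂) (indicator-periodic 0 2) (f-periodic d₀₂ d₀₂-periodic) refl refl refl refl refl) (suc n)))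

-- For negative `n` the reversed expansion adds `10 ∣ n ∣` to the exponent, so that `- 2 a ∣ n ∣`
-- becomes `2 (5 - a) ∣ n ∣` with the opposite sign.
lambert-parts : ∀ a b → a ℕ.+ b ≡ 5 → ∀ n → lambert (+ a) n ≡ Σ< (n ℕ.+ 10) (λ i → lambertPart b i n - lambertPart a i n)
lambert-parts a b a+b n = trans (sumZ-Σ< (n ℕ.+ 10) (λ i → lambertTerm (+ a) i n)) (trans (ℤP.+-identityˡ (Σ< (n ℕ.+ 10) (λ i → lambertTerm (+ a) (+ suc i) n + lambertTerm (+ a) -[1+ i ] n)))
  (Σ<-cong (n ℕ.+ 10) (λ i _ → trans (cong₂ (λ x y → (- sgℕ i) * x + (- sgℕ i) * y) (positive i n) (negative i n))
    (ℤS.solve 3 (λ s x y → (:- s) :* x :+ (:- s) :* (:- y) := s :* y :- s :* x) refl (sgℕ i) ((q^ (ψ-exponent a i) ⊗ geo (9 ℕ.+ i ℕ.* 10)) n) ((q^ (ψ-exponent b i) ⊗ geo (9 ℕ.+ i ℕ.* 10)) n)))))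
  where
  exponent : ∀ m i → + ψ-exponent m i ≡ + suc i * + suc i + (+ m + + m) * + suc i
  exponent m i = cong (λ z → + suc i * + suc i + z) (trans (cong +_ (N.solve 2 (λ m i → (N.con 1 N.:+ i) N.:* (m N.:* N.con 2) N.:= (m N.:+ m) N.:* (N.con 1 N.:+ i)) refl m i)) (ℤP.pos-* (m ℕ.+ m) (suc i)))
  pole : ∀ i → + 10 * + suc i ≡ + (10 ℕ.+ i ℕ.* 10)
  pole i = cong +_ (ℕP.*-comm 10 (suc i))
  positive : ∀ i → G (+ suc i * + suc i + (+ a + + a) * + suc i) (+ 10 * + suc i) ≈ˢ q^ (ψ-exponent a i) ⊗ geo (9 ℕ.+ i ℕ.* 10)
  positive i = G-cong (sym (exponent a i)) (pole i)
  negative : ∀ i → G (-[1+ i ] * -[1+ i ] + (+ a + + a) * -[1+ i ]) (+ 10 * -[1+ i ]) ≈ˢ ⊝ (q^ (ψ-exponent b i) ⊗ geo (9 ℕ.+ i ℕ.* 10))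
  negative i m = trans (G-cong {e = e} refl (cong -_ (pole i)) m) (cong (λ z → - (mono z ⊗ geo (9 ℕ.+ i ℕ.* 10)) m) shifted-exponent)
    where
    e = -[1+ i ] * -[1+ i ] + (+ a + + a) * -[1+ i ]
    shifted-exponent : e + + (10 ℕ.+ i ℕ.* 10) ≡ + ψ-exponent b i
    shifted-exponent = trans (cong (λ z → e + z) (sym (pole i))) (trans
      (cong (λ z → -[1+ i ] * -[1+ i ] + (+ a + + a) * -[1+ i ] + (+ 2 * + z) * + suc i) (sym a+b))
      (trans (ℤS.solve 3 (λ a b i → (:- i) :* (:- i) :+ (a :+ a) :* (:- i) :+ (con (+ 2) :* (a :+ b)) :* i := i :* i :+ (b :+ b) :* i) refl (+ a) (+ b) (+ suc i)) (sym (exponent b i))))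

equation₁₂ : φ ⊗ rankDifference 1 2 ≈ˢ -[1+ 1 ] ⋆ lambert (+ 1) ⊕ (+ 6) ⋆ lambert (+ 2) ⊕ (+ 0) ⋆ one
equation₁₂ n = begin
  (φ ⊗ rankDifference 1 2) n
    ≡⟨ ⊗-congˡ {φ} (λ m → sym (ℤP.+-identityʳ (rankDifference 1 2 m))) n ⟩
  (φ ⊗ (rankDifference 1 2 ⊕ (+ 0) ⋆ one)) n
    ≡⟨ Eq₁₂.rank-equation n ⟩
  Σ< len (λ i → + 2 * Σ< 5 (λ b → Eq₁₂.c b * (lambertPart b i n - lambertPart (suc b) i n))) + + 0 * φ n
    -- The weights `c 0` to `c 4` are 0, 1, - 2, 1, 0, and their second differences produce the
    -- coefficients - 2 and 6.
    ≡⟨ trans (ℤP.+-identityʳ _) (Σ<-cong len (λ i _ → simplify (lambertPart 0 i n) (lambertPart 1 i n) (lambertPart 2 i n) (lambertPart 3 i n) (lambertPart 4 i n) (lambertPart 5 i n))) ⟩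
  Σ< len (λ i → -[1+ 1 ] * (lambertPart 4 i n - lambertPart 1 i n) + + 6 * (lambertPart 3 i n - lambertPart 2 i n))
    ≡⟨ trans (Σ<-+ len _ _) (cong₂ _+_ (Σ<-*ˡ len -[1+ 1 ] _) (Σ<-*ˡ len (+ 6) _)) ⟩
  -[1+ 1 ] * Σ< len (λ i → lambertPart 4 i n - lambertPart 1 i n) + + 6 * Σ< len (λ i → lambertPart 3 i n - lambertPart 2 i n)
    ≡⟨ sym (trans (ℤP.+-identityʳ _) (cong₂ (λ x y → -[1+ 1 ] * x + + 6 * y) (lambert-parts 1 4 refl n) (lambert-parts 2 3 refl n))) ⟩
  (-[1+ 1 ] ⋆ lambert (+ 1) ⊕ (+ 6) ⋆ lambert (+ 2) ⊕ (+ 0) ⋆ one) n ∎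
  where
  open ≡.≡-Reasoning
  len = n ℕ.+ 10
  simplify : ∀ x₀ x₁ x₂ x₃ x₄ x₅ → + 2 * (+ 0 * (x₀ - x₁) + (+ 1 * (x₁ - x₂) + (-[1+ 1 ] * (x₂ - x₃) + (+ 1 * (x₃ - x₄) + (+ 0 * (x₄ - x₅) + + 0)))))
    ≡ -[1+ 1 ] * (x₄ - x₁) + + 6 * (x₃ - x₂)
  simplify = ℤS.solve 6 (λ x₀ x₁ x₂ x₃ x₄ x₅ → con (+ 2) :* (con (+ 0) :* (x₀ :- x₁) :+ (con (+ 1) :* (x₁ :- x₂) :+ (con -[1+ 1 ] :* (x₂ :- x₃) :+ (con (+ 1) :* (x₃ :- x₄) :+ (con (+ 0) :* (x₄ :- x₅) :+ con (+ 0))))))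
    := con -[1+ 1 ] :* (x₄ :- x₁) :+ con (+ 6) :* (x₃ :- x₂)) refl

equation₀₂ : φ ⊗ (rankDifference 0 2 ⊕ one) ≈ˢ (+ 4) ⋆ lambert (+ 1) ⊕ -[1+ 1 ] ⋆ lambert (+ 2) ⊕ (+ 1) ⋆ one
equation₀₂ n = begin
  (φ ⊗ (rankDifference 0 2 ⊕ one)) n
    ≡⟨ ⊗-congˡ {φ} (λ m → cong (λ z → rankDifference 0 2 m + z) (sym (ℤP.*-identityˡ (one m)))) n ⟩
  (φ ⊗ (rankDifference 0 2 ⊕ (+ 1) ⋆ one)) n
    ≡⟨ Eq₀₂.rank-equation n ⟩
  Σ< len (λ i → + 2 * Σ< 5 (λ b → Eq₀₂.c b * (lambertPart b i n - lambertPart (suc b) i n))) + + 1 * φ n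
    -- The weights are now 1, - 1, 0, - 1, 1. Their ends give `2 Ψ 0`, which cancels against the `φ`
    -- belonging to the empty overpartition and leaves 1.
    ≡⟨ cong₂ _+_ (Σ<-cong len (λ i _ → simplify (lambertPart 0 i n) (lambertPart 1 i n) (lambertPart 2 i n) (lambertPart 3 i n) (lambertPart 4 i n) (lambertPart 5 i n)))
         (trans (ℤP.*-identityˡ (φ n)) (φ-Ψ n)) ⟩
  Σ< len (λ i → (+ 4 * (lambertPart 4 i n - lambertPart 1 i n) + -[1+ 1 ] * (lambertPart 3 i n - lambertPart 2 i n)) + + 2 * (lambertPart 0 i n - lambertPart 5 i n)) + (one n - (Ψ 0 n + Ψ 0 n))
    ≡⟨ cong (_+ (one n - (Ψ 0 n + Ψ 0 n))) (trans (Σ<-+ len _ _) (cong₂ _+_ (trans (Σ<-+ len _ _) (cong₂ _+_ (Σ<-*ˡ len (+ 4) _) (Σ<-*ˡ len -[1+ 1 ] _)))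
         (trans (Σ<-*ˡ len (+ 2) _) (cong (λ z → + 2 * z) (trans (Σ<-cong len (λ i _ → sym (ψ-lambert 0 i n))) (Ψ-agree 0 len n (ℕP.m<m+n n (s≤s z≤n)))))))) ⟩
  (+ 4 * Σ< len (λ i → lambertPart 4 i n - lambertPart 1 i n) + -[1+ 1 ] * Σ< len (λ i → lambertPart 3 i n - lambertPart 2 i n)) + + 2 * Ψ 0 n + (one n - (Ψ 0 n + Ψ 0 n))
    ≡⟨ cong₂ (λ x y → (+ 4 * x + -[1+ 1 ] * y) + + 2 * Ψ 0 n + (one n - (Ψ 0 n + Ψ 0 n))) (sym (lambert-parts 1 4 refl n)) (sym (lambert-parts 2 3 refl n)) ⟩
  (+ 4 * lambert (+ 1) n + -[1+ 1 ] * lambert (+ 2) n) + + 2 * Ψ 0 n + (one n - (Ψ 0 n + Ψ 0 n))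
    ≡⟨ ℤS.solve 4 (λ l m p o → (con (+ 4) :* l :+ con -[1+ 1 ] :* m) :+ con (+ 2) :* p :+ (o :- (p :+ p)) := con (+ 4) :* l :+ con -[1+ 1 ] :* m :+ con (+ 1) :* o) refl (lambert (+ 1) n) (lambert (+ 2) n) (Ψ 0 n) (one n) ⟩
  ((+ 4) ⋆ lambert (+ 1) ⊕ -[1+ 1 ] ⋆ lambert (+ 2) ⊕ (+ 1) ⋆ one) n ∎
  where
  open ≡.≡-Reasoning
  len = n ℕ.+ 10
  simplify : ∀ x₀ x₁ x₂ x₃ x₄ x₅ → + 2 * (+ 1 * (x₀ - x₁) + (-[1+ 0 ] * (x₁ - x₂) + (+ 0 * (x₂ - x₃) + (-[1+ 0 ] * (x₃ - x₄) + (+ 1 * (x₄ - x₅) + + 0)))))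
    ≡ (+ 4 * (x₄ - x₁) + -[1+ 1 ] * (x₃ - x₂)) + + 2 * (x₀ - x₅)
  simplify = ℤS.solve 6 (λ x₀ x₁ x₂ x₃ x₄ x₅ → con (+ 2) :* (con (+ 1) :* (x₀ :- x₁) :+ (con -[1+ 0 ] :* (x₁ :- x₂) :+ (con (+ 0) :* (x₂ :- x₃) :+ (con -[1+ 0 ] :* (x₃ :- x₄) :+ (con (+ 1) :* (x₄ :- x₅) :+ con (+ 0))))))
    := (con (+ 4) :* (x₄ :- x₁) :+ con -[1+ 1 ] :* (x₃ :- x₂)) :+ con (+ 2) :* (x₀ :- x₅)) refl

ℓ₁₂ : (+ 2) ⋆ ⟦ ℓB ⟧ₜ ≈ˢ -[1+ 1 ] ⋆ L₂ ⊕ (+ 6) ⋆ L₄ ⊕ (+ 0) ⋆ one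
ℓ₁₂ n = trans (cong (λ z → + 2 * z) (sym (lambert-B n)))
    (ℤS.solve 3 (λ l m o → con (+ 2) :* (m :+ m :+ m :- l) := con -[1+ 1 ] :* l :+ con (+ 6) :* m :+ con (+ 0) :* o) refl (L₂ n) (L₄ n) (one n))

ℓ₀₂ : ⟦ ℓA ⟧ₜ ⊖ ⟦ ℓB ⟧ₜ ≈ˢ (+ 4) ⋆ L₂ ⊕ -[1+ 1 ] ⋆ L₄ ⊕ (+ 1) ⋆ one
ℓ₀₂ n = trans (cong₂ _-_ (sym (lambert-A n)) (sym (lambert-B n)))
    (ℤS.solve 3 (λ l m o → (l :+ l :+ l :+ m :+ o) :- (m :+ m :+ m :- l) := con (+ 4) :* l :+ con -[1+ 1 ] :* m :+ con (+ 1) :* o) refl (L₂ n) (L₄ n) (one n))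

module D₁₂ = Determined (rankDifference 1 2) -[1+ 1 ] (+ 6) (+ 0) equation₁₂ ⟪ r₀ ⟫ ⟪ r₁ ⟫ ⟪ r₂ ⟫ ⟪ r₃ ⟫ (q^ 1 ⊗ ⟪ r₄ ⟫) ((+ 2) ⋆ ⟦ ℓB ⟧ₜ)
    r-section₀ ℓ₁₂ r-section₁ r-section₂ r-section₃ r-section₄

module D₀₂ = Determined (rankDifference 0 2 ⊕ one) (+ 4) -[1+ 1 ] (+ 1) equation₀₂ ⟪ s₀ ⟫ ⟪ s₁ ⟫ ⟪ s₂ ⟫ ⟪ s₃ ⟫ ⟪ qs₄ ⟫ (⟦ ℓA ⟧ₜ ⊖ ⟦ ℓB ⟧ₜ)
    s-section₀ ℓ₀₂ s-section₁ s-section₂ s-section₃ s-section₄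

sec-one : ∀ d → sec (suc d) one ≈ˢ λ _ → + 0
sec-one d = sec-q^ {suc d} {0} z≤n

-- The series `one` added for the empty overpartition is invisible in every section except the
-- zeroth.
strip : ∀ {d g} → sec (suc d) (rankDifference 0 2 ⊕ one) ≈ˢ g → R 0 2 (suc d) ≈ˢ g
strip {d} p n = trans (sym (trans (cong (λ z → R 0 2 (suc d) n + z) (sec-one d n)) (ℤP.+-identityʳ (R 0 2 (suc d) n)))) (p n)

subtracted : ∀ {f m m′ : Series} b {t u : Series} → b ⋆ m ≈ˢ m′ → f ≈ˢ (t ⊕ u) ⊖ (- b) ⋆ m → f ≈ˢ m′ ⊕ t ⊕ u
subtracted {m = m} b {t} {u} p e n = trans (e n) (trans (ℤS.solve 4 (λ t u b m → (t :+ u) :- (:- b) :* m := b :* m :+ t :+ u) refl (t n) (u n) b (m n)) (cong (λ z → z + t n + u n) (p n)))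

R₁₂₁ : R 1 2 1 ≈ˢ (-[1+ 5 ] ⋆ q^ 3 ⊗ Pn 5 5 ⊗ S 4) ÷ P 5 5 ⊕ ⟪ r₁₀ ⟫ ⊕ ⟪ r₁₁ ⟫
R₁₂₁ = subtracted -[1+ 5 ] (mock-scale -[1+ 5 ] 4) D₁₂.value₁

R₁₂₄ : R 1 2 4 ≈ˢ (-[1+ 1 ] ⋆ q^ 1 ⊗ Pn 5 5 ⊗ S 2) ÷ P 5 5 ⊕ ⟪ r₄ ⟫
R₁₂₄ = q^-cancelˡ 1 {R 1 2 4} (≈-trans D₁₂.value₄ (≈-trans (⊕-cong (≈-refl {q^ 1 ⊗ ⟪ r₄ ⟫}) (≈-sym (⊗-⋆ -[1+ 1 ] (q^ 1) (mock 2))))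
  (≈-trans (𝕊.solve 3 (λ q r m → q *: r +: q *: m =: q *: (m +: r)) ≈-refl (q^ 1) ⟪ r₄ ⟫ (-[1+ 1 ] ⋆ mock 2))
    (⊗-congˡ {q^ 1} (⊕-cong (mock-scale -[1+ 1 ] 2) (≈-refl {⟪ r₄ ⟫}))))))

R₀₂₀ : R 0 2 0 ≈ˢ -[1+ 0 ] ⋆ one ⊕ ⟪ s₀₀ ⟫ ⊕ ⟪ s₀₁ ⟫ ⊕ ⟪ s₀₂ ⟫ ⊖ ⟪ s₀₃ ⟫
R₀₂₀ n = trans (ℤS.solve 2 (λ r o → r := (r :+ o) :- o) refl (R 0 2 0 n) (sec 0 one n)) (trans (cong₂ _-_ (D₀₂.value₀ n) (sec-one₀ n))
  (rearrange (⟪ s₀₀ ⟫ n) (⟪ s₀₁ ⟫ n) (⟪ s₀₂ ⟫ n) (⟪ s₀₃ ⟫ n) (one n)))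
  where
  sec-one₀ : sec 0 one ≈ˢ one
  sec-one₀ = ≈-trans (sec-q^ {0} {0} z≤n) (1⋆ one)
  rearrange : ∀ a b c d o → (a + b + c - d) - o ≡ (- + 1) * o + a + b + c - d
  rearrange = ℤS.solve 5 (λ a b c d o → (a :+ b :+ c :- d) :- o := con -[1+ 0 ] :* o :+ a :+ b :+ c :- d) refl

R₀₂₁ : R 0 2 1 ≈ˢ ((+ 2) ⋆ q^ 3 ⊗ Pn 5 5 ⊗ S 4) ÷ P 5 5 ⊕ ⟪ s₁₀ ⟫ ⊕ ⟪ s₁₁ ⟫
R₀₂₁ = subtracted (+ 2) (mock-scale (+ 2) 4) (strip D₀₂.value₁)

R₀₂₄ : q^ 1 ⊗ R 0 2 4 ≈ˢ ((+ 4) ⋆ q^ 2 ⊗ Pn 5 5 ⊗ S 2) ÷ P 5 5 ⊖ ⟪ qs₄₀ ⟫ ⊖ ⟪ qs₄₁ ⟫ ⊕ ⟪ qs₄₂ ⟫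
R₀₂₄ n = trans (⊗-congˡ {q^ 1} (strip {3} {sec 4 (rankDifference 0 2 ⊕ one)} ≈-refl) n) (trans (D₀₂.value₄ n)
  (trans (cong (λ z → ⟪ qs₄ ⟫ n + z) (trans (sym (⊗-⋆ (+ 4) (q^ 1) (mock 2) n)) (trans (⊗-congˡ {q^ 1} (mock-scale (+ 4) 2) n) (merge n))))
    (rearrange (⟪ qs₄₀ ⟫ n) (⟪ qs₄₁ ⟫ n) (⟪ qs₄₂ ⟫ n) ((((+ 4) ⋆ q^ 2 ⊗ Pn 5 5 ⊗ S 2) ÷ P 5 5) n))))
  where
  merge : q^ 1 ⊗ (((+ 4) ⋆ q^ 1 ⊗ Pn 5 5 ⊗ S 2) ÷ P 5 5) ≈ˢ ((+ 4) ⋆ q^ 2 ⊗ Pn 5 5 ⊗ S 2) ÷ P 5 5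
  merge = ≈-trans (𝕊.solve 5 (λ q c n s p → q *: ((c *: n *: s) *: p) =: ((q *: c) *: n *: s) *: p) ≈-refl (q^ 1) ((+ 4) ⋆ q^ 1) (Pn 5 5) (S 2) (inv (P 5 5)))
    (⊗-congʳ {inv (P 5 5)} (⊗-congʳ {S 2} (⊗-congʳ {Pn 5 5} (≈-trans (⊗-⋆ (+ 4) (q^ 1) (q^ 1)) (⋆-cong {+ 4} refl (q^-+ 1 1))))))
  rearrange : ∀ a b c m → (-[1+ 0 ] * a - b + c) + m ≡ m - a - b + c
  rearrange = ℤS.solve 4 (λ a b c m → (con -[1+ 0 ] :* a :- b :+ c) :+ m := m :- a :- b :+ c) refl

theorem1p2 : (R 1 2 0 ≈ˢ
    ((+ 10) ⋆ q^ 2 ⊗ P 10 10 ^ˢ 4 ⊗ P 1 10 ⊗ P 2 10 ⊗ P 8 10 ⊗ P 9 10)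
    ÷ (P 1 1 ^ˢ 3 ⊗ P 1 2)
    ⊕ ((+ 2) ⋆ q^ 1 ⊗ P 5 5)
    ÷ (P 1 2 ^ˢ 5 ⊗ P 3 10 ⊗ P 4 10 ⊗ P 6 10 ⊗ P 7 10))
    ×
    (R 1 2 1 ≈ˢ
    ((- (+ 6)) ⋆ q^ 3 ⊗ Pn 5 5 ⊗ S 4) ÷ P 5 5
    ⊕ ((+ 4) ⋆ q^ 1 ⊗ P 10 10 ^ˢ 2)
    ÷ (P 1 2 ^ˢ 5 ⊗ P 4 10 ⊗ P 6 10 ⊗ P 5 5)
    ⊕ ((+ 20) ⋆ q^ 3 ⊗ P 10 10 ^ˢ 7 ⊗ (P 1 10 ⊗ P 9 10) ^ˢ 2
    ⊗ (P 2 10 ⊗ P 8 10) ^ˢ 3)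
    ÷ (P 1 1 ^ˢ 4 ⊗ P 5 5 ^ˢ 2))
    ×
    (R 1 2 2 ≈ˢ
    ((+ 10) ⋆ q^ 1 ⊗ P 10 10 ^ˢ 3)
    ÷ (P 1 1 ^ˢ 2 ⊗ (P 3 10 ⊗ P 7 10) ^ˢ 3
    ⊗ P 1 10 ⊗ P 2 10 ⊗ P 8 10 ⊗ P 9 10))
    ×
    (R 1 2 3 ≈ˢ
    ((+ 10) ⋆ P 10 10 ^ˢ 3)
    ÷ (P 1 1 ^ˢ 2 ⊗ P 3 10 ⊗ P 4 10 ⊗ P 6 10 ⊗ P 7 10
    ⊗ (P 1 10 ⊗ P 9 10) ^ˢ 3)
    ⊖ ((+ 8) ⋆ P 5 5)
    ÷ (P 1 2 ^ˢ 5 ⊗ P 2 10 ⊗ P 3 10 ⊗ P 7 10 ⊗ P 8 10))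
    ×
    (R 1 2 4 ≈ˢ
    ((- (+ 2)) ⋆ q^ 1 ⊗ Pn 5 5 ⊗ S 2) ÷ P 5 5
    ⊕ ((+ 4) ⋆ P 2 2)
    ÷ (P 1 2 ^ˢ 4 ⊗ (P 2 10 ⊗ P 3 10 ⊗ P 7 10 ⊗ P 8 10) ^ˢ 3))
    ×
    (R 0 2 0 ≈ˢ
    (- (+ 1)) ⋆ one
    ⊕ P 5 5 ^ˢ 6
    ÷ (P 1 2 ^ˢ 6 ⊗ P 3 10 ⊗ P 4 10 ⊗ P 6 10 ⊗ P 7 10 ⊗ P 10 10 ^ˢ 5)
    ⊕ (q^ 2 ⊗ P 1 1 ⊗ P 10 10)
    ÷ ((P 3 10 ⊗ P 4 10 ⊗ P 6 10 ⊗ P 7 10) ^ˢ 3 ⊗ P 5 5)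
    ⊕ ((+ 4) ⋆ q^ 1 ⊗ P 5 5 ^ˢ 2 ⊗ P 1 10 ⊗ P 9 10)
    ÷ (P 1 2 ^ˢ 6 ⊗ P 4 10 ⊗ P 6 10 ⊗ P 10 10)
    ⊖ ((+ 10) ⋆ q^ 2 ⊗ P 10 10 ^ˢ 3)
    ÷ (P 1 1 ^ˢ 2 ⊗ P 2 10 ⊗ P 8 10 ⊗ (P 3 10 ⊗ P 7 10) ^ˢ 4))
    ×
    (R 0 2 1 ≈ˢ
    ((+ 2) ⋆ q^ 3 ⊗ Pn 5 5 ⊗ S 4) ÷ P 5 5
    ⊕ ((+ 2) ⋆ P 5 5 ^ˢ 4)
    ÷ (P 1 2 ^ˢ 6 ⊗ P 4 10 ⊗ P 6 10 ⊗ P 10 10 ^ˢ 3)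
    ⊕ ((+ 2) ⋆ q^ 2 ⊗ P 1 1 ⊗ P 10 10 ^ˢ 3)
    ÷ ((P 3 10 ⊗ P 7 10) ^ˢ 2 ⊗ (P 4 10 ⊗ P 6 10) ^ˢ 3 ⊗ P 5 5 ^ˢ 3))
    ×
    (R 0 2 2 ≈ˢ
    ((+ 4) ⋆ P 3 10 ⊗ P 7 10 ⊗ P 5 5 ^ˢ 2)
    ÷ (P 1 2 ^ˢ 6 ⊗ P 4 10 ⊗ P 6 10 ⊗ P 10 10)
    ⊖ ((+ 10) ⋆ q^ 1 ⊗ P 10 10 ^ˢ 3)
    ÷ (P 1 1 ^ˢ 2 ⊗ (P 3 10 ⊗ P 7 10) ^ˢ 3
    ⊗ P 1 10 ⊗ P 2 10 ⊗ P 8 10 ⊗ P 9 10))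
    ×
    (R 0 2 3 ≈ˢ
    ((+ 4) ⋆ P 5 5)
    ÷ (P 1 2 ^ˢ 5 ⊗ P 2 10 ⊗ P 3 10 ⊗ P 7 10 ⊗ P 8 10))
    ×
    (q^ 1 ⊗ R 0 2 4 ≈ˢ
    ((+ 4) ⋆ q^ 2 ⊗ Pn 5 5 ⊗ S 2) ÷ P 5 5
    ⊖ ((+ 10) ⋆ q^ 1 ⊗ P 10 10 ^ˢ 3 ⊗ P 5 5 ⊗ P 4 10 ⊗ P 6 10)
    ÷ (P 1 10 ⊗ P 9 10 ⊗ P 1 1 ^ˢ 3 ⊗ P 3 10 ⊗ P 7 10)
    ⊖ ((+ 2) ⋆ P 10 10 ⊗ Pn 2 5 ⊗ Pn 3 5)
    ÷ (Pn 1 5 ⊗ Pn 4 5 ⊗ P 1 10 ⊗ P 2 10 ⊗ P 8 10 ⊗ P 9 10)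
    ⊕ ((+ 2) ⋆ P 5 5 ^ˢ 2 ⊗ (P 2 10 ⊗ P 8 10) ^ˢ 5 ⊗ P 10 10 ^ˢ 2)
    ÷ (P 1 2 ^ˢ 4 ⊗ (P 1 10 ⊗ P 9 10) ^ˢ 4 ⊗ P 2 2 ^ˢ 3))
theorem1p2 = D₁₂.value₀ , R₁₂₁ , D₁₂.value₂ , D₁₂.value₃ , R₁₂₄ , R₀₂₀ , R₀₂₁ , strip D₀₂.value₂ , strip D₀₂.value₃ , R₀₂₄
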